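{- For any even positive integer $n$, there exists a $4$-dense set of $n$ points in general position in the plane with $n e^{\Omega(\sqrt{\log n})}$ halving lines. Explicitly: there exist constants $c>0$ and $n_0$ such that for every even positive integer $n$ there is a $4$-dense set $P_n\subset\mathbb{R}^2$ of $n$ points in general position such that, whenever $n\ge n_0$, the set $P_n$ has at least $n e^{c\sqrt{\log n}}$ halving lines.
   Context: A set of points in the plane is in general position if no three of its points are on a line. For a set $P$ of $n$ points in the plane, a line determined by two points of $P$ is a halving line of $P$ if it has exactly $(n-2)/2$ points of $P$ on each of its two (open) sides. For $\gamma>0$, a planar set $P$ of $n$ points is $\gamma$-dense if the ratio of the largest and smallest distances determined by (pairs of distinct points of) $P$ is at most $\gamma\sqrt{n}$. -}

module Defs where

open import Data.Fin using (Fin)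
open import Data.Fin.Subset using (Subset; _∈_; ∣_∣)
open import Data.Integer as ℤ using (+_)
import Data.Integer.Properties as ℤ
open import Data.Nat as ℕ using (ℕ; zero; suc; NonZero)
import Data.Nat.DivMod as ℕ
import Data.Nat.Properties as ℕ
open import Data.Product using (∃; ∃-syntax; Σ-syntax; _×_; _,_; proj₁; proj₂)
open import Data.Rational as ℚ using (ℚ; mkℚ; 0ℚ; 1ℚ; ½; _+_; _*_; _-_; -_; _/_; _≤_; _<_)
open import Data.Rational.Properties
open import Data.Rational.Solver using (module +-*-Solver)
open import Data.Rational.Unnormalised as ℚᵘ using (mkℚᵘ)
import Data.Rational.Unnormalised.Properties as ℚᵘ
open import Data.Sum using (inj₁; inj₂)
open import Function using (_⇔_)
open import Relation.Binary.PropositionalEquality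
  using (_≡_; _≢_; refl; sym; trans; cong; cong₂; subst; subst₂)
open import Relation.Nullary using (¬_; yes; no)

open +-*-Solver using (solve; con; _:+_; _:*_; _:-_; :-_; _:=_)

ι : ℕ → ℚ
ι n = + n / 1

inv : ℕ → ℚ
inv k = + 1 / suc k

private
  toℚᵘ-/ : ∀ i k → ℚ.toℚᵘ (i / suc k) ℚᵘ.≃ mkℚᵘ i k
  toℚᵘ-/ i k = toℚᵘ-fromℚᵘ (mkℚᵘ i k)

ι-+ : ∀ m n → ι (m ℕ.+ n) ≡ ι m + ι n
ι-+ m n = toℚᵘ-injective (ℚᵘ.≃-trans (toℚᵘ-/ (+ (m ℕ.+ n)) 0) (ℚᵘ.≃-sym
  (ℚᵘ.≃-trans (toℚᵘ-homo-+ (ι m) (ι n))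
  (ℚᵘ.≃-trans (ℚᵘ.+-cong (toℚᵘ-/ (+ m) 0) (toℚᵘ-/ (+ n) 0))
  (ℚᵘ.*≡* (cong (ℤ._* + 1) (cong₂ ℤ._+_ (ℤ.*-identityʳ (+ m)) (ℤ.*-identityʳ (+ n)))))))))

ι-* : ∀ m n → ι (m ℕ.* n) ≡ ι m * ι n
ι-* m n = toℚᵘ-injective (ℚᵘ.≃-trans (toℚᵘ-/ (+ (m ℕ.* n)) 0) (ℚᵘ.≃-sym
  (ℚᵘ.≃-trans (toℚᵘ-homo-* (ι m) (ι n))
  (ℚᵘ.≃-trans (ℚᵘ.*-cong (toℚᵘ-/ (+ m) 0) (toℚᵘ-/ (+ n) 0))
  (ℚᵘ.*≡* (cong (ℤ._* + 1) (sym (ℤ.pos-* m n))))))))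

ι-suc : ∀ n → ι (suc n) ≡ 1ℚ + ι n
ι-suc n = ι-+ 1 n

ι-mono : ∀ {m n} → m ℕ.≤ n → ι m ≤ ι n
ι-mono {m} {n} m≤n = toℚᵘ-cancel-≤
  (ℚᵘ.≤-respˡ-≃ (ℚᵘ.≃-sym (toℚᵘ-/ (+ m) 0)) (ℚᵘ.≤-respʳ-≃ (ℚᵘ.≃-sym (toℚᵘ-/ (+ n) 0))
  (ℚᵘ.*≤* (ℤ.*-monoʳ-≤-nonNeg (+ 1) (ℤ.+≤+ m≤n)))))

ι-mono-< : ∀ {m n} → m ℕ.< n → ι m < ι n
ι-mono-< {m} {n} m<n = <-≤-trans
  (subst₂ _<_ (+-identityˡ (ι m)) (sym (ι-suc m)) (+-monoˡ-< (ι m) (positive⁻¹ 1ℚ)))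
  (ι-mono m<n)

0≤ι : ∀ n → 0ℚ ≤ ι n
0≤ι n = ι-mono {0} {n} ℕ.z≤n

0<ι-suc : ∀ n → 0ℚ < ι (suc n)
0<ι-suc n = ι-mono-< {0} {suc n} (ℕ.s≤s ℕ.z≤n)

ι*inv : ∀ k → ι (suc k) * inv k ≡ 1ℚ
ι*inv k = toℚᵘ-injective
  (ℚᵘ.≃-trans (toℚᵘ-homo-* (ι (suc k)) (inv k))
  (ℚᵘ.≃-trans (ℚᵘ.*-cong (toℚᵘ-/ (+ suc k) 0) (toℚᵘ-/ (+ 1) k))
  (ℚᵘ.*≡* (trans (ℤ.*-identityʳ (+ suc k ℤ.* + 1)) (trans (ℤ.*-identityʳ (+ suc k))
    (trans (cong +_ (sym (ℕ.+-identityʳ (suc k)))) (sym (ℤ.*-identityˡ (+ (1 ℕ.* suc k))))))))))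

*-mono-l : ∀ {r p q} → 0ℚ ≤ r → p ≤ q → r * p ≤ r * q
*-mono-l {r} 0≤r = *-monoˡ-≤-nonNeg r {{ℚ.nonNegative 0≤r}}

*-mono-r : ∀ {r p q} → 0ℚ ≤ r → p ≤ q → p * r ≤ q * r
*-mono-r {r} 0≤r = *-monoʳ-≤-nonNeg r {{ℚ.nonNegative 0≤r}}

*-mono : ∀ {a b c d} → 0ℚ ≤ a → 0ℚ ≤ d → a ≤ b → c ≤ d → a * c ≤ b * d
*-mono 0≤a 0≤d a≤b c≤d = ≤-trans (*-mono-l 0≤a c≤d) (*-mono-r 0≤d a≤b)

0≤* : ∀ {p q} → 0ℚ ≤ p → 0ℚ ≤ q → 0ℚ ≤ p * q
0≤* {p} {q} 0≤p 0≤q = subst (_≤ p * q) (*-zeroʳ p) (*-mono-l 0≤p 0≤q)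

0<* : ∀ {p q} → 0ℚ < p → 0ℚ < q → 0ℚ < p * q
0<* {p} {q} 0<p 0<q =
  subst (_< p * q) (*-zeroʳ p) (*-monoʳ-<-pos p {{ℚ.positive 0<p}} 0<q)

0≤+ : ∀ {p q} → 0ℚ ≤ p → 0ℚ ≤ q → 0ℚ ≤ p + q
0≤+ 0≤p 0≤q = +-mono-≤ 0≤p 0≤q

cancel-≤ : ∀ {r p q} → 0ℚ < r → r * p ≤ r * q → p ≤ q
cancel-≤ {r} 0<r = *-cancelˡ-≤-pos r {{ℚ.positive 0<r}}

cancel-< : ∀ {r p q} → 0ℚ < r → r * p < r * q → p < q
cancel-< {r} 0<r = *-cancelˡ-<-nonNeg r {{ℚ.nonNegative (<⇒≤ 0<r)}}

p≤p+q : ∀ {p q} → 0ℚ ≤ q → p ≤ p + q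
p≤p+q {p} {q} 0≤q = subst (_≤ p + q) (+-identityʳ p) (+-monoʳ-≤ p 0≤q)

p≤q+p : ∀ {p q} → 0ℚ ≤ q → p ≤ q + p
p≤q+p {p} {q} 0≤q = subst (p ≤_) (+-comm p q) (p≤p+q 0≤q)

≤+⇒-≤ : ∀ {p q r} → p ≤ q + r → p - q ≤ r
≤+⇒-≤ {p} {q} {r} h = subst (p - q ≤_)
  (solve 2 (λ q r → q :+ r :- q := r) refl q r) (+-monoˡ-≤ (- q) h)

-≤⇒≤+ : ∀ {p q r} → p - q ≤ r → p ≤ q + r
-≤⇒≤+ {p} {q} {r} h = subst (_≤ q + r)
  (solve 2 (λ q p → q :+ (p :- q) := p) refl q p) (+-monoʳ-≤ q h)

inv>0 : ∀ k → 0ℚ < inv k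
inv>0 k = cancel-< (0<ι-suc k)
  (subst₂ _<_ (sym (*-zeroʳ (ι (suc k)))) (sym (ι*inv k)) (positive⁻¹ 1ℚ))

0≤inv : ∀ k → 0ℚ ≤ inv k
0≤inv k = <⇒≤ (inv>0 k)

inv-anti : ∀ {m n} → m ℕ.≤ n → inv n ≤ inv m
inv-anti {m} {n} m≤n = subst₂ _≤_ lhs rhs
  (*-mono-r (0≤* (0≤inv m) (0≤inv n)) (ι-mono (ℕ.s≤s m≤n)))
  where
  lhs : ι (suc m) * (inv m * inv n) ≡ inv n
  lhs = trans (sym (*-assoc (ι (suc m)) (inv m) (inv n)))
          (trans (cong (_* inv n) (ι*inv m)) (*-identityˡ (inv n)))
  rhs : ι (suc n) * (inv m * inv n) ≡ inv m
  rhs = trans (solve 3 (λ a b c → a :* (b :* c) := (a :* c) :* b) refl (ι (suc n)) (inv m) (inv n))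
          (trans (cong (_* inv m) (ι*inv n)) (*-identityˡ (inv m)))

½+½ : ∀ p → ½ * p + ½ * p ≡ p
½+½ p = solve 1 (λ p → con ½ :* p :+ con ½ :* p := p) refl p

0<½* : ∀ {p} → 0ℚ < p → 0ℚ < ½ * p
0<½* = 0<* (positive⁻¹ ½)

½*< : ∀ {p} → 0ℚ < p → ½ * p < p
½*< {p} 0<p = subst₂ _<_ (+-identityʳ (½ * p)) (½+½ p) (+-monoʳ-< (½ * p) (0<½* 0<p))

∣∣≤ : ∀ {p q} → p ≤ q → - p ≤ q → ℚ.∣ p ∣ ≤ q
∣∣≤ {p} h₁ h₂ with ∣p∣≡p∨∣p∣≡-p p
... | inj₁ e = subst (_≤ _) (sym e) h₁
... | inj₂ e = subst (_≤ _) (sym e) h₂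

≤∣∣ : ∀ p → p ≤ ℚ.∣ p ∣
≤∣∣ p with ≤-total 0ℚ p
... | inj₁ 0≤p = ≤-reflexive (sym (0≤p⇒∣p∣≡p 0≤p))
... | inj₂ p≤0 = ≤-trans p≤0 (0≤∣p∣ p)

∣-∣-sym : ∀ p q → ℚ.∣ p - q ∣ ≡ ℚ.∣ q - p ∣
∣-∣-sym p q = trans (sym (∣-p∣≡∣p∣ (p - q)))
  (cong ℚ.∣_∣ (solve 2 (λ p q → :- (p :- q) := q :- p) refl p q))

∣-∣-triangle : ∀ p q r → ℚ.∣ p - r ∣ ≤ ℚ.∣ p - q ∣ + ℚ.∣ q - r ∣
∣-∣-triangle p q r = subst (λ z → ℚ.∣ z ∣ ≤ ℚ.∣ p - q ∣ + ℚ.∣ q - r ∣)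
  (solve 3 (λ p q r → (p :- q) :+ (q :- r) := p :- r) refl p q r)
  (∣p+q∣≤∣p∣+∣q∣ (p - q) (q - r))

∣∣≤∣∣+∣-∣ : ∀ p q → ℚ.∣ p ∣ ≤ ℚ.∣ q ∣ + ℚ.∣ p - q ∣
∣∣≤∣∣+∣-∣ p q = subst (λ z → ℚ.∣ z ∣ ≤ ℚ.∣ q ∣ + ℚ.∣ p - q ∣)
  (solve 2 (λ p q → q :+ (p :- q) := p) refl p q)
  (∣p+q∣≤∣p∣+∣q∣ q (p - q))

scale : ∀ B ε → 0ℚ < B → 0ℚ < ε → ∃[ δ ] 0ℚ < δ × B * δ ≡ ε
scale B ε 0<B 0<ε = B⁻¹ * ε , 0<* B⁻¹>0 0<ε ,
  trans (sym (*-assoc B B⁻¹ ε))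
    (trans (cong (_* ε) (*-inverseʳ B {{B≢0}})) (*-identityˡ ε))
  where
  B≢0 : ℚ.NonZero B
  B≢0 = pos⇒nonZero B {{ℚ.positive 0<B}}
  B⁻¹ : ℚ
  B⁻¹ = (ℚ.1/ B) {{B≢0}}
  B⁻¹>0 : 0ℚ < B⁻¹
  B⁻¹>0 = positive⁻¹ B⁻¹ {{1/pos⇒pos B {{ℚ.positive 0<B}}}}

∣↥∣ : ∀ q → ι ℤ.∣ ℚ.↥ q ∣ ≡ ℚ.∣ q ∣ * ι (ℚ.↧ₙ q)
∣↥∣ q@(mkℚ i k _) = sym (toℚᵘ-injective
  (ℚᵘ.≃-trans (toℚᵘ-homo-* ℚ.∣ q ∣ (ι (suc k)))
  (ℚᵘ.≃-trans (ℚᵘ.*-cong (toℚᵘ-homo-∣-∣ q) (toℚᵘ-/ (+ suc k) 0))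
  (ℚᵘ.≃-trans
    (ℚᵘ.*≡* (trans (ℤ.*-assoc (+ ℤ.∣ i ∣) (+ suc k) (+ 1))
      (cong (λ z → + ℤ.∣ i ∣ ℤ.* z)
        (trans (ℤ.*-identityʳ (+ suc k)) (cong +_ (sym (ℕ.*-identityʳ (suc k))))))))
    (ℚᵘ.≃-sym (toℚᵘ-/ (+ ℤ.∣ i ∣) 0))))))

upper : ∀ q → ∃[ N ] q ≤ ι N
upper q = ℤ.∣ ℚ.↥ q ∣ , ≤-trans (≤∣∣ q) (subst (ℚ.∣ q ∣ ≤_) (sym (∣↥∣ q))
  (subst (_≤ ℚ.∣ q ∣ * ι (ℚ.↧ₙ q)) (*-identityʳ ℚ.∣ q ∣)
    (*-mono-l (0≤∣p∣ q) (ι-mono {1} {ℚ.↧ₙ q} (ℕ.s≤s ℕ.z≤n)))))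

inv-small : ∀ C ε → 0ℚ < ε → ∃[ N ] (∀ {n} → N ℕ.≤ n → C * inv n ≤ ε)
inv-small C ε 0<ε =
  let (ε⁻¹ , _ , eq) = scale ε 1ℚ 0<ε (positive⁻¹ 1ℚ)
      (N , h) = upper (ε⁻¹ * C)
  in N , λ {n} N≤n → bound {ε⁻¹} {n} eq (≤-trans h (ι-mono {N} {suc n} (ℕ.m≤n⇒m≤1+n N≤n)))
  where
  open ≤-Reasoning
  bound : ∀ {ε⁻¹ n} → ε * ε⁻¹ ≡ 1ℚ → ε⁻¹ * C ≤ ι (suc n) → C * inv n ≤ ε
  bound {ε⁻¹} {n} eq h = begin
    C * inv n                 ≡⟨ cong (_* inv n) (*-identityˡ C) ⟨
    1ℚ * C * inv n            ≡⟨ cong (λ z → z * C * inv n) eq ⟨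
    ε * ε⁻¹ * C * inv n       ≡⟨ cong (_* inv n) (*-assoc ε ε⁻¹ C) ⟩
    ε * (ε⁻¹ * C) * inv n     ≤⟨ *-mono-r (0≤inv n) (*-mono-l (<⇒≤ 0<ε) h) ⟩
    ε * ι (suc n) * inv n     ≡⟨ *-assoc ε (ι (suc n)) (inv n) ⟩
    ε * (ι (suc n) * inv n)   ≡⟨ cong (ε *_) (ι*inv n) ⟩
    ε * 1ℚ                    ≡⟨ *-identityʳ ε ⟩
    ε                         ∎

Cauchy : (ℕ → ℚ) → Set
Cauchy x = ∀ ε → 0ℚ < ε → ∃[ N ] (∀ {m n} → N ℕ.≤ m → N ℕ.≤ n → ℚ.∣ x m - x n ∣ < ε)

record ℝ : Set where
  constructor mkℝ
  field
    seq    : ℕ → ℚ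
    cauchy : Cauchy seq

open ℝ public

infix 4 _≤ℝ_ _<ℝ_ _≈ℝ_

_≤ℝ_ : ℝ → ℝ → Set
x ≤ℝ y = ∀ ε → 0ℚ < ε → ∃[ N ] (∀ {n} → N ℕ.≤ n → seq x n ≤ seq y n + ε)

_<ℝ_ : ℝ → ℝ → Set
x <ℝ y = ∃[ ε ] 0ℚ < ε × ∃[ N ] (∀ {n} → N ℕ.≤ n → seq x n + ε ≤ seq y n)

_≈ℝ_ : ℝ → ℝ → Set
x ≈ℝ y = x ≤ℝ y × y ≤ℝ x

cauchy-≤ : ∀ {x} →
           (∀ ε → 0ℚ < ε → ∃[ N ] (∀ {m n} → N ℕ.≤ m → N ℕ.≤ n → ℚ.∣ x m - x n ∣ ≤ ε)) →
           Cauchy x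
cauchy-≤ h ε 0<ε with h (½ * ε) (0<½* {ε} 0<ε)
... | N , p = N , λ N≤m N≤n → ≤-<-trans (p N≤m N≤n) (½*< 0<ε)

cauchy-one-sided : ∀ {x} →
  (∀ ε → 0ℚ < ε → ∃[ N ] (∀ {m n} → N ℕ.≤ m → N ℕ.≤ n → x m ≤ x n + ε)) → Cauchy x
cauchy-one-sided {x} h = cauchy-≤ {x} λ ε 0<ε → let (N , p) = h ε 0<ε in
  N , λ {m} {n} N≤m N≤n → ∣∣≤ (≤+⇒-≤ (p N≤m N≤n))
    (subst (_≤ ε) (solve 2 (λ a b → b :- a := :- (a :- b)) refl (x m) (x n)) (≤+⇒-≤ (p N≤n N≤m)))

cauchy-ordered : ∀ {x} →
  (∀ ε → 0ℚ < ε → ∃[ N ] (∀ {m n} → N ℕ.≤ n → n ℕ.≤ m → ℚ.∣ x m - x n ∣ ≤ ε)) → Cauchy x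
cauchy-ordered {x} h = cauchy-≤ {x} λ ε 0<ε → let (N , p) = h ε 0<ε in N , λ {m} {n} → both p
  where
  both : ∀ {ε N} → (∀ {m n} → N ℕ.≤ n → n ℕ.≤ m → ℚ.∣ x m - x n ∣ ≤ ε) →
         ∀ {m n} → N ℕ.≤ m → N ℕ.≤ n → ℚ.∣ x m - x n ∣ ≤ ε
  both {ε} p {m} {n} N≤m N≤n with ℕ.≤-total n m
  ... | inj₁ n≤m = p N≤n n≤m
  ... | inj₂ m≤n = subst (_≤ ε) (∣-∣-sym (x n) (x m)) (p N≤m m≤n)

bounded : ∀ x → Cauchy x →
          ∃[ B ] 0ℚ < B × ∃[ N ] (∀ {n} → N ℕ.≤ n → ℚ.∣ x n ∣ ≤ B)
bounded x c with c 1ℚ (positive⁻¹ 1ℚ)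
... | N , p = ℚ.∣ x N ∣ + 1ℚ ,
  <-≤-trans (positive⁻¹ 1ℚ) (p≤q+p (0≤∣p∣ (x N))) ,
  N , λ {n} N≤n → ≤-trans (∣∣≤∣∣+∣-∣ (x n) (x N))
    (+-monoʳ-≤ ℚ.∣ x N ∣ (<⇒≤ (p N≤n ℕ.≤-refl)))

fromℚ : ℚ → ℝ
fromℚ q = mkℝ (λ _ → q) λ ε 0<ε → 0 , λ _ _ →
  subst (_< ε) (cong ℚ.∣_∣ (sym (+-inverseʳ q))) 0<ε

fromℕ : ℕ → ℝ
fromℕ n = fromℚ (ι n)

0ℝ : ℝ
0ℝ = fromℕ 0

infixl 6 _+ℝ_ _-ℝ_
infixl 7 _*ℝ_
infix  8 -ℝ_

+-cauchy : ∀ {x y} → Cauchy x → Cauchy y → Cauchy (λ n → x n + y n)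
+-cauchy {x} {y} cx cy = cauchy-≤ {λ n → x n + y n} λ ε 0<ε →
  let (N , p) = cx (½ * ε) (0<½* 0<ε)
      (M , q) = cy (½ * ε) (0<½* 0<ε)
  in N ℕ.⊔ M , λ {m} {n} h₁ h₂ →
    subst₂ _≤_
      (cong ℚ.∣_∣ (solve 4 (λ a b c d → (a :- c) :+ (b :- d) := (a :+ b) :- (c :+ d)) refl
        (x m) (y m) (x n) (y n)))
      (½+½ ε)
      (≤-trans (∣p+q∣≤∣p∣+∣q∣ (x m - x n) (y m - y n))
        (+-mono-≤ (<⇒≤ (p (ℕ.m⊔n≤o⇒m≤o N M h₁) (ℕ.m⊔n≤o⇒m≤o N M h₂)))
                  (<⇒≤ (q (ℕ.m⊔n≤o⇒n≤o N M h₁) (ℕ.m⊔n≤o⇒n≤o N M h₂)))))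

_+ℝ_ : ℝ → ℝ → ℝ
x +ℝ y = mkℝ (λ n → seq x n + seq y n) (+-cauchy {seq x} {seq y} (cauchy x) (cauchy y))

neg-cauchy : ∀ {x} → Cauchy x → Cauchy (λ n → - x n)
neg-cauchy {x} cx ε 0<ε = let (N , p) = cx ε 0<ε in
  N , λ {m} {n} N≤m N≤n → subst (_< ε)
    (cong ℚ.∣_∣ (solve 2 (λ a b → b :- a := (:- a) :- (:- b)) refl (x m) (x n)))
    (p N≤n N≤m)

-ℝ_ : ℝ → ℝ
-ℝ x = mkℝ (λ n → - seq x n) (neg-cauchy {seq x} (cauchy x))

_-ℝ_ : ℝ → ℝ → ℝ
x -ℝ y = x +ℝ -ℝ y

*-lipschitz : ∀ {B a b c d} → ℚ.∣ a ∣ ≤ B → ℚ.∣ d ∣ ≤ B →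
  ℚ.∣ a * b - c * d ∣ ≤ B * ℚ.∣ b - d ∣ + B * ℚ.∣ a - c ∣
*-lipschitz {B} {a} {b} {c} {d} ha hd = begin
  ℚ.∣ a * b - c * d ∣
    ≡⟨ cong ℚ.∣_∣ (solve 4 (λ a b c d → a :* b :- c :* d := a :* (b :- d) :+ d :* (a :- c)) refl a b c d) ⟩
  ℚ.∣ a * (b - d) + d * (a - c) ∣
    ≤⟨ ∣p+q∣≤∣p∣+∣q∣ (a * (b - d)) (d * (a - c)) ⟩
  ℚ.∣ a * (b - d) ∣ + ℚ.∣ d * (a - c) ∣
    ≡⟨ cong₂ _+_ (∣p*q∣≡∣p∣*∣q∣ a (b - d)) (∣p*q∣≡∣p∣*∣q∣ d (a - c)) ⟩
  ℚ.∣ a ∣ * ℚ.∣ b - d ∣ + ℚ.∣ d ∣ * ℚ.∣ a - c ∣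
    ≤⟨ +-mono-≤ (*-mono-r (0≤∣p∣ (b - d)) ha) (*-mono-r (0≤∣p∣ (a - c)) hd) ⟩
  B * ℚ.∣ b - d ∣ + B * ℚ.∣ a - c ∣ ∎
  where open ≤-Reasoning

*-cauchy : ∀ {x y} → Cauchy x → Cauchy y → Cauchy (λ n → x n * y n)
*-cauchy {x} {y} cx cy = cauchy-≤ {λ n → x n * y n} go
  where
  go : ∀ ε → 0ℚ < ε →
       ∃[ N ] (∀ {m n} → N ℕ.≤ m → N ℕ.≤ n → ℚ.∣ x m * y m - x n * y n ∣ ≤ ε)
  go ε 0<ε =
    let (B₁ , 0<B₁ , N₁ , b₁) = bounded x cx
        (B₂ , 0<B₂ , N₂ , b₂) = bounded y cy
        0<B = +-mono-< 0<B₁ 0<B₂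
        (δ , 0<δ , eq) = scale (B₁ + B₂) (½ * ε) 0<B (0<½* 0<ε)
        (N₃ , p) = cx δ 0<δ
        (N₄ , q) = cy δ 0<δ
        N = (N₁ ℕ.⊔ N₂) ℕ.⊔ (N₃ ℕ.⊔ N₄)
        N₁₂≤N = ℕ.m≤m⊔n (N₁ ℕ.⊔ N₂) (N₃ ℕ.⊔ N₄)
        N₃₄≤N = ℕ.m≤n⊔m (N₁ ℕ.⊔ N₂) (N₃ ℕ.⊔ N₄)
        N₁≤N = ℕ.≤-trans (ℕ.m≤m⊔n N₁ N₂) N₁₂≤N
        N₂≤N = ℕ.≤-trans (ℕ.m≤n⊔m N₁ N₂) N₁₂≤N
        N₃≤N = ℕ.≤-trans (ℕ.m≤m⊔n N₃ N₄) N₃₄≤N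
        N₄≤N = ℕ.≤-trans (ℕ.m≤n⊔m N₃ N₄) N₃₄≤N
    in N , λ {m} {n} hm hn →
      close {B₁ + B₂} {δ} (<⇒≤ 0<B) eq
        (≤-trans (b₁ (ℕ.≤-trans N₁≤N hm)) (p≤p+q (<⇒≤ 0<B₂)))
        (≤-trans (b₂ (ℕ.≤-trans N₂≤N hn)) (p≤q+p (<⇒≤ 0<B₁)))
        (<⇒≤ (p (ℕ.≤-trans N₃≤N hm) (ℕ.≤-trans N₃≤N hn)))
        (<⇒≤ (q (ℕ.≤-trans N₄≤N hm) (ℕ.≤-trans N₄≤N hn)))
    where
    close : ∀ {B δ m n} → 0ℚ ≤ B → B * δ ≡ ½ * ε → ℚ.∣ x m ∣ ≤ B → ℚ.∣ y n ∣ ≤ B →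
            ℚ.∣ x m - x n ∣ ≤ δ → ℚ.∣ y m - y n ∣ ≤ δ → ℚ.∣ x m * y m - x n * y n ∣ ≤ ε
    close {B} {δ} {m} {n} 0≤B eq hx hy dx dy = begin
      ℚ.∣ x m * y m - x n * y n ∣
        ≤⟨ *-lipschitz {B} {x m} {y m} {x n} {y n} hx hy ⟩
      B * ℚ.∣ y m - y n ∣ + B * ℚ.∣ x m - x n ∣
        ≤⟨ +-mono-≤ (*-mono-l 0≤B dy) (*-mono-l 0≤B dx) ⟩
      B * δ + B * δ
        ≡⟨ cong₂ _+_ eq eq ⟩
      ½ * ε + ½ * ε
        ≡⟨ ½+½ ε ⟩
      ε ∎
      where open ≤-Reasoning

_*ℝ_ : ℝ → ℝ → ℝ
x *ℝ y = mkℝ (λ n → seq x n * seq y n) (*-cauchy {seq x} {seq y} (cauchy x) (cauchy y))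

-- ⌊√n⌋
isqrt : ℕ → ℕ
isqrt zero    = 0
isqrt (suc n) with suc (isqrt n) ℕ.* suc (isqrt n) ℕ.≤? suc n
... | yes _ = suc (isqrt n)
... | no  _ = isqrt n

isqrt-lower : ∀ n → isqrt n ℕ.* isqrt n ℕ.≤ n
isqrt-lower zero    = ℕ.z≤n
isqrt-lower (suc n) with suc (isqrt n) ℕ.* suc (isqrt n) ℕ.≤? suc n
... | yes p = p
... | no  _ = ℕ.m≤n⇒m≤1+n (isqrt-lower n)

isqrt-upper : ∀ n → n ℕ.< suc (isqrt n) ℕ.* suc (isqrt n)
isqrt-upper zero    = ℕ.s≤s ℕ.z≤n
isqrt-upper (suc n) with suc (isqrt n) ℕ.* suc (isqrt n) ℕ.≤? suc n
... | yes p = ℕ.≤-<-trans (isqrt-upper n)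
                (ℕ.*-mono-< (ℕ.n<1+n (suc (isqrt n))) (ℕ.n<1+n (suc (isqrt n))))
... | no ¬p = ℕ.≰⇒> ¬p

-- With N = k + 1 this is ⌊√⌊∣q∣N²⌋⌋, so that sqrtℚ k q is the largest multiple
-- of 1/N whose square is at most ∣q∣.
sqrtNum : ℕ → ℚ → ℕ
sqrtNum k q = isqrt ((ℤ.∣ ℚ.↥ q ∣ ℕ.* (suc k ℕ.* suc k)) ℕ./ ℚ.↧ₙ q)

sqrtℚ : ℕ → ℚ → ℚ
sqrtℚ k q = ι (sqrtNum k q) * inv k

0≤sqrtℚ : ∀ k q → 0ℚ ≤ sqrtℚ k q
0≤sqrtℚ k q = 0≤* (0≤ι (sqrtNum k q)) (0≤inv k)

/-upper : ∀ m n .{{_ : NonZero n}} → m ℕ.< suc (m ℕ./ n) ℕ.* n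
/-upper m n = subst (ℕ._< suc (m ℕ./ n) ℕ.* n) (sym (ℕ.m≡m%n+[m/n]*n m n))
  (ℕ.+-monoˡ-< (m ℕ./ n ℕ.* n) (ℕ.m%n<n m n))

private
  ι∣q∣N² : ∀ k q → ι (ℤ.∣ ℚ.↥ q ∣ ℕ.* (suc k ℕ.* suc k)) ≡
                   ι (ℚ.↧ₙ q) * (ℚ.∣ q ∣ * (ι (suc k) * ι (suc k)))
  ι∣q∣N² k q = trans (ι-* ℤ.∣ ℚ.↥ q ∣ (suc k ℕ.* suc k))
    (trans (cong₂ _*_ (∣↥∣ q) (ι-* (suc k) (suc k)))
      (solve 3 (λ a b c → (a :* b) :* c := b :* (a :* c)) refl
        ℚ.∣ q ∣ (ι (ℚ.↧ₙ q)) (ι (suc k) * ι (suc k))))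

  cancel-N : ∀ k p → p * (ι (suc k) * ι (suc k)) * (inv k * inv k) ≡ p
  cancel-N k p = trans
    (solve 3 (λ p n i → p :* (n :* n) :* (i :* i) := p :* ((n :* i) :* (n :* i))) refl
      p (ι (suc k)) (inv k))
    (trans (cong (λ z → p * (z * z)) (ι*inv k)) (*-identityʳ p))

  square-* : ∀ a b → (a * a) * (b * b) ≡ (a * b) * (a * b)
  square-* = solve 2 (λ a b → (a :* a) :* (b :* b) := (a :* b) :* (a :* b)) refl

0<↧ : ∀ q → 0ℚ < ι (ℚ.↧ₙ q)
0<↧ (mkℚ _ k _) = 0<ι-suc k

sqrtℚ-lower : ∀ k q → sqrtℚ k q * sqrtℚ k q ≤ ℚ.∣ q ∣
sqrtℚ-lower k q = subst₂ _≤_ (square-* (ι r) (inv k)) (cancel-N k ℚ.∣ q ∣)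
  (*-mono-r (0≤* (0≤inv k) (0≤inv k)) (cancel-≤ (0<↧ q) step))
  where
  open ≤-Reasoning
  b  = ℚ.↧ₙ q
  aN = ℤ.∣ ℚ.↥ q ∣ ℕ.* (suc k ℕ.* suc k)
  r  = sqrtNum k q
  step : ι b * (ι r * ι r) ≤ ι b * (ℚ.∣ q ∣ * (ι (suc k) * ι (suc k)))
  step = begin
    ι b * (ι r * ι r)        ≡⟨ cong (ι b *_) (ι-* r r) ⟨
    ι b * ι (r ℕ.* r)        ≡⟨ ι-* b (r ℕ.* r) ⟨
    ι (b ℕ.* (r ℕ.* r))      ≤⟨ ι-mono (ℕ.*-monoʳ-≤ b (isqrt-lower (aN ℕ./ b))) ⟩
    ι (b ℕ.* (aN ℕ./ b))     ≡⟨ cong ι (ℕ.*-comm b (aN ℕ./ b)) ⟩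
    ι (aN ℕ./ b ℕ.* b)       ≤⟨ ι-mono (ℕ.m/n*n≤m aN b) ⟩
    ι aN                     ≡⟨ ι∣q∣N² k q ⟩
    ι b * (ℚ.∣ q ∣ * (ι (suc k) * ι (suc k))) ∎

sqrtℚ-upper : ∀ k q → ℚ.∣ q ∣ ≤ (sqrtℚ k q + inv k) * (sqrtℚ k q + inv k)
sqrtℚ-upper k q = subst₂ _≤_ (cancel-N k ℚ.∣ q ∣) eq
  (*-mono-r (0≤* (0≤inv k) (0≤inv k)) (cancel-≤ (0<↧ q) step))
  where
  open ≤-Reasoning
  b  = ℚ.↧ₙ q
  aN = ℤ.∣ ℚ.↥ q ∣ ℕ.* (suc k ℕ.* suc k)
  r  = sqrtNum k q
  step : ι b * (ℚ.∣ q ∣ * (ι (suc k) * ι (suc k))) ≤ ι b * (ι (suc r) * ι (suc r))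
  step = begin
    ι b * (ℚ.∣ q ∣ * (ι (suc k) * ι (suc k)))  ≡⟨ ι∣q∣N² k q ⟨
    ι aN                        ≤⟨ ι-mono (ℕ.<⇒≤ (/-upper aN b)) ⟩
    ι (suc (aN ℕ./ b) ℕ.* b)    ≤⟨ ι-mono (ℕ.*-monoˡ-≤ b (isqrt-upper (aN ℕ./ b))) ⟩
    ι (suc r ℕ.* suc r ℕ.* b)   ≡⟨ cong ι (ℕ.*-comm (suc r ℕ.* suc r) b) ⟩
    ι (b ℕ.* (suc r ℕ.* suc r)) ≡⟨ ι-* b (suc r ℕ.* suc r) ⟩
    ι b * ι (suc r ℕ.* suc r)   ≡⟨ cong (ι b *_) (ι-* (suc r) (suc r)) ⟩
    ι b * (ι (suc r) * ι (suc r)) ∎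
  eq : (ι (suc r) * ι (suc r)) * (inv k * inv k) ≡ (sqrtℚ k q + inv k) * (sqrtℚ k q + inv k)
  eq = trans (cong (λ z → (z * z) * (inv k * inv k)) (ι-suc r))
    (solve 2 (λ r i → ((con 1ℚ :+ r) :* (con 1ℚ :+ r)) :* (i :* i) :=
                      (r :* i :+ i) :* (r :* i :+ i)) refl (ι r) (inv k))

sqrt-close : ∀ {s t δ η p q} → 0ℚ ≤ t → 0ℚ ≤ δ → 0ℚ < η →
             s * s ≤ p → p ≤ q + η * η → q ≤ (t + δ) * (t + δ) → s ≤ t + δ + η
sqrt-close {s} {t} {δ} {η} {p} {q} 0≤t 0≤δ 0<η hs hpq ht = ≮⇒≥ λ lt →
  <-irrefl refl (begin-strict
    s * s                                ≤⟨ hs ⟩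
    p                                    ≤⟨ hpq ⟩
    q + η * η                            ≤⟨ +-monoˡ-≤ (η * η) ht ⟩
    u * u + η * η                        ≤⟨ p≤p+q (0≤+ 0≤uη 0≤uη) ⟩
    u * u + η * η + (u * η + u * η)      ≡⟨ solve 2 (λ u η → u :* u :+ η :* η :+ (u :* η :+ u :* η) :=
                                                             (u :+ η) :* (u :+ η)) refl u η ⟩
    (u + η) * (u + η)                    ≤⟨ *-mono-l (<⇒≤ 0<w) (<⇒≤ lt) ⟩
    (u + η) * s                          <⟨ *-monoˡ-<-pos s {{ℚ.positive (<-trans 0<w lt)}} lt ⟩
    s * s                                ∎)
  where
  open ≤-Reasoning
  u = t + δ
  0≤u : 0ℚ ≤ u
  0≤u = 0≤+ 0≤t 0≤δ
  0≤uη : 0ℚ ≤ u * η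
  0≤uη = 0≤* 0≤u (<⇒≤ 0<η)
  0<w : 0ℚ < u + η
  0<w = +-mono-≤-< 0≤u 0<η

sqrt-cauchy : ∀ {x} → Cauchy x → Cauchy (λ n → sqrtℚ n (x n))
sqrt-cauchy {x} cx = cauchy-one-sided {λ n → sqrtℚ n (x n)} go
  where
  go : ∀ ε → 0ℚ < ε →
       ∃[ N ] (∀ {m n} → N ℕ.≤ m → N ℕ.≤ n → sqrtℚ m (x m) ≤ sqrtℚ n (x n) + ε)
  go ε 0<ε =
    let η = ½ * ε
        0<η = 0<½* 0<ε
        (N₁ , p) = cx (η * η) (0<* 0<η 0<η)
        (N₂ , q) = inv-small 1ℚ η 0<η
    in N₁ ℕ.⊔ N₂ , λ {m} {n} hm hn →
      subst (λ z → sqrtℚ m (x m) ≤ sqrtℚ n (x n) + z) (½+½ ε)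
        (subst (sqrtℚ m (x m) ≤_) (+-assoc (sqrtℚ n (x n)) η η)
          (≤-trans
            (sqrt-close {p = ℚ.∣ x m ∣} {q = ℚ.∣ x n ∣} (0≤sqrtℚ n (x n)) (0≤inv n) 0<η
              (sqrtℚ-lower m (x m))
              (≤-trans (∣∣≤∣∣+∣-∣ (x m) (x n))
                (+-monoʳ-≤ ℚ.∣ x n ∣
                  (<⇒≤ (p (ℕ.m⊔n≤o⇒m≤o N₁ N₂ hm) (ℕ.m⊔n≤o⇒m≤o N₁ N₂ hn)))))
              (sqrtℚ-upper n (x n)))
            (+-monoˡ-≤ η (+-monoʳ-≤ (sqrtℚ n (x n))
              (subst (_≤ η) (*-identityˡ (inv n)) (q (ℕ.m⊔n≤o⇒n≤o N₁ N₂ hn)))))))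

-- √∣x∣; only ever applied to nonnegative reals below.
sqrt : ℝ → ℝ
sqrt x = mkℝ (λ n → sqrtℚ n (seq x n)) (sqrt-cauchy {seq x} (cauchy x))

-- xᵏ/k!
expTerm : ℕ → ℚ → ℚ
expTerm zero    x = 1ℚ
expTerm (suc k) x = expTerm k x * x * inv k

-- ∑_{k<n} xᵏ/k!
expSum : ℕ → ℚ → ℚ
expSum zero    x = 0ℚ
expSum (suc n) x = expSum n x + expTerm n x

expTerm-suc : ∀ k x → ι (suc k) * expTerm (suc k) x ≡ expTerm k x * x
expTerm-suc k x = trans
  (solve 3 (λ n t i → n :* (t :* i) := t :* (n :* i)) refl (ι (suc k)) (expTerm k x * x) (inv k))
  (trans (cong (expTerm k x * x *_) (ι*inv k)) (*-identityʳ (expTerm k x * x)))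

∣inv∣ : ∀ k → ℚ.∣ inv k ∣ ≡ inv k
∣inv∣ k = 0≤p⇒∣p∣≡p (0≤inv k)

module _ {B : ℚ} (0<B : 0ℚ < B) where

  open ≤-Reasoning

  private
    0≤B : 0ℚ ≤ B
    0≤B = <⇒≤ 0<B

    t E : ℕ → ℚ
    t k = expTerm k B
    E n = expSum n B

  0≤term : ∀ k → 0ℚ ≤ t k
  0≤term zero    = <⇒≤ (positive⁻¹ 1ℚ)
  0≤term (suc k) = 0≤* (0≤* (0≤term k) 0≤B) (0≤inv k)

  ∣term∣≤ : ∀ {x} → ℚ.∣ x ∣ ≤ B → ∀ k → ℚ.∣ expTerm k x ∣ ≤ t k
  ∣term∣≤ hx zero    = ≤-refl
  ∣term∣≤ {x} hx (suc k) = begin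
    ℚ.∣ expTerm k x * x * inv k ∣
      ≡⟨ ∣p*q∣≡∣p∣*∣q∣ (expTerm k x * x) (inv k) ⟩
    ℚ.∣ expTerm k x * x ∣ * ℚ.∣ inv k ∣
      ≡⟨ cong₂ _*_ (∣p*q∣≡∣p∣*∣q∣ (expTerm k x) x) (∣inv∣ k) ⟩
    ℚ.∣ expTerm k x ∣ * ℚ.∣ x ∣ * inv k
      ≤⟨ *-mono-r (0≤inv k) (*-mono (0≤∣p∣ (expTerm k x)) 0≤B (∣term∣≤ hx k) hx) ⟩
    t k * B * inv k ∎

  sum-mono : ∀ {n m} → n ℕ.≤′ m → E n ≤ E m
  sum-mono ℕ.≤′-refl            = ≤-refl
  sum-mono (ℕ.≤′-step {m} n≤m) = ≤-trans (sum-mono n≤m) (p≤p+q (0≤term m))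

  ∣sum-sum∣≤ : ∀ {x} → ℚ.∣ x ∣ ≤ B → ∀ {n m} → n ℕ.≤′ m →
               ℚ.∣ expSum m x - expSum n x ∣ ≤ E m - E n
  ∣sum-sum∣≤ {x} hx {n} ℕ.≤′-refl = ≤-reflexive
    (trans (cong ℚ.∣_∣ (+-inverseʳ (expSum n x))) (sym (+-inverseʳ (E n))))
  ∣sum-sum∣≤ {x} hx {n} (ℕ.≤′-step {m} n≤m) = begin
    ℚ.∣ expSum m x + expTerm m x - expSum n x ∣
      ≡⟨ cong ℚ.∣_∣ (swap (expSum m x) (expTerm m x) (expSum n x)) ⟩
    ℚ.∣ (expSum m x - expSum n x) + expTerm m x ∣
      ≤⟨ ∣p+q∣≤∣p∣+∣q∣ (expSum m x - expSum n x) (expTerm m x) ⟩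
    ℚ.∣ expSum m x - expSum n x ∣ + ℚ.∣ expTerm m x ∣
      ≤⟨ +-mono-≤ (∣sum-sum∣≤ hx n≤m) (∣term∣≤ hx m) ⟩
    (E m - E n) + t m
      ≡⟨ swap (E m) (t m) (E n) ⟨
    E m + t m - E n ∎
    where
    swap : ∀ a b c → a + b - c ≡ (a - c) + b
    swap = solve 3 (λ a b c → a :+ b :- c := (a :- c) :+ b) refl

  -- Beyond K ≥ 2B consecutive terms at least halve, so n ↦ E n + 2 t n is
  -- nonincreasing.
  private
    K : ℕ
    K = proj₁ (upper (B + B))

    2B≤ : ∀ {k} → K ℕ.≤ k → B + B ≤ ι (suc k)
    2B≤ K≤k = ≤-trans (proj₂ (upper (B + B))) (ι-mono (ℕ.m≤n⇒m≤1+n K≤k))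

  term-halves : ∀ {k} → K ℕ.≤ k → t (suc k) + t (suc k) ≤ t k
  term-halves {k} K≤k = cancel-≤ 0<B (begin
    B * (t (suc k) + t (suc k))
      ≡⟨ solve 2 (λ b u → b :* (u :+ u) := (b :+ b) :* u) refl B (t (suc k)) ⟩
    (B + B) * t (suc k)
      ≤⟨ *-mono-r (0≤term (suc k)) (2B≤ K≤k) ⟩
    ι (suc k) * t (suc k)
      ≡⟨ expTerm-suc k B ⟩
    t k * B
      ≡⟨ *-comm (t k) B ⟩
    B * t k ∎)

  sum+tail-anti : ∀ {n m} → K ℕ.≤ n → n ℕ.≤′ m → E m + (t m + t m) ≤ E n + (t n + t n)
  sum+tail-anti K≤n ℕ.≤′-refl = ≤-refl
  sum+tail-anti {n} K≤n (ℕ.≤′-step {m} n≤m) = begin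
    E m + t m + (t (suc m) + t (suc m))
      ≤⟨ +-monoʳ-≤ (E m + t m) (term-halves (ℕ.≤-trans K≤n (ℕ.≤′⇒≤ n≤m))) ⟩
    E m + t m + t m
      ≡⟨ +-assoc (E m) (t m) (t m) ⟩
    E m + (t m + t m)
      ≤⟨ sum+tail-anti K≤n n≤m ⟩
    E n + (t n + t n) ∎

  tail≤ : ∀ {n m} → K ℕ.≤ n → n ℕ.≤′ m → E m - E n ≤ t n + t n
  tail≤ {n} {m} K≤n n≤m = ≤+⇒-≤ {E m} {E n}
    (≤-trans (p≤p+q (0≤+ (0≤term m) (0≤term m))) (sum+tail-anti K≤n n≤m))

  sumBound : ℚ
  sumBound = E K + (t K + t K)

  sum≤ : ∀ n → E n ≤ sumBound
  sum≤ n with ℕ.≤-total K n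
  ... | inj₁ K≤n = ≤-trans (p≤p+q (0≤+ (0≤term n) (0≤term n)))
                     (sum+tail-anti ℕ.≤-refl (ℕ.≤⇒≤′ K≤n))
  ... | inj₂ n≤K = ≤-trans (sum-mono (ℕ.≤⇒≤′ n≤K)) (p≤p+q (0≤+ (0≤term K) (0≤term K)))

  0<sumBound+1 : 0ℚ < sumBound + 1ℚ
  0<sumBound+1 = +-mono-≤-< (sum≤ 0) (positive⁻¹ 1ℚ)

  term≤ : ∀ k → t (suc k) ≤ (sumBound * B) * inv k
  term≤ k = *-mono-r (0≤inv k) (*-mono-r 0≤B (begin
    t k         ≤⟨ p≤q+p (sum-mono {0} {k} (ℕ.≤⇒≤′ ℕ.z≤n)) ⟩
    E k + t k   ≤⟨ sum≤ (suc k) ⟩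
    sumBound    ∎))

  term-lipschitz : ∀ {x y} → ℚ.∣ x ∣ ≤ B → ℚ.∣ y ∣ ≤ B → ∀ k →
                   ℚ.∣ expTerm (suc k) x - expTerm (suc k) y ∣ ≤ t k * ℚ.∣ x - y ∣
  term-lipschitz {x} {y} hx hy zero = ≤-reflexive
    (trans (cong ℚ.∣_∣ (cong₂ _-_ (simp x) (simp y))) (sym (*-identityˡ ℚ.∣ x - y ∣)))
    where
    simp : ∀ z → 1ℚ * z * inv 0 ≡ z
    simp z = trans (*-identityʳ (1ℚ * z)) (*-identityˡ z)
  term-lipschitz {x} {y} hx hy (suc k) = begin
    ℚ.∣ a * x * i - b * y * i ∣
      ≡⟨ cong ℚ.∣_∣ (solve 5 (λ a b x y i → a :* x :* i :- b :* y :* i :=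
                                          (x :* (a :- b) :+ b :* (x :- y)) :* i) refl a b x y i) ⟩
    ℚ.∣ (x * (a - b) + b * (x - y)) * i ∣
      ≡⟨ trans (∣p*q∣≡∣p∣*∣q∣ e i) (cong (ℚ.∣ e ∣ *_) (∣inv∣ (suc k))) ⟩
    ℚ.∣ x * (a - b) + b * (x - y) ∣ * i
      ≤⟨ *-mono-r (0≤inv (suc k)) (∣p+q∣≤∣p∣+∣q∣ (x * (a - b)) (b * (x - y))) ⟩
    (ℚ.∣ x * (a - b) ∣ + ℚ.∣ b * (x - y) ∣) * i
      ≡⟨ cong (_* i) (cong₂ _+_ (∣p*q∣≡∣p∣*∣q∣ x (a - b)) (∣p*q∣≡∣p∣*∣q∣ b (x - y))) ⟩
    (ℚ.∣ x ∣ * ℚ.∣ a - b ∣ + ℚ.∣ b ∣ * d) * i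
      ≤⟨ *-mono-r (0≤inv (suc k)) (+-mono-≤
           (*-mono (0≤∣p∣ x) (0≤* (0≤term k) (0≤∣p∣ (x - y))) hx (term-lipschitz hx hy k))
           (*-mono-r (0≤∣p∣ (x - y)) (∣term∣≤ hy (suc k)))) ⟩
    (B * (t k * d) + t (suc k) * d) * i
      ≡⟨ solve 5 (λ B u v d i → (B :* (u :* d) :+ v :* d) :* i := (v :+ u :* B) :* i :* d) refl
           B (t k) (t (suc k)) d i ⟩
    (t (suc k) + t k * B) * i * d
      ≡⟨ cong (λ z → (t (suc k) + z) * i * d) (expTerm-suc k B) ⟨
    (t (suc k) + ι (suc k) * t (suc k)) * i * d
      ≡⟨ solve 4 (λ v n i d → (v :+ n :* v) :* i :* d := v :* ((con 1ℚ :+ n) :* i) :* d) refl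
           (t (suc k)) (ι (suc k)) i d ⟩
    t (suc k) * ((1ℚ + ι (suc k)) * i) * d
      ≡⟨ cong (λ z → t (suc k) * (z * i) * d) (ι-suc (suc k)) ⟨
    t (suc k) * (ι (suc (suc k)) * i) * d
      ≡⟨ cong (λ z → t (suc k) * z * d) (ι*inv (suc k)) ⟩
    t (suc k) * 1ℚ * d
      ≡⟨ cong (_* d) (*-identityʳ (t (suc k))) ⟩
    t (suc k) * d ∎
    where
    a = expTerm (suc k) x
    b = expTerm (suc k) y
    i = inv (suc k)
    e = x * (a - b) + b * (x - y)
    d = ℚ.∣ x - y ∣

  sum-lipschitz-suc : ∀ {x y} → ℚ.∣ x ∣ ≤ B → ℚ.∣ y ∣ ≤ B → ∀ n →
                      ℚ.∣ expSum (suc n) x - expSum (suc n) y ∣ ≤ E n * ℚ.∣ x - y ∣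
  sum-lipschitz-suc {x} {y} hx hy zero = ≤-reflexive (sym (*-zeroˡ ℚ.∣ x - y ∣))
  sum-lipschitz-suc {x} {y} hx hy (suc n) = begin
    ℚ.∣ (a + u) - (b + v) ∣
      ≡⟨ cong ℚ.∣_∣ (solve 4 (λ a u b v → (a :+ u) :- (b :+ v) := (a :- b) :+ (u :- v)) refl a u b v) ⟩
    ℚ.∣ (a - b) + (u - v) ∣
      ≤⟨ ∣p+q∣≤∣p∣+∣q∣ (a - b) (u - v) ⟩
    ℚ.∣ a - b ∣ + ℚ.∣ u - v ∣
      ≤⟨ +-mono-≤ (sum-lipschitz-suc hx hy n) (term-lipschitz hx hy n) ⟩
    E n * d + t n * d
      ≡⟨ *-distribʳ-+ d (E n) (t n) ⟨
    (E n + t n) * d ∎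
    where
    a = expSum (suc n) x
    b = expSum (suc n) y
    u = expTerm (suc n) x
    v = expTerm (suc n) y
    d = ℚ.∣ x - y ∣

  sum-lipschitz : ∀ {x y} → ℚ.∣ x ∣ ≤ B → ℚ.∣ y ∣ ≤ B → ∀ n →
                  ℚ.∣ expSum n x - expSum n y ∣ ≤ (sumBound + 1ℚ) * ℚ.∣ x - y ∣
  sum-lipschitz {x} {y} hx hy zero    = 0≤* (<⇒≤ 0<sumBound+1) (0≤∣p∣ (x - y))
  sum-lipschitz {x} {y} hx hy (suc n) = ≤-trans (sum-lipschitz-suc hx hy n)
    (*-mono-r (0≤∣p∣ (x - y)) (≤-trans (sum≤ n) (p≤p+q (<⇒≤ (positive⁻¹ 1ℚ)))))

  tail-small : ∀ ε → 0ℚ < ε → ∃[ N ] (∀ {n m} → N ℕ.≤ n → n ℕ.≤ m → E m - E n ≤ ε)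
  tail-small ε 0<ε =
    let (N , p) = inv-small (sumBound * B) (½ * ε) (0<½* 0<ε)
    in K ℕ.⊔ suc N , λ {n} {m} h n≤m →
      ≤-trans (tail≤ (ℕ.m⊔n≤o⇒m≤o K (suc N) h) (ℕ.≤⇒≤′ n≤m))
        (subst (t n + t n ≤_) (½+½ ε)
          (let s = small N p (ℕ.m⊔n≤o⇒n≤o K (suc N) h) in +-mono-≤ s s))
    where
    small : ∀ {η} N → (∀ {n} → N ℕ.≤ n → (sumBound * B) * inv n ≤ η) →
            ∀ {n} → suc N ℕ.≤ n → t n ≤ η
    small N p {suc n} (ℕ.s≤s N≤n) = ≤-trans (term≤ n) (p N≤n)

exp-cauchy : ∀ {x} → Cauchy x → Cauchy (λ n → expSum n (x n))
exp-cauchy {x} cx = cauchy-ordered {λ n → expSum n (x n)} go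
  where
  go : ∀ ε → 0ℚ < ε →
       ∃[ N ] (∀ {m n} → N ℕ.≤ n → n ℕ.≤ m → ℚ.∣ expSum m (x m) - expSum n (x n) ∣ ≤ ε)
  go ε 0<ε =
    let (B , 0<B , N₁ , b) = bounded x cx
        0<½ε = 0<½* 0<ε
        (δ , 0<δ , eq) = scale (sumBound 0<B + 1ℚ) (½ * ε) (0<sumBound+1 0<B) 0<½ε
        (N₂ , p) = cx δ 0<δ
        (N₃ , q) = tail-small 0<B (½ * ε) 0<½ε
        N = N₁ ℕ.⊔ (N₂ ℕ.⊔ N₃)
        N₁≤N = ℕ.m≤m⊔n N₁ (N₂ ℕ.⊔ N₃)
        N₂≤N = ℕ.≤-trans (ℕ.m≤m⊔n N₂ N₃) (ℕ.m≤n⊔m N₁ (N₂ ℕ.⊔ N₃))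
        N₃≤N = ℕ.≤-trans (ℕ.m≤n⊔m N₂ N₃) (ℕ.m≤n⊔m N₁ (N₂ ℕ.⊔ N₃))
    in N , λ {m} {n} N≤n n≤m →
      let N≤m = ℕ.≤-trans N≤n n≤m in
      close 0<B eq n≤m
        (b (ℕ.≤-trans N₁≤N N≤m)) (b (ℕ.≤-trans N₁≤N N≤n))
        (<⇒≤ (p (ℕ.≤-trans N₂≤N N≤m) (ℕ.≤-trans N₂≤N N≤n)))
        (q (ℕ.≤-trans N₃≤N N≤n) n≤m)
    where
    open ≤-Reasoning
    close : ∀ {B δ m n} (0<B : 0ℚ < B) → (sumBound 0<B + 1ℚ) * δ ≡ ½ * ε → n ℕ.≤ m →
            ℚ.∣ x m ∣ ≤ B → ℚ.∣ x n ∣ ≤ B → ℚ.∣ x m - x n ∣ ≤ δ →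
            expSum m B - expSum n B ≤ ½ * ε →
            ℚ.∣ expSum m (x m) - expSum n (x n) ∣ ≤ ε
    close {B} {δ} {m} {n} 0<B eq n≤m hm hn hd ht = begin
      ℚ.∣ expSum m (x m) - expSum n (x n) ∣
        ≤⟨ ∣-∣-triangle (expSum m (x m)) (expSum n (x m)) (expSum n (x n)) ⟩
      ℚ.∣ expSum m (x m) - expSum n (x m) ∣ + ℚ.∣ expSum n (x m) - expSum n (x n) ∣
        ≤⟨ +-mono-≤ (∣sum-sum∣≤ 0<B hm (ℕ.≤⇒≤′ n≤m)) (sum-lipschitz 0<B hm hn n) ⟩
      (expSum m B - expSum n B) + (sumBound 0<B + 1ℚ) * ℚ.∣ x m - x n ∣
        ≤⟨ +-mono-≤ ht (*-mono-l (<⇒≤ (0<sumBound+1 0<B)) hd) ⟩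
      ½ * ε + (sumBound 0<B + 1ℚ) * δ
        ≡⟨ cong (_+_ (½ * ε)) eq ⟩
      ½ * ε + ½ * ε
        ≡⟨ ½+½ ε ⟩
      ε ∎

exp : ℝ → ℝ
exp x = mkℝ (λ n → expSum n (seq x n)) (exp-cauchy {seq x} (cauchy x))

-- ∑_{1≤j≤m} 1/j
harmonic : ℕ → ℚ
harmonic zero    = 0ℚ
harmonic (suc m) = harmonic m + inv m

-- With N = k + 1 this is ∑_{N<j≤Nn} 1/j = ∑_{N<j≤Nn} (1/N)·1/(j/N), the right
-- Riemann sum of mesh 1/N of ∫₁ⁿ dt/t.
logSeq : ℕ → ℕ → ℚ
logSeq n k = harmonic (suc k ℕ.* n) - harmonic (suc k)

module _ (n-1 : ℕ) where

  open ≤-Reasoning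

  private
    n : ℕ
    n = suc n-1

    L : ℕ → ℚ
    L = logSeq n

  inv-* : ∀ a → ι n * inv (n-1 ℕ.+ a ℕ.* n) ≡ inv a
  inv-* a = begin-equality
    ι n * w                             ≡⟨ *-identityˡ (ι n * w) ⟨
    1ℚ * (ι n * w)                      ≡⟨ cong (_* (ι n * w)) (ι*inv a) ⟨
    ι (suc a) * inv a * (ι n * w)       ≡⟨ solve 4 (λ a i n w → a :* i :* (n :* w) :=
                                                     i :* (a :* n :* w)) refl (ι (suc a)) (inv a) (ι n) w ⟩
    inv a * (ι (suc a) * ι n * w)       ≡⟨ cong (λ z → inv a * (z * w)) (ι-* (suc a) n) ⟨
    inv a * (ι (suc a ℕ.* n) * w)       ≡⟨ cong (inv a *_) (ι*inv (n-1 ℕ.+ a ℕ.* n)) ⟩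
    inv a * 1ℚ                          ≡⟨ *-identityʳ (inv a) ⟩
    inv a                               ∎
    where
    w = inv (n-1 ℕ.+ a ℕ.* n)

  block-lower : ∀ {w} a j → (∀ i → i ℕ.< j → w ≤ inv (i ℕ.+ a)) →
                ι j * w + harmonic a ≤ harmonic (j ℕ.+ a)
  block-lower {w} a zero    h = ≤-reflexive
    (trans (cong (_+ harmonic a) (*-zeroˡ w)) (+-identityˡ (harmonic a)))
  block-lower {w} a (suc j) h = begin
    ι (suc j) * w + harmonic a     ≡⟨ cong (λ z → z * w + harmonic a) (ι-suc j) ⟩
    (1ℚ + ι j) * w + harmonic a    ≡⟨ solve 3 (λ j w h → (con 1ℚ :+ j) :* w :+ h := (j :* w :+ h) :+ w)
                                        refl (ι j) w (harmonic a) ⟩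
    (ι j * w + harmonic a) + w     ≤⟨ +-mono-≤ (block-lower a j (λ i i<j → h i (ℕ.m≤n⇒m≤1+n i<j)))
                                               (h j ℕ.≤-refl) ⟩
    harmonic (j ℕ.+ a) + inv (j ℕ.+ a) ∎

  block-upper : ∀ {w} a j → (∀ i → i ℕ.< j → inv (i ℕ.+ a) ≤ w) →
                harmonic (j ℕ.+ a) ≤ ι j * w + harmonic a
  block-upper {w} a zero    h = ≤-reflexive
    (sym (trans (cong (_+ harmonic a) (*-zeroˡ w)) (+-identityˡ (harmonic a))))
  block-upper {w} a (suc j) h = begin
    harmonic (j ℕ.+ a) + inv (j ℕ.+ a)
                                   ≤⟨ +-mono-≤ (block-upper a j (λ i i<j → h i (ℕ.m≤n⇒m≤1+n i<j)))
                                               (h j ℕ.≤-refl) ⟩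
    (ι j * w + harmonic a) + w     ≡⟨ solve 3 (λ j w h → (con 1ℚ :+ j) :* w :+ h := (j :* w :+ h) :+ w)
                                        refl (ι j) w (harmonic a) ⟨
    (1ℚ + ι j) * w + harmonic a    ≡⟨ cong (λ z → z * w + harmonic a) (ι-suc j) ⟨
    ι (suc j) * w + harmonic a     ∎

  log-mono-suc : ∀ k → L k ≤ L (suc k)
  log-mono-suc k = begin
    H - h                          ≡⟨ solve 3 (λ u H h → H :- h := (u :+ H) :- (h :+ u)) refl
                                        (inv (suc k)) H h ⟩
    (inv (suc k) + H) - (h + inv (suc k))
      ≡⟨ cong (λ z → (z + H) - (h + inv (suc k))) (inv-* (suc k)) ⟨
    (ι n * w + H) - (h + inv (suc k))
      ≤⟨ +-monoˡ-≤ (- (h + inv (suc k))) (block-lower (suc k ℕ.* n) n λ i i<n →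
           inv-anti (ℕ.+-monoˡ-≤ (suc k ℕ.* n) (ℕ.s≤s⁻¹ i<n))) ⟩
    harmonic (n ℕ.+ suc k ℕ.* n) - (h + inv (suc k)) ∎
    where
    H = harmonic (suc k ℕ.* n)
    h = harmonic (suc k)
    w = inv (n-1 ℕ.+ suc k ℕ.* n)

  log+inv-anti-suc : ∀ k → L (suc k) + inv (suc k) ≤ L k + inv k
  log+inv-anti-suc k = begin
    harmonic (n ℕ.+ suc k ℕ.* n) - (h + u) + u
      ≤⟨ +-monoˡ-≤ u (+-monoˡ-≤ (- (h + u)) (block-upper (suc k ℕ.* n) n λ i _ →
           inv-anti (ℕ.≤-trans (ℕ.n≤1+n _) (ℕ.m≤n+m (suc k ℕ.* n) i)))) ⟩
    (ι n * w + H) - (h + u) + u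
      ≡⟨ cong (λ z → (z + H) - (h + u) + u) (inv-* k) ⟩
    (inv k + H) - (h + u) + u
      ≡⟨ solve 4 (λ v u H h → (v :+ H) :- (h :+ u) :+ u := (H :- h) :+ v) refl (inv k) u H h ⟩
    (H - h) + inv k ∎
    where
    H = harmonic (suc k ℕ.* n)
    h = harmonic (suc k)
    u = inv (suc k)
    w = inv (n-1 ℕ.+ k ℕ.* n)

  log-mono : ∀ {j k} → j ℕ.≤′ k → L j ≤ L k
  log-mono ℕ.≤′-refl            = ≤-refl
  log-mono (ℕ.≤′-step {k} j≤k) = ≤-trans (log-mono j≤k) (log-mono-suc k)

  log+inv-anti : ∀ {j k} → j ℕ.≤′ k → L k + inv k ≤ L j + inv j
  log+inv-anti ℕ.≤′-refl            = ≤-refl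
  log+inv-anti (ℕ.≤′-step {k} j≤k) = ≤-trans (log+inv-anti-suc k) (log+inv-anti j≤k)

  log-cauchy : Cauchy L
  log-cauchy = cauchy-ordered {L} λ ε 0<ε →
    let (N , p) = inv-small 1ℚ ε 0<ε in
    N , λ {m} {k} N≤k k≤m →
      ∣∣≤ (≤-trans (≤+⇒-≤ {L m} {L k} (≤-trans (p≤p+q {L m} (0≤inv m)) (log+inv-anti (ℕ.≤⇒≤′ k≤m))))
                   (subst (_≤ ε) (*-identityˡ (inv k)) (p N≤k)))
          (≤-trans (subst (_≤ 0ℚ) (solve 2 (λ a b → b :- a := :- (a :- b)) refl (L m) (L k))
                     (≤+⇒-≤ {L k} {L m} (subst (L k ≤_) (sym (+-identityʳ (L m))) (log-mono (ℕ.≤⇒≤′ k≤m)))))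
                   (<⇒≤ 0<ε))

log : (n : ℕ) .{{_ : NonZero n}} → ℝ
log (suc n-1) = mkℝ (logSeq (suc n-1)) (log-cauchy n-1)

record Point : Set where
  constructor mkPoint
  field
    x y : ℝ

open Point public

infix 4 _≈ᴾ_ _≈ᴸ_ _on_

_≈ᴾ_ : Point → Point → Set
p ≈ᴾ q = x p ≈ℝ x q × y p ≈ℝ y q

dist : Point → Point → ℝ
dist p q = sqrt ((x p -ℝ x q) *ℝ (x p -ℝ x q) +ℝ (y p -ℝ y q) *ℝ (y p -ℝ y q))

record Line : Set where
  field
    a b c         : ℝ  -- ax + by = c
    nondegenerate : ¬ (a ≈ℝ 0ℝ × b ≈ℝ 0ℝ)

  form : Point → ℝ
  form p = a *ℝ x p +ℝ b *ℝ y p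

open Line using (c; form)

_on_ : Point → Line → Set
p on ℓ = form ℓ p ≈ℝ c ℓ

Side⁻ Side⁺ : Line → Point → Set
Side⁻ ℓ p = form ℓ p <ℝ c ℓ
Side⁺ ℓ p = c ℓ <ℝ form ℓ p

-- Equality as sets of points: proportional equations give the same line.
_≈ᴸ_ : Line → Line → Set
ℓ ≈ᴸ ℓ′ = ∀ p → p on ℓ ⇔ p on ℓ′

-- A set of n points, given by an enumeration without repetition.
record PointSet (n : ℕ) : Set where
  field
    pt       : Fin n → Point
    distinct : ∀ {i j} → i ≢ j → ¬ pt i ≈ᴾ pt j

open PointSet

GeneralPosition : ∀ {n} → PointSet n → Set
GeneralPosition P = ∀ {i j k} → i ≢ j → i ≢ k → j ≢ k →
  ¬ (∃[ ℓ ] pt P i on ℓ × pt P j on ℓ × pt P k on ℓ)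

-- max distance / min distance ≤ γ√n, with the denominator cleared (the minimum
-- distance is positive because the points are distinct).
Dense : ℝ → ∀ {n} → PointSet n → Set
Dense γ {n} P = ∀ {i j k l} → i ≢ j → k ≢ l →
  dist (pt P i) (pt P j) ≤ℝ γ *ℝ sqrt (fromℕ n) *ℝ dist (pt P k) (pt P l)

HasExactly : ∀ {n} → ℕ → (Point → Set) → PointSet n → Set
HasExactly {n} k Q P = Σ[ S ∈ Subset n ] (∀ i → i ∈ S ⇔ Q (pt P i)) × ∣ S ∣ ≡ k

-- 2k + 2 = n says k = (n-2)/2 without truncation.
HalvingLine : ∀ {n} → PointSet n → Line → Set
HalvingLine {n} P ℓ =
  (∃[ i ] ∃[ j ] i ≢ j × pt P i on ℓ × pt P j on ℓ) ×
  (∃[ k ] 2 ℕ.* k ℕ.+ 2 ≡ n × HasExactly k (Side⁻ ℓ) P × HasExactly k (Side⁺ ℓ) P)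

HalvingLines≥ : ∀ {n} → PointSet n → ℕ → Set
HalvingLines≥ P m = Σ[ ℓ ∈ (Fin m → Line) ]
  (∀ i → HalvingLine P (ℓ i)) × (∀ {i j} → i ≢ j → ¬ ℓ i ≈ᴸ ℓ j)

{-# OPTIONS --safe #-}

-- A set of N points with about (8/5)ᵐ N halving lines, log N = O(m²), is grown in m stages. A stage replaces every point by a
-- cluster, a short vertical arithmetic progression; the cluster of a bold point b receives in addition, for each edge (halving
-- line) from b to a plain point q, a new bold point r on bq close to b and a mirror image r′ of r behind b. The spacings are such that,
-- seen from r, the a-term progressions at b and q interleave; then all 2a lines from r to their terms are halving. Lines
-- of other edges do not separate the points of a cluster, or else pass between r and r′. With d edges at each bold point the number of
-- points grows by the factor a + 2d and that of the edges by 2a; a = 8d gives the ratio 8/5. Each stage loses a factor 2^O(m)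
-- of resolution, so 2^O(m²) suffices in the end.
-- For density, the abscissae are stretched and rounded to integers distinct modulo N, so that the translates by multiples of
-- N fill an interval of integers. Flattened copies of the set are laid along many lines of small slope through the origin, on
-- their right halves, N points lie on the left between consecutive lines, and grid points above and below all the lines
-- make up for the rest: an affine copy of a halving line then halves everything. A final generic perturbation gives general
-- position and preserves the relevant orientations.
module Submission where

open import Data.Bool using (Bool; true; false)
open import Data.Fin as Fin using (Fin; toℕ)
import Data.Fin.Properties as Fin
open import Data.Fin.Subset as Subset using (Subset)
open import Data.Integer as ℤ using (ℤ; +_; 0ℤ; 1ℤ; -1ℤ)
import Data.Integer.Properties as ℤ
open import Data.List as List using (List; []; _∷_; _++_; map; allFin; cartesianProduct; length; lookup)
import Data.List.Properties as List
open import Data.List.Membership.Propositional using (_∈_)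
open import Data.List.Membership.Propositional.Properties
  using (∈-allFin; ∈-map⁺; ∈-map⁻; ∈-++⁺ˡ; ∈-++⁺ʳ; ∈-cartesianProduct⁺; ∈-lookup)
open import Data.List.Relation.Unary.All as All using (All; []; _∷_)
open import Data.List.Relation.Unary.AllPairs using ([]; _∷_)
open import Data.List.Relation.Unary.Any as Any using (here; there)
import Data.List.Relation.Unary.Any.Properties as Any
open import Data.List.Relation.Unary.Unique.Propositional using (Unique)
import Data.List.Relation.Unary.Unique.Propositional.Properties as Unique
open import Data.Nat as ℕ using (ℕ; zero; suc; NonZero)
import Data.Nat.Divisibility as ℕ
import Data.Nat.DivMod as ℕ
import Data.Nat.Properties as ℕ
open import Data.Nat.Tactic.RingSolver using () renaming (solve-∀ to ℕ-solve)
open import Data.Product using (∃-syntax; Σ-syntax; _×_; _,_; proj₁; proj₂)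
open import Data.Product.Properties using () renaming (≡-dec to ×-≡-dec)
open import Data.Rational as ℚ using (ℚ; 0ℚ; 1ℚ; ½; _+_; _*_; _-_; -_; _≤_; _<_; ∣_∣)
open import Data.Rational.Properties
open import Data.Sum using (_⊎_; inj₁; inj₂; [_,_]′)
open import Data.Sum.Properties using (inj₁-injective; inj₂-injective) renaming (≡-dec to ⊎-≡-dec)
open import Data.Unit using (⊤; tt)
import Data.Unit.Properties as Unit
import Data.Vec as Vec
import Data.Vec.Properties as Vec
open import Function using (_∘_; id; mk⇔; Equivalence)
open import Level using (0ℓ)
open import Relation.Binary using (DecidableEquality; Tri; tri<; tri≈; tri>)
open import Relation.Binary.PropositionalEquality
  using (_≡_; _≢_; refl; sym; trans; cong; cong₂; subst; subst₂; module ≡-Reasoning)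
open import Relation.Nullary using (¬_; Dec; yes; no; does; contradiction; dec⇒maybe)
open import Relation.Nullary.Decidable using (from-yes)
open import Tactic.RingSolver using (solve-∀)
open import Tactic.RingSolver.Core.AlmostCommutativeRing using (AlmostCommutativeRing; fromCommutativeRing)

open import Defs

-- Halving is kept as one linear equation: the signs of all points relative to a line add up to
-- zero, and only its two ends lie on it. The equation survives a stage because every old point,
-- bold or plain, turns into exactly a + 2d points; plain clusters are padded to that number, half
-- of the padding above and half below the lines concerned. The interleaved progressions of an edge
-- leave a surplus of one, as the term on the line drops out of its pair; the mirror image of r,
-- pushed slightly downwards, absorbs it. Points of a stage may coincide: only heights above edges
-- are controlled, and rounding to distinct abscissae separates them. All coordinates are rational,
-- so that every sign is decidable; real numbers enter only when the final points are interpreted.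
-- The constant 4 is comfortable. With b = ⌊√n⌋ everything lies in a square of side about 2b, of
-- diagonal about 2√2 b, while distances are at least nearly 1. The slack pays for the lifted
-- copies, the perturbation and the truncated square roots, and a square of this size has ample room
-- for the fillers.

ℚ-ring : AlmostCommutativeRing 0ℓ 0ℓ
ℚ-ring = fromCommutativeRing +-*-commutativeRing λ p → dec⇒maybe (0ℚ ≟ p)

ℤ-ring : AlmostCommutativeRing 0ℓ 0ℓ
ℤ-ring = fromCommutativeRing ℤ.+-*-commutativeRing λ i → dec⇒maybe (0ℤ ℤ.≟ i)

-- Inequalities and absolute values of rationals

0<1 : 0ℚ < 1ℚ
0<1 = positive⁻¹ 1ℚ

-- Most estimates below are certificates of this form: the slack `r` is a combination of the slacks
-- of the hypotheses with nonnegative coefficients, and the ring solver checks the identity.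
≤-by : ∀ {p q} r → 0ℚ ≤ r → q ≡ p + r → p ≤ q
≤-by r 0≤r eq = ≤-trans (p≤p+q 0≤r) (≤-reflexive (sym eq))

<-by : ∀ {p q} r → 0ℚ < r → q ≡ p + r → p < q
<-by {p} r 0<r refl = subst (_< p + r) (+-identityʳ p) (+-monoʳ-< p 0<r)

0≤- : ∀ {p q} → p ≤ q → 0ℚ ≤ q - p
0≤- {p} {q} h = subst (_≤ q - p) (+-inverseʳ p) (+-monoˡ-≤ (- p) h)

0<- : ∀ {p q} → p < q → 0ℚ < q - p
0<- {p} {q} h = subst (_< q - p) (+-inverseʳ p) (+-monoˡ-< (- p) h)

0<+ : ∀ {p q} → 0ℚ < p → 0ℚ ≤ q → 0ℚ < p + q
0<+ 0<p 0≤q = +-mono-<-≤ 0<p 0≤q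

≤+1* : ∀ {p q} → 0ℚ ≤ q → p ≤ 1ℚ → p * q ≤ q
≤+1* {p} {q} 0≤q h = subst (p * q ≤_) (*-identityˡ q) (*-mono-r 0≤q h)

neg-neg : ∀ p → - (- p) ≡ p
neg-neg = solve-∀ ℚ-ring

∣+∣≤ : ∀ {p q P Q} → ∣ p ∣ ≤ P → ∣ q ∣ ≤ Q → ∣ p + q ∣ ≤ P + Q
∣+∣≤ {p} {q} hp hq = ≤-trans (∣p+q∣≤∣p∣+∣q∣ p q) (+-mono-≤ hp hq)

∣*∣≤ : ∀ {p q P Q} → ∣ p ∣ ≤ P → ∣ q ∣ ≤ Q → ∣ p * q ∣ ≤ P * Q
∣*∣≤ {p} {q} hp hq = ≤-trans (≤-reflexive (∣p*q∣≡∣p∣*∣q∣ p q))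
  (*-mono (0≤∣p∣ p) (≤-trans (0≤∣p∣ q) hq) hp hq)

∣-∣≤ : ∀ {p P} → ∣ p ∣ ≤ P → ∣ - p ∣ ≤ P
∣-∣≤ {p} h = ≤-trans (≤-reflexive (∣-p∣≡∣p∣ p)) h

∣pos∣ : ∀ {p} → 0ℚ ≤ p → ∣ p ∣ ≡ p
∣pos∣ = 0≤p⇒∣p∣≡p

∣neg∣ : ∀ {p} → p ≤ 0ℚ → ∣ p ∣ ≡ - p
∣neg∣ {p} h = trans (sym (∣-p∣≡∣p∣ p)) (∣pos∣ (neg-antimono-≤ h))

-∣∣≤ : ∀ p → - ∣ p ∣ ≤ p
-∣∣≤ p = subst (- ∣ p ∣ ≤_) (neg-neg p)
  (neg-antimono-≤ (subst (- p ≤_) (∣-p∣≡∣p∣ p) (≤∣∣ (- p))))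

∣∣≤⇒≤ : ∀ {p P} → ∣ p ∣ ≤ P → p ≤ P
∣∣≤⇒≤ {p} = ≤-trans (≤∣∣ p)

∣∣≤⇒-≤ : ∀ {p P} → ∣ p ∣ ≤ P → - P ≤ p
∣∣≤⇒-≤ {p} h = ≤-trans (neg-antimono-≤ h) (-∣∣≤ p)

∣∣-≢0 : ∀ {p} → p ≢ 0ℚ → 0ℚ < ∣ p ∣
∣∣-≢0 {p} p≢0 with <-cmp p 0ℚ
... | tri< p<0 _ _ = subst (0ℚ <_) (sym (∣neg∣ (<⇒≤ p<0))) (neg-antimono-< p<0)
... | tri≈ _ p≡0 _ = contradiction p≡0 p≢0
... | tri> _ _ 0<p = subst (0ℚ <_) (sym (∣pos∣ (<⇒≤ 0<p))) 0<p

0<-⇒<0 : ∀ {p} → 0ℚ < - p → p < 0ℚ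
0<-⇒<0 {p} h = subst (_< 0ℚ) (neg-neg p) (neg-antimono-< h)

recip : ∀ {p} → 0ℚ < p → ℚ
recip {p} h = (ℚ.1/ p) {{pos⇒nonZero p {{ℚ.positive h}}}}

*-recip : ∀ {p} (h : 0ℚ < p) → p * recip h ≡ 1ℚ
*-recip {p} h = *-inverseʳ p {{pos⇒nonZero p {{ℚ.positive h}}}}

0<recip : ∀ {p} (h : 0ℚ < p) → 0ℚ < recip h
0<recip {p} h = positive⁻¹ (recip h) {{1/pos⇒pos p {{ℚ.positive h}}}}

-- Signs of rationals

sgn : ℚ → ℤ
sgn p with <-cmp p 0ℚ
... | tri< _ _ _ = -1ℤ
... | tri≈ _ _ _ = 0ℤ
... | tri> _ _ _ = 1ℤ

sgn-pos : ∀ {p} → 0ℚ < p → sgn p ≡ 1ℤ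
sgn-pos {p} h with <-cmp p 0ℚ
... | tri< _ _ ¬h = contradiction h ¬h
... | tri≈ _ _ ¬h = contradiction h ¬h
... | tri> _ _ _  = refl

sgn-neg : ∀ {p} → p < 0ℚ → sgn p ≡ -1ℤ
sgn-neg {p} h with <-cmp p 0ℚ
... | tri< _ _ _  = refl
... | tri≈ ¬h _ _ = contradiction h ¬h
... | tri> ¬h _ _ = contradiction h ¬h

sgn-zero : ∀ {p} → p ≡ 0ℚ → sgn p ≡ 0ℤ
sgn-zero {p} h with <-cmp p 0ℚ
... | tri< _ ¬h _ = contradiction h ¬h
... | tri≈ _ _ _  = refl
... | tri> _ ¬h _ = contradiction h ¬h

≢0-cases : ∀ {p} → p ≢ 0ℚ → 0ℚ < p ⊎ p < 0ℚ
≢0-cases {p} h with <-cmp p 0ℚ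
... | tri< p<0 _ _ = inj₂ p<0
... | tri≈ _ p≡0 _ = contradiction p≡0 h
... | tri> _ _ 0<p = inj₁ 0<p

>0⇒≢0 : ∀ {p} → 0ℚ < p → p ≢ 0ℚ
>0⇒≢0 h refl = <-irrefl refl h

<0⇒≢0 : ∀ {p} → p < 0ℚ → p ≢ 0ℚ
<0⇒≢0 h refl = <-irrefl refl h

∣∣>0⇒≢0 : ∀ {p} → 0ℚ < ∣ p ∣ → p ≢ 0ℚ
∣∣>0⇒≢0 h refl = <-irrefl refl h

sgn-negate : ∀ p → sgn (- p) ≡ ℤ.- sgn p
sgn-negate p with <-cmp p 0ℚ
... | tri< p<0 _ _  = sgn-pos (neg-antimono-< p<0)
... | tri≈ _ refl _ = sgn-zero refl
... | tri> _ _ 0<p  = sgn-neg (neg-antimono-< 0<p)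

sgn-* : ∀ p q → sgn (p * q) ≡ sgn p ℤ.* sgn q
sgn-* p q with <-cmp p 0ℚ | <-cmp q 0ℚ
... | tri≈ _ refl _ | _             = sgn-zero (*-zeroˡ q)
... | tri< _ _ _    | tri≈ _ refl _ = sgn-zero (*-zeroʳ p)
... | tri> _ _ _    | tri≈ _ refl _ = sgn-zero (*-zeroʳ p)
... | tri< a _ _    | tri< b _ _ = sgn-pos (subst (0ℚ <_) (eq p q)
        (0<* (neg-antimono-< a) (neg-antimono-< b)))
  where
  eq : ∀ p q → (- p) * (- q) ≡ p * q
  eq = solve-∀ ℚ-ring
... | tri< a _ _    | tri> _ _ b = sgn-neg (0<-⇒<0 (subst (0ℚ <_) (eq p q)
        (0<* (neg-antimono-< a) b)))
  where
  eq : ∀ p q → (- p) * q ≡ - (p * q)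
  eq = solve-∀ ℚ-ring
... | tri> _ _ a    | tri< b _ _ = sgn-neg (0<-⇒<0 (subst (0ℚ <_) (eq p q)
        (0<* a (neg-antimono-< b))))
  where
  eq : ∀ p q → p * (- q) ≡ - (p * q)
  eq = solve-∀ ℚ-ring
... | tri> _ _ a    | tri> _ _ b = sgn-pos (0<* a b)

sgn-pos-* : ∀ {p} q → 0ℚ < p → sgn (p * q) ≡ sgn q
sgn-pos-* {p} q h = trans (sgn-* p q) (trans (cong (ℤ._* sgn q) (sgn-pos h)) (ℤ.*-identityˡ (sgn q)))

sgn≡0⇒≡0 : ∀ p → sgn p ≡ 0ℤ → p ≡ 0ℚ
sgn≡0⇒≡0 p h with <-cmp p 0ℚ
sgn≡0⇒≡0 p () | tri< _ _ _
sgn≡0⇒≡0 p h  | tri≈ _ e _ = e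
sgn≡0⇒≡0 p () | tri> _ _ _

sgn-near< : ∀ {p q} → ∣ q - p ∣ < ∣ p ∣ → sgn q ≡ sgn p
sgn-near< {p} {q} h with <-cmp p 0ℚ
... | tri≈ _ refl _ = contradiction (≤-<-trans (0≤∣p∣ (q - 0ℚ)) h) (<-irrefl refl)
... | tri> _ _ 0<p = sgn-pos (<-by (∣ p ∣ - ∣ q - p ∣ + (q - p - - ∣ q - p ∣))
        (0<+ (0<- h) (0≤- (-∣∣≤ (q - p))))
        (trans (eq (∣ q - p ∣) p q) (cong (λ z → 0ℚ + (z - ∣ q - p ∣ + (q - p - - ∣ q - p ∣)))
          (sym (∣pos∣ (<⇒≤ 0<p))))))
  where
  eq : ∀ d p q → q ≡ 0ℚ + (p - d + (q - p - - d))
  eq = solve-∀ ℚ-ring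
... | tri< p<0 _ _ = sgn-neg (<-by (∣ p ∣ - ∣ q - p ∣ + (∣ q - p ∣ - (q - p)))
        (0<+ (0<- h) (0≤- (≤∣∣ (q - p))))
        (trans (eq (∣ q - p ∣) p q) (cong (λ z → q + (z - ∣ q - p ∣ + (∣ q - p ∣ - (q - p))))
          (sym (∣neg∣ (<⇒≤ p<0))))))
  where
  eq : ∀ d p q → 0ℚ ≡ q + (- p - d + (d - (q - p)))
  eq = solve-∀ ℚ-ring

module _ {p q : ℚ} (close : ∣ q - p ∣ + ∣ q - p ∣ ≤ ∣ p ∣) where

  -- Half of the size survives an error of at most half. Through this each separation bound passes
  -- to the next stage at the cost of a constant factor.
  ∣near∣ : ∣ p ∣ ≤ ∣ q ∣ + ∣ q ∣
  ∣near∣ = ≤-by ((∣ q ∣ + ∣ q - p ∣ - ∣ p ∣) + (∣ q ∣ + ∣ q - p ∣ - ∣ p ∣) + (∣ p ∣ - (∣ q - p ∣ + ∣ q - p ∣)))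
    (0≤+ (0≤+ s s) (0≤- close)) (eq (∣ p ∣) (∣ q ∣) (∣ q - p ∣))
    where
    s : 0ℚ ≤ ∣ q ∣ + ∣ q - p ∣ - ∣ p ∣
    s = 0≤- (subst (λ z → ∣ p ∣ ≤ ∣ q ∣ + z) (∣-∣-sym p q) (∣∣≤∣∣+∣-∣ p q))
    eq : ∀ p q d → q + q ≡ p + ((q + d - p) + (q + d - p) + (p - (d + d)))
    eq = solve-∀ ℚ-ring

  sgn-near : 0ℚ < ∣ p ∣ → sgn q ≡ sgn p
  sgn-near 0<p = sgn-near< (<-by (½ * ∣ p ∣ + ½ * (∣ p ∣ - (∣ q - p ∣ + ∣ q - p ∣)))
    (0<+ (0<½* 0<p) (0≤* (<⇒≤ (positive⁻¹ ½)) (0≤- close)))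
    (eq (∣ p ∣) (∣ q - p ∣)))
    where
    eq : ∀ p d → p ≡ d + (½ * p + ½ * (p - (d + d)))
    eq = solve-∀ ℚ-ring

-- Finite types and sums over them

record Finite : Set₁ where
  field
    Carrier  : Set
    elems    : List Carrier
    unique   : Unique elems
    complete : ∀ x → x ∈ elems
    _≟ᶠ_     : DecidableEquality Carrier

open Finite public using (elems; unique; complete) renaming (Carrier to ∥_∥)

size : Finite → ℕ
size F = length (elems F)

unitᶠ : Finite
unitᶠ = record { Carrier = ⊤ ; elems = tt ∷ [] ; unique = [] ∷ []
               ; complete = λ _ → here refl ; _≟ᶠ_ = Unit._≟_ }

finᶠ : ℕ → Finite
finᶠ n = record { Carrier = Fin n ; elems = allFin n ; unique = Unique.allFin⁺ n
                ; complete = ∈-allFin ; _≟ᶠ_ = Fin._≟_ }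

infixr 6 _×ᶠ_
infixr 5 _⊎ᶠ_

_×ᶠ_ : Finite → Finite → Finite
F ×ᶠ G = record
  { Carrier  = ∥ F ∥ × ∥ G ∥
  ; elems    = cartesianProduct (elems F) (elems G)
  ; unique   = Unique.cartesianProduct⁺ (unique F) (unique G)
  ; complete = λ (x , y) → ∈-cartesianProduct⁺ (complete F x) (complete G y)
  ; _≟ᶠ_     = ×-≡-dec (Finite._≟ᶠ_ F) (Finite._≟ᶠ_ G)
  }

_⊎ᶠ_ : Finite → Finite → Finite
F ⊎ᶠ G = record
  { Carrier  = ∥ F ∥ ⊎ ∥ G ∥
  ; elems    = map inj₁ (elems F) ++ map inj₂ (elems G)
  ; unique   = Unique.++⁺ (Unique.map⁺ inj₁-injective (unique F)) (Unique.map⁺ inj₂-injective (unique G)) disjoint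
  ; complete = λ { (inj₁ x) → ∈-++⁺ˡ (∈-map⁺ inj₁ (complete F x))
                 ; (inj₂ y) → ∈-++⁺ʳ (map inj₁ (elems F)) (∈-map⁺ inj₂ (complete G y)) }
  ; _≟ᶠ_     = ⊎-≡-dec (Finite._≟ᶠ_ F) (Finite._≟ᶠ_ G)
  }
  where
  disjoint : ∀ {z} → ¬ (z ∈ map inj₁ (elems F) × z ∈ map inj₂ (elems G))
  disjoint (p , q) with ∈-map⁻ inj₁ p | ∈-map⁻ inj₂ q
  ... | _ , _ , refl | _ , _ , ()

size-⊎ : ∀ F G → size (F ⊎ᶠ G) ≡ size F ℕ.+ size G
size-⊎ F G = trans (List.length-++ (map inj₁ (elems F)))
  (cong₂ ℕ._+_ (List.length-map inj₁ (elems F)) (List.length-map inj₂ (elems G)))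

size-× : ∀ F G → size (F ×ᶠ G) ≡ size F ℕ.* size G
size-× F G = go (elems F)
  where
  go : ∀ xs → length (cartesianProduct xs (elems G)) ≡ length xs ℕ.* size G
  go []       = refl
  go (x ∷ xs) = trans (List.length-++ (map (x ,_) (elems G)))
    (cong₂ ℕ._+_ (List.length-map (x ,_) (elems G)) (go xs))

size-fin : ∀ n → size (finᶠ n) ≡ n
size-fin n = List.length-tabulate id

∑ˡ : {A : Set} → List A → (A → ℤ) → ℤ
∑ˡ []       f = 0ℤ
∑ˡ (x ∷ xs) f = f x ℤ.+ ∑ˡ xs f

module _ {A : Set} where

  ∑ˡ-cong : ∀ (xs : List A) {f g} → (∀ x → f x ≡ g x) → ∑ˡ xs f ≡ ∑ˡ xs g
  ∑ˡ-cong []       h = refl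
  ∑ˡ-cong (x ∷ xs) h = cong₂ ℤ._+_ (h x) (∑ˡ-cong xs h)

  ∑ˡ-++ : ∀ (xs ys : List A) f → ∑ˡ (xs ++ ys) f ≡ ∑ˡ xs f ℤ.+ ∑ˡ ys f
  ∑ˡ-++ []       ys f = sym (ℤ.+-identityˡ _)
  ∑ˡ-++ (x ∷ xs) ys f = trans (cong (ℤ._+_ (f x)) (∑ˡ-++ xs ys f)) (sym (ℤ.+-assoc (f x) (∑ˡ xs f) (∑ˡ ys f)))

  ∑ˡ-+ : ∀ (xs : List A) f g → ∑ˡ xs (λ x → f x ℤ.+ g x) ≡ ∑ˡ xs f ℤ.+ ∑ˡ xs g
  ∑ˡ-+ []       f g = refl
  ∑ˡ-+ (x ∷ xs) f g = trans (cong (ℤ._+_ (f x ℤ.+ g x)) (∑ˡ-+ xs f g))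
    (eq (f x) (g x) (∑ˡ xs f) (∑ˡ xs g))
    where
    eq : ∀ a b c d → a ℤ.+ b ℤ.+ (c ℤ.+ d) ≡ a ℤ.+ c ℤ.+ (b ℤ.+ d)
    eq = solve-∀ ℤ-ring

  ∑ˡ-* : ∀ (xs : List A) c f → ∑ˡ xs (λ x → c ℤ.* f x) ≡ c ℤ.* ∑ˡ xs f
  ∑ˡ-* []       c f = sym (ℤ.*-zeroʳ c)
  ∑ˡ-* (x ∷ xs) c f = trans (cong (ℤ._+_ (c ℤ.* f x)) (∑ˡ-* xs c f)) (sym (ℤ.*-distribˡ-+ c (f x) (∑ˡ xs f)))

  ∑ˡ-const : ∀ (xs : List A) c → ∑ˡ xs (λ _ → c) ≡ + length xs ℤ.* c
  ∑ˡ-const []       c = sym (ℤ.*-zeroˡ c)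
  ∑ˡ-const (x ∷ xs) c = trans (cong (ℤ._+_ c) (∑ˡ-const xs c)) (eq c (+ length xs))
    where
    eq : ∀ c n → c ℤ.+ n ℤ.* c ≡ (1ℤ ℤ.+ n) ℤ.* c
    eq = solve-∀ ℤ-ring

  ∑ˡ-map : ∀ {B : Set} (φ : B → A) xs f → ∑ˡ (map φ xs) f ≡ ∑ˡ xs (f ∘ φ)
  ∑ˡ-map φ []       f = refl
  ∑ˡ-map φ (x ∷ xs) f = cong (ℤ._+_ (f (φ x))) (∑ˡ-map φ xs f)

  ∑ˡ-cong-All : ∀ {xs : List A} {f g} → All (λ x → f x ≡ g x) xs → ∑ˡ xs f ≡ ∑ˡ xs g
  ∑ˡ-cong-All []       = refl
  ∑ˡ-cong-All (h ∷ hs) = cong₂ ℤ._+_ h (∑ˡ-cong-All hs)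

  -- Moving the exceptional terms across the equation spares a sum with one point removed. The ends
  -- of an edge are treated in this way, apart from all other points.
  ∑ˡ-change : ∀ {xs : List A} {z} → Unique xs → z ∈ xs → ∀ {f g} → (∀ x → x ≢ z → f x ≡ g x) →
              ∑ˡ xs f ℤ.+ g z ≡ ∑ˡ xs g ℤ.+ f z
  ∑ˡ-change {x ∷ xs} (x∉ ∷ u) (here refl) {f} {g} h = trans
    (cong (λ z → f x ℤ.+ z ℤ.+ g x) (∑ˡ-cong-All (All.map (λ x≢ → h _ (x≢ ∘ sym)) x∉)))
    (eq (f x) (∑ˡ xs g) (g x))
    where
    eq : ∀ a b c → a ℤ.+ b ℤ.+ c ≡ c ℤ.+ b ℤ.+ a
    eq = solve-∀ ℤ-ring
  ∑ˡ-change {x ∷ xs} {z} (x∉ ∷ u) (there z∈) {f} {g} h = trans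
    (ℤ.+-assoc (f x) _ (g z)) (trans
    (cong₂ ℤ._+_ (h x λ { refl → All.lookup x∉ z∈ refl }) (∑ˡ-change u z∈ h))
    (sym (ℤ.+-assoc (g x) _ (f z))))

∑ˡ-swap : ∀ {A B : Set} (xs : List A) (ys : List B) f →
          ∑ˡ (cartesianProduct xs ys) f ≡ ∑ˡ xs (λ x → ∑ˡ ys (λ y → f (x , y)))
∑ˡ-swap []       ys f = refl
∑ˡ-swap (x ∷ xs) ys f = trans (∑ˡ-++ (map (x ,_) ys) (cartesianProduct xs ys) f)
  (cong₂ ℤ._+_ (∑ˡ-map (x ,_) ys f) (∑ˡ-swap xs ys f))

∑ : (F : Finite) → (∥ F ∥ → ℤ) → ℤ
∑ F = ∑ˡ (elems F)

module _ (F : Finite) where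

  ∑-cong : ∀ {f g} → (∀ x → f x ≡ g x) → ∑ F f ≡ ∑ F g
  ∑-cong = ∑ˡ-cong (elems F)

  ∑-+ : ∀ f g → ∑ F (λ x → f x ℤ.+ g x) ≡ ∑ F f ℤ.+ ∑ F g
  ∑-+ = ∑ˡ-+ (elems F)

  ∑-* : ∀ c f → ∑ F (λ x → c ℤ.* f x) ≡ c ℤ.* ∑ F f
  ∑-* = ∑ˡ-* (elems F)

  ∑-const : ∀ c → ∑ F (λ _ → c) ≡ + size F ℤ.* c
  ∑-const = ∑ˡ-const (elems F)

  ∑-zero : ∀ {f} → (∀ x → f x ≡ 0ℤ) → ∑ F f ≡ 0ℤ
  ∑-zero h = trans (∑-cong h) (trans (∑-const 0ℤ) (ℤ.*-zeroʳ (+ size F)))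

  ∑-change : ∀ {z f g} → (∀ x → x ≢ z → f x ≡ g x) → ∑ F f ℤ.+ g z ≡ ∑ F g ℤ.+ f z
  ∑-change {z} = ∑ˡ-change (unique F) (complete F z)

  ∑-single : ∀ {z f} → (∀ x → x ≢ z → f x ≡ 0ℤ) → ∑ F f ≡ f z
  ∑-single {z} {f} h = trans (sym (ℤ.+-identityʳ (∑ F f)))
    (trans (∑-change {z} {f} {λ _ → 0ℤ} h) (trans (cong (ℤ._+ f z) (∑-zero {λ _ → 0ℤ} λ _ → refl)) (ℤ.+-identityˡ (f z))))

∑-× : ∀ F G f → ∑ (F ×ᶠ G) f ≡ ∑ F (λ x → ∑ G (λ y → f (x , y)))
∑-× F G = ∑ˡ-swap (elems F) (elems G)

∑-⊎ : ∀ F G f → ∑ (F ⊎ᶠ G) f ≡ ∑ F (f ∘ inj₁) ℤ.+ ∑ G (f ∘ inj₂)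
∑-⊎ F G f = trans (∑ˡ-++ (map inj₁ (elems F)) (map inj₂ (elems G)) f)
  (cong₂ ℤ._+_ (∑ˡ-map inj₁ (elems F) f) (∑ˡ-map inj₂ (elems G) f))

-- Estimates for the tilted lines of one stage

infixl 6 _⊕_
infixl 7 _⊗_

_⊕_ : ∀ {p q} → 0ℚ ≤ p → 0ℚ ≤ q → 0ℚ ≤ p + q
_⊕_ = 0≤+

_⊗_ : ∀ {p q} → 0ℚ ≤ p → 0ℚ ≤ q → 0ℚ ≤ p * q
_⊗_ = 0≤*

0≤½ : 0ℚ ≤ ½
0≤½ = <⇒≤ (positive⁻¹ ½)

¼ : ℚ
¼ = ½ * ½

0<¼ : 0ℚ < ¼
0<¼ = positive⁻¹ ¼

-- `c` is the spacing of the progressions relative to the weights, `A` their number of terms, and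
-- `Γ` bounds 1/`G`. A cluster has a height of order `u * ω`, and a new edge differs in slope from
-- its parent by at most `u * Γ`; the factor 32 keeps both well below the separation `ν`.
module Perturb {A c ϖ Γ ν D : ℚ} (1≤A : 1ℚ ≤ A) (0<c : 0ℚ < c) (0<ϖ : 0ℚ < ϖ) (1≤Γ : 1ℚ ≤ Γ)
               (0<D : 0ℚ < D) (D≤1 : D ≤ 1ℚ) (0<ν : 0ℚ < ν) (32AcΓ≡νD : ι 32 * (A * c * Γ) ≡ ν * D) where

  u : ℚ
  u = A * c

  private
    0≤c : 0ℚ ≤ c
    0≤c = <⇒≤ 0<c
    0≤A : 0ℚ ≤ A
    0≤A = ≤-trans (<⇒≤ 0<1) 1≤A
    0≤u : 0ℚ ≤ u
    0≤u = 0≤A ⊗ 0≤c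
    0≤Γ : 0ℚ ≤ Γ
    0≤Γ = ≤-trans (<⇒≤ 0<1) 1≤Γ
    0≤ϖ : 0ℚ ≤ ϖ
    0≤ϖ = <⇒≤ 0<ϖ
    0≤uΓ : 0ℚ ≤ u * Γ
    0≤uΓ = 0≤u ⊗ 0≤Γ
    0≤D : 0ℚ ≤ D
    0≤D = <⇒≤ 0<D
    0≤ν : 0ℚ ≤ ν
    0≤ν = <⇒≤ 0<ν

  c≤uΓ : c ≤ u * Γ
  c≤uΓ = ≤-by ((A - 1ℚ) * c * Γ + c * (Γ - 1ℚ))
    (0≤- 1≤A ⊗ 0≤c ⊗ 0≤Γ ⊕ 0≤c ⊗ 0≤- 1≤Γ) (eq A c Γ)
    where
    eq : ∀ A c Γ → A * c * Γ ≡ c + ((A - 1ℚ) * c * Γ + c * (Γ - 1ℚ))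
    eq = solve-∀ ℚ-ring

  32uΓ≤ν : ι 32 * (u * Γ) ≤ ν
  32uΓ≤ν = ≤-by (ν * (1ℚ - D)) (0≤ν ⊗ 0≤- D≤1)
    (trans (eq ν D) (cong (_+ ν * (1ℚ - D)) (sym 32AcΓ≡νD)))
    where
    eq : ∀ ν D → ν ≡ ν * D + ν * (1ℚ - D)
    eq = solve-∀ ℚ-ring

  -- S, w, ω, Δ stand for ϖ∣s₀-s∣, ∣v₀∣, the weight of the parent point and its horizontal distance.
  far-bound : ∀ {S w ω Δ} → ϖ ≤ ω → 0ℚ ≤ Δ → ν * (ω + Δ) ≤ w → ι 4 * S ≤ w →
              let T = (S + ι 4 * (u * ω)) + (A * (c * ϖ) + c * Γ * A * (Δ + ϖ)) in T + T ≤ w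
  far-bound {S} {w} {ω} {Δ} ϖ≤ω 0≤Δ hw hS = ≤-by
    (½ * (w - ι 4 * S) + ½ * (w - ν * (ω + Δ)) + ½ * (ν - ι 32 * (u * Γ)) * (ω + Δ)
      + (ι 14 * (u * Γ) * Δ + ι 2 * (u * Γ) * (ω - ϖ) + ι 2 * u * (ω - ϖ)
      + ι 14 * u * (Γ - 1ℚ) * ω + ι 4 * u * ω))
    (0≤½ ⊗ 0≤- hS ⊕ 0≤½ ⊗ 0≤- hw ⊕ 0≤½ ⊗ 0≤- 32uΓ≤ν ⊗ (0≤ω ⊕ 0≤Δ)
      ⊕ (0≤ι 14 ⊗ 0≤uΓ ⊗ 0≤Δ ⊕ 0≤ι 2 ⊗ 0≤uΓ ⊗ 0≤- ϖ≤ω ⊕ 0≤ι 2 ⊗ 0≤u ⊗ 0≤- ϖ≤ω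
      ⊕ 0≤ι 14 ⊗ 0≤u ⊗ 0≤- 1≤Γ ⊗ 0≤ω ⊕ 0≤ι 4 ⊗ 0≤u ⊗ 0≤ω))
    (eq A c ϖ Γ ν S w ω Δ)
    where
    0≤ω : 0ℚ ≤ ω
    0≤ω = ≤-trans 0≤ϖ ϖ≤ω
    eq : ∀ A c ϖ Γ ν S w ω Δ → w ≡
      (((S + ι 4 * (A * c * ω)) + (A * (c * ϖ) + c * Γ * A * (Δ + ϖ))) +
       ((S + ι 4 * (A * c * ω)) + (A * (c * ϖ) + c * Γ * A * (Δ + ϖ)))) +
      (½ * (w - ι 4 * S) + ½ * (w - ν * (ω + Δ)) + ½ * (ν - ι 32 * (A * c * Γ)) * (ω + Δ)
      + (ι 14 * (A * c * Γ) * Δ + ι 2 * (A * c * Γ) * (ω - ϖ) + ι 2 * (A * c) * (ω - ϖ)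
      + ι 14 * (A * c) * (Γ - 1ℚ) * ω + ι 4 * (A * c) * ω))
    eq = solve-∀ ℚ-ring

  -- For a point on another edge from the same bold point all distances are of order `ϖ`, and the
  -- main term is a difference of slopes times as little as `D * ϖ`. This is why `c` is measured
  -- against `ν * D` and not just `ν`.
  sibling-bound : ∀ {m} → ν * (D * ϖ) ≤ m →
                  let T = ι 4 * (u * ϖ) + (A * (c * ϖ) + c * Γ * A * ϖ) in T + T ≤ m
  sibling-bound {m} hm = ≤-by
    ((m - ν * (D * ϖ)) + (ν * D - ι 32 * (A * c * Γ)) * ϖ + (ι 10 * u * (Γ - 1ℚ) * ϖ + ι 20 * (u * Γ) * ϖ))
    (0≤- hm ⊕ 0≤- (≤-reflexive 32AcΓ≡νD) ⊗ 0≤ϖ ⊕ (0≤ι 10 ⊗ 0≤u ⊗ 0≤- 1≤Γ ⊗ 0≤ϖ ⊕ 0≤ι 20 ⊗ 0≤uΓ ⊗ 0≤ϖ))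
    (eq A c ϖ Γ ν D m)
    where
    eq : ∀ A c ϖ Γ ν D m → m ≡
      ((ι 4 * (A * c * ϖ) + (A * (c * ϖ) + c * Γ * A * ϖ)) + (ι 4 * (A * c * ϖ) + (A * (c * ϖ) + c * Γ * A * ϖ)))
      + ((m - ν * (D * ϖ)) + (ν * D - ι 32 * (A * c * Γ)) * ϖ
      + (ι 10 * (A * c) * (Γ - 1ℚ) * ϖ + ι 20 * (A * c * Γ) * ϖ))
    eq = solve-∀ ℚ-ring

  module _ {w W ω Δ} (ϖ≤ω : ϖ ≤ ω) (0≤Δ : 0ℚ ≤ Δ) (hw : ν * (ω + Δ) ≤ w) (w≤2W : w ≤ W + W) where

    private
      0≤ω : 0ℚ ≤ ω
      0≤ω = ≤-trans 0≤ϖ ϖ≤ω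

    -- The new separation `¼ * c` is so much smaller than `ν` that half of the old height covers it.
    -- The term `ϖ + ϖ` allows both the point and the pivot of the new line to have moved by `ϖ`.
    far-new : ∀ {ω′ δ} → ω′ ≤ ω → δ ≤ Δ + (ϖ + ϖ) → ¼ * c * (ω′ + δ) ≤ W
    far-new {ω′} {δ} hω hδ = ≤-by
      (½ * (W + W - w) + ½ * (w - ν * (ω + Δ)) + ½ * (ν - ι 32 * (u * Γ)) * (ω + Δ) + ι 16 * (u * Γ - c) * (ω + Δ)
        + ¼ * c * (ω - ω′) + ¼ * c * (Δ + (ϖ + ϖ) - δ) + ½ * c * (ω - ϖ) + (¼ * ι 61) * c * ω + (¼ * ι 63) * c * Δ)
      (0≤½ ⊗ 0≤- w≤2W ⊕ 0≤½ ⊗ 0≤- hw ⊕ 0≤½ ⊗ 0≤- 32uΓ≤ν ⊗ (0≤ω ⊕ 0≤Δ) ⊕ 0≤ι 16 ⊗ 0≤- c≤uΓ ⊗ (0≤ω ⊕ 0≤Δ)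
        ⊕ <⇒≤ 0<¼ ⊗ 0≤c ⊗ 0≤- hω ⊕ <⇒≤ 0<¼ ⊗ 0≤c ⊗ 0≤- hδ ⊕ 0≤½ ⊗ 0≤c ⊗ 0≤- ϖ≤ω
        ⊕ (<⇒≤ 0<¼ ⊗ 0≤ι 61) ⊗ 0≤c ⊗ 0≤ω ⊕ (<⇒≤ 0<¼ ⊗ 0≤ι 63) ⊗ 0≤c ⊗ 0≤Δ)
      (eq A c ϖ Γ ν w W ω Δ ω′ δ)
      where
      eq : ∀ A c ϖ Γ ν w W ω Δ ω′ δ → W ≡ ¼ * c * (ω′ + δ) +
        (½ * (W + W - w) + ½ * (w - ν * (ω + Δ)) + ½ * (ν - ι 32 * (A * c * Γ)) * (ω + Δ) + ι 16 * (A * c * Γ - c) * (ω + Δ)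
        + ¼ * c * (ω - ω′) + ¼ * c * (Δ + (ϖ + ϖ) - δ) + ½ * c * (ω - ϖ) + (¼ * ι 61) * c * ω + (¼ * ι 63) * c * Δ)
      eq = solve-∀ ℚ-ring

    far-slope : ∀ {σ S} → 0ℚ ≤ w → ι 4 * (ϖ * S) ≤ w → σ ≤ S + (u * Γ + u * Γ) →
                ι 4 * (¼ * ¼ * (ϖ * D) * σ) ≤ W
    far-slope {σ} {S} 0≤w hS hσ = ≤-by
      (½ * (W + W - w) + ¼ * ϖ * D * (S + (u * Γ + u * Γ) - σ) + ¼ * ¼ * D * (w - ι 4 * (ϖ * S))
        + ¼ * ¼ * (1ℚ - D) * w + ι 7 * (¼ * ¼) * (w - ν * (ω + Δ)) + ι 7 * (¼ * ¼) * (ν - ι 32 * (u * Γ)) * (ω + Δ)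
        + ι 14 * (u * Γ) * (ω - ϖ) + ι 14 * (u * Γ) * Δ + ½ * (u * Γ) * ϖ * (1ℚ - D) + ½ * ι 27 * (u * Γ) * ϖ)
      (0≤½ ⊗ 0≤- w≤2W ⊕ <⇒≤ 0<¼ ⊗ 0≤ϖ ⊗ 0≤D ⊗ 0≤- hσ ⊕ 0≤1/16 ⊗ 0≤D ⊗ 0≤- hS
        ⊕ 0≤1/16 ⊗ 0≤- D≤1 ⊗ 0≤w ⊕ 0≤ι 7 ⊗ 0≤1/16 ⊗ 0≤- hw ⊕ 0≤ι 7 ⊗ 0≤1/16 ⊗ 0≤- 32uΓ≤ν ⊗ (0≤ω ⊕ 0≤Δ)
        ⊕ 0≤ι 14 ⊗ 0≤uΓ ⊗ 0≤- ϖ≤ω ⊕ 0≤ι 14 ⊗ 0≤uΓ ⊗ 0≤Δ ⊕ 0≤½ ⊗ 0≤uΓ ⊗ 0≤ϖ ⊗ 0≤- D≤1 ⊕ 0≤½ ⊗ 0≤ι 27 ⊗ 0≤uΓ ⊗ 0≤ϖ)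
      (eq A c ϖ Γ ν D w W ω Δ σ S)
      where
      0≤1/16 : 0ℚ ≤ ¼ * ¼
      0≤1/16 = <⇒≤ 0<¼ ⊗ <⇒≤ 0<¼
      eq : ∀ A c ϖ Γ ν D w W ω Δ σ S → W ≡ ι 4 * (¼ * ¼ * (ϖ * D) * σ) +
        (½ * (W + W - w) + ¼ * ϖ * D * (S + (A * c * Γ + A * c * Γ) - σ) + ¼ * ¼ * D * (w - ι 4 * (ϖ * S))
        + ¼ * ¼ * (1ℚ - D) * w + ι 7 * (¼ * ¼) * (w - ν * (ω + Δ)) + ι 7 * (¼ * ¼) * (ν - ι 32 * (A * c * Γ)) * (ω + Δ)
        + ι 14 * (A * c * Γ) * (ω - ϖ) + ι 14 * (A * c * Γ) * Δ + ½ * (A * c * Γ) * ϖ * (1ℚ - D) + ½ * ι 27 * (A * c * Γ) * ϖ)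
      eq = solve-∀ ℚ-ring

  module _ {m W} (m≤2W : m ≤ W + W) where

    sibling-new : ∀ {ω′ δ} → ν * (D * ϖ) ≤ m → ω′ ≤ ϖ → δ ≤ ϖ + ϖ → ¼ * c * (ω′ + δ) ≤ W
    sibling-new {ω′} {δ} hm hω hδ = ≤-by
      (½ * (W + W - m) + ½ * (m - ν * (D * ϖ)) + ½ * (ν * D - ι 32 * (A * c * Γ)) * ϖ + ι 16 * (u * Γ - c) * ϖ
        + ¼ * c * (ϖ - ω′) + ¼ * c * (ϖ + ϖ - δ) + (¼ * ι 61) * c * ϖ)
      (0≤½ ⊗ 0≤- m≤2W ⊕ 0≤½ ⊗ 0≤- hm ⊕ 0≤½ ⊗ 0≤- (≤-reflexive 32AcΓ≡νD) ⊗ 0≤ϖ ⊕ 0≤ι 16 ⊗ 0≤- c≤uΓ ⊗ 0≤ϖ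
        ⊕ <⇒≤ 0<¼ ⊗ 0≤c ⊗ 0≤- hω ⊕ <⇒≤ 0<¼ ⊗ 0≤c ⊗ 0≤- hδ ⊕ (<⇒≤ 0<¼ ⊗ 0≤ι 61) ⊗ 0≤c ⊗ 0≤ϖ)
      (eq A c ϖ Γ ν D m W ω′ δ)
      where
      eq : ∀ A c ϖ Γ ν D m W ω′ δ → W ≡ ¼ * c * (ω′ + δ) +
        (½ * (W + W - m) + ½ * (m - ν * (D * ϖ)) + ½ * (ν * D - ι 32 * (A * c * Γ)) * ϖ + ι 16 * (A * c * Γ - c) * ϖ
        + ¼ * c * (ϖ - ω′) + ¼ * c * (ϖ + ϖ - δ) + (¼ * ι 61) * c * ϖ)
      eq = solve-∀ ℚ-ring

    -- This case dictates the new bold weight: the height may be as small as `S * (D * ϖ)`, so the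
    -- weight has to be a small fraction of `D * ϖ`.
    sibling-slope : ∀ {σ S} → S * (D * ϖ) ≤ m → ν ≤ S → σ ≤ S + (u * Γ + u * Γ) →
                    ι 4 * (¼ * ¼ * (ϖ * D) * σ) ≤ W
    sibling-slope {σ} {S} hm hS hσ = ≤-by
      (½ * (W + W - m) + ½ * (m - S * (D * ϖ)) + ¼ * ϖ * D * (S + (u * Γ + u * Γ) - σ) + ¼ * ϖ * D * (S - ν)
        + ¼ * ϖ * D * (ν - ι 32 * (u * Γ)) + ¼ * ϖ * D * (ι 30 * (u * Γ)))
      (0≤½ ⊗ 0≤- m≤2W ⊕ 0≤½ ⊗ 0≤- hm ⊕ ¼ϖD ⊗ 0≤- hσ ⊕ ¼ϖD ⊗ 0≤- hS ⊕ ¼ϖD ⊗ 0≤- 32uΓ≤ν ⊕ ¼ϖD ⊗ (0≤ι 30 ⊗ 0≤uΓ))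
      (eq A c ϖ Γ ν D m W σ S)
      where
      ¼ϖD : 0ℚ ≤ ¼ * ϖ * D
      ¼ϖD = <⇒≤ 0<¼ ⊗ 0≤ϖ ⊗ 0≤D
      eq : ∀ A c ϖ Γ ν D m W σ S → W ≡ ι 4 * (¼ * ¼ * (ϖ * D) * σ) +
        (½ * (W + W - m) + ½ * (m - S * (D * ϖ)) + ¼ * ϖ * D * (S + (A * c * Γ + A * c * Γ) - σ) + ¼ * ϖ * D * (S - ν)
        + ¼ * ϖ * D * (ν - ι 32 * (A * c * Γ)) + ¼ * ϖ * D * (ι 30 * (A * c * Γ)))
      eq = solve-∀ ℚ-ring

  -- The binding case for the new `ν`: points that stem from the two ends of an edge may be only one
  -- spacing `c * w` off its new lines.
  own-new : ∀ {κ w ω′ δ} → 0ℚ ≤ w → 1ℚ ≤ ∣ κ ∣ → ω′ ≤ w → δ ≤ w + w → ¼ * c * (ω′ + δ) ≤ ∣ κ * (c * w) ∣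
  own-new {κ} {w} {ω′} {δ} 0≤w hκ hω hδ = ≤-by
    ((∣ κ ∣ - 1ℚ) * (c * w) + ¼ * c * (w - ω′) + ¼ * c * (w + w - δ) + ¼ * c * w)
    (0≤- hκ ⊗ (0≤c ⊗ 0≤w) ⊕ <⇒≤ 0<¼ ⊗ 0≤c ⊗ 0≤- hω ⊕ <⇒≤ 0<¼ ⊗ 0≤c ⊗ 0≤- hδ ⊕ <⇒≤ 0<¼ ⊗ 0≤c ⊗ 0≤w)
    (trans (trans (∣p*q∣≡∣p∣*∣q∣ κ (c * w)) (cong (∣ κ ∣ *_) (∣pos∣ (0≤c ⊗ 0≤w)))) (eq (∣ κ ∣) c w ω′ δ))
    where
    eq : ∀ κ c w ω′ δ → κ * (c * w) ≡ ¼ * c * (ω′ + δ) +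
      ((κ - 1ℚ) * (c * w) + ¼ * c * (w - ω′) + ¼ * c * (w + w - δ) + ¼ * c * w)
    eq = solve-∀ ℚ-ring

  -- The line of slope s + cgk through (xb + Gϖ, yb + sGϖ); V is the height above it.
  module Tilt (xb yb s g G : ℚ) {k : ℚ} (Gg : G * g ≡ 1ℚ) (∣G∣≤1 : ∣ G ∣ ≤ 1ℚ) (∣g∣≤Γ : ∣ g ∣ ≤ Γ) (∣k∣≤A : ∣ k ∣ ≤ A) where

    xr yr : ℚ
    xr = xb + G * ϖ
    yr = yb + s * (G * ϖ)

    V : ℚ → ℚ → ℚ
    V x y = (y - yr) - (s + c * g * k) * (x - xr)

    V-shift : ∀ x y → V x y ≡ ((y - yb) - s * (x - xb)) + (k * (c * ϖ) - c * g * k * (x - xb))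
    V-shift x y = trans (eq₁ x y xb yb s g G k c ϖ)
      (trans (cong (λ z → ((y - yb) - s * (x - xb)) + (z * (k * (c * ϖ)) - c * g * k * (x - xb))) Gg)
        (cong (λ z → ((y - yb) - s * (x - xb)) + (z - c * g * k * (x - xb))) (*-identityˡ (k * (c * ϖ)))))
      where
      eq₁ : ∀ x y xb yb s g G k c ϖ →
        (y - (yb + s * (G * ϖ))) - (s + c * g * k) * (x - (xb + G * ϖ)) ≡
        ((y - yb) - s * (x - xb)) + (G * g * (k * (c * ϖ)) - c * g * k * (x - xb))
      eq₁ = solve-∀ ℚ-ring

    ∣Gϖ∣≤ϖ : ∣ G * ϖ ∣ ≤ ϖ
    ∣Gϖ∣≤ϖ = ≤-trans (∣*∣≤ ∣G∣≤1 (≤-reflexive (∣pos∣ 0≤ϖ))) (≤-reflexive (*-identityˡ ϖ))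

    ∣cgk∣≤ : ∣ c * g * k ∣ ≤ c * Γ * A
    ∣cgk∣≤ = ∣*∣≤ (∣*∣≤ {c} (≤-reflexive (∣pos∣ 0≤c)) ∣g∣≤Γ) ∣k∣≤A

    ∣cgk∣≤uΓ : ∣ c * g * k ∣ ≤ u * Γ
    ∣cgk∣≤uΓ = ≤-trans ∣cgk∣≤ (≤-reflexive (eq A c Γ))
      where
      eq : ∀ A c Γ → c * Γ * A ≡ A * c * Γ
      eq = solve-∀ ℚ-ring

    ∣kcϖ∣≤ : ∣ k * (c * ϖ) ∣ ≤ A * (c * ϖ)
    ∣kcϖ∣≤ = ∣*∣≤ ∣k∣≤A (≤-reflexive (∣pos∣ (0≤c ⊗ 0≤ϖ)))

    module _ {x₀ y₀ s₀ dx dy ω x y} (ex : x ≡ x₀ + dx) (ey : y ≡ y₀ + (s₀ * dx + dy))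
             (ϖ≤ω : ϖ ≤ ω) (hdx : ∣ dx ∣ ≤ ϖ) (hdy : ∣ dy ∣ ≤ ι 4 * (u * ω)) where

      private
        v₀ : ℚ
        v₀ = (y₀ - yb) - s * (x₀ - xb)

      ∣x-xr∣≤ : ∣ x - xr ∣ ≤ ∣ x₀ - xb ∣ + (ϖ + ϖ)
      ∣x-xr∣≤ = subst (λ z → ∣ z ∣ ≤ ∣ x₀ - xb ∣ + (ϖ + ϖ)) (trans (eq x₀ xb dx (G * ϖ)) (cong (_- xr) (sym ex)))
        (∣+∣≤ {x₀ - xb} ≤-refl (∣+∣≤ hdx (∣-∣≤ {G * ϖ} ∣Gϖ∣≤ϖ)))
        where
        eq : ∀ x₀ xb dx e → (x₀ - xb) + (dx + (- e)) ≡ (x₀ + dx) - (xb + e)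
        eq = solve-∀ ℚ-ring

      V-near : ν * (ω + ∣ x₀ - xb ∣) ≤ ∣ v₀ ∣ → ι 4 * (ϖ * ∣ s₀ - s ∣) ≤ ∣ v₀ ∣ →
               ∣ V x y - v₀ ∣ + ∣ V x y - v₀ ∣ ≤ ∣ v₀ ∣
      V-near hν hs = ≤-trans (+-mono-≤ bound bound) (far-bound {S = ϖ * ∣ s₀ - s ∣} ϖ≤ω (0≤∣p∣ (x₀ - xb)) hν hs)
        where
        eq : ∀ x₀ y₀ s₀ dx dy xb yb s g k c ϖ →
          ((((y₀ + (s₀ * dx + dy)) - yb) - s * ((x₀ + dx) - xb)) + (k * (c * ϖ) - c * g * k * ((x₀ + dx) - xb)))
            - ((y₀ - yb) - s * (x₀ - xb))
          ≡ (dx * (s₀ - s) + dy) + (k * (c * ϖ) + (- (c * g * k * ((x₀ - xb) + dx))))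
        eq = solve-∀ ℚ-ring
        bound : ∣ V x y - v₀ ∣ ≤ (ϖ * ∣ s₀ - s ∣ + ι 4 * (u * ω)) + (A * (c * ϖ) + c * Γ * A * (∣ x₀ - xb ∣ + ϖ))
        bound = subst (λ z → ∣ z ∣ ≤ (ϖ * ∣ s₀ - s ∣ + ι 4 * (u * ω)) + (A * (c * ϖ) + c * Γ * A * (∣ x₀ - xb ∣ + ϖ)))
          (sym (trans (cong (_- v₀) (trans (V-shift x y) (cong₂ (λ x y → ((y - yb) - s * (x - xb)) + (k * (c * ϖ) - c * g * k * (x - xb))) ex ey)))
            (eq x₀ y₀ s₀ dx dy xb yb s g k c ϖ)))
          (∣+∣≤ (∣+∣≤ {dx * (s₀ - s)} (∣*∣≤ {dx} hdx ≤-refl) hdy)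
            (∣+∣≤ ∣kcϖ∣≤ (∣-∣≤ {c * g * k * ((x₀ - xb) + dx)} (∣*∣≤ ∣cgk∣≤ (∣+∣≤ {x₀ - xb} ≤-refl hdx)))))

    module _ {s₀ dx dy x y} (ex : x ≡ xb + dx) (ey : y ≡ yb + (s₀ * dx + dy))
             (hdx : ∣ dx ∣ ≤ ϖ) (hdx′ : D * ϖ ≤ ∣ dx ∣) (hdy : ∣ dy ∣ ≤ ι 4 * (u * ϖ)) (hs : ν ≤ ∣ s₀ - s ∣) where

      ∣main∣≥ : ∣ s₀ - s ∣ * (D * ϖ) ≤ ∣ (s₀ - s) * dx ∣
      ∣main∣≥ = ≤-trans (*-mono-l (0≤∣p∣ (s₀ - s)) hdx′) (≤-reflexive (sym (∣p*q∣≡∣p∣*∣q∣ (s₀ - s) dx)))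

      ∣main∣≥ν : ν * (D * ϖ) ≤ ∣ (s₀ - s) * dx ∣
      ∣main∣≥ν = ≤-trans (*-mono-r (0≤D ⊗ 0≤ϖ) hs) ∣main∣≥

      0<∣main∣ : 0ℚ < ∣ (s₀ - s) * dx ∣
      0<∣main∣ = <-≤-trans (0<* 0<ν (0<* 0<D 0<ϖ)) ∣main∣≥ν

      sibling-∣x-xr∣≤ : ∣ x - xr ∣ ≤ ϖ + ϖ
      sibling-∣x-xr∣≤ = subst (λ z → ∣ z ∣ ≤ ϖ + ϖ) (trans (eq xb dx (G * ϖ)) (cong (_- xr) (sym ex)))
        (∣+∣≤ hdx (∣-∣≤ {G * ϖ} ∣Gϖ∣≤ϖ))
        where
        eq : ∀ xb dx e → dx + (- e) ≡ (xb + dx) - (xb + e)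
        eq = solve-∀ ℚ-ring

      sibling-near : ∣ V x y - (s₀ - s) * dx ∣ + ∣ V x y - (s₀ - s) * dx ∣ ≤ ∣ (s₀ - s) * dx ∣
      sibling-near = ≤-trans (+-mono-≤ bound bound) (sibling-bound ∣main∣≥ν)
        where
        eq : ∀ s₀ dx dy xb yb s g k c ϖ →
          ((((yb + (s₀ * dx + dy)) - yb) - s * ((xb + dx) - xb)) + (k * (c * ϖ) - c * g * k * ((xb + dx) - xb)))
            - (s₀ - s) * dx
          ≡ dy + (k * (c * ϖ) + (- (c * g * k * dx)))
        eq = solve-∀ ℚ-ring
        bound : ∣ V x y - (s₀ - s) * dx ∣ ≤ ι 4 * (u * ϖ) + (A * (c * ϖ) + c * Γ * A * ϖ)
        bound = subst (λ z → ∣ z ∣ ≤ ι 4 * (u * ϖ) + (A * (c * ϖ) + c * Γ * A * ϖ))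
          (sym (trans (cong (_- (s₀ - s) * dx) (trans (V-shift x y) (cong₂ (λ x y → ((y - yb) - s * (x - xb)) + (k * (c * ϖ) - c * g * k * (x - xb))) ex ey)))
            (eq s₀ dx dy xb yb s g k c ϖ)))
          (∣+∣≤ hdy (∣+∣≤ ∣kcϖ∣≤ (∣-∣≤ {c * g * k * dx} (∣*∣≤ ∣cgk∣≤ hdx))))

    -- The pivot divides the edge in the ratio of the weights, and the spacings are proportional to
    -- the weights. Turning the line by `k` units therefore moves it past the same number of
    -- spacings at both ends, in opposite directions.
    V-bold : ∀ t → V xb (yb + c * ϖ * t) ≡ (t + k) * (c * ϖ)
    V-bold t = trans (V-shift xb (yb + c * ϖ * t)) (eq t xb yb s g k c ϖ)
      where
      eq : ∀ t xb yb s g k c ϖ → (((yb + c * ϖ * t) - yb) - s * (xb - xb)) + (k * (c * ϖ) - c * g * k * (xb - xb))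
           ≡ (t + k) * (c * ϖ)
      eq = solve-∀ ℚ-ring

    V-plain : ∀ {x y ω} t → x ≡ xb + G * (ϖ + ω) → y ≡ yb + s * (G * (ϖ + ω)) →
              V x (y + c * ω * t) ≡ (t - k) * (c * ω)
    V-plain {ω = ω} t refl refl = trans (V-shift (xb + G * (ϖ + ω)) (yb + s * (G * (ϖ + ω)) + c * ω * t)) (trans (eq t xb yb s g G k c ϖ ω)
      (trans (cong (λ z → c * ω * t + (k * (c * ϖ) - z * (c * k * (ϖ + ω)))) Gg) (eq′ t k c ϖ ω)))
      where
      eq : ∀ t xb yb s g G k c ϖ ω →
        (((yb + s * (G * (ϖ + ω)) + c * ω * t) - yb) - s * ((xb + G * (ϖ + ω)) - xb))
          + (k * (c * ϖ) - c * g * k * ((xb + G * (ϖ + ω)) - xb))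
        ≡ c * ω * t + (k * (c * ϖ) - G * g * (c * k * (ϖ + ω)))
      eq = solve-∀ ℚ-ring
      eq′ : ∀ t k c ϖ ω → c * ω * t + (k * (c * ϖ) - 1ℚ * (c * k * (ϖ + ω))) ≡ (t - k) * (c * ω)
      eq′ = solve-∀ ℚ-ring

    -- The mirror image is twice as far from the pivot as the bold point, so there the line moves by
    -- 2`k` spacings. Lowering the point by 4`A` spacings keeps it below the line, as `k` is at most
    -- `A` in absolute value.
    V-mirror : V (xb + (- (G * ϖ))) (yb + (s * (- (G * ϖ)) + (- (ι 4 * (u * ϖ))))) ≡ (- (ι 4 * A - ι 2 * k)) * (c * ϖ)
    V-mirror = trans (V-shift (xb + (- (G * ϖ))) (yb + (s * (- (G * ϖ)) + (- (ι 4 * (u * ϖ)))))) (trans (eq xb yb s g G k c ϖ A)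
      (trans (cong (λ z → (- (ι 4 * (A * c * ϖ))) + (k * (c * ϖ) + z * (k * (c * ϖ)))) Gg) (eq′ k c ϖ A)))
      where
      eq : ∀ xb yb s g G k c ϖ A →
        (((yb + (s * (- (G * ϖ)) + (- (ι 4 * (A * c * ϖ))))) - yb) - s * ((xb + (- (G * ϖ))) - xb))
          + (k * (c * ϖ) - c * g * k * ((xb + (- (G * ϖ))) - xb))
        ≡ (- (ι 4 * (A * c * ϖ))) + (k * (c * ϖ) + G * g * (k * (c * ϖ)))
      eq = solve-∀ ℚ-ring
      eq′ : ∀ k c ϖ A → (- (ι 4 * (A * c * ϖ))) + (k * (c * ϖ) + 1ℚ * (k * (c * ϖ))) ≡ (- (ι 4 * A - ι 2 * k)) * (c * ϖ)
      eq′ = solve-∀ ℚ-ring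

-- The edge (b , l) joins the bold point b to the plain point pl b l; vB b l and vQ b l are the vertical heights above its line,
-- whose slope is s b l. In the next stage a bold point turns into a vertical progression with spacing proportional to ϖ, a plain
-- point q into one with spacing proportional to ω q, and the lines joining opposite terms of the progressions at the two ends
-- of an edge meet in the point dividing it in the ratio ϖ : ω q, at the horizontal distance G ϖ from b.
-- The separation of a point from an edge is measured relative to its weight and its horizontal distance (farB, farQ), and
-- relative to the difference of slopes (slopeB, slopeL); an absolute bound would be squared at each stage.
record Stage : Set₁ where
  field
    B Q L : Finite
    ν ϖ Γ D : ℚ
    0<ν : 0ℚ < ν
    0<ϖ : 0ℚ < ϖ
    0<D : 0ℚ < D
    D≤1 : D ≤ 1ℚ
    DΓ≡1 : D * Γ ≡ 1ℚ
    ω   : ∥ Q ∥ → ℚ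
    ϖ≤ω : ∀ q → ϖ ≤ ω q
    xB yB : ∥ B ∥ → ℚ
    xQ yQ : ∥ Q ∥ → ℚ
    pl  : ∥ B ∥ → ∥ L ∥ → ∥ Q ∥
    s G g : ∥ B ∥ → ∥ L ∥ → ℚ
    Gg≡1 : ∀ b l → G b l * g b l ≡ 1ℚ
    ∣G∣≤1 : ∀ b l → ∣ G b l ∣ ≤ 1ℚ
    ∣g∣≤Γ : ∀ b l → ∣ g b l ∣ ≤ Γ
    x-pl : ∀ b l → xQ (pl b l) ≡ xB b + G b l * (ϖ + ω (pl b l))
    y-pl : ∀ b l → yQ (pl b l) ≡ yB b + s b l * (G b l * (ϖ + ω (pl b l)))

  vB : ∀ b (l : ∥ L ∥) → ∥ B ∥ → ℚ
  vB b l b′ = (yB b′ - yB b) - s b l * (xB b′ - xB b)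

  vQ : ∀ b (l : ∥ L ∥) → ∥ Q ∥ → ℚ
  vQ b l q = (yQ q - yB b) - s b l * (xQ q - xB b)

  field
    farQ   : ∀ {b l q} → q ≢ pl b l → ν * (ω q + ∣ xQ q - xB b ∣) ≤ ∣ vQ b l q ∣
    farB   : ∀ {b} l {b′} → b′ ≢ b → ν * (ϖ + ∣ xB b′ - xB b ∣) ≤ ∣ vB b l b′ ∣
    -- New points at `b′` are displaced by at most `ϖ` along an edge of `b′`; seen from an edge of
    -- `b`, this changes their height by at most `ϖ` times the difference of slopes, which must be a
    -- small part of it.
    slopeB : ∀ {b b′} → b′ ≢ b → ∀ l l′ → ι 4 * (ϖ * ∣ s b′ l′ - s b l ∣) ≤ ∣ vB b l b′ ∣
    slopeL : ∀ b {l l′} → l′ ≢ l → ν ≤ ∣ s b l′ - s b l ∣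
    pl-injective : ∀ {b l l′} → pl b l ≡ pl b l′ → l ≡ l′
    balanced : ∀ b l → ∑ B (sgn ∘ vB b l) ℤ.+ ∑ Q (sgn ∘ vQ b l) ≡ 0ℤ
    -- The reserves `ϖ + ϖ` here and `ν` in `s-bound` pay for the displacements and the changes of
    -- slope in all later stages.
    xB-bound : ∀ b → ∣ xB b ∣ + (ϖ + ϖ) ≤ ι 2
    xQ-bound : ∀ q → ∣ xQ q ∣ ≤ ι 2
    s-bound  : ∀ b l → ∣ s b l ∣ + ν ≤ 1ℚ

  1≤Γ : 1ℚ ≤ Γ
  1≤Γ = cancel-≤ 0<D (≤-trans (≤-reflexive (*-identityʳ D)) (≤-trans D≤1 (≤-reflexive (sym DΓ≡1))))

  D≤∣G∣ : ∀ b l → D ≤ ∣ G b l ∣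
  D≤∣G∣ b l = ≤-trans (≤-reflexive e) (≤-trans
    (*-mono-l (<⇒≤ 0<D) (≤-trans (≤-reflexive (∣p*q∣≡∣p∣*∣q∣ (G b l) (g b l)))
       (*-mono-l (0≤∣p∣ (G b l)) (∣g∣≤Γ b l))))
    (≤-reflexive (trans (swap D (∣ G b l ∣) Γ) (trans (cong (∣ G b l ∣ *_) DΓ≡1) (*-identityʳ (∣ G b l ∣))))))
    where
    e : D ≡ D * ∣ G b l * g b l ∣
    e = sym (trans (cong (λ z → D * ∣ z ∣) (Gg≡1 b l)) (*-identityʳ D))
    swap : ∀ D G Γ → D * (G * Γ) ≡ G * (D * Γ)
    swap = solve-∀ ℚ-ring

  1≤∣g∣ : ∀ b l → 1ℚ ≤ ∣ g b l ∣
  1≤∣g∣ b l = ≤-trans (≤-reflexive (sym (cong ∣_∣ (Gg≡1 b l))))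
    (≤-trans (≤-reflexive (∣p*q∣≡∣p∣*∣q∣ (G b l) (g b l))) (≤+1* (0≤∣p∣ (g b l)) (∣G∣≤1 b l)))

  vB-self : ∀ b l → vB b l b ≡ 0ℚ
  vB-self b l = eq (xB b) (yB b) (s b l)
    where
    eq : ∀ x y s → (y - y) - s * (x - x) ≡ 0ℚ
    eq = solve-∀ ℚ-ring

  vQ-pl : ∀ b l → vQ b l (pl b l) ≡ 0ℚ
  vQ-pl b l = trans (cong₂ (λ x y → (y - yB b) - s b l * (x - xB b)) (x-pl b l) (y-pl b l))
    (eq (xB b) (yB b) (s b l) (G b l * (ϖ + ω (pl b l))))
    where
    eq : ∀ x y s X → ((y + s * X) - y) - s * ((x + X) - x) ≡ 0ℚ
    eq = solve-∀ ℚ-ring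

-- Signs of even and odd differences

ι-diff≥1 : ∀ {m n} → n ℕ.< m → 1ℚ ≤ ι m - ι n
ι-diff≥1 {m} {n} h = ≤-trans (≤-reflexive (trans (eq (ι n)) (cong (_- ι n) (sym (ι-suc n))))) (+-monoˡ-≤ (- ι n) (ι-mono h))
  where
  eq : ∀ n → 1ℚ ≡ 1ℚ + n - n
  eq = solve-∀ ℚ-ring

ι-compare : ∀ m n → (m ≡ n) ⊎ (1ℚ ≤ ι m - ι n) ⊎ (1ℚ ≤ ι n - ι m)
ι-compare m n = go (ℕ.<-cmp m n)
  where
  go : Tri (m ℕ.< n) (m ≡ n) (n ℕ.< m) → (m ≡ n) ⊎ (1ℚ ≤ ι m - ι n) ⊎ (1ℚ ≤ ι n - ι m)
  go (tri< m<n _ _) = inj₂ (inj₂ (ι-diff≥1 m<n))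
  go (tri≈ _ e _)   = inj₁ e
  go (tri> _ _ n<m) = inj₂ (inj₁ (ι-diff≥1 n<m))

module Gap (d e : ℚ) (1≤d-e : 1ℚ ≤ d - e) where

  1≤2* : 1ℚ ≤ ι 2 * (d - e)
  1≤2* = ≤-by ((d - e - 1ℚ) + (d - e - 1ℚ) + 1ℚ) (0≤- 1≤d-e ⊕ 0≤- 1≤d-e ⊕ <⇒≤ 0<1) (eq d e)
    where
    eq : ∀ d e → ι 2 * (d - e) ≡ 1ℚ + ((d - e - 1ℚ) + (d - e - 1ℚ) + 1ℚ)
    eq = solve-∀ ℚ-ring

  1≤-[1-2*] : 1ℚ ≤ - (1ℚ - ι 2 * (d - e))
  1≤-[1-2*] = ≤-by ((d - e - 1ℚ) + (d - e - 1ℚ)) (0≤- 1≤d-e ⊕ 0≤- 1≤d-e) (eq d e)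
    where
    eq : ∀ d e → - (1ℚ - ι 2 * (d - e)) ≡ 1ℚ + ((d - e - 1ℚ) + (d - e - 1ℚ))
    eq = solve-∀ ℚ-ring

  1≤-2* : 1ℚ ≤ - (ι 2 * (e - d))
  1≤-2* = subst (1ℚ ≤_) (eq d e) 1≤2*
    where
    eq : ∀ d e → ι 2 * (d - e) ≡ - (ι 2 * (e - d))
    eq = solve-∀ ℚ-ring

  1≤1-2* : 1ℚ ≤ 1ℚ - ι 2 * (e - d)
  1≤1-2* = ≤-by (ι 2 * (d - e)) (≤-trans (<⇒≤ 0<1) 1≤2*) (eq d e)
    where
    eq : ∀ d e → 1ℚ - ι 2 * (e - d) ≡ 1ℚ + ι 2 * (d - e)
    eq = solve-∀ ℚ-ring

sgn≥1 : ∀ {p} → 1ℚ ≤ p → sgn p ≡ 1ℤ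
sgn≥1 h = sgn-pos (<-≤-trans 0<1 h)

sgn≤-1 : ∀ {p} → 1ℚ ≤ - p → sgn p ≡ -1ℤ
sgn≤-1 h = sgn-neg (0<-⇒<0 (<-≤-trans 0<1 h))

∣∣≥1 : ∀ {p} → 1ℚ ≤ p → 1ℚ ≤ ∣ p ∣
∣∣≥1 {p} h = ≤-trans h (≤∣∣ p)

∣∣≥1′ : ∀ {p} → 1ℚ ≤ - p → 1ℚ ≤ ∣ p ∣
∣∣≥1′ {p} h = ≤-trans h (≤-trans (≤∣∣ (- p)) (≤-reflexive (∣-p∣≡∣p∣ p)))

even-gap : ∀ {m n} → m ≢ n → 1ℚ ≤ ∣ ι 2 * (ι m - ι n) ∣
even-gap {m} {n} m≢n = go (ι-compare m n)
  where
  go : (m ≡ n) ⊎ (1ℚ ≤ ι m - ι n) ⊎ (1ℚ ≤ ι n - ι m) → 1ℚ ≤ ∣ ι 2 * (ι m - ι n) ∣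
  go (inj₁ e)        = contradiction e m≢n
  go (inj₂ (inj₁ h)) = ∣∣≥1 (Gap.1≤2* (ι m) (ι n) h)
  go (inj₂ (inj₂ h)) = ∣∣≥1′ {ι 2 * (ι m - ι n)} (Gap.1≤-2* (ι n) (ι m) h)

odd-gap : ∀ m n → 1ℚ ≤ ∣ 1ℚ - ι 2 * (ι m - ι n) ∣
odd-gap m n = go (ι-compare m n)
  where
  eq : ∀ x → 1ℚ ≡ 1ℚ - ι 2 * (x - x)
  eq = solve-∀ ℚ-ring
  go : (m ≡ n) ⊎ (1ℚ ≤ ι m - ι n) ⊎ (1ℚ ≤ ι n - ι m) → 1ℚ ≤ ∣ 1ℚ - ι 2 * (ι m - ι n) ∣
  go (inj₁ e)        = ∣∣≥1 (≤-reflexive (trans (eq (ι m)) (cong (λ k → 1ℚ - ι 2 * (ι m - ι k)) e)))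
  go (inj₂ (inj₁ h)) = ∣∣≥1′ {1ℚ - ι 2 * (ι m - ι n)} (Gap.1≤-[1-2*] (ι m) (ι n) h)
  go (inj₂ (inj₂ h)) = ∣∣≥1 (Gap.1≤1-2* (ι n) (ι m) h)

-- For an integer d other than 0, the numbers 2d and 1 - 2d have opposite signs; for d = 0 the pair
-- contributes 1. This is the interleaving, both of the two progressions at an edge and, later, of
-- the copies on the right and on the left.
sgn-even+odd : ∀ {m n} → m ≢ n → sgn (ι 2 * (ι m - ι n)) ℤ.+ sgn (1ℚ - ι 2 * (ι m - ι n)) ≡ 0ℤ
sgn-even+odd {m} {n} m≢n = go (ι-compare m n)
  where
  go : (m ≡ n) ⊎ (1ℚ ≤ ι m - ι n) ⊎ (1ℚ ≤ ι n - ι m) → sgn (ι 2 * (ι m - ι n)) ℤ.+ sgn (1ℚ - ι 2 * (ι m - ι n)) ≡ 0ℤ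
  go (inj₁ e)        = contradiction e m≢n
  go (inj₂ (inj₁ h)) = cong₂ ℤ._+_ (sgn≥1 (Gap.1≤2* (ι m) (ι n) h))
    (sgn≤-1 {1ℚ - ι 2 * (ι m - ι n)} (Gap.1≤-[1-2*] (ι m) (ι n) h))
  go (inj₂ (inj₂ h)) = cong₂ ℤ._+_ (sgn≤-1 {ι 2 * (ι m - ι n)} (Gap.1≤-2* (ι n) (ι m) h))
    (sgn≥1 (Gap.1≤1-2* (ι n) (ι m) h))

sgn-even+odd-self : ∀ n → sgn (ι 2 * (ι n - ι n)) ℤ.+ sgn (1ℚ - ι 2 * (ι n - ι n)) ≡ 1ℤ
sgn-even+odd-self n = cong₂ ℤ._+_ (sgn-zero (eq (ι n))) (sgn≥1 (≤-reflexive (eq′ (ι n))))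
  where
  eq : ∀ x → ι 2 * (x - x) ≡ 0ℚ
  eq = solve-∀ ℚ-ring
  eq′ : ∀ x → 1ℚ ≡ 1ℚ - ι 2 * (x - x)
  eq′ = solve-∀ ℚ-ring

-- The quantities attached to an edge whose plain end has weight w and whose bold end has weight ϖ′.
module Scaled {ϖ′ w : ℚ} (0<ϖ′ : 0ℚ < ϖ′) (ϖ′≤w : ϖ′ ≤ w) where

  private
    0<w : 0ℚ < w
    0<w = <-≤-trans 0<ϖ′ ϖ′≤w
    0<ϖ′+w : 0ℚ < ϖ′ + w
    0<ϖ′+w = 0<+ 0<ϖ′ (<⇒≤ 0<w)
    i j : ℚ
    i = recip 0<ϖ′+w
    j = recip 0<w

  ratio ratio⁻¹ : ℚ
  ratio   = w * i
  ratio⁻¹ = (ϖ′ + w) * j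

  ratio-inverse : ratio * ratio⁻¹ ≡ 1ℚ
  ratio-inverse = trans (eq w i ϖ′ j) (cong₂ _*_ (*-recip 0<w) (*-recip 0<ϖ′+w))
    where
    eq : ∀ w i ϖ j → w * i * ((ϖ + w) * j) ≡ w * j * ((ϖ + w) * i)
    eq = solve-∀ ℚ-ring

  ratio-* : ratio * (ϖ′ + w) ≡ w
  ratio-* = trans (eq w i ϖ′) (trans (cong (w *_) (*-recip 0<ϖ′+w)) (*-identityʳ w))
    where
    eq : ∀ w i ϖ → w * i * (ϖ + w) ≡ w * ((ϖ + w) * i)
    eq = solve-∀ ℚ-ring

  0≤ratio : 0ℚ ≤ ratio
  0≤ratio = <⇒≤ 0<w ⊗ <⇒≤ (0<recip 0<ϖ′+w)

  0≤ratio⁻¹ : 0ℚ ≤ ratio⁻¹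
  0≤ratio⁻¹ = <⇒≤ 0<ϖ′+w ⊗ <⇒≤ (0<recip 0<w)

  ratio≤1 : ratio ≤ 1ℚ
  ratio≤1 = ≤-by (ϖ′ * i) (<⇒≤ 0<ϖ′ ⊗ <⇒≤ (0<recip 0<ϖ′+w))
    (trans (sym (*-recip 0<ϖ′+w)) (eq w i ϖ′))
    where
    eq : ∀ w i ϖ → (ϖ + w) * i ≡ w * i + ϖ * i
    eq = solve-∀ ℚ-ring

  -- Since the bold weight does not exceed the plain one, 1/`G` at most doubles in a stage. Hence
  -- `Γ` after m stages may be taken as 2 to the power m.
  ratio⁻¹≤2 : ratio⁻¹ ≤ ι 2
  ratio⁻¹≤2 = ≤-by ((w - ϖ′) * j) (0≤- ϖ′≤w ⊗ <⇒≤ (0<recip 0<w))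
    (trans (cong (ι 2 *_) (sym (*-recip 0<w))) (eq w j ϖ′))
    where
    eq : ∀ w j ϖ → ι 2 * (w * j) ≡ (ϖ + w) * j + (w - ϖ) * j
    eq = solve-∀ ℚ-ring

-- The points and edges of the next stage

module Step (S : Stage) (a-1 : ℕ) where

  open Stage S

  a : ℕ
  a = suc a-1

  A c ϖ′ : ℚ
  A  = ι a
  -- This solves 32`A * c * Γ` = `ν * D` for `c`: `inv 31 * inv a-1` is 1/(32a), and `D` stands for
  -- 1/`Γ`.
  c  = ν * D * D * (inv 31 * inv a-1)
  ϖ′ = ¼ * ¼ * (ϖ * D)

  1≤A : 1ℚ ≤ A
  1≤A = ι-mono {1} {a} (ℕ.s≤s ℕ.z≤n)

  0≤A : 0ℚ ≤ A
  0≤A = ≤-trans (<⇒≤ 0<1) 1≤A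

  0<c : 0ℚ < c
  0<c = 0<* (0<* (0<* 0<ν 0<D) 0<D) (0<* (inv>0 31) (inv>0 a-1))

  0≤c : 0ℚ ≤ c
  0≤c = <⇒≤ 0<c

  0≤ϖ : 0ℚ ≤ ϖ
  0≤ϖ = <⇒≤ 0<ϖ

  32AcΓ≡νD : ι 32 * (A * c * Γ) ≡ ν * D
  32AcΓ≡νD = trans (eq (ι 32) A ν D Γ (inv 31) (inv a-1))
    (trans (cong₂ (λ p q → ν * D * (p * q) * (ι 32 * inv 31)) (ι*inv a-1) DΓ≡1)
      (trans (cong (ν * D * (1ℚ * 1ℚ) *_) (ι*inv 31)) (eq′ ν D)))
    where
    eq : ∀ t A ν D Γ i j → t * (A * (ν * D * D * (i * j)) * Γ) ≡ ν * D * ((A * j) * (D * Γ)) * (t * i)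
    eq = solve-∀ ℚ-ring
    eq′ : ∀ ν D → ν * D * (1ℚ * 1ℚ) * 1ℚ ≡ ν * D
    eq′ = solve-∀ ℚ-ring

  0<ϖ′ : 0ℚ < ϖ′
  0<ϖ′ = 0<* (0<* 0<¼ 0<¼) (0<* 0<ϖ 0<D)

  16ϖ′≤ϖ : ι 16 * ϖ′ ≤ ϖ
  16ϖ′≤ϖ = ≤-by (ϖ * (1ℚ - D)) (0≤ϖ ⊗ 0≤- D≤1) (eq ϖ D)
    where
    eq : ∀ ϖ D → ϖ ≡ ι 16 * (¼ * ¼ * (ϖ * D)) + ϖ * (1ℚ - D)
    eq = solve-∀ ℚ-ring

  ϖ′≤ϖ : ϖ′ ≤ ϖ
  ϖ′≤ϖ = ≤-trans (≤-by (ι 15 * ϖ′) (0≤ι 15 ⊗ <⇒≤ 0<ϖ′) (eq ϖ′)) 16ϖ′≤ϖ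
    where
    eq : ∀ p → ι 16 * p ≡ p + ι 15 * p
    eq = solve-∀ ℚ-ring

  open Perturb {A} {c} {ϖ} {Γ} {ν} {D} 1≤A 0<c 0<ϖ 1≤Γ 0<D D≤1 0<ν 32AcΓ≡νD

  -- Heights of the clusters at bold and at plain points, in units of their spacing.
  tB tQ : Fin a → ℚ
  tB i = ι 2 * ι (toℕ i) - (A - 1ℚ)
  tQ j = A - ι 2 * ι (toℕ j)

  -- Besides its `a` terms a plain cluster has one padding point above and one below for each label,
  -- which makes it as numerous as a bold cluster together with its mirror images and new bold
  -- points. The padding points of different labels coincide.
  U B′ Q′ L′ : Finite
  U  = finᶠ a ⊎ᶠ (L ⊎ᶠ L)
  B′ = B ×ᶠ L
  Q′ = (Q ×ᶠ U) ⊎ᶠ (B ×ᶠ (finᶠ a ⊎ᶠ L))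
  L′ = finᶠ a ⊎ᶠ finᶠ a

  tU : ∥ U ∥ → ℚ
  tU (inj₁ j)        = tQ j
  tU (inj₂ (inj₁ _)) = ι 3 * A
  tU (inj₂ (inj₂ _)) = - (ι 3 * A)

  xB′ yB′ : ∥ B′ ∥ → ℚ
  xB′ (b , l) = xB b + G b l * ϖ
  yB′ (b , l) = yB b + s b l * (G b l * ϖ)

  xQ′ yQ′ ω′ : ∥ Q′ ∥ → ℚ
  xQ′ (inj₁ (q , u))      = xQ q
  xQ′ (inj₂ (b , inj₁ i)) = xB b
  xQ′ (inj₂ (b , inj₂ l)) = xB b + (- (G b l * ϖ))
  yQ′ (inj₁ (q , t))      = yQ q + c * ω q * tU t
  yQ′ (inj₂ (b , inj₁ i)) = yB b + c * ϖ * tB i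
  yQ′ (inj₂ (b , inj₂ l)) = yB b + (s b l * (- (G b l * ϖ)) + (- (ι 4 * (u * ϖ))))
  ω′ (inj₁ (q , _)) = ω q
  ω′ (inj₂ _)       = ϖ

  pl′ : ∥ B′ ∥ → ∥ L′ ∥ → ∥ Q′ ∥
  pl′ (b , l) (inj₁ i) = inj₂ (b , inj₁ i)
  pl′ (b , l) (inj₂ j) = inj₁ (pl b l , inj₁ j)

  -- The tilt at which the line through the new bold point hits the chosen term. At the bold end it
  -- is the negative of `tB i`, because the line moves in opposite directions at the two ends.
  κ : ∥ L′ ∥ → ℚ
  κ (inj₁ i) = A - 1ℚ - ι 2 * ι (toℕ i)
  κ (inj₂ j) = A - ι 2 * ι (toℕ j)

  s′ : ∥ B′ ∥ → ∥ L′ ∥ → ℚ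
  s′ (b , l) m = s b l + c * g b l * κ m

  ϖ′≤ω′ : ∀ q → ϖ′ ≤ ω′ q
  ϖ′≤ω′ (inj₁ (q , _)) = ≤-trans ϖ′≤ϖ (ϖ≤ω q)
  ϖ′≤ω′ (inj₂ _)       = ϖ′≤ϖ

  private
    module R q = Scaled {ϖ′} {ω′ q} 0<ϖ′ (ϖ′≤ω′ q)

  -- Seen from the new bold point the ends of its edges are at the horizontal distances `- G * ϖ`
  -- and `G * ω`; `ratio` extracts the share that belongs to the new bold weight.
  G′ g′ : ∥ B′ ∥ → ∥ L′ ∥ → ℚ
  G′ r@(b , l) (inj₁ i) = (- G b l) * R.ratio (pl′ r (inj₁ i))
  G′ r@(b , l) (inj₂ j) = G b l * R.ratio (pl′ r (inj₂ j))
  g′ r@(b , l) (inj₁ i) = (- g b l) * R.ratio⁻¹ (pl′ r (inj₁ i))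
  g′ r@(b , l) (inj₂ j) = g b l * R.ratio⁻¹ (pl′ r (inj₂ j))

  Gg′≡1 : ∀ r m → G′ r m * g′ r m ≡ 1ℚ
  Gg′≡1 r@(b , l) (inj₁ i) = trans (eq (G b l) (g b l) (R.ratio q) (R.ratio⁻¹ q))
    (cong₂ _*_ (Gg≡1 b l) (R.ratio-inverse q))
    where
    q = pl′ r (inj₁ i)
    eq : ∀ G g p q → (- G) * p * ((- g) * q) ≡ (G * g) * (p * q)
    eq = solve-∀ ℚ-ring
  Gg′≡1 r@(b , l) (inj₂ j) = trans (eq (G b l) (g b l) (R.ratio q) (R.ratio⁻¹ q))
    (cong₂ _*_ (Gg≡1 b l) (R.ratio-inverse q))
    where
    q = pl′ r (inj₂ j)
    eq : ∀ G g p q → G * p * (g * q) ≡ (G * g) * (p * q)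
    eq = solve-∀ ℚ-ring

  ∣ratio∣≤1 : ∀ q → ∣ R.ratio q ∣ ≤ 1ℚ
  ∣ratio∣≤1 q = ≤-trans (≤-reflexive (∣pos∣ (R.0≤ratio q))) (R.ratio≤1 q)

  ∣ratio⁻¹∣≤2 : ∀ q → ∣ R.ratio⁻¹ q ∣ ≤ ι 2
  ∣ratio⁻¹∣≤2 q = ≤-trans (≤-reflexive (∣pos∣ (R.0≤ratio⁻¹ q))) (R.ratio⁻¹≤2 q)

  ∣G′∣≤1 : ∀ r m → ∣ G′ r m ∣ ≤ 1ℚ
  ∣G′∣≤1 r@(b , l) (inj₁ i) = ∣*∣≤ {(- G b l)} (∣-∣≤ {G b l} (∣G∣≤1 b l)) (∣ratio∣≤1 (pl′ r (inj₁ i)))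
  ∣G′∣≤1 r@(b , l) (inj₂ j) = ∣*∣≤ {G b l} (∣G∣≤1 b l) (∣ratio∣≤1 (pl′ r (inj₂ j)))

  ∣g′∣≤2Γ : ∀ r m → ∣ g′ r m ∣ ≤ Γ * ι 2
  ∣g′∣≤2Γ r@(b , l) (inj₁ i) = ∣*∣≤ {(- g b l)} (∣-∣≤ {g b l} (∣g∣≤Γ b l)) (∣ratio⁻¹∣≤2 (pl′ r (inj₁ i)))
  ∣g′∣≤2Γ r@(b , l) (inj₂ j) = ∣*∣≤ {g b l} (∣g∣≤Γ b l) (∣ratio⁻¹∣≤2 (pl′ r (inj₂ j)))

  G′-plain : ∀ b l j → G′ (b , l) (inj₂ j) * (ϖ′ + ω (pl b l)) ≡ G b l * ω (pl b l)
  G′-plain b l j = trans (*-assoc (G b l) (R.ratio q) (ϖ′ + ω (pl b l)))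
    (cong (G b l *_) (R.ratio-* q))
    where q = pl′ (b , l) (inj₂ j)

  G′-bold : ∀ b l i → G′ (b , l) (inj₁ i) * (ϖ′ + ϖ) ≡ (- G b l) * ϖ
  G′-bold b l i = trans (*-assoc (- G b l) (R.ratio q) (ϖ′ + ϖ))
    (cong ((- G b l) *_) (R.ratio-* q))
    where q = pl′ (b , l) (inj₁ i)

  x-pl′ : ∀ r m → xQ′ (pl′ r m) ≡ xB′ r + G′ r m * (ϖ′ + ω′ (pl′ r m))
  x-pl′ r@(b , l) (inj₁ i) = trans (eq (xB b) (G b l) ϖ) (cong (_+_ (xB′ r)) (sym (G′-bold b l i)))
    where
    eq : ∀ x G ϖ → x ≡ x + G * ϖ + (- G) * ϖ
    eq = solve-∀ ℚ-ring
  x-pl′ r@(b , l) (inj₂ j) = trans (x-pl b l)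
    (trans (eq (xB b) (G b l) ϖ (ω (pl b l))) (cong (_+_ (xB′ r)) (sym (G′-plain b l j))))
    where
    eq : ∀ x G ϖ ω → x + G * (ϖ + ω) ≡ x + G * ϖ + G * ω
    eq = solve-∀ ℚ-ring

  y-pl′ : ∀ r m → yQ′ (pl′ r m) ≡ yB′ r + s′ r m * (G′ r m * (ϖ′ + ω′ (pl′ r m)))
  y-pl′ r@(b , l) (inj₁ i) = trans
    (trans (cong (_+_ (yB b)) (trans (sym (*-identityˡ (c * ϖ * tB i))) (cong (_* (c * ϖ * tB i)) (sym (Gg≡1 b l)))))
      (eq (yB b) (s b l) c (g b l) (G b l) ϖ A (ι (toℕ i))))
    (cong (λ z → yB′ r + s′ r (inj₁ i) * z) (sym (G′-bold b l i)))
    where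
    eq : ∀ y s c g G ϖ A i → y + G * g * (c * ϖ * (ι 2 * i - (A - 1ℚ))) ≡
         y + s * (G * ϖ) + (s + c * g * (A - 1ℚ - ι 2 * i)) * ((- G) * ϖ)
    eq = solve-∀ ℚ-ring
  y-pl′ r@(b , l) (inj₂ j) = trans
    (trans (cong₂ (λ y z → y + z) (y-pl b l)
        (trans (sym (*-identityˡ (c * ω (pl b l) * tQ j))) (cong (_* (c * ω (pl b l) * tQ j)) (sym (Gg≡1 b l)))))
      (eq (yB b) (s b l) c (g b l) (G b l) ϖ (ω (pl b l)) (tQ j)))
    (cong (λ z → yB′ r + s′ r (inj₂ j) * z) (sym (G′-plain b l j)))
    where
    eq : ∀ y s c g G ϖ ω t → y + s * (G * (ϖ + ω)) + G * g * (c * ω * t) ≡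
         y + s * (G * ϖ) + (s + c * g * t) * (G * ω)
    eq = solve-∀ ℚ-ring

  private
    toℕ≤a : ∀ (i : Fin a) → ι (toℕ i) ≤ A - 1ℚ
    toℕ≤a i = ≤-trans (ι-mono (ℕ.s≤s⁻¹ (Fin.toℕ<n i)))
      (≤-reflexive (trans (eq (ι a-1)) (cong (_- 1ℚ) (sym (ι-suc a-1)))))
      where
      eq : ∀ x → x ≡ 1ℚ + x - 1ℚ
      eq = solve-∀ ℚ-ring

  ∣κ∣≤A : ∀ m → ∣ κ m ∣ ≤ A
  ∣κ∣≤A (inj₁ i) = ∣∣≤
    (≤-by (1ℚ + ι 2 * ι (toℕ i)) (<⇒≤ 0<1 ⊕ 0≤ι 2 ⊗ 0≤ι (toℕ i)) (eq A (ι (toℕ i))))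
    (≤-by (ι 2 * (A - 1ℚ - ι (toℕ i)) + 1ℚ) (0≤ι 2 ⊗ 0≤- (toℕ≤a i) ⊕ <⇒≤ 0<1) (eq′ A (ι (toℕ i))))
    where
    eq : ∀ A i → A ≡ (A - 1ℚ - ι 2 * i) + (1ℚ + ι 2 * i)
    eq = solve-∀ ℚ-ring
    eq′ : ∀ A i → A ≡ (- (A - 1ℚ - ι 2 * i)) + (ι 2 * (A - 1ℚ - i) + 1ℚ)
    eq′ = solve-∀ ℚ-ring
  ∣κ∣≤A (inj₂ j) = ∣∣≤
    (≤-by (ι 2 * ι (toℕ j)) (0≤ι 2 ⊗ 0≤ι (toℕ j)) (eq A (ι (toℕ j))))
    (≤-by (ι 2 * (A - 1ℚ - ι (toℕ j)) + ι 2) (0≤ι 2 ⊗ 0≤- (toℕ≤a j) ⊕ 0≤ι 2) (eq′ A (ι (toℕ j))))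
    where
    eq : ∀ A i → A ≡ (A - ι 2 * i) + (ι 2 * i)
    eq = solve-∀ ℚ-ring
    eq′ : ∀ A i → A ≡ (- (A - ι 2 * i)) + (ι 2 * (A - 1ℚ - i) + ι 2)
    eq′ = solve-∀ ℚ-ring

  ∣tB∣≤A : ∀ i → ∣ tB i ∣ ≤ A
  ∣tB∣≤A i = subst (λ z → ∣ z ∣ ≤ A) (eq A (ι (toℕ i))) (∣-∣≤ {κ (inj₁ i)} (∣κ∣≤A (inj₁ i)))
    where
    eq : ∀ A i → - (A - 1ℚ - ι 2 * i) ≡ ι 2 * i - (A - 1ℚ)
    eq = solve-∀ ℚ-ring

  private
    A≤4A : A ≤ ι 4 * A
    A≤4A = ≤-by (ι 3 * A) (0≤ι 3 ⊗ 0≤A) (eq A)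
      where
      eq : ∀ A → ι 4 * A ≡ A + ι 3 * A
      eq = solve-∀ ℚ-ring

    ∣3A∣≤4A : ∣ ι 3 * A ∣ ≤ ι 4 * A
    ∣3A∣≤4A = ≤-trans (≤-reflexive (∣pos∣ (0≤ι 3 ⊗ 0≤A))) (≤-by A 0≤A (eq A))
      where
      eq : ∀ A → ι 4 * A ≡ ι 3 * A + A
      eq = solve-∀ ℚ-ring

  ∣tU∣≤4A : ∀ t → ∣ tU t ∣ ≤ ι 4 * A
  ∣tU∣≤4A (inj₁ j)        = ≤-trans (∣κ∣≤A (inj₂ j)) A≤4A
  ∣tU∣≤4A (inj₂ (inj₁ _)) = ∣3A∣≤4A
  ∣tU∣≤4A (inj₂ (inj₂ _)) = ∣-∣≤ {ι 3 * A} ∣3A∣≤4A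

  private
    ∣cωt∣≤ : ∀ {ω t} → 0ℚ ≤ ω → ∣ t ∣ ≤ ι 4 * A → ∣ c * ω * t ∣ ≤ ι 4 * (u * ω)
    ∣cωt∣≤ {ω} {t} 0≤ω h = ≤-trans (∣*∣≤ {c * ω} {t} (≤-reflexive (∣pos∣ (0≤c ⊗ 0≤ω))) h) (≤-reflexive (eq A c ω))
      where
      eq : ∀ A c ω → c * ω * (ι 4 * A) ≡ ι 4 * (A * c * ω)
      eq = solve-∀ ℚ-ring

    0≤ω : ∀ q → 0ℚ ≤ ω q
    0≤ω q = ≤-trans 0≤ϖ (ϖ≤ω q)

    +0 : ∀ p → p ≡ p + 0ℚ
    +0 = solve-∀ ℚ-ring

    +s0 : ∀ p s t → p + t ≡ p + (s * 0ℚ + t)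
    +s0 = solve-∀ ℚ-ring

    0≤4uϖ : 0ℚ ≤ ι 4 * (u * ϖ)
    0≤4uϖ = 0≤ι 4 ⊗ (0≤A ⊗ 0≤c ⊗ 0≤ϖ)

  module Edge (b : ∥ B ∥) (l : ∥ L ∥) (m : ∥ L′ ∥) where

    module T = Tilt (xB b) (yB b) (s b l) (g b l) (G b l) {κ m} (Gg≡1 b l) (∣G∣≤1 b l) (∣g∣≤Γ b l) (∣κ∣≤A m)
    open T using (xr; V)

    private
      4ϖ∣s-s∣≤ : ∀ {p} → ι 4 * (ϖ * ∣ s b l - s b l ∣) ≤ ∣ p ∣
      4ϖ∣s-s∣≤ {p} = ≤-trans (≤-reflexive (trans (cong (λ z → ι 4 * (ϖ * ∣ z ∣)) (+-inverseʳ (s b l))) (eq ϖ))) (0≤∣p∣ p)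
        where
        eq : ∀ ϖ → ι 4 * (ϖ * 0ℚ) ≡ 0ℚ
        eq = solve-∀ ℚ-ring

    -- `v` is the height of the parent point above the parent edge, `W` that of the new point above
    -- the new edge. The parent is not an end of the parent edge, so `v` dominates.
    record Far (v W ω₀ Δ δ : ℚ) : Set where
      field
        near : ∣ W - v ∣ + ∣ W - v ∣ ≤ ∣ v ∣
        0<v  : 0ℚ < ∣ v ∣
        new  : ∀ {ω″} → ω″ ≤ ω₀ → ¼ * c * (ω″ + δ) ≤ ∣ W ∣
        slope : ∀ {σ S} → ι 4 * (ϖ * S) ≤ ∣ v ∣ → σ ≤ S + (u * Γ + u * Γ) → ι 4 * (ϖ′ * σ) ≤ ∣ W ∣

      sign : sgn W ≡ sgn v
      sign = sgn-near {v} {W} near 0<v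

    far : ∀ {x₀ y₀ s₀ dx dy ω₀ x y} → x ≡ x₀ + dx → y ≡ y₀ + (s₀ * dx + dy) → ϖ ≤ ω₀ →
          ∣ dx ∣ ≤ ϖ → ∣ dy ∣ ≤ ι 4 * (u * ω₀) →
          let v = (y₀ - yB b) - s b l * (x₀ - xB b) in
          ν * (ω₀ + ∣ x₀ - xB b ∣) ≤ ∣ v ∣ → ι 4 * (ϖ * ∣ s₀ - s b l ∣) ≤ ∣ v ∣ →
          Far v (V x y) ω₀ (∣ x₀ - xB b ∣) (∣ x - xr ∣)
    far {x₀} {y₀} {s₀} {dx} {dy} {ω₀} {x} {y} ex ey ϖ≤ω₀ hdx hdy hν hs = record
      { near = near
      ; 0<v = <-≤-trans (0<* 0<ν (0<+ (<-≤-trans 0<ϖ ϖ≤ω₀) (0≤∣p∣ (x₀ - xB b)))) hν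
      ; new = λ hω → far-new ϖ≤ω₀ (0≤∣p∣ (x₀ - xB b)) hν (∣near∣ {v} {V x y} near) hω
          (T.∣x-xr∣≤ {x₀} {y₀} {s₀} {dx} {dy} ex ey ϖ≤ω₀ hdx hdy)
      ; slope = λ {σ} {S} hS hσ → far-slope ϖ≤ω₀ (0≤∣p∣ (x₀ - xB b)) hν (∣near∣ {v} {V x y} near)
          {σ} {S} (0≤∣p∣ v) hS hσ
      }
      where
      v = (y₀ - yB b) - s b l * (x₀ - xB b)
      near = T.V-near {x₀} {y₀} {s₀} {dx} {dy} ex ey ϖ≤ω₀ hdx hdy hν hs

    W-Q : ∥ Q′ ∥ → ℚ
    W-Q q = V (xQ′ q) (yQ′ q)

    W-B : ∥ B′ ∥ → ℚ
    W-B r = V (xB′ r) (yB′ r)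

    far-Q : ∀ {q} t → q ≢ pl b l →
            Far (vQ b l q) (W-Q (inj₁ (q , t))) (ω q) (∣ xQ q - xB b ∣) (∣ xQ q - xr ∣)
    far-Q {q} t q≢ = far {xQ q} {yQ q} {s b l} {0ℚ} {c * ω q * tU t} (+0 (xQ q)) (+s0 (yQ q) (s b l) (c * ω q * tU t))
      (ϖ≤ω q) 0≤ϖ (∣cωt∣≤ {ω q} {tU t} (0≤ω q) (∣tU∣≤4A t)) (farQ q≢) (4ϖ∣s-s∣≤ {vQ b l q})

    far-cluster : ∀ {b′} i → b′ ≢ b →
                  Far (vB b l b′) (W-Q (inj₂ (b′ , inj₁ i))) ϖ (∣ xB b′ - xB b ∣) (∣ xB b′ - xr ∣)
    far-cluster {b′} i b′≢ = far {xB b′} {yB b′} {s b l} {0ℚ} {c * ϖ * tB i} (+0 (xB b′)) (+s0 (yB b′) (s b l) (c * ϖ * tB i))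
      ≤-refl 0≤ϖ (∣cωt∣≤ {ϖ} {tB i} 0≤ϖ (≤-trans (∣tB∣≤A i) A≤4A)) (farB l b′≢) (4ϖ∣s-s∣≤ {vB b l b′})

    private
      ∣Gϖ∣≤ϖ′ : ∀ b l → ∣ G b l * ϖ ∣ ≤ ϖ
      ∣Gϖ∣≤ϖ′ b l = ≤-trans (∣*∣≤ {G b l} (∣G∣≤1 b l) (≤-reflexive (∣pos∣ 0≤ϖ))) (≤-reflexive (*-identityˡ ϖ))

      Dϖ≤∣Gϖ∣ : ∀ b l → D * ϖ ≤ ∣ G b l * ϖ ∣
      Dϖ≤∣Gϖ∣ b l = ≤-trans (*-mono-r 0≤ϖ (D≤∣G∣ b l))
        (≤-reflexive (sym (trans (∣p*q∣≡∣p∣*∣q∣ (G b l) ϖ) (cong (∣ G b l ∣ *_) (∣pos∣ 0≤ϖ)))))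

      ∣-4uϖ∣≤ : ∣ - (ι 4 * (u * ϖ)) ∣ ≤ ι 4 * (u * ϖ)
      ∣-4uϖ∣≤ = ∣-∣≤ {ι 4 * (u * ϖ)} (≤-reflexive (∣pos∣ 0≤4uϖ))

    far-mirror : ∀ {b′} l′ → b′ ≢ b →
                 Far (vB b l b′) (W-Q (inj₂ (b′ , inj₂ l′))) ϖ (∣ xB b′ - xB b ∣) (∣ xQ′ (inj₂ (b′ , inj₂ l′)) - xr ∣)
    far-mirror {b′} l′ b′≢ = far {xB b′} {yB b′} {s b′ l′} {(- (G b′ l′ * ϖ))} {(- (ι 4 * (u * ϖ)))} refl refl
      ≤-refl (∣-∣≤ {G b′ l′ * ϖ} (∣Gϖ∣≤ϖ′ b′ l′)) ∣-4uϖ∣≤ (farB l b′≢) (slopeB b′≢ l l′)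

    far-bold : ∀ {b′} l′ → b′ ≢ b →
               Far (vB b l b′) (W-B (b′ , l′)) ϖ (∣ xB b′ - xB b ∣) (∣ xB′ (b′ , l′) - xr ∣)
    far-bold {b′} l′ b′≢ = far {xB b′} {yB b′} {s b′ l′} {G b′ l′ * ϖ} {0ℚ} refl
      (cong (_+_ (yB b′)) (+0 (s b′ l′ * (G b′ l′ * ϖ))))
      ≤-refl (∣Gϖ∣≤ϖ′ b′ l′) (0≤4uϖ) (farB l b′≢) (slopeB b′≢ l l′)

    -- A new point at the bold end `b` itself, lying on or near another edge from `b`. Its parent
    -- has height zero, and the main term `v` is the difference of slopes times the displacement.
    record Sibling (v W S δ : ℚ) : Set where
      field
        near : ∣ W - v ∣ + ∣ W - v ∣ ≤ ∣ v ∣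
        0<v  : 0ℚ < ∣ v ∣
        new  : ∀ {ω″} → ω″ ≤ ϖ → ¼ * c * (ω″ + δ) ≤ ∣ W ∣
        slope : ∀ {σ} → σ ≤ S + (u * Γ + u * Γ) → ι 4 * (ϖ′ * σ) ≤ ∣ W ∣

      sign : sgn W ≡ sgn v
      sign = sgn-near {v} {W} near 0<v

    sibling : ∀ {s₀ dx dy x y} → x ≡ xB b + dx → y ≡ yB b + (s₀ * dx + dy) →
              ∣ dx ∣ ≤ ϖ → D * ϖ ≤ ∣ dx ∣ → ∣ dy ∣ ≤ ι 4 * (u * ϖ) → ν ≤ ∣ s₀ - s b l ∣ →
              Sibling ((s₀ - s b l) * dx) (V x y) (∣ s₀ - s b l ∣) (∣ x - xr ∣)
    sibling {s₀} {dx} {dy} {x} {y} ex ey hdx hdx′ hdy hs = record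
      { near = near
      ; 0<v = T.0<∣main∣ {s₀} {dx} {dy} ex ey hdx hdx′ hdy hs
      ; new = λ hω → sibling-new (∣near∣ {v} {V x y} near) (T.∣main∣≥ν {s₀} {dx} {dy} ex ey hdx hdx′ hdy hs) hω
          (T.sibling-∣x-xr∣≤ {s₀} {dx} {dy} ex ey hdx hdx′ hdy hs)
      ; slope = λ {σ} → sibling-slope (∣near∣ {v} {V x y} near) {σ} {∣ s₀ - s b l ∣} (T.∣main∣≥ {s₀} {dx} {dy} ex ey hdx hdx′ hdy hs) hs
      }
      where
      v = (s₀ - s b l) * dx
      near = T.sibling-near {s₀} {dx} {dy} ex ey hdx hdx′ hdy hs

    sibling-mirror : ∀ {l′} → l′ ≢ l →
                     Sibling ((s b l′ - s b l) * (- (G b l′ * ϖ))) (W-Q (inj₂ (b , inj₂ l′)))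
                             (∣ s b l′ - s b l ∣) (∣ xQ′ (inj₂ (b , inj₂ l′)) - xr ∣)
    sibling-mirror {l′} l′≢ = sibling {s b l′} {(- (G b l′ * ϖ))} {(- (ι 4 * (u * ϖ)))} refl refl
      (∣-∣≤ {G b l′ * ϖ} (∣Gϖ∣≤ϖ′ b l′))
      (≤-trans (Dϖ≤∣Gϖ∣ b l′) (≤-reflexive (sym (∣-p∣≡∣p∣ (G b l′ * ϖ))))) ∣-4uϖ∣≤ (slopeL b l′≢)

    sibling-bold : ∀ {l′} → l′ ≢ l →
                   Sibling ((s b l′ - s b l) * (G b l′ * ϖ)) (W-B (b , l′))
                           (∣ s b l′ - s b l ∣) (∣ xB′ (b , l′) - xr ∣)
    sibling-bold {l′} l′≢ = sibling {s b l′} {G b l′ * ϖ} {0ℚ} refl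
      (cong (_+_ (yB b)) (+0 (s b l′ * (G b l′ * ϖ))))
      (∣Gϖ∣≤ϖ′ b l′) (Dϖ≤∣Gϖ∣ b l′) 0≤4uϖ (slopeL b l′≢)

    W-plain : ∀ t → W-Q (inj₁ (pl b l , t)) ≡ (tU t - κ m) * (c * ω (pl b l))
    W-plain t = T.V-plain {xQ (pl b l)} {yQ (pl b l)} {ω (pl b l)} (tU t) (x-pl b l) (y-pl b l)

    W-cluster : ∀ i → W-Q (inj₂ (b , inj₁ i)) ≡ (tB i + κ m) * (c * ϖ)
    W-cluster i = T.V-bold (tB i)

    W-mirror : W-Q (inj₂ (b , inj₂ l)) ≡ (- (ι 4 * A - ι 2 * κ m)) * (c * ϖ)
    W-mirror = T.V-mirror

    1≤3A-κ : 1ℚ ≤ ι 3 * A - κ m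
    1≤3A-κ = ≤-by ((A - κ m) + A + (A - 1ℚ)) (0≤- (∣∣≤⇒≤ {κ m} (∣κ∣≤A m)) ⊕ 0≤A ⊕ 0≤- 1≤A) (eq A (κ m))
      where
      eq : ∀ A k → ι 3 * A - k ≡ 1ℚ + ((A - k) + A + (A - 1ℚ))
      eq = solve-∀ ℚ-ring

    1≤3A+κ : 1ℚ ≤ - ((- (ι 3 * A)) - κ m)
    1≤3A+κ = ≤-by ((κ m - - A) + A + (A - 1ℚ)) (0≤- (∣∣≤⇒-≤ {κ m} (∣κ∣≤A m)) ⊕ 0≤A ⊕ 0≤- 1≤A) (eq A (κ m))
      where
      eq : ∀ A k → - ((- (ι 3 * A)) - k) ≡ 1ℚ + ((k - - A) + A + (A - 1ℚ))
      eq = solve-∀ ℚ-ring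

    1≤4A-2κ : 1ℚ ≤ - (- (ι 4 * A - ι 2 * κ m))
    1≤4A-2κ = ≤-by (ι 2 * (A - κ m) + A + (A - 1ℚ)) (0≤ι 2 ⊗ 0≤- (∣∣≤⇒≤ {κ m} (∣κ∣≤A m)) ⊕ 0≤A ⊕ 0≤- 1≤A) (eq A (κ m))
      where
      eq : ∀ A k → - (- (ι 4 * A - ι 2 * k)) ≡ 1ℚ + (ι 2 * (A - k) + A + (A - 1ℚ))
      eq = solve-∀ ℚ-ring

sgn-*-pos : ∀ p {q} → 0ℚ < q → sgn (p * q) ≡ sgn p
sgn-*-pos p {q} h = trans (cong sgn (*-comm p q)) (sgn-pos-* p h)

-- The invariants after a stage

module NextStage (S : Stage) (a-1 : ℕ) where

  open Stage S
  open Step S a-1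
  open Perturb {A} {c} {ϖ} {Γ} {ν} {D} 1≤A 0<c 0<ϖ 1≤Γ 0<D D≤1 0<ν 32AcΓ≡νD using (u; own-new; c≤uΓ; 32uΓ≤ν)

  _≟B_ = Finite._≟ᶠ_ B
  _≟Q_ = Finite._≟ᶠ_ Q
  _≟L_ = Finite._≟ᶠ_ L

  plain-gap : ∀ i j → 1ℚ ≤ ∣ tQ j - κ (inj₁ i) ∣
  plain-gap i j = subst (λ z → 1ℚ ≤ ∣ z ∣) (eq A (ι (toℕ i)) (ι (toℕ j))) (odd-gap (toℕ j) (toℕ i))
    where
    eq : ∀ A i j → 1ℚ - ι 2 * (j - i) ≡ A - ι 2 * j - (A - 1ℚ - ι 2 * i)
    eq = solve-∀ ℚ-ring

  plain-gap′ : ∀ {i j} → i ≢ j → 1ℚ ≤ ∣ tQ j - κ (inj₂ i) ∣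
  plain-gap′ {i} {j} i≢j = subst (λ z → 1ℚ ≤ ∣ z ∣) (eq A (ι (toℕ i)) (ι (toℕ j))) (even-gap (i≢j ∘ Fin.toℕ-injective))
    where
    eq : ∀ A i j → ι 2 * (i - j) ≡ A - ι 2 * j - (A - ι 2 * i)
    eq = solve-∀ ℚ-ring

  bold-gap : ∀ {i j} → j ≢ i → 1ℚ ≤ ∣ tB j + κ (inj₁ i) ∣
  bold-gap {i} {j} j≢i = subst (λ z → 1ℚ ≤ ∣ z ∣) (eq A (ι (toℕ i)) (ι (toℕ j))) (even-gap (j≢i ∘ Fin.toℕ-injective))
    where
    eq : ∀ A i j → ι 2 * (j - i) ≡ (ι 2 * j - (A - 1ℚ)) + (A - 1ℚ - ι 2 * i)
    eq = solve-∀ ℚ-ring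

  bold-gap′ : ∀ i j → 1ℚ ≤ ∣ tB j + κ (inj₂ i) ∣
  bold-gap′ i j = subst (λ z → 1ℚ ≤ ∣ z ∣) (eq A (ι (toℕ i)) (ι (toℕ j))) (odd-gap (toℕ i) (toℕ j))
    where
    eq : ∀ A i j → 1ℚ - ι 2 * (i - j) ≡ (ι 2 * j - (A - 1ℚ)) + (A - ι 2 * i)
    eq = solve-∀ ℚ-ring

  -- Seen from r the two progressions interleave: their signs cancel in pairs, but for the term on the line itself.
  cluster-sign : ∀ m → ∑ (finᶠ a) (λ i → sgn (tB i + κ m) ℤ.+ sgn (tQ i - κ m)) ≡ 1ℤ
  cluster-sign (inj₁ i) = trans (∑-single (finᶠ a) {i} λ j j≢i → trans (split j)
      (sgn-even+odd (j≢i ∘ Fin.toℕ-injective)))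
    (trans (split i) (sgn-even+odd-self (toℕ i)))
    where
    eq : ∀ A i j → (ι 2 * j - (A - 1ℚ)) + (A - 1ℚ - ι 2 * i) ≡ ι 2 * (j - i)
    eq = solve-∀ ℚ-ring
    eq′ : ∀ A i j → A - ι 2 * j - (A - 1ℚ - ι 2 * i) ≡ 1ℚ - ι 2 * (j - i)
    eq′ = solve-∀ ℚ-ring
    split : ∀ j → sgn (tB j + κ (inj₁ i)) ℤ.+ sgn (tQ j - κ (inj₁ i)) ≡
                  sgn (ι 2 * (ι (toℕ j) - ι (toℕ i))) ℤ.+ sgn (1ℚ - ι 2 * (ι (toℕ j) - ι (toℕ i)))
    split j = cong₂ (λ p q → sgn p ℤ.+ sgn q) (eq A (ι (toℕ i)) (ι (toℕ j))) (eq′ A (ι (toℕ i)) (ι (toℕ j)))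
  cluster-sign (inj₂ i) = trans (∑-single (finᶠ a) {i} λ j j≢i → trans (split j)
      (sgn-even+odd (j≢i ∘ sym ∘ Fin.toℕ-injective)))
    (trans (split i) (sgn-even+odd-self (toℕ i)))
    where
    eq : ∀ A i j → (ι 2 * j - (A - 1ℚ)) + (A - ι 2 * i) ≡ 1ℚ - ι 2 * (i - j)
    eq = solve-∀ ℚ-ring
    eq′ : ∀ A i j → A - ι 2 * j - (A - ι 2 * i) ≡ ι 2 * (i - j)
    eq′ = solve-∀ ℚ-ring
    split : ∀ j → sgn (tB j + κ (inj₂ i)) ℤ.+ sgn (tQ j - κ (inj₂ i)) ≡
                  sgn (ι 2 * (ι (toℕ i) - ι (toℕ j))) ℤ.+ sgn (1ℚ - ι 2 * (ι (toℕ i) - ι (toℕ j)))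
    split j = trans (ℤ.+-comm (sgn (tB j + κ (inj₂ i))) (sgn (tQ j - κ (inj₂ i))))
      (cong₂ (λ p q → sgn p ℤ.+ sgn q) (eq′ A (ι (toℕ i)) (ι (toℕ j))) (eq A (ι (toℕ i)) (ι (toℕ j))))

  private
    ∣Gϖ∣≤ : ∀ b l → ∣ G b l * ϖ ∣ ≤ ϖ
    ∣Gϖ∣≤ b l = ≤-trans (∣*∣≤ {G b l} (∣G∣≤1 b l) (≤-reflexive (∣pos∣ 0≤ϖ))) (≤-reflexive (*-identityˡ ϖ))

  module NewEdge (b : ∥ B ∥) (l : ∥ L ∥) (m : ∥ L′ ∥) where

    open Edge b l m
    open T using (xr; V)

    κcw : ∀ {w} → 0ℚ < w → ∀ k → sgn (k * (c * w)) ≡ sgn k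
    κcw 0<w k = sgn-*-pos k (0<* 0<c 0<w)

    self : W-B (b , l) ≡ 0ℚ
    self = eq (xr) (yB′ (b , l)) (s b l + c * g b l * κ m)
      where
      eq : ∀ x y s → (y - y) - s * (x - x) ≡ 0ℚ
      eq = solve-∀ ℚ-ring

    ω-pl>0 : 0ℚ < ω (pl b l)
    ω-pl>0 = <-≤-trans 0<ϖ (ϖ≤ω (pl b l))

    plain-dist : ∣ xQ (pl b l) - xr ∣ ≤ ω (pl b l) + ω (pl b l)
    plain-dist = subst (λ z → ∣ z ∣ ≤ ω (pl b l) + ω (pl b l))
      (trans (eq (xB b) (G b l) ϖ (ω (pl b l))) (cong (_- xr) (sym (x-pl b l))))
      (≤-trans (∣*∣≤ {G b l} (∣G∣≤1 b l) (≤-reflexive (∣pos∣ (<⇒≤ ω-pl>0))))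
        (≤-trans (≤-reflexive (*-identityˡ (ω (pl b l)))) (p≤p+q (<⇒≤ ω-pl>0))))
      where
      eq : ∀ x G ϖ ω → G * ω ≡ (x + G * (ϖ + ω)) - (x + G * ϖ)
      eq = solve-∀ ℚ-ring

    cluster-dist : ∣ xB b - xr ∣ ≤ ϖ + ϖ
    cluster-dist = subst (λ z → ∣ z ∣ ≤ ϖ + ϖ) (eq (xB b) (G b l * ϖ))
      (≤-trans (∣-∣≤ {G b l * ϖ} (∣Gϖ∣≤ b l)) (p≤p+q 0≤ϖ))
      where
      eq : ∀ x e → - e ≡ x - (x + e)
      eq = solve-∀ ℚ-ring

    mirror-dist : ∣ xQ′ (inj₂ (b , inj₂ l)) - xr ∣ ≤ ϖ + ϖ
    mirror-dist = subst (λ z → ∣ z ∣ ≤ ϖ + ϖ) (eq (xB b) (G b l * ϖ))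
      (∣+∣≤ {(- (G b l * ϖ))} (∣-∣≤ {G b l * ϖ} (∣Gϖ∣≤ b l)) (∣-∣≤ {G b l * ϖ} (∣Gϖ∣≤ b l)))
      where
      eq : ∀ x e → (- e) + (- e) ≡ (x + (- e)) - (x + e)
      eq = solve-∀ ℚ-ring

    plain-κ : ∀ t → inj₁ (pl b l , t) ≢ pl′ (b , l) m → 1ℚ ≤ ∣ tU t - κ m ∣
    plain-κ t ne = go t m refl ne
      where
      go : ∀ t m′ → m ≡ m′ → inj₁ (pl b l , t) ≢ pl′ (b , l) m′ → 1ℚ ≤ ∣ tU t - κ m′ ∣
      go (inj₁ j) (inj₁ i) _ _  = plain-gap i j
      go (inj₁ j) (inj₂ i) _ ne = plain-gap′ {i} {j} λ { refl → ne refl }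
      go (inj₂ (inj₁ _)) _ refl _ = ∣∣≥1 1≤3A-κ
      go (inj₂ (inj₂ _)) _ refl _ = ∣∣≥1′ {(- (ι 3 * A)) - κ m} 1≤3A+κ

    cluster-κ : ∀ i → inj₂ (b , inj₁ i) ≢ pl′ (b , l) m → 1ℚ ≤ ∣ tB i + κ m ∣
    cluster-κ i ne = go m ne
      where
      go : ∀ m′ → inj₂ (b , inj₁ i) ≢ pl′ (b , l) m′ → 1ℚ ≤ ∣ tB i + κ m′ ∣
      go (inj₁ j) ne = bold-gap {j} {i} λ { refl → ne refl }
      go (inj₂ j) _  = bold-gap′ j i

    Clear : ℚ → ℚ → ℚ → Set
    Clear w x W = ¼ * c * (w + ∣ x - xr ∣) ≤ ∣ W ∣

    far-Q′ : ∀ q → q ≢ pl′ (b , l) m → Clear (ω′ q) (xQ′ q) (W-Q q)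
    far-Q′ (inj₁ (q , t)) ne = go (q ≟Q pl b l) ne
      where
      go : ∀ {q} → Dec (q ≡ pl b l) → inj₁ (q , t) ≢ pl′ (b , l) m → Clear (ω q) (xQ q) (W-Q (inj₁ (q , t)))
      go (no q≢)    _  = Far.new (far-Q t q≢) ≤-refl
      go (yes refl) ne = subst (Clear (ω (pl b l)) (xQ (pl b l))) (sym (W-plain t))
        (own-new {tU t - κ m} {ω (pl b l)} (<⇒≤ ω-pl>0) (plain-κ t ne) ≤-refl plain-dist)
    far-Q′ (inj₂ (b′ , inj₁ i)) ne = go (b′ ≟B b) ne
      where
      go : ∀ {b′} → Dec (b′ ≡ b) → inj₂ (b′ , inj₁ i) ≢ pl′ (b , l) m → Clear ϖ (xB b′) (W-Q (inj₂ (b′ , inj₁ i)))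
      go (no b′≢)   _  = Far.new (far-cluster i b′≢) ≤-refl
      go (yes refl) ne = subst (Clear ϖ (xB b)) (sym (W-cluster i))
        (own-new {tB i + κ m} {ϖ} 0≤ϖ (cluster-κ i ne) ≤-refl cluster-dist)
    far-Q′ (inj₂ (b′ , inj₂ l′)) _ = go (b′ ≟B b) (l′ ≟L l)
      where
      go : ∀ {b′ l′} → Dec (b′ ≡ b) → Dec (l′ ≡ l) → Clear ϖ (xQ′ (inj₂ (b′ , inj₂ l′))) (W-Q (inj₂ (b′ , inj₂ l′)))
      go {l′ = l′} (no b′≢) _ = Far.new (far-mirror l′ b′≢) ≤-refl
      go (yes refl) (no l′≢)   = Sibling.new (sibling-mirror l′≢) ≤-refl
      go (yes refl) (yes refl) = subst (Clear ϖ (xQ′ (inj₂ (b , inj₂ l)))) (sym W-mirror)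
        (own-new { - (ι 4 * A - ι 2 * κ m)} {ϖ} 0≤ϖ (∣∣≥1′ { - (ι 4 * A - ι 2 * κ m)} 1≤4A-2κ) ≤-refl mirror-dist)

    far-B′ : ∀ r → r ≢ (b , l) → Clear ϖ′ (xB′ r) (W-B r)
    far-B′ (b′ , l′) ne = go (b′ ≟B b) ne
      where
      go : ∀ {b′} → Dec (b′ ≡ b) → (b′ , l′) ≢ (b , l) → Clear ϖ′ (xB′ (b′ , l′)) (W-B (b′ , l′))
      go (no b′≢)   _  = Far.new (far-bold l′ b′≢) ϖ′≤ϖ
      go (yes refl) ne = Sibling.new (sibling-bold λ { refl → ne refl }) ϖ′≤ϖ

    ∣cgκ∣≤uΓ : ∀ b l m → ∣ c * g b l * κ m ∣ ≤ u * Γ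
    ∣cgκ∣≤uΓ b l m = Tilt.∣cgk∣≤uΓ (xB b) (yB b) (s b l) (g b l) (G b l) {κ m} (Gg≡1 b l) (∣G∣≤1 b l) (∣g∣≤Γ b l) (∣κ∣≤A m)
      where open Perturb {A} {c} {ϖ} {Γ} {ν} {D} 1≤A 0<c 0<ϖ 1≤Γ 0<D D≤1 0<ν 32AcΓ≡νD

    slope-diff : ∀ r m′ → ∣ s′ r m′ - s′ (b , l) m ∣ ≤ ∣ s (proj₁ r) (proj₂ r) - s b l ∣ + (u * Γ + u * Γ)
    slope-diff (b′ , l′) m′ = subst (λ z → ∣ z ∣ ≤ ∣ s b′ l′ - s b l ∣ + (u * Γ + u * Γ))
      (eq (s b′ l′) (s b l) (c * g b′ l′ * κ m′) (c * g b l * κ m))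
      (∣+∣≤ {s b′ l′ - s b l} ≤-refl (∣+∣≤ (∣cgκ∣≤uΓ b′ l′ m′) (∣-∣≤ {c * g b l * κ m} (∣cgκ∣≤uΓ b l m))))
      where
      eq : ∀ s₁ s₂ p q → (s₁ - s₂) + (p + (- q)) ≡ (s₁ + p) - (s₂ + q)
      eq = solve-∀ ℚ-ring

    slope-B′ : ∀ r → r ≢ (b , l) → ∀ m′ → ι 4 * (ϖ′ * ∣ s′ r m′ - s′ (b , l) m ∣) ≤ ∣ W-B r ∣
    slope-B′ (b′ , l′) ne m′ = go (b′ ≟B b) ne
      where
      go : ∀ {b′} → Dec (b′ ≡ b) → (b′ , l′) ≢ (b , l) → ι 4 * (ϖ′ * ∣ s′ (b′ , l′) m′ - s′ (b , l) m ∣) ≤ ∣ W-B (b′ , l′) ∣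
      go {b′} (no b′≢) _ = Far.slope (far-bold l′ b′≢) {S = ∣ s b′ l′ - s b l ∣} (slopeB b′≢ l l′) (slope-diff (b′ , l′) m′)
      go (yes refl) ne   = Sibling.slope (sibling-bold λ { refl → ne refl }) (slope-diff (b , l′) m′)

    N : ℤ
    N = + size U

    F : ∥ Q ∥ → ℤ
    F q = ∑ U (λ t → sgn (W-Q (inj₁ (q , t))))

    M K H : ∥ B ∥ → ℤ
    M b′ = ∑ (finᶠ a ⊎ᶠ L) (λ t → sgn (W-Q (inj₂ (b′ , t))))
    K b′ = ∑ L (λ l′ → sgn (W-B (b′ , l′)))
    H b′ = M b′ ℤ.+ K b′

    F-far : ∀ q → q ≢ pl b l → F q ≡ N ℤ.* sgn (vQ b l q)
    F-far q q≢ = trans (∑-cong U λ t → Far.sign (far-Q t q≢)) (∑-const U (sgn (vQ b l q)))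

    -- Here the padding of the plain clusters pays: what stems from a bold point also consists of
    -- `size U` points, all on the side of their parent, so that bold and plain points enter the sum
    -- with the same factor.
    H-far : ∀ b′ → b′ ≢ b → H b′ ≡ N ℤ.* sgn (vB b l b′)
    H-far b′ b′≢ = trans (cong₂ ℤ._+_
        (trans (∑-⊎ (finᶠ a) L (λ t → sgn (W-Q (inj₂ (b′ , t)))))
          (cong₂ ℤ._+_
            (trans (∑-cong (finᶠ a) λ i → Far.sign (far-cluster i b′≢)) (∑-const (finᶠ a) σ))
            (trans (∑-cong L λ l′ → Far.sign (far-mirror l′ b′≢)) (∑-const L σ))))
        (trans (∑-cong L λ l′ → Far.sign (far-bold l′ b′≢)) (∑-const L σ)))
      (trans (eq (+ size (finᶠ a)) (+ size L) σ) (cong (ℤ._* σ) (cong +_ (sym size-U))))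
      where
      σ = sgn (vB b l b′)
      size-U : size U ≡ size (finᶠ a) ℕ.+ (size L ℕ.+ size L)
      size-U = trans (size-⊎ (finᶠ a) (L ⊎ᶠ L)) (cong (size (finᶠ a) ℕ.+_) (size-⊎ L L))
      eq : ∀ a l σ → a ℤ.* σ ℤ.+ l ℤ.* σ ℤ.+ l ℤ.* σ ≡ (a ℤ.+ (l ℤ.+ l)) ℤ.* σ
      eq = solve-∀ ℤ-ring

    F-near : F (pl b l) ≡ ∑ (finᶠ a) (λ j → sgn (tQ j - κ m))
    F-near = trans (∑-⊎ (finᶠ a) (L ⊎ᶠ L) (λ t → sgn (W-Q (inj₁ (pl b l , t)))))
      (trans (cong₂ ℤ._+_
        (∑-cong (finᶠ a) λ j → sign (inj₁ j))
        (trans (∑-⊎ L L (λ t → sgn (W-Q (inj₁ (pl b l , inj₂ t)))))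
          (trans (cong₂ ℤ._+_
            (trans (∑-cong L λ l → trans (sign (inj₂ (inj₁ l))) (sgn≥1 1≤3A-κ)) (∑-const L 1ℤ))
            (trans (∑-cong L λ l → trans (sign (inj₂ (inj₂ l))) (sgn≤-1 {(- (ι 3 * A)) - κ m} 1≤3A+κ)) (∑-const L -1ℤ)))
            (eq (+ size L)))))
        (ℤ.+-identityʳ (∑ (finᶠ a) (λ j → sgn (tQ j - κ m)))))
      where
      sign : ∀ t → sgn (W-Q (inj₁ (pl b l , t))) ≡ sgn (tU t - κ m)
      sign t = trans (cong sgn (W-plain t)) (κcw ω-pl>0 (tU t - κ m))
      eq : ∀ n → n ℤ.* 1ℤ ℤ.+ n ℤ.* -1ℤ ≡ 0ℤ
      eq = solve-∀ ℤ-ring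

    -- For another label the new bold point and its mirror image lie on opposite sides and cancel.
    -- For the label `l` the bold point lies on the line, and its lowered mirror image leaves the -1
    -- that offsets the surplus in `cluster-sign`.
    H-near : H b ≡ ∑ (finᶠ a) (λ i → sgn (tB i + κ m)) ℤ.+ -1ℤ
    H-near = trans (cong (ℤ._+ K b) (∑-⊎ (finᶠ a) L (λ t → sgn (W-Q (inj₂ (b , t))))))
      (trans (ℤ.+-assoc (∑ (finᶠ a) (λ i → sgn (W-Q (inj₂ (b , inj₁ i))))) (∑ L mir) (K b))
        (cong₂ ℤ._+_
          (∑-cong (finᶠ a) λ i → trans (cong sgn (W-cluster i)) (κcw 0<ϖ (tB i + κ m)))
          (trans (sym (∑-+ L mir bold))
            (trans (∑-single L {l} others)
              (cong₂ ℤ._+_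
                (trans (cong sgn W-mirror) (trans (κcw 0<ϖ (- (ι 4 * A - ι 2 * κ m))) (sgn≤-1 { - (ι 4 * A - ι 2 * κ m)} 1≤4A-2κ)))
                (sgn-zero self))))))
      where
      mir bold : ∥ L ∥ → ℤ
      mir l′  = sgn (W-Q (inj₂ (b , inj₂ l′)))
      bold l′ = sgn (W-B (b , l′))
      others : ∀ l′ → l′ ≢ l → mir l′ ℤ.+ bold l′ ≡ 0ℤ
      others l′ l′≢ = trans (cong₂ ℤ._+_
          (trans (Sibling.sign (sibling-mirror l′≢))
            (trans (cong sgn (eq (s b l′ - s b l) (G b l′ * ϖ))) (sgn-negate ((s b l′ - s b l) * (G b l′ * ϖ)))))
          (Sibling.sign (sibling-bold l′≢)))
        (ℤ.+-inverseˡ (sgn ((s b l′ - s b l) * (G b l′ * ϖ))))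
        where
        eq : ∀ p q → p * (- q) ≡ - (p * q)
        eq = solve-∀ ℚ-ring

    -- Away from the two ends the signs are those of the parents, `N` times each, and the parents
    -- are balanced. The ends had sign 0 and contribute 0 in total by `F-near` and `H-near`.
    balanced′ : ∑ B′ (λ r → sgn (W-B r)) ℤ.+ ∑ Q′ (λ q → sgn (W-Q q)) ≡ 0ℤ
    balanced′ = begin
      ∑ B′ (λ r → sgn (W-B r)) ℤ.+ ∑ Q′ (λ q → sgn (W-Q q))
        ≡⟨ cong₂ ℤ._+_ (∑-× B L (λ r → sgn (W-B r)))
             (trans (∑-⊎ (Q ×ᶠ U) (B ×ᶠ (finᶠ a ⊎ᶠ L)) (λ q → sgn (W-Q q)))
               (cong₂ ℤ._+_ (∑-× Q U (λ q → sgn (W-Q (inj₁ q)))) (∑-× B (finᶠ a ⊎ᶠ L) (λ q → sgn (W-Q (inj₂ q)))))) ⟩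
      ∑ B K ℤ.+ (∑ Q F ℤ.+ ∑ B M)
        ≡⟨ eq₁ (∑ B K) (∑ Q F) (∑ B M) ⟩
      ∑ Q F ℤ.+ (∑ B M ℤ.+ ∑ B K)
        ≡⟨ cong (ℤ._+_ (∑ Q F)) (∑-+ B M K) ⟨
      ∑ Q F ℤ.+ ∑ B H
        ≡⟨ cong₂ ℤ._+_ ∑F ∑H ⟩
      (N ℤ.* ∑ Q (sgn ∘ vQ b l) ℤ.+ F (pl b l)) ℤ.+ (N ℤ.* ∑ B (sgn ∘ vB b l) ℤ.+ H b)
        ≡⟨ eq₂ N (∑ Q (sgn ∘ vQ b l)) (∑ B (sgn ∘ vB b l)) (F (pl b l)) (H b) ⟩
      N ℤ.* (∑ B (sgn ∘ vB b l) ℤ.+ ∑ Q (sgn ∘ vQ b l)) ℤ.+ (F (pl b l) ℤ.+ H b)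
        ≡⟨ cong₂ (λ x y → N ℤ.* x ℤ.+ y) (balanced b l) near ⟩
      N ℤ.* 0ℤ ℤ.+ 0ℤ
        ≡⟨ cong (ℤ._+ 0ℤ) (ℤ.*-zeroʳ N) ⟩
      0ℤ ∎
      where
      open ≡-Reasoning
      eq₁ : ∀ k f m → k ℤ.+ (f ℤ.+ m) ≡ f ℤ.+ (m ℤ.+ k)
      eq₁ = solve-∀ ℤ-ring
      eq₂ : ∀ n p q f h → (n ℤ.* p ℤ.+ f) ℤ.+ (n ℤ.* q ℤ.+ h) ≡ n ℤ.* (q ℤ.+ p) ℤ.+ (f ℤ.+ h)
      eq₂ = solve-∀ ℤ-ring
      cancel-zero : ∀ {x y z : ℤ} → y ≡ 0ℤ → x ℤ.+ N ℤ.* y ≡ z → x ≡ z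
      cancel-zero {x} refl e = trans (sym (trans (cong (ℤ._+_ x) (ℤ.*-zeroʳ N)) (ℤ.+-identityʳ x))) e
      ∑F : ∑ Q F ≡ N ℤ.* ∑ Q (sgn ∘ vQ b l) ℤ.+ F (pl b l)
      ∑F = cancel-zero (sgn-zero (vQ-pl b l))
        (trans (∑-change Q F-far) (cong (ℤ._+ F (pl b l)) (∑-* Q N (sgn ∘ vQ b l))))
      ∑H : ∑ B H ≡ N ℤ.* ∑ B (sgn ∘ vB b l) ℤ.+ H b
      ∑H = cancel-zero (sgn-zero (vB-self b l))
        (trans (∑-change B H-far) (cong (ℤ._+ H b) (∑-* B N (sgn ∘ vB b l))))
      near : F (pl b l) ℤ.+ H b ≡ 0ℤ
      near = trans (cong₂ ℤ._+_ F-near H-near)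
        (trans (eq₃ (∑ (finᶠ a) (λ j → sgn (tQ j - κ m))) (∑ (finᶠ a) (λ i → sgn (tB i + κ m))))
          (cong (ℤ._+ -1ℤ) (trans (sym (∑-+ (finᶠ a) (λ i → sgn (tB i + κ m)) (λ j → sgn (tQ j - κ m)))) (cluster-sign m))))
        where
        eq₃ : ∀ p q → p ℤ.+ (q ℤ.+ -1ℤ) ≡ (q ℤ.+ p) ℤ.+ -1ℤ
        eq₃ = solve-∀ ℤ-ring

  -- Tilts of the same kind differ by multiples of 2, and those of different kinds have different
  -- parity.
  κ-gap : ∀ {m m′} → m′ ≢ m → 1ℚ ≤ ∣ κ m′ - κ m ∣
  κ-gap {inj₁ i} {inj₁ j} ne = subst (λ z → 1ℚ ≤ ∣ z ∣) (eq A (ι (toℕ i)) (ι (toℕ j))) (even-gap {toℕ i} {toℕ j} λ e → ne (cong inj₁ (sym (Fin.toℕ-injective e))))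
    where
    eq : ∀ A i j → ι 2 * (i - j) ≡ (A - 1ℚ - ι 2 * j) - (A - 1ℚ - ι 2 * i)
    eq = solve-∀ ℚ-ring
  κ-gap {inj₂ i} {inj₂ j} ne = subst (λ z → 1ℚ ≤ ∣ z ∣) (eq A (ι (toℕ i)) (ι (toℕ j))) (even-gap {toℕ i} {toℕ j} λ e → ne (cong inj₂ (sym (Fin.toℕ-injective e))))
    where
    eq : ∀ A i j → ι 2 * (i - j) ≡ (A - ι 2 * j) - (A - ι 2 * i)
    eq = solve-∀ ℚ-ring
  κ-gap {inj₁ i} {inj₂ j} ne = subst (λ z → 1ℚ ≤ ∣ z ∣) (eq A (ι (toℕ i)) (ι (toℕ j))) (odd-gap (toℕ j) (toℕ i))
    where
    eq : ∀ A i j → 1ℚ - ι 2 * (j - i) ≡ (A - ι 2 * j) - (A - 1ℚ - ι 2 * i)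
    eq = solve-∀ ℚ-ring
  κ-gap {inj₂ i} {inj₁ j} ne = subst (1ℚ ≤_) (trans (sym (∣-p∣≡∣p∣ (1ℚ - ι 2 * (ι (toℕ i) - ι (toℕ j)))))
      (cong ∣_∣ (eq A (ι (toℕ i)) (ι (toℕ j))))) (odd-gap (toℕ i) (toℕ j))
    where
    eq : ∀ A i j → - (1ℚ - ι 2 * (i - j)) ≡ (A - 1ℚ - ι 2 * j) - (A - ι 2 * i)
    eq = solve-∀ ℚ-ring

  private
    ¼c≤c : ¼ * c ≤ c
    ¼c≤c = ≤-by (¼ * ι 3 * c) ((<⇒≤ 0<¼ ⊗ 0≤ι 3) ⊗ 0≤c) (eq c)
      where
      eq : ∀ c → c ≡ ¼ * c + ¼ * ι 3 * c
      eq = solve-∀ ℚ-ring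

  slopeL′ : ∀ r {m m′} → m′ ≢ m → ¼ * c ≤ ∣ s′ r m′ - s′ r m ∣
  slopeL′ (b , l) {m} {m′} ne = ≤-trans ¼c≤c (subst (λ z → c ≤ ∣ z ∣) (eq (s b l) c (g b l) (κ m′) (κ m))
    (≤-trans (≤-reflexive (sym (trans (*-identityʳ (c * 1ℚ)) (*-identityʳ c))))
      (≤-trans (*-mono (0≤c ⊗ <⇒≤ 0<1) (0≤∣p∣ (κ m′ - κ m)) (*-mono-l 0≤c (1≤∣g∣ b l)) (κ-gap ne))
      (≤-reflexive (sym (trans (∣p*q∣≡∣p∣*∣q∣ (c * g b l) (κ m′ - κ m))
        (cong (_* ∣ κ m′ - κ m ∣) (trans (∣p*q∣≡∣p∣*∣q∣ c (g b l)) (cong (_* ∣ g b l ∣) (∣pos∣ 0≤c))))))))))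
    where
    eq : ∀ s c g p q → c * g * (p - q) ≡ (s + c * g * p) - (s + c * g * q)
    eq = solve-∀ ℚ-ring

  pl-injective′ : ∀ {r m m′} → pl′ r m ≡ pl′ r m′ → m ≡ m′
  pl-injective′ {_} {inj₁ i} {inj₁ j} refl = refl
  pl-injective′ {_} {inj₂ i} {inj₂ j} refl = refl

  xB-bound′ : ∀ r → ∣ xB′ r ∣ + (ϖ′ + ϖ′) ≤ ι 2
  xB-bound′ (b , l) = ≤-trans (+-mono-≤ (∣+∣≤ {xB b} ≤-refl (∣Gϖ∣≤ b l)) 2ϖ′≤ϖ)
    (≤-trans (≤-reflexive (+-assoc (∣ xB b ∣) ϖ ϖ)) (xB-bound b))
    where
    eq : ∀ p → ι 16 * p ≡ p + p + ι 14 * p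
    eq = solve-∀ ℚ-ring
    2ϖ′≤ϖ : ϖ′ + ϖ′ ≤ ϖ
    2ϖ′≤ϖ = ≤-trans (≤-by (ι 14 * ϖ′) (0≤ι 14 ⊗ <⇒≤ 0<ϖ′) (eq ϖ′)) 16ϖ′≤ϖ

  xQ-bound′ : ∀ q → ∣ xQ′ q ∣ ≤ ι 2
  xQ-bound′ (inj₁ (q , _))      = xQ-bound q
  xQ-bound′ (inj₂ (b , inj₁ _)) = ≤-trans (p≤p+q (0≤ϖ ⊕ 0≤ϖ)) (xB-bound b)
  xQ-bound′ (inj₂ (b , inj₂ l)) = ≤-trans (∣+∣≤ {xB b} ≤-refl (∣-∣≤ {G b l * ϖ} (∣Gϖ∣≤ b l)))
    (≤-trans (+-monoʳ-≤ (∣ xB b ∣) (p≤p+q 0≤ϖ)) (xB-bound b))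

  s-bound′ : ∀ r m → ∣ s′ r m ∣ + ¼ * c ≤ 1ℚ
  s-bound′ (b , l) m = ≤-trans (+-mono-≤ (∣+∣≤ {s b l} ≤-refl (NewEdge.∣cgκ∣≤uΓ b l m b l m)) (≤-trans ¼c≤c c≤uΓ))
    (≤-trans (≤-reflexive (+-assoc (∣ s b l ∣) (u * Γ) (u * Γ)))
      (≤-trans (+-monoʳ-≤ (∣ s b l ∣) 2uΓ≤ν) (s-bound b l)))
    where
    0≤uΓ : 0ℚ ≤ u * Γ
    0≤uΓ = ≤-trans 0≤c c≤uΓ
    eq : ∀ p → ι 32 * p ≡ p + p + ι 30 * p
    eq = solve-∀ ℚ-ring
    2uΓ≤ν : u * Γ + u * Γ ≤ ν
    2uΓ≤ν = ≤-trans (≤-by (ι 30 * (u * Γ)) (0≤ι 30 ⊗ 0≤uΓ) (eq (u * Γ))) 32uΓ≤ν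

  next : Stage
  next = record
    { B = B′ ; Q = Q′ ; L = L′
    ; ν = ¼ * c ; ϖ = ϖ′ ; Γ = Γ * ι 2 ; D = D * ½
    ; 0<ν = 0<* 0<¼ 0<c
    ; 0<ϖ = 0<ϖ′
    ; 0<D = 0<* 0<D (positive⁻¹ ½)
    ; D≤1 = ≤-trans (≤-by (D * ½) (<⇒≤ 0<D ⊗ 0≤½) (eq₁ D)) D≤1
    ; DΓ≡1 = trans (eq₂ D Γ) DΓ≡1
    ; ω = ω′
    ; ϖ≤ω = ϖ′≤ω′
    ; xB = xB′ ; yB = yB′ ; xQ = xQ′ ; yQ = yQ′
    ; pl = pl′
    ; s = s′ ; G = G′ ; g = g′
    ; Gg≡1 = Gg′≡1
    ; ∣G∣≤1 = ∣G′∣≤1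
    ; ∣g∣≤Γ = ∣g′∣≤2Γ
    ; x-pl = x-pl′
    ; y-pl = y-pl′
    ; farQ = λ { {b , l} {m} {q} → NewEdge.far-Q′ b l m q }
    ; farB = λ { {b , l} m {r} → NewEdge.far-B′ b l m r }
    ; slopeB = λ { {b , l} {r} ne m m′ → NewEdge.slope-B′ b l m r ne m′ }
    ; slopeL = slopeL′
    ; pl-injective = λ {r} {m} {m′} → pl-injective′ {r} {m} {m′}
    ; balanced = λ { (b , l) m → NewEdge.balanced′ b l m }
    ; xB-bound = xB-bound′
    ; xQ-bound = xQ-bound′
    ; s-bound = s-bound′
    }
    where
    eq₁ : ∀ D → D ≡ D * ½ + D * ½
    eq₁ = solve-∀ ℚ-ring
    eq₂ : ∀ D Γ → D * ½ * (Γ * ι 2) ≡ D * Γ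
    eq₂ = solve-∀ ℚ-ring

-- Iteration and the numbers of points and edges

base : Stage
base = record
  { B = unitᶠ ; Q = unitᶠ ; L = unitᶠ
  ; ν = 1ℚ ; ϖ = 1ℚ ; Γ = 1ℚ ; D = 1ℚ
  ; 0<ν = 0<1 ; 0<ϖ = 0<1 ; 0<D = 0<1 ; D≤1 = ≤-refl ; DΓ≡1 = refl
  ; ω = λ _ → 1ℚ ; ϖ≤ω = λ _ → ≤-refl
  ; xB = λ _ → 0ℚ ; yB = λ _ → 0ℚ ; xQ = λ _ → ι 2 ; yQ = λ _ → 0ℚ
  ; pl = λ _ _ → tt
  ; s = λ _ _ → 0ℚ ; G = λ _ _ → 1ℚ ; g = λ _ _ → 1ℚ
  ; Gg≡1 = λ _ _ → refl ; ∣G∣≤1 = λ _ _ → ≤-refl ; ∣g∣≤Γ = λ _ _ → ≤-refl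
  ; x-pl = λ _ _ → refl ; y-pl = λ _ _ → refl
  ; farQ = λ ne → contradiction refl ne
  ; farB = λ _ ne → contradiction refl ne
  ; slopeB = λ ne _ _ → contradiction refl ne
  ; slopeL = λ _ ne → contradiction refl ne
  ; pl-injective = λ _ → refl
  ; balanced = λ _ _ → refl
  ; xB-bound = λ _ → ≤-refl
  ; xQ-bound = λ _ → ≤-refl
  ; s-bound = λ _ _ → ≤-refl
  }

-- Eight times the number d of edges at a bold point. A stage multiplies the ratio of edges to
-- points by 2a/(a + 2d), which exceeds 1 as soon as a > 2d; taking a as d times a power of two
-- makes the degrees powers of 16.
multiplicity : ℕ → ℕ
multiplicity m = 8 ℕ.* 16 ℕ.^ m

multiplicity-suc : ∀ m → suc (ℕ.pred (multiplicity m)) ≡ multiplicity m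
multiplicity-suc m = ℕ.suc-pred (multiplicity m) {{ℕ.m*n≢0 8 (16 ℕ.^ m) {{_}} {{ℕ.m^n≢0 16 m}}}}

stage : ℕ → Stage
stage zero    = base
stage (suc m) = NextStage.next (stage m) (ℕ.pred (multiplicity m))

module _ (m : ℕ) where
  open Stage (stage m)

  ∣L∣ ∣E∣ ∣P∣ : ℕ
  ∣L∣ = size L
  ∣E∣ = size (B ×ᶠ L)
  ∣P∣ = size (B ⊎ᶠ Q)

∣L∣≡ : ∀ m → ∣L∣ m ≡ 16 ℕ.^ m
∣L∣≡ zero    = refl
∣L∣≡ (suc m) = trans (size-⊎ (finᶠ a) (finᶠ a)) (trans (cong₂ ℕ._+_ (size-fin a) (size-fin a))
  (trans (cong₂ ℕ._+_ (multiplicity-suc m) (multiplicity-suc m)) (eq (16 ℕ.^ m))))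
  where
  a = suc (ℕ.pred (multiplicity m))
  eq : ∀ x → 8 ℕ.* x ℕ.+ 8 ℕ.* x ≡ 16 ℕ.* x
  eq x = sym (ℕ.*-distribʳ-+ x 8 8)

∣E∣-suc : ∀ m → ∣E∣ (suc m) ≡ ∣E∣ m ℕ.* 16 ℕ.^ suc m
∣E∣-suc m = trans (size-× (Stage.B (stage m) ×ᶠ Stage.L (stage m)) (Stage.L (stage (suc m)))) (cong (∣E∣ m ℕ.*_) (∣L∣≡ (suc m)))

∣P∣-suc : ∀ m → ∣P∣ (suc m) ≡ ∣P∣ m ℕ.* (10 ℕ.* 16 ℕ.^ m)
∣P∣-suc m = begin
  size ((B ×ᶠ L) ⊎ᶠ ((Q ×ᶠ U) ⊎ᶠ (B ×ᶠ (finᶠ a ⊎ᶠ L))))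
    ≡⟨ trans (size-⊎ (B ×ᶠ L) ((Q ×ᶠ U) ⊎ᶠ (B ×ᶠ (finᶠ a ⊎ᶠ L)))) (cong₂ ℕ._+_ (size-× B L)
         (trans (size-⊎ (Q ×ᶠ U) (B ×ᶠ (finᶠ a ⊎ᶠ L))) (cong₂ ℕ._+_
           (trans (size-× Q U) (cong (size Q ℕ.*_) (trans (size-⊎ (finᶠ a) (L ⊎ᶠ L)) (cong₂ ℕ._+_ ∣a∣ (size-⊎ L L)))))
           (trans (size-× B (finᶠ a ⊎ᶠ L)) (cong (size B ℕ.*_) (trans (size-⊎ (finᶠ a) L) (cong (ℕ._+ size L) ∣a∣))))))) ⟩
  size B ℕ.* size L ℕ.+ (size Q ℕ.* (multiplicity m ℕ.+ (size L ℕ.+ size L)) ℕ.+ size B ℕ.* (multiplicity m ℕ.+ size L))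
    ≡⟨ cong (λ l → size B ℕ.* l ℕ.+ (size Q ℕ.* (multiplicity m ℕ.+ (l ℕ.+ l)) ℕ.+ size B ℕ.* (multiplicity m ℕ.+ l))) (∣L∣≡ m) ⟩
  size B ℕ.* 16 ℕ.^ m ℕ.+ (size Q ℕ.* (8 ℕ.* 16 ℕ.^ m ℕ.+ (16 ℕ.^ m ℕ.+ 16 ℕ.^ m)) ℕ.+ size B ℕ.* (8 ℕ.* 16 ℕ.^ m ℕ.+ 16 ℕ.^ m))
    ≡⟨ eq (size B) (size Q) (16 ℕ.^ m) ⟩
  (size B ℕ.+ size Q) ℕ.* (10 ℕ.* 16 ℕ.^ m)
    ≡⟨ cong (ℕ._* (10 ℕ.* 16 ℕ.^ m)) (size-⊎ B Q) ⟨
  ∣P∣ m ℕ.* (10 ℕ.* 16 ℕ.^ m) ∎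
  where
  open ≡-Reasoning
  open Stage (stage m) using (B; Q; L)
  open Step (stage m) (ℕ.pred (multiplicity m)) using (a; U)
  ∣a∣ : size (finᶠ a) ≡ multiplicity m
  ∣a∣ = trans (size-fin a) (multiplicity-suc m)
  eq : ∀ b q x → b ℕ.* x ℕ.+ (q ℕ.* (8 ℕ.* x ℕ.+ (x ℕ.+ x)) ℕ.+ b ℕ.* (8 ℕ.* x ℕ.+ x)) ≡ (b ℕ.+ q) ℕ.* (10 ℕ.* x)
  eq = ℕ-solve

∣E∣∣P∣ : ∀ m → ∣E∣ m ℕ.* 2 ℕ.* 5 ℕ.^ m ≡ ∣P∣ m ℕ.* 8 ℕ.^ m
∣E∣∣P∣ zero    = refl
∣E∣∣P∣ (suc m) = begin
  ∣E∣ (suc m) ℕ.* 2 ℕ.* 5 ℕ.^ suc m            ≡⟨ cong (λ e → e ℕ.* 2 ℕ.* 5 ℕ.^ suc m) (∣E∣-suc m) ⟩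
  ∣E∣ m ℕ.* 16 ℕ.^ suc m ℕ.* 2 ℕ.* 5 ℕ.^ suc m ≡⟨ eq (∣E∣ m) (16 ℕ.^ m) (5 ℕ.^ m) ⟩
  ∣E∣ m ℕ.* 2 ℕ.* 5 ℕ.^ m ℕ.* (80 ℕ.* 16 ℕ.^ m) ≡⟨ cong (ℕ._* (80 ℕ.* 16 ℕ.^ m)) (∣E∣∣P∣ m) ⟩
  ∣P∣ m ℕ.* 8 ℕ.^ m ℕ.* (80 ℕ.* 16 ℕ.^ m)      ≡⟨ eq′ (∣P∣ m) (16 ℕ.^ m) (8 ℕ.^ m) ⟩
  ∣P∣ m ℕ.* (10 ℕ.* 16 ℕ.^ m) ℕ.* 8 ℕ.^ suc m  ≡⟨ cong (ℕ._* 8 ℕ.^ suc m) (∣P∣-suc m) ⟨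
  ∣P∣ (suc m) ℕ.* 8 ℕ.^ suc m                  ∎
  where
  open ≡-Reasoning
  eq : ∀ e x f → e ℕ.* (16 ℕ.* x) ℕ.* 2 ℕ.* (5 ℕ.* f) ≡ e ℕ.* 2 ℕ.* f ℕ.* (80 ℕ.* x)
  eq = ℕ-solve
  eq′ : ∀ p x f → p ℕ.* f ℕ.* (80 ℕ.* x) ≡ p ℕ.* (10 ℕ.* x) ℕ.* (8 ℕ.* f)
  eq′ = ℕ-solve

-- Evenness is used twice in the choice of parameters: half of this number enters the number of
-- copies, and the surplus of fillers on one side must not spoil the parity of n.
∣P∣-even : ∀ m → ∃[ k ] ∣P∣ m ≡ 2 ℕ.* k
∣P∣-even zero    = 1 , refl
∣P∣-even (suc m) = let (k , e) = ∣P∣-even m in k ℕ.* (10 ℕ.* 16 ℕ.^ m) ,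
  trans (∣P∣-suc m) (trans (cong (ℕ._* (10 ℕ.* 16 ℕ.^ m)) e) (ℕ.*-assoc 2 k (10 ℕ.* 16 ℕ.^ m)))

-- The resolution needed to round the abscissae.

margin : Stage → ℚ
margin S = ν * ϖ * ϖ * D
  where open Stage S

ι-^-suc : ∀ n k → ι (n ℕ.^ suc k) ≡ ι n * ι (n ℕ.^ k)
ι-^-suc n k = ι-* n (n ℕ.^ k)

D-stage : ∀ m → Stage.D (stage m) * ι (2 ℕ.^ m) ≡ 1ℚ
D-stage zero    = refl
D-stage (suc m) = trans (cong (Stage.D (stage (suc m)) *_) (ι-^-suc 2 m))
  (trans (eq (Stage.D (stage m)) (ι (2 ℕ.^ m))) (D-stage m))
  where
  eq : ∀ d e → d * ½ * (ι 2 * e) ≡ d * e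
  eq = solve-∀ ℚ-ring

-- A stage costs the margin a factor `D` twice through `c` and twice through the square of `ϖ′`, a
-- factor `a`, and the constant 4 · 16 · 16 · 2 · 32, which is 2 to the power 16. As `D` is 2 to the
-- power -m, the loss is 2^O(m).
margin-suc : ∀ m → let t = 2 ℕ.^ m in
             margin (stage (suc m)) * ι (t ℕ.* t ℕ.* (t ℕ.* t) ℕ.* multiplicity m ℕ.* 2 ℕ.^ 16) ≡ margin (stage m)
margin-suc m = begin
  margin (stage (suc m)) * ι (t ℕ.* t ℕ.* (t ℕ.* t) ℕ.* multiplicity m ℕ.* 2 ℕ.^ 16)
    ≡⟨ cong (margin (stage (suc m)) *_) (trans (ι-* (t ℕ.* t ℕ.* (t ℕ.* t) ℕ.* multiplicity m) (2 ℕ.^ 16))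
         (cong (_* ι (2 ℕ.^ 16)) (trans (ι-* (t ℕ.* t ℕ.* (t ℕ.* t)) (multiplicity m))
           (cong₂ _*_ (trans (ι-* (t ℕ.* t) (t ℕ.* t)) (cong₂ _*_ (ι-* t t) (ι-* t t)))
             (cong ι (sym (multiplicity-suc m))))))) ⟩
  ¼ * (ν * D * D * (inv 31 * inv a-1)) * (¼ * ¼ * (ϖ * D)) * (¼ * ¼ * (ϖ * D)) * (D * ½) *
    (ι t * ι t * (ι t * ι t) * ι (suc a-1) * ι (2 ℕ.^ 16))
    ≡⟨ eq ν ϖ D (inv 31) (inv a-1) (ι t) (ι (suc a-1)) ¼ ½ (ι (2 ℕ.^ 16)) ⟩
  ν * ϖ * ϖ * D * ((D * ι t) * (D * ι t) * ((D * ι t) * (D * ι t))) * (ι (suc a-1) * inv a-1) * constant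
    ≡⟨ cong₂ (λ x y → ν * ϖ * ϖ * D * (x * x * (x * x)) * y * constant) (D-stage m) (ι*inv a-1) ⟩
  ν * ϖ * ϖ * D * (1ℚ * 1ℚ * (1ℚ * 1ℚ)) * 1ℚ * constant
    ≡⟨ cong (ν * ϖ * ϖ * D * (1ℚ * 1ℚ * (1ℚ * 1ℚ)) * 1ℚ *_) constant≡1 ⟩
  ν * ϖ * ϖ * D * (1ℚ * 1ℚ * (1ℚ * 1ℚ)) * 1ℚ * 1ℚ
    ≡⟨ eq′ (ν * ϖ * ϖ * D) ⟩
  ν * ϖ * ϖ * D ∎
  where
  open ≡-Reasoning
  open Stage (stage m) using (ν; ϖ; D)
  t = 2 ℕ.^ m
  a-1 = ℕ.pred (multiplicity m)
  constant = ¼ * (¼ * ¼) * (¼ * ¼) * ½ * ι (2 ℕ.^ 16) * inv 31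
  constant≡1 : constant ≡ 1ℚ
  constant≡1 = refl
  eq : ∀ ν ϖ D i j t A q h K → q * (ν * D * D * (i * j)) * (q * q * (ϖ * D)) * (q * q * (ϖ * D)) * (D * h) *
    (t * t * (t * t) * A * K) ≡
    ν * ϖ * ϖ * D * ((D * t) * (D * t) * ((D * t) * (D * t))) * (A * j) * (q * (q * q) * (q * q) * h * K * i)
  eq = solve-∀ ℚ-ring
  eq′ : ∀ x → x * (1ℚ * 1ℚ * (1ℚ * 1ℚ)) * 1ℚ * 1ℚ ≡ x
  eq′ = solve-∀ ℚ-ring

-- Orientations, and rounding a stage to a pattern

orient : ℚ × ℚ → ℚ × ℚ → ℚ × ℚ → ℚ
orient (x₁ , y₁) (x₂ , y₂) (x₃ , y₃) = (x₂ - x₁) * (y₃ - y₁) - (y₂ - y₁) * (x₃ - x₁)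

orient-left : ∀ p q → orient p q p ≡ 0ℚ
orient-left (x₁ , y₁) (x₂ , y₂) = eq x₁ y₁ x₂ y₂
  where
  eq : ∀ x₁ y₁ x₂ y₂ → (x₂ - x₁) * (y₁ - y₁) - (y₂ - y₁) * (x₁ - x₁) ≡ 0ℚ
  eq = solve-∀ ℚ-ring

orient-right : ∀ p q → orient p q q ≡ 0ℚ
orient-right (x₁ , y₁) (x₂ , y₂) = eq x₁ y₁ x₂ y₂
  where
  eq : ∀ x₁ y₁ x₂ y₂ → (x₂ - x₁) * (y₂ - y₁) - (y₂ - y₁) * (x₂ - x₁) ≡ 0ℚ
  eq = solve-∀ ℚ-ring

-- Halving in a form that survives perturbation: it depends only on the signs of nonzero
-- orientations.
record HalvingPair (F : Finite) (pos : ∥ F ∥ → ℚ × ℚ) (i j : ∥ F ∥) : Set where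
  field
    off      : ∀ k → k ≢ i → k ≢ j → orient (pos i) (pos j) (pos k) ≢ 0ℚ
    balanced : ∑ F (λ k → sgn (orient (pos i) (pos j) (pos k))) ≡ 0ℤ

bracket : ∀ M {q} → 0ℚ ≤ q → q ≤ ι M → ∃[ k ] k ℕ.≤ M × ι k ≤ q × q ≤ 1ℚ + ι k
bracket zero        h h′ = 0 , ℕ.z≤n , h , ≤-trans h′ (<⇒≤ 0<1)
bracket (suc M) {q} h h′ = go (≤-total (ι M) q)
  where
  go : ι M ≤ q ⊎ q ≤ ι M → ∃[ k ] k ℕ.≤ suc M × ι k ≤ q × q ≤ 1ℚ + ι k
  go (inj₁ M≤q) = M , ℕ.n≤1+n M , M≤q , ≤-trans h′ (≤-reflexive (ι-suc M))
  go (inj₂ q≤M) = let (k , k≤M , p) = bracket M h q≤M in k , ℕ.m≤n⇒m≤1+n k≤M , p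

module Index (F : Finite) where

  index : ∥ F ∥ → ℕ
  index x = toℕ (Any.index (complete F x))

  index<size : ∀ x → index x ℕ.< size F
  index<size x = Fin.toℕ<n (Any.index (complete F x))

  index-injective : ∀ {x y} → index x ≡ index y → x ≡ y
  index-injective {x} {y} e = trans (Any.lookup-index (complete F x))
    (trans (cong (lookup (elems F)) (Fin.toℕ-injective e)) (sym (Any.lookup-index (complete F y))))

-- The abscissae X are pairwise distinct modulo the number of points.
record Pattern : Set₁ where
  field
    P E : Finite
    W   : ℕ
    quot idx : ∥ P ∥ → ℕ
    quot<W : ∀ p → quot p ℕ.< W
    idx<N  : ∀ p → idx p ℕ.< size P
    idx-injective : ∀ {p q} → idx p ≡ idx q → p ≡ q
    height : ∥ P ∥ → ℚ
    end₁ end₂ : ∥ E ∥ → ∥ P ∥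
    end₁≢end₂ : ∀ e → end₁ e ≢ end₂ e

  X : ∥ P ∥ → ℕ
  X p = size P ℕ.* quot p ℕ.+ idx p

  pos : ∥ P ∥ → ℚ × ℚ
  pos p = ι (X p) , height p

  field
    halving  : ∀ e → HalvingPair P pos (end₁ e) (end₂ e)
    -- An end of `e′` that is no end of `e`: together with general position this will keep the two
    -- lines apart.
    distinct : ∀ {e e′} → e ≢ e′ → Σ[ p ∈ ∥ P ∥ ] ((p ≡ end₁ e′ ⊎ p ≡ end₂ e′) × p ≢ end₁ e × p ≢ end₂ e)

module Round (S : Stage) (K : ℕ) (hK : ι 64 ≤ ι K * margin S) where

  open Stage S

  private
    0≤ν = <⇒≤ 0<ν
    0≤ϖ = <⇒≤ 0<ϖ
    0≤D = <⇒≤ 0<D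

  P E : Finite
  P = B ⊎ᶠ Q
  E = B ×ᶠ L

  N : ℕ
  N = size P

  px py : ∥ P ∥ → ℚ
  px = [ xB , xQ ]′
  py = [ yB , yQ ]′

  ∣x∣≤2 : ∀ p → ∣ px p ∣ ≤ ι 2
  ∣x∣≤2 (inj₁ b) = ≤-trans (p≤p+q (0≤ϖ ⊕ 0≤ϖ)) (xB-bound b)
  ∣x∣≤2 (inj₂ q) = xQ-bound q

  scaled : ∥ P ∥ → ℚ
  scaled p = ι K * (px p + ι 2)

  0≤scaled : ∀ p → 0ℚ ≤ scaled p
  0≤scaled p = 0≤ι K ⊗ subst (0ℚ ≤_) (eq (px p)) (0≤- (∣∣≤⇒-≤ {px p} (∣x∣≤2 p)))
    where
    eq : ∀ x → x - (- (ι 2)) ≡ x + ι 2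
    eq = solve-∀ ℚ-ring

  scaled≤ : ∀ p → scaled p ≤ ι (K ℕ.* 4)
  scaled≤ p = ≤-trans (*-mono-l (0≤ι K) (+-monoˡ-≤ (ι 2) (∣∣≤⇒≤ {px p} (∣x∣≤2 p)))) (≤-reflexive (sym (ι-* K 4)))

  quot : ∥ P ∥ → ℕ
  quot p = proj₁ (bracket (K ℕ.* 4) (0≤scaled p) (scaled≤ p))

  quot-spec : ∀ p → quot p ℕ.≤ K ℕ.* 4 × ι (quot p) ≤ scaled p × scaled p ≤ 1ℚ + ι (quot p)
  quot-spec p = proj₂ (bracket (K ℕ.* 4) (0≤scaled p) (scaled≤ p))

  open Index P

  X : ∥ P ∥ → ℕ
  X p = N ℕ.* quot p ℕ.+ index p

  ∣X-scaled∣≤N : ∀ p → ∣ ι (X p) - ι N * scaled p ∣ ≤ ι N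
  ∣X-scaled∣≤N p = subst (λ z → ∣ z - ι N * scaled p ∣ ≤ ι N) (sym eX) (∣∣≤
    (≤-by (ι N * (scaled p - f) + (ι N - i)) (0≤ι N ⊗ 0≤- (proj₁ (proj₂ (quot-spec p))) ⊕ 0≤- (ι-mono (ℕ.<⇒≤ (index<size p))))
      (eq₁ (ι N) f i (scaled p)))
    (≤-by (ι N * (1ℚ + f - scaled p) + i) (0≤ι N ⊗ 0≤- (proj₂ (proj₂ (quot-spec p))) ⊕ 0≤ι (index p))
      (eq₂ (ι N) f i (scaled p))))
    where
    f = ι (quot p)
    i = ι (index p)
    eX : ι (X p) ≡ ι N * f + i
    eX = trans (ι-+ (N ℕ.* quot p) (index p)) (cong (_+ i) (ι-* N (quot p)))
    eq₁ : ∀ N f i s → N ≡ (N * f + i - N * s) + (N * (s - f) + (N - i))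
    eq₁ = solve-∀ ℚ-ring
    eq₂ : ∀ N f i s → N ≡ (- (N * f + i - N * s)) + (N * (1ℚ + f - s) + i)
    eq₂ = solve-∀ ℚ-ring

  M : ℚ
  M = ι N * ι K

  -- Truncation and the added index together displace each abscissa by at most one step `N`.
  error : ∀ p q → ∣ (ι (X p) - ι (X q)) - M * (px p - px q) ∣ ≤ ι N + ι N
  error p q = subst (λ z → ∣ z ∣ ≤ ι N + ι N) (eq (ι (X p)) (ι (X q)) (ι N) (ι K) (px p) (px q))
    (∣+∣≤ (∣X-scaled∣≤N p) (∣-∣≤ {ι (X q) - ι N * scaled q} (∣X-scaled∣≤N q)))
    where
    eq : ∀ X Y N K x y → (X - N * (K * (x + ι 2))) + (- (Y - N * (K * (y + ι 2)))) ≡ (X - Y) - N * K * (x - y)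
    eq = solve-∀ ℚ-ring

  v : ∥ B ∥ → ∥ L ∥ → ∥ P ∥ → ℚ
  v b l p = (py p - yB b) - s b l * (px p - xB b)

  height≥ : ∀ {b l} p → p ≢ inj₁ b → p ≢ inj₂ (pl b l) → ν * ϖ ≤ ∣ v b l p ∣
  height≥ {b} {l} (inj₁ b′) ne _ = ≤-trans (*-mono-l 0≤ν (p≤p+q (0≤∣p∣ (xB b′ - xB b)))) (farB l λ e → ne (cong inj₁ e))
  height≥ {b} {l} (inj₂ q) _ ne = ≤-trans (*-mono-l 0≤ν (≤-trans (ϖ≤ω q) (p≤p+q (0≤∣p∣ (xQ q - xB b))))) (farQ λ e → ne (cong inj₂ e))

  0<N : ∥ P ∥ → 0ℚ < ι N
  0<N p = ι-mono-< (ℕ.≤-<-trans ℕ.z≤n (index<size p))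

  -- After division by `n` the rounding errors amount to at most 2|v| + 16, against a main term that
  -- is at least 64 times |v| and at least 64.
  sign-bound : ∀ {n k X s d v e₁ e₂} → 0ℚ < n → ∣ s ∣ ≤ 1ℚ → ∣ d ∣ ≤ ι 4 → ∣ X ∣ ≤ ι 4 →
               ∣ e₁ ∣ ≤ n + n → ∣ e₂ ∣ ≤ n + n → ι 64 * ∣ v ∣ ≤ k * ∣ X ∣ * ∣ v ∣ → ι 64 ≤ k * ∣ X ∣ * ∣ v ∣ → 0ℚ ≤ k →
               ∣ ((n * k * X + e₁) * (v + s * d) - s * X * (n * k * d + e₂)) - n * k * X * v ∣ < ∣ n * k * X * v ∣
  sign-bound {n} {k} {X} {s} {d} {v} {e₁} {e₂} 0<n hs hd hX h₁ h₂ hv hk 0≤k = ≤-<-trans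
    (subst (λ z → ∣ z ∣ ≤ (n + n) * (∣ v ∣ + 1ℚ * ι 4) + 1ℚ * ι 4 * (n + n)) (eq n k X s d v e₁ e₂)
      (∣+∣≤ {e₁ * (v + s * d)} (∣*∣≤ h₁ (∣+∣≤ {v} ≤-refl (∣*∣≤ hs hd))) (∣-∣≤ {s * X * e₂} (∣*∣≤ (∣*∣≤ hs hX) h₂))))
    (<-by (n * (½ * (R - ι 64 * ∣ v ∣) + ½ * (R - ι 64) + ι 30 * ∣ v ∣ + ι 16))
      (0<* 0<n (<-≤-trans (0<ι-suc 15) (p≤q+p (0≤½ ⊗ 0≤- hv ⊕ 0≤½ ⊗ 0≤- hk ⊕ 0≤ι 30 ⊗ 0≤∣p∣ v))))
      (trans e (eq′ n R (∣ v ∣))))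
    where
    R = k * ∣ X ∣ * ∣ v ∣
    eq : ∀ n k X s d v e₁ e₂ → e₁ * (v + s * d) + (- (s * X * e₂)) ≡
      ((n * k * X + e₁) * (v + s * d) - s * X * (n * k * d + e₂)) - n * k * X * v
    eq = solve-∀ ℚ-ring
    eq′ : ∀ n R v → n * R ≡ ((n + n) * (v + 1ℚ * ι 4) + 1ℚ * ι 4 * (n + n)) +
      n * (½ * (R - ι 64 * v) + ½ * (R - ι 64) + ι 30 * v + ι 16)
    eq′ = solve-∀ ℚ-ring
    assoc : ∀ n k X v → n * k * X * v ≡ n * (k * X * v)
    assoc = solve-∀ ℚ-ring
    e : ∣ n * k * X * v ∣ ≡ n * R
    e = trans (∣p*q∣≡∣p∣*∣q∣ (n * k * X) v) (trans (cong (_* ∣ v ∣) (∣p*q∣≡∣p∣*∣q∣ (n * k) X))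
      (trans (cong (λ z → z * ∣ X ∣ * ∣ v ∣) (∣pos∣ (<⇒≤ 0<n ⊗ 0≤k))) (assoc n k (∣ X ∣) (∣ v ∣))))

  module _ (b : ∥ B ∥) (l : ∥ L ∥) where

    private
      q : ∥ P ∥
      q = inj₂ (pl b l)
      Δ : ℚ
      Δ = px q - xB b

    ν≤1 : ν ≤ 1ℚ
    ν≤1 = ≤-trans (p≤q+p (0≤∣p∣ (s b l))) (s-bound b l)

    ϖ≤1 : ϖ ≤ 1ℚ
    ϖ≤1 = ≤-by (½ * (ι 2 - (ϖ + ϖ))) (0≤½ ⊗ 0≤- (≤-trans (p≤q+p (0≤∣p∣ (xB b))) (xB-bound b))) (eq ϖ)
      where
      eq : ∀ ϖ → 1ℚ ≡ ϖ + ½ * (ι 2 - (ϖ + ϖ))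
      eq = solve-∀ ℚ-ring

    νϖ≤1 : ν * ϖ ≤ 1ℚ
    νϖ≤1 = ≤-trans (*-mono 0≤ν (<⇒≤ 0<1) ν≤1 ϖ≤1) (≤-reflexive (*-identityˡ 1ℚ))

    Δ≡ : Δ ≡ G b l * (ϖ + ω (pl b l))
    Δ≡ = trans (cong (_- xB b) (x-pl b l)) (eq (xB b) (G b l * (ϖ + ω (pl b l))))
      where
      eq : ∀ x d → x + d - x ≡ d
      eq = solve-∀ ℚ-ring

    Dϖ≤∣Δ∣ : D * ϖ ≤ ∣ Δ ∣
    Dϖ≤∣Δ∣ = ≤-trans (*-mono 0≤D (0≤ϖ ⊕ 0≤ω) (D≤∣G∣ b l) (p≤p+q 0≤ω))
      (≤-reflexive (sym (trans (cong ∣_∣ Δ≡) (trans (∣p*q∣≡∣p∣*∣q∣ (G b l) (ϖ + ω (pl b l)))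
        (cong (∣ G b l ∣ *_) (∣pos∣ (0≤ϖ ⊕ 0≤ω)))))))
      where
      0≤ω : 0ℚ ≤ ω (pl b l)
      0≤ω = ≤-trans 0≤ϖ (ϖ≤ω (pl b l))

    -- The margin is the product of the least horizontal length `D * ϖ` of an edge and the least
    -- height `ν * ϖ` of a point off its line.
    64≤KDϖνϖ : ι 64 ≤ ι K * (D * ϖ) * (ν * ϖ)
    64≤KDϖνϖ = ≤-trans hK (≤-reflexive (eq (ι K) ν ϖ D))
      where
      eq : ∀ K ν ϖ D → K * (ν * ϖ * ϖ * D) ≡ K * (D * ϖ) * (ν * ϖ)
      eq = solve-∀ ℚ-ring

    64≤KΔ : ι 64 ≤ ι K * ∣ Δ ∣
    64≤KΔ = ≤-trans 64≤KDϖνϖ (≤-trans (*-mono-l (0≤ι K ⊗ (0≤D ⊗ 0≤ϖ)) νϖ≤1)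
      (≤-trans (≤-reflexive (*-identityʳ (ι K * (D * ϖ)))) (*-mono-l (0≤ι K) Dϖ≤∣Δ∣)))

    ∣diff∣≤4 : ∀ p r → ∣ px p - px r ∣ ≤ ι 4
    ∣diff∣≤4 p r = ∣+∣≤ (∣x∣≤2 p) (∣-∣≤ {px r} (∣x∣≤2 r))

    orient-near : ∀ p → p ≢ inj₁ b → p ≢ q →
                  let o = orient (ι (X (inj₁ b)) , yB b) (ι (X q) , py q) (ι (X p) , py p)
                      m = M * Δ * v b l p in ∣ o - m ∣ < ∣ m ∣
    orient-near p p≢b p≢q = subst (λ z → ∣ z - M * Δ * v b l p ∣ < ∣ M * Δ * v b l p ∣)
      (trans (eq (M * Δ) (ι (X q) - ι (X (inj₁ b))) (M * d) (ι (X p) - ι (X (inj₁ b))) (s b l) d (py p - yB b) Δ)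
        (cong (λ z → (ι (X q) - ι (X (inj₁ b))) * (py p - yB b) - z * (ι (X p) - ι (X (inj₁ b)))) (sym yq)))
      (sign-bound {ι N} {ι K} {Δ} {s b l} {d} {v b l p} (0<N p)
        (≤-trans (p≤p+q 0≤ν) (s-bound b l)) (∣diff∣≤4 p (inj₁ b)) (∣diff∣≤4 q (inj₁ b))
        (error q (inj₁ b)) (error p (inj₁ b))
        (*-mono-r (0≤∣p∣ (v b l p)) 64≤KΔ)
        (≤-trans 64≤KDϖνϖ (*-mono (0≤ι K ⊗ (0≤D ⊗ 0≤ϖ)) (0≤∣p∣ (v b l p)) (*-mono-l (0≤ι K) Dϖ≤∣Δ∣) (height≥ p p≢b p≢q)))
        (0≤ι K))
      where
      d = px p - xB b
      eq : ∀ m X₁ m′ X₂ s d y Δ → (m + (X₁ - m)) * ((y - s * d) + s * d) - s * Δ * (m′ + (X₂ - m′)) ≡ X₁ * y - s * Δ * X₂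
      eq = solve-∀ ℚ-ring
      yq : py q - yB b ≡ s b l * Δ
      yq = trans (cong (_- yB b) (y-pl b l)) (trans (eq′ (yB b) (s b l * (G b l * (ϖ + ω (pl b l)))))
        (cong (s b l *_) (sym Δ≡)))
        where
        eq′ : ∀ x d → x + d - x ≡ d
        eq′ = solve-∀ ℚ-ring

    o : ∥ P ∥ → ℚ
    o p = orient (ι (X (inj₁ b)) , yB b) (ι (X q) , py q) (ι (X p) , py p)

    o-sign : ∀ p → sgn (o p) ≡ sgn Δ ℤ.* sgn (v b l p)
    o-sign p = go p (Finite._≟ᶠ_ P p (inj₁ b)) (Finite._≟ᶠ_ P p q)
      where
      go : ∀ p → Dec (p ≡ inj₁ b) → Dec (p ≡ q) → sgn (o p) ≡ sgn Δ ℤ.* sgn (v b l p)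
      go p (yes refl) _ = trans (sgn-zero (orient-left (ι (X (inj₁ b)) , yB b) (ι (X q) , py q)))
        (sym (trans (cong (ℤ._*_ (sgn Δ)) (sgn-zero (vB-self b l))) (ℤ.*-zeroʳ (sgn Δ))))
      go p (no _) (yes refl) = trans (sgn-zero (orient-right (ι (X (inj₁ b)) , yB b) (ι (X q) , py q)))
        (sym (trans (cong (ℤ._*_ (sgn Δ)) (sgn-zero (vQ-pl b l))) (ℤ.*-zeroʳ (sgn Δ))))
      go p (no p≢b) (no p≢q) = trans (sgn-near< {M * Δ * v b l p} {o p} (orient-near p p≢b p≢q))
        (trans (sgn-* (M * Δ) (v b l p)) (cong (ℤ._* sgn (v b l p)) (sgn-pos-* Δ 0<M)))
        where
        0<K : 0ℚ < ι K
        0<K = ≰⇒> λ K≤0 → <-irrefl refl (<-≤-trans (0<ι-suc 63) (≤-trans 64≤KΔ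
          (≤-trans (*-mono-r (0≤∣p∣ Δ) K≤0) (≤-reflexive (*-zeroˡ (∣ Δ ∣))))))
        0<M : 0ℚ < M
        0<M = 0<* (0<N p) 0<K

    halving : HalvingPair P (λ p → ι (X p) , py p) (inj₁ b) q
    halving = record
      { off = λ p p≢b p≢q e → <-irrefl refl (subst (_< ∣ M * Δ * v b l p ∣)
          (trans (cong (λ z → ∣ z - M * Δ * v b l p ∣) e)
            (trans (cong ∣_∣ (+-identityˡ (- (M * Δ * v b l p)))) (∣-p∣≡∣p∣ (M * Δ * v b l p))))
          (orient-near p p≢b p≢q))
      ; balanced = trans (∑-cong P o-sign) (trans (∑-* P (sgn Δ) (λ p → sgn (v b l p)))
          (trans (cong (ℤ._*_ (sgn Δ)) (trans (∑-⊎ B Q (λ p → sgn (v b l p))) (balanced b l))) (ℤ.*-zeroʳ (sgn Δ))))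
      }

  rounded : 0 ℕ.< K → Pattern
  rounded 0<K = record
    { P = P ; E = E ; W = K ℕ.* 8
    ; quot = quot ; idx = index
    ; quot<W = λ p → ℕ.≤-<-trans (proj₁ (quot-spec p)) (ℕ.*-monoʳ-< K {{ℕ.>-nonZero 0<K}} (ℕ.s≤s (ℕ.s≤s (ℕ.s≤s (ℕ.s≤s (ℕ.s≤s ℕ.z≤n))))))
    ; idx<N = index<size
    ; idx-injective = index-injective
    ; height = py
    ; end₁ = λ (b , l) → inj₁ b
    ; end₂ = λ (b , l) → inj₂ (pl b l)
    ; end₁≢end₂ = λ _ ()
    ; halving = λ (b , l) → halving b l
    ; distinct = λ {e} {e′} → distinct e e′
    }
    where
    distinct : ∀ e e′ → e ≢ e′ → Σ[ p ∈ ∥ P ∥ ] ((p ≡ inj₁ (proj₁ e′) ⊎ p ≡ inj₂ (pl (proj₁ e′) (proj₂ e′))) ×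
               p ≢ inj₁ (proj₁ e) × p ≢ inj₂ (pl (proj₁ e) (proj₂ e)))
    distinct (b , l) (b′ , l′) e≢ with Finite._≟ᶠ_ B b b′
    ... | no b≢b′  = inj₁ b′ , inj₁ refl , (λ e → b≢b′ (sym (inj₁-injective e))) , λ ()
    ... | yes refl = inj₂ (pl b l′) , inj₂ refl , (λ ()) , λ e → e≢ (cong (b ,_) (sym (pl-injective (inj₂-injective e))))

resolution : ℕ → ℕ
resolution zero    = 64
resolution (suc m) = resolution m ℕ.* (2 ℕ.^ m ℕ.* 2 ℕ.^ m ℕ.* (2 ℕ.^ m ℕ.* 2 ℕ.^ m) ℕ.* multiplicity m ℕ.* 2 ℕ.^ 16)

resolution-margin : ∀ m → ι (resolution m) * margin (stage m) ≡ ι 64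
resolution-margin zero    = refl
resolution-margin (suc m) = trans (cong (_* margin (stage (suc m))) (ι-* (resolution m) f))
  (trans (eq (ι (resolution m)) (ι f) (margin (stage (suc m))))
    (trans (cong (ι (resolution m) *_) (margin-suc m)) (resolution-margin m)))
  where
  f = 2 ℕ.^ m ℕ.* 2 ℕ.^ m ℕ.* (2 ℕ.^ m ℕ.* 2 ℕ.^ m) ℕ.* multiplicity m ℕ.* 2 ℕ.^ 16
  eq : ∀ r f x → r * f * x ≡ r * (x * f)
  eq = solve-∀ ℚ-ring

resolution>0 : ∀ m → 0 ℕ.< resolution m
resolution>0 m with resolution m in e
... | suc _ = ℕ.s≤s ℕ.z≤n
... | zero  = contradiction (trans (sym (resolution-margin m)) (trans (cong (λ k → ι k * margin (stage m)) e) (*-zeroˡ (margin (stage m))))) λ ()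

patternAt : ℕ → Pattern
patternAt m = Round.rounded (stage m) (resolution m) (≤-reflexive (sym (resolution-margin m))) (resolution>0 m)

-- Stability of orientations

Near : ℚ → ℚ × ℚ → ℚ × ℚ → Set
Near δ (x , y) (x′ , y′) = ∣ x′ - x ∣ ≤ δ × ∣ y′ - y ∣ ≤ δ

near-refl : ∀ {δ} → 0ℚ ≤ δ → ∀ p → Near δ p p
near-refl {δ} 0≤δ (x , y) = subst (λ z → ∣ z ∣ ≤ δ) (sym (+-inverseʳ x)) 0≤δ , subst (λ z → ∣ z ∣ ≤ δ) (sym (+-inverseʳ y)) 0≤δ

near-mono : ∀ {δ δ′ p q} → δ ≤ δ′ → Near δ p q → Near δ′ p q
near-mono h (h₁ , h₂) = ≤-trans h₁ h , ≤-trans h₂ h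

diff-near : ∀ {x₁ x₂ x₁′ x₂′ δ} → ∣ x₁′ - x₁ ∣ ≤ δ → ∣ x₂′ - x₂ ∣ ≤ δ → ∣ (x₂′ - x₁′) - (x₂ - x₁) ∣ ≤ δ + δ
diff-near {x₁} {x₂} {x₁′} {x₂′} {δ} h₁ h₂ = subst (λ z → ∣ z ∣ ≤ δ + δ) (eq x₁ x₂ x₁′ x₂′)
  (∣+∣≤ h₂ (∣-∣≤ {x₁′ - x₁} h₁))
  where
  eq : ∀ x₁ x₂ x₁′ x₂′ → (x₂′ - x₂) + (- (x₁′ - x₁)) ≡ (x₂′ - x₁′) - (x₂ - x₁)
  eq = solve-∀ ℚ-ring

product-near : ∀ {a b a′ b′ η} → η ≤ 1ℚ → ∣ a′ - a ∣ ≤ η → ∣ b′ - b ∣ ≤ η → ∣ a′ * b′ - a * b ∣ ≤ η * (∣ a ∣ + ∣ b ∣ + 1ℚ)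
product-near {a} {b} {a′} {b′} {η} η≤1 ha hb = ≤-trans
  (subst (λ z → ∣ z ∣ ≤ ∣ a ∣ * η + (∣ b ∣ * η + η * 1ℚ)) (eq a b a′ b′)
    (∣+∣≤ {a * (b′ - b)} (∣*∣≤ {a} ≤-refl hb) (∣+∣≤ {b * (a′ - a)} (∣*∣≤ {b} ≤-refl ha)
      (∣*∣≤ {a′ - a} ha (≤-trans hb η≤1)))))
  (≤-reflexive (eq′ (∣ a ∣) (∣ b ∣) η))
  where
  eq : ∀ a b a′ b′ → a * (b′ - b) + (b * (a′ - a) + (a′ - a) * (b′ - b)) ≡ a′ * b′ - a * b
  eq = solve-∀ ℚ-ring
  eq′ : ∀ a b η → a * η + (b * η + η * 1ℚ) ≡ η * (a + b + 1ℚ)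
  eq′ = solve-∀ ℚ-ring

min-pos : ∀ {p q} → 0ℚ < p → 0ℚ < q → ∃[ r ] 0ℚ < r × r ≤ p × r ≤ q
min-pos {p} {q} 0<p 0<q = go (≤-total p q)
  where
  go : p ≤ q ⊎ q ≤ p → ∃[ r ] 0ℚ < r × r ≤ p × r ≤ q
  go (inj₁ p≤q) = p , 0<p , ≤-refl , p≤q
  go (inj₂ q≤p) = q , 0<q , q≤p , ≤-refl

Stable : ℚ → ℚ × ℚ → ℚ × ℚ → ℚ × ℚ → Set
Stable δ p q r = orient p q r ≢ 0ℚ → ∀ p′ q′ r′ → Near δ p p′ → Near δ q q′ → Near δ r r′ →
                 sgn (orient p′ q′ r′) ≡ sgn (orient p q r)

stable : ∀ p q r → ∃[ δ ] 0ℚ < δ × Stable δ p q r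
stable p@(x₁ , y₁) q@(x₂ , y₂) r@(x₃ , y₃) = go (orient p q r ≟ 0ℚ)
  where
  o = orient p q r
  T = (∣ x₂ - x₁ ∣ + ∣ y₃ - y₁ ∣ + 1ℚ) + (∣ y₂ - y₁ ∣ + ∣ x₃ - x₁ ∣ + 1ℚ)
  0<T : 0ℚ < T
  0<T = 0<+ (<-≤-trans 0<1 (p≤q+p (0≤∣p∣ (x₂ - x₁) ⊕ 0≤∣p∣ (y₃ - y₁)))) (0≤∣p∣ (y₂ - y₁) ⊕ 0≤∣p∣ (x₃ - x₁) ⊕ <⇒≤ 0<1)
  go : Dec (o ≡ 0ℚ) → ∃[ δ ] 0ℚ < δ × Stable δ p q r
  -- Nothing is claimed for collinear triples, so any positive default serves.
  go (yes o≡0) = 1ℚ , 0<1 , λ o≢0 → contradiction o≡0 o≢0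
  go (no  o≢0) =
    let (η , 0<η , eq) = scale T (½ * ∣ o ∣) 0<T (0<½* (∣∣-≢0 o≢0))
        (η′ , 0<η′ , η′≤η , η′≤1) = min-pos 0<η 0<1
    in ½ * η′ , 0<½* 0<η′ , λ _ p′ q′ r′ → close {η} {η′} eq η′≤η η′≤1 (<⇒≤ 0<η′) p′ q′ r′
    where
    close : ∀ {η η′} → T * η ≡ ½ * ∣ o ∣ → η′ ≤ η → η′ ≤ 1ℚ → 0ℚ ≤ η′ → ∀ p′ q′ r′ →
            Near (½ * η′) p p′ → Near (½ * η′) q q′ → Near (½ * η′) r r′ → sgn (orient p′ q′ r′) ≡ sgn o
    close {η} {η′} eq η′≤η η′≤1 0≤η′ (x₁′ , y₁′) (x₂′ , y₂′) (x₃′ , y₃′) (hx₁ , hy₁) (hx₂ , hy₂) (hx₃ , hy₃) =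
      sgn-near< {o} {orient (x₁′ , y₁′) (x₂′ , y₂′) (x₃′ , y₃′)} (≤-<-trans
        (subst (λ z → ∣ z ∣ ≤ η′ * (∣ A ∣ + ∣ B ∣ + 1ℚ) + η′ * (∣ C ∣ + ∣ D ∣ + 1ℚ)) (split A B C D A′ B′ C′ D′)
          (∣+∣≤ {A′ * B′ - A * B} (product-near {A} {B} {A′} {B′} η′≤1 (d x₁ x₁′ x₂ x₂′ hx₁ hx₂) (d y₁ y₁′ y₃ y₃′ hy₁ hy₃))
            (∣-∣≤ {C′ * D′ - C * D} (product-near {C} {D} {C′} {D′} η′≤1 (d y₁ y₁′ y₂ y₂′ hy₁ hy₂) (d x₁ x₁′ x₃ x₃′ hx₁ hx₃)))))
        (≤-<-trans (≤-trans (≤-reflexive (distrib η′ (∣ A ∣ + ∣ B ∣ + 1ℚ) (∣ C ∣ + ∣ D ∣ + 1ℚ)))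
            (≤-trans (*-mono-l (<⇒≤ 0<T) η′≤η) (≤-reflexive eq)))
          (½*< (∣∣-≢0 o≢0))))
      where
      A = x₂ - x₁
      B = y₃ - y₁
      C = y₂ - y₁
      D = x₃ - x₁
      A′ = x₂′ - x₁′
      B′ = y₃′ - y₁′
      C′ = y₂′ - y₁′
      D′ = x₃′ - x₁′
      d : ∀ x x′ z z′ → ∣ x′ - x ∣ ≤ ½ * η′ → ∣ z′ - z ∣ ≤ ½ * η′ → ∣ (z′ - x′) - (z - x) ∣ ≤ η′
      d x x′ z z′ h₁ h₂ = ≤-trans (diff-near {x} {z} {x′} {z′} h₁ h₂) (≤-reflexive (½+½ η′))
      split : ∀ A B C D A′ B′ C′ D′ → (A′ * B′ - A * B) + (- (C′ * D′ - C * D)) ≡ (A′ * B′ - C′ * D′) - (A * B - C * D)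
      split = solve-∀ ℚ-ring
      distrib : ∀ η a b → η * a + η * b ≡ (a + b) * η
      distrib = solve-∀ ℚ-ring

uniform : ∀ (F : Finite) {R : ∥ F ∥ → ℚ → Set} → (∀ x {δ δ′} → δ′ ≤ δ → R x δ → R x δ′) →
          (∀ x → ∃[ δ ] 0ℚ < δ × R x δ) → ∃[ δ ] 0ℚ < δ × (∀ x → R x δ)
uniform F {R} mono h = let (δ , 0<δ , all) = go (elems F) in δ , 0<δ , λ x → All.lookup all (complete F x)
  where
  go : ∀ xs → ∃[ δ ] 0ℚ < δ × All (λ x → R x δ) xs
  go []       = 1ℚ , 0<1 , []
  go (x ∷ xs) = let (δ₁ , 0<δ₁ , r)   = h x
                    (δ₂ , 0<δ₂ , rs)  = go xs
                    (δ , 0<δ , le₁ , le₂) = min-pos 0<δ₁ 0<δ₂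
                in δ , 0<δ , mono x le₁ r ∷ All.map (λ {y} → mono y le₂) rs

stable-all : ∀ (F : Finite) (pos : ∥ F ∥ → ℚ × ℚ) → ∃[ δ ] 0ℚ < δ × (∀ i j k → Stable δ (pos i) (pos j) (pos k))
stable-all F pos =
  let (δ , 0<δ , st) = uniform (F ×ᶠ F ×ᶠ F) {λ (i , j , k) δ → Stable δ (pos i) (pos j) (pos k)}
        (λ (i , j , k) le st o≢0 p′ q′ r′ h₁ h₂ h₃ → st o≢0 p′ q′ r′
          (near-mono {p = pos i} {p′} le h₁) (near-mono {p = pos j} {q′} le h₂) (near-mono {p = pos k} {r′} le h₃))
        (λ (i , j , k) → stable (pos i) (pos j) (pos k))
  in δ , 0<δ , λ i j k → st (i , j , k)

-- Generic perturbation

avoid : ∀ (fs : List ℚ) {lo hi} → lo < hi → ∃[ y ] lo < y × y < hi × All (y ≢_) fs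
avoid [] {lo} {hi} lo<hi = let (y , p , q) = <-dense lo<hi in y , p , q , []
avoid (f ∷ fs) {lo} {hi} lo<hi = let (mid , p , q) = <-dense lo<hi in go mid p q (≤-total f mid)
  where
  go : ∀ mid → lo < mid → mid < hi → f ≤ mid ⊎ mid ≤ f → ∃[ y ] lo < y × y < hi × All (y ≢_) (f ∷ fs)
  go mid p q (inj₁ f≤mid) = let (y , r , s , all) = avoid fs q in
    y , <-trans p r , s , (λ { refl → <-irrefl refl (<-≤-trans r f≤mid) }) ∷ all
  go mid p q (inj₂ mid≤f) = let (y , r , s , all) = avoid fs p in
    y , r , <-trans s q , (λ { refl → <-irrefl refl (<-≤-trans s mid≤f) }) ∷ all

root : ∀ a c → ∃[ v ] (a ≢ 0ℚ → ∀ {y} → a * y + c ≡ 0ℚ → y ≡ v)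
root a c = go (a ≟ 0ℚ)
  where
  go : Dec (a ≡ 0ℚ) → ∃[ v ] (a ≢ 0ℚ → ∀ {y} → a * y + c ≡ 0ℚ → y ≡ v)
  go (yes a≡0) = 0ℚ , λ a≢0 → contradiction a≡0 a≢0
  go (no a≢0)  = a⁻¹ * (- c) , λ _ {y} e → trans (sym (trans (sym (*-assoc a⁻¹ a y))
      (trans (cong (_* y) (*-inverseˡ a {{nz}})) (*-identityˡ y))))
      (cong (a⁻¹ *_) (trans (eq (a * y) c) (trans (cong (_- c) e) (+-identityˡ (- c)))))
    where
    nz = ℚ.≢-nonZero a≢0
    a⁻¹ = (ℚ.1/ a) {{nz}}
    eq : ∀ p c → p ≡ p + c - c
    eq = solve-∀ ℚ-ring

orient-rotate : ∀ p q r → orient q r p ≡ orient p q r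
orient-rotate (x₁ , y₁) (x₂ , y₂) (x₃ , y₃) = eq x₁ y₁ x₂ y₂ x₃ y₃
  where
  eq : ∀ x₁ y₁ x₂ y₂ x₃ y₃ → (x₃ - x₂) * (y₁ - y₂) - (y₃ - y₂) * (x₁ - x₂) ≡ (x₂ - x₁) * (y₃ - y₁) - (y₂ - y₁) * (x₃ - x₁)
  eq = solve-∀ ℚ-ring

line-root : ∀ p q x → ∃[ v ] (proj₁ q ≢ proj₁ p → ∀ y → orient p q (x , y) ≡ 0ℚ → y ≡ v)
line-root (x₁ , y₁) (x₂ , y₂) x₃ = let (v , h) = root (x₂ - x₁) (- ((x₂ - x₁) * y₁ + (y₂ - y₁) * (x₃ - x₁))) in
  v , λ ne y e → h (λ d → ne (trans (eq′ x₂ x₁) (trans (cong (_+ x₁) d) (+-identityˡ x₁)))) {y} (trans (eq x₁ y₁ x₂ y₂ x₃ y) e)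
  where
  eq : ∀ x₁ y₁ x₂ y₂ x₃ y₃ → (x₂ - x₁) * y₃ + (- ((x₂ - x₁) * y₁ + (y₂ - y₁) * (x₃ - x₁))) ≡
       (x₂ - x₁) * (y₃ - y₁) - (y₂ - y₁) * (x₃ - x₁)
  eq = solve-∀ ℚ-ring
  eq′ : ∀ x y → x ≡ x - y + y
  eq′ = solve-∀ ℚ-ring

module Generic (F : Finite) (pos₀ : ∥ F ∥ → ℚ × ℚ) (δ : ℚ) (0<δ : 0ℚ < δ) where

  private
    I = ∥ F ∥
    _≟I_ = Finite._≟ᶠ_ F

  record Good (js : List I) : Set where
    field
      pos  : I → ℚ × ℚ
      near : ∀ j → Near δ (pos₀ j) (pos j)
      x-distinct : ∀ {i j} → i ∈ js → j ∈ js → i ≢ j → proj₁ (pos i) ≢ proj₁ (pos j)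
      general : ∀ {i j k} → i ∈ js → j ∈ js → k ∈ js → i ≢ j → i ≢ k → j ≢ k → orient (pos i) (pos j) (pos k) ≢ 0ℚ

  module Place {js : List I} (good : Good js) (j₀ : I) (j₀∉ : ∀ {j} → j ∈ js → j ≢ j₀) (x′ y′ : ℚ)
               (near-new : Near δ (pos₀ j₀) (x′ , y′)) (x-new : ∀ {j} → j ∈ js → proj₁ (Good.pos good j) ≢ x′)
               (general-new : ∀ {i k} → i ∈ js → k ∈ js → i ≢ k → orient (Good.pos good i) (Good.pos good k) (x′ , y′) ≢ 0ℚ) where

    open Good good

    private
      place : ∀ j → Dec (j ≡ j₀) → ℚ × ℚ
      place j (yes _) = x′ , y′
      place j (no _)  = pos j

      place-new : ∀ d → place j₀ d ≡ (x′ , y′)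
      place-new (yes _) = refl
      place-new (no ne) = contradiction refl ne

      place-old : ∀ {j} → j ≢ j₀ → ∀ d → place j d ≡ pos j
      place-old j≢ (yes e) = contradiction e j≢
      place-old j≢ (no _)  = refl

      place-near : ∀ j d → Near δ (pos₀ j) (place j d)
      place-near j (yes refl) = near-new
      place-near j (no _)     = near j

    pos′ : I → ℚ × ℚ
    pos′ j = place j (j ≟I j₀)

    new : pos′ j₀ ≡ (x′ , y′)
    new = place-new (j₀ ≟I j₀)

    old : ∀ {j} → j ≢ j₀ → pos′ j ≡ pos j
    old {j} j≢ = place-old j≢ (j ≟I j₀)

    near′ : ∀ j → Near δ (pos₀ j) (pos′ j)
    near′ j = place-near j (j ≟I j₀)

    private
      O : I → I → I → Set
      O i j k = orient (pos′ i) (pos′ j) (pos′ k) ≢ 0ℚ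

      O-rotate : ∀ i j k → O i j k → O j k i
      O-rotate i j k h e = h (trans (sym (orient-rotate (pos′ i) (pos′ j) (pos′ k))) e)

      O-new : ∀ {i k} → i ∈ js → k ∈ js → i ≢ k → O i k j₀
      O-new {i} {k} i∈ k∈ i≢k e = general-new i∈ k∈ i≢k (trans (sym (cong₂ (λ p q → orient p q (x′ , y′)) (old (j₀∉ i∈)) (old (j₀∉ k∈))))
        (trans (cong (orient (pos′ i) (pos′ k)) (sym new)) e))

    extend : Good (j₀ ∷ js)
    extend = record { pos = pos′ ; near = near′ ; x-distinct = x-distinct′ ; general = general′ }
      where
      x-distinct′ : ∀ {i j} → i ∈ j₀ ∷ js → j ∈ j₀ ∷ js → i ≢ j → proj₁ (pos′ i) ≢ proj₁ (pos′ j)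
      x-distinct′ (here refl) (here refl) i≢j = contradiction refl i≢j
      x-distinct′ (here refl) (there j∈)  _ e = x-new j∈ (trans (sym (cong proj₁ (old (j₀∉ j∈)))) (trans (sym e) (cong proj₁ new)))
      x-distinct′ (there i∈)  (here refl) _ e = x-new i∈ (trans (sym (cong proj₁ (old (j₀∉ i∈)))) (trans e (cong proj₁ new)))
      x-distinct′ (there i∈)  (there j∈) i≢j e = x-distinct i∈ j∈ i≢j
        (trans (sym (cong proj₁ (old (j₀∉ i∈)))) (trans e (cong proj₁ (old (j₀∉ j∈)))))
      general′ : ∀ {i j k} → i ∈ j₀ ∷ js → j ∈ j₀ ∷ js → k ∈ j₀ ∷ js → i ≢ j → i ≢ k → j ≢ k → O i j k
      general′ (here refl) (here refl) _ i≢j _ _ = contradiction refl i≢j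
      general′ (here refl) _ (here refl) _ i≢k _ = contradiction refl i≢k
      general′ _ (here refl) (here refl) _ _ j≢k = contradiction refl j≢k
      general′ {i} {j} {k} (there i∈) (there j∈) (here refl) i≢j _ _ = O-new i∈ j∈ i≢j
      general′ {i} {j} {k} (there i∈) (here refl) (there k∈) _ i≢k _ = O-rotate k i j (O-new k∈ i∈ (λ e → i≢k (sym e)))
      general′ {i} {j} {k} (here refl) (there j∈) (there k∈) _ _ j≢k = O-rotate k i j (O-rotate j k i (O-new j∈ k∈ j≢k))
      general′ {i} {j} {k} (there i∈) (there j∈) (there k∈) i≢j i≢k j≢k e = general i∈ j∈ k∈ i≢j i≢k j≢k
        (trans (sym (trans (cong₂ (λ p q → orient p q (pos′ k)) (old (j₀∉ i∈)) (old (j₀∉ j∈)))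
          (cong (orient (pos i) (pos j)) (old (j₀∉ k∈))))) e)

  -- The new abscissa avoids those already used, which keeps all lines through two placed points
  -- from being vertical. Over it each such line then forbids a single ordinate.
  extended : ∀ {js} → Good js → ∀ j₀ → (∀ {j} → j ∈ js → j ≢ j₀) → Good (j₀ ∷ js)
  extended {js} good j₀ j₀∉ =
    let (x′ , x> , x< , x∉) = avoid (map (λ j → proj₁ (pos j)) js) (interval (proj₁ (pos₀ j₀)))
        (y′ , y> , y< , y∉) = avoid (map (roots x′) (cartesianProduct js js)) (interval (proj₂ (pos₀ j₀)))
    in Place.extend good j₀ j₀∉ x′ y′ (near-interval (proj₁ (pos₀ j₀)) x> x< , near-interval (proj₂ (pos₀ j₀)) y> y<)
         (λ j∈ e → All.lookup x∉ (∈-map⁺ (λ j → proj₁ (pos j)) j∈) (sym e))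
         (λ i∈ k∈ i≢k → new-general x′ y′ (λ e → x-distinct k∈ i∈ (λ e → i≢k (sym e)) e)
           (All.lookup y∉ (∈-map⁺ (roots x′) (∈-cartesianProduct⁺ i∈ k∈))))
    where
    open Good good
    near-interval : ∀ a {y} → a - δ < y → y < a + δ → ∣ y - a ∣ ≤ δ
    near-interval a {y} h₁ h₂ = ∣∣≤ (≤+⇒-≤ {y} {a} (<⇒≤ h₂)) (≤-by (y - (a - δ)) (0≤- (<⇒≤ h₁)) (eq y a δ))
      where
      eq : ∀ y a δ → δ ≡ (- (y - a)) + (y - (a - δ))
      eq = solve-∀ ℚ-ring
    interval : ∀ a → a - δ < a + δ
    interval a = <-by (δ + δ) (0<+ 0<δ (<⇒≤ 0<δ)) (eq a δ)
      where
      eq : ∀ a δ → a + δ ≡ (a - δ) + (δ + δ)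
      eq = solve-∀ ℚ-ring
    roots : ℚ → I × I → ℚ
    roots x₃ (i , k) = proj₁ (line-root (pos i) (pos k) x₃)
    new-general : ∀ {i k} x′ y′ → proj₁ (pos k) ≢ proj₁ (pos i) → y′ ≢ roots x′ (i , k) → orient (pos i) (pos k) (x′ , y′) ≢ 0ℚ
    new-general {i} {k} x′ y′ x≢ y≢ o≡0 = y≢ (proj₂ (line-root (pos i) (pos k) x′) x≢ y′ o≡0)

  good : ∀ js → Unique js → Good js
  good []       _          = record { pos = pos₀ ; near = λ j → near-refl (<⇒≤ 0<δ) (pos₀ j) ; x-distinct = λ () ; general = λ () }
  good (j ∷ js) (j∉ ∷ uniq) = extended (good js uniq) j λ i∈ e → All.lookup j∉ i∈ (sym e)

  perturbed : Good (elems F)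
  perturbed = good (elems F) (unique F)

-- Rational configurations in a square

𝟙/16 𝟙/32 : ℚ
𝟙/16 = inv 15
𝟙/32 = inv 31

record Configuration (n b : ℕ) : Set₁ where
  field
    1≤b    : 1 ℕ.≤ b
    b²≤n   : b ℕ.* b ℕ.≤ n
    pos    : Fin n → ℚ × ℚ
    x-bound : ∀ i → ∣ proj₁ (pos i) ∣ ≤ ι b + 𝟙/32
    y-bound : ∀ i → ∣ proj₂ (pos i) ∣ ≤ ι b + 𝟙/32
    apart  : ∀ {i j} → i ≢ j → 1ℚ - 𝟙/16 ≤ ∣ proj₁ (pos i) - proj₁ (pos j) ∣ ⊎ 1ℚ - 𝟙/16 ≤ ∣ proj₂ (pos i) - proj₂ (pos j) ∣
    E      : Finite
    end₁ end₂ : ∥ E ∥ → Fin n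
    ends-distinct : ∀ e → end₁ e ≢ end₂ e
    halving  : ∀ e → HalvingPair (finᶠ n) pos (end₁ e) (end₂ e)
    distinct : ∀ {e e′} → e ≢ e′ → Σ[ p ∈ Fin n ] ((p ≡ end₁ e′ ⊎ p ≡ end₂ e′) × p ≢ end₁ e × p ≢ end₂ e)

-- Rational points as real points

constant-≤ : ∀ {u v p q} → (∀ n → seq u n ≡ p) → (∀ n → seq v n ≡ q) → p ≤ q → u ≤ℝ v
constant-≤ eu ev p≤q ε 0<ε = 0 , λ {n} _ → ≤-trans (≤-reflexive (eu n))
  (≤-trans p≤q (≤-trans (p≤p+q (<⇒≤ 0<ε)) (+-monoˡ-≤ ε (≤-reflexive (sym (ev n))))))

constant-≤⁻¹ : ∀ {u v p q} → (∀ n → seq u n ≡ p) → (∀ n → seq v n ≡ q) → u ≤ℝ v → p ≤ q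
constant-≤⁻¹ {u} {v} {p} {q} eu ev u≤v = ≮⇒≥ λ q<p →
  let 0<ε = 0<½* (0<- q<p)
      (N , h) = u≤v (½ * (p - q)) 0<ε
  in <-irrefl refl (≤-<-trans (subst₂ (λ a b → a ≤ b + ½ * (p - q)) (eu N) (ev N) (h ℕ.≤-refl))
       (subst (q + ½ * (p - q) <_) (eq p q) (+-monoʳ-< q (½*< (0<- q<p)))))
  where
  eq : ∀ p q → q + (p - q) ≡ p
  eq = solve-∀ ℚ-ring

constant-< : ∀ {u v p q} → (∀ n → seq u n ≡ p) → (∀ n → seq v n ≡ q) → p < q → u <ℝ v
constant-< {p = p} {q} eu ev p<q = q - p , 0<- p<q , 0 , λ {n} _ →
  ≤-reflexive (trans (cong (_+ (q - p)) (eu n)) (trans (eq p q) (sym (ev n))))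
  where
  eq : ∀ p q → p + (q - p) ≡ q
  eq = solve-∀ ℚ-ring

constant-<⁻¹ : ∀ {u v p q} → (∀ n → seq u n ≡ p) → (∀ n → seq v n ≡ q) → u <ℝ v → p < q
constant-<⁻¹ {p = p} {q} eu ev (ε , 0<ε , N , h) = <-≤-trans
  (<-by {p} {p + ε} ε 0<ε refl) (subst₂ (λ a b → a + ε ≤ b) (eu N) (ev N) (h ℕ.≤-refl))

constant-≈ : ∀ {u v p q} → (∀ n → seq u n ≡ p) → (∀ n → seq v n ≡ q) → p ≡ q → u ≈ℝ v
constant-≈ {u} {v} eu ev e = constant-≤ {u} {v} eu ev (≤-reflexive e) , constant-≤ {v} {u} ev eu (≤-reflexive (sym e))

constant-≈⁻¹ : ∀ {u v p q} → (∀ n → seq u n ≡ p) → (∀ n → seq v n ≡ q) → u ≈ℝ v → p ≡ q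
constant-≈⁻¹ {u} {v} eu ev (h₁ , h₂) = ≤-antisym (constant-≤⁻¹ {u} {v} eu ev h₁) (constant-≤⁻¹ {v} {u} ev eu h₂)

point : ℚ × ℚ → Point
point (p , q) = mkPoint (fromℚ p) (fromℚ q)

Null : (ℕ → ℚ) → Set
Null z = ∀ ε → 0ℚ < ε → ∃[ N ] (∀ {n} → N ℕ.≤ n → ∣ z n ∣ ≤ ε)

null-+ : ∀ {y z} → Null y → Null z → Null (λ n → y n + z n)
null-+ {y} {z} hy hz ε 0<ε =
  let (N , p) = hy (½ * ε) (0<½* 0<ε) ; (M , q) = hz (½ * ε) (0<½* 0<ε) in
  N ℕ.⊔ M , λ {n} h → ≤-trans (∣+∣≤ {y n} {z n} (p (ℕ.m⊔n≤o⇒m≤o N M h)) (q (ℕ.m⊔n≤o⇒n≤o N M h))) (≤-reflexive (½+½ ε))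

null-* : ∀ k {z} → Null z → Null (λ n → k * z n)
null-* k {z} hz ε 0<ε =
  let 0<K = 0<+ 0<1 (0≤∣p∣ k)
      (δ , 0<δ , eq) = scale (1ℚ + ∣ k ∣) ε 0<K 0<ε
      (N , p) = hz δ 0<δ
  in N , λ {n} h → ≤-trans (∣*∣≤ {k} {z n} (p≤q+p (<⇒≤ 0<1)) (p h)) (≤-reflexive eq)

null-cong : ∀ {y z} → (∀ n → y n ≡ z n) → Null y → Null z
null-cong e h ε 0<ε = let (N , p) = h ε 0<ε in N , λ {n} N≤n → subst (λ w → ∣ w ∣ ≤ ε) (e n) (p N≤n)

≈⇒null : ∀ {u v} → u ≈ℝ v → Null (λ n → seq u n - seq v n)
≈⇒null {u} {v} (h₁ , h₂) ε 0<ε =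
  let (N , p) = h₁ ε 0<ε ; (M , q) = h₂ ε 0<ε in
  N ℕ.⊔ M , λ {n} h → ∣∣≤ (≤+⇒-≤ {seq u n} {seq v n} (p (ℕ.m⊔n≤o⇒m≤o N M h)))
    (subst (_≤ ε) (eq (seq u n) (seq v n)) (≤+⇒-≤ {seq v n} {seq u n} (q (ℕ.m⊔n≤o⇒n≤o N M h))))
  where
  eq : ∀ a b → b - a ≡ - (a - b)
  eq = solve-∀ ℚ-ring

null⇒≈0 : ∀ {u} → Null (seq u) → u ≈ℝ 0ℝ
null⇒≈0 {u} h =
  (λ ε 0<ε → let (N , p) = h ε 0<ε in N , λ {n} N≤n → ≤-trans (∣∣≤⇒≤ {seq u n} (p N≤n)) (≤-reflexive (sym (+-identityˡ ε)))) ,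
  (λ ε 0<ε → let (N , p) = h ε 0<ε in N , λ {n} N≤n →
    ≤-by (seq u n - (- ε)) (0≤- (∣∣≤⇒-≤ {seq u n} (p N≤n))) (eq (seq u n) ε))
  where
  eq : ∀ a ε → a + ε ≡ ι 0 + (a - (- ε))
  eq = solve-∀ ℚ-ring

-- A line through three points with nonzero orientation o would satisfy a o = b o = 0.
not-collinear : ∀ p q r → orient p q r ≢ 0ℚ → ¬ (∃[ ℓ ] point p on ℓ × point q on ℓ × point r on ℓ)
not-collinear p@(x₁ , y₁) q@(x₂ , y₂) r@(x₃ , y₃) o≢0 (ℓ , h₁ , h₂ , h₃) =
  nondegenerate (null⇒≈0 {a} (divide a-null) , null⇒≈0 {b} (divide b-null))
  where
  open Line ℓ
  o : ℚ
  o = orient p q r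
  instance
    o-nonZero : ℚ.NonZero o
    o-nonZero = ℚ.≢-nonZero o≢0
  form-c : ℚ × ℚ → ℕ → ℚ
  form-c (x , y) n = (seq a n * x + seq b n * y) - seq c n
  n₁ : Null (form-c p)
  n₁ = ≈⇒null {form (point p)} {c} h₁
  n₂ : Null (form-c q)
  n₂ = ≈⇒null {form (point q)} {c} h₂
  n₃ : Null (form-c r)
  n₃ = ≈⇒null {form (point r)} {c} h₃
  combine : ∀ k₁ k₂ k₃ → Null (λ n → k₁ * form-c p n + (k₂ * form-c q n + k₃ * form-c r n))
  combine k₁ k₂ k₃ = null-+ {λ n → k₁ * form-c p n} (null-* k₁ {form-c p} n₁)
    (null-+ {λ n → k₂ * form-c q n} (null-* k₂ {form-c q} n₂) (null-* k₃ {form-c r} n₃))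
  a-null : Null (λ n → o * seq a n)
  a-null = null-cong (λ n → eq (seq a n) (seq b n) (seq c n) x₁ y₁ x₂ y₂ x₃ y₃)
    (combine (y₂ - y₃) (y₃ - y₁) (y₁ - y₂))
    where
    eq : ∀ a b c x₁ y₁ x₂ y₂ x₃ y₃ →
      (y₂ - y₃) * ((a * x₁ + b * y₁) - c) + ((y₃ - y₁) * ((a * x₂ + b * y₂) - c) + (y₁ - y₂) * ((a * x₃ + b * y₃) - c))
      ≡ ((x₂ - x₁) * (y₃ - y₁) - (y₂ - y₁) * (x₃ - x₁)) * a
    eq = solve-∀ ℚ-ring
  b-null : Null (λ n → o * seq b n)
  b-null = null-cong (λ n → eq (seq a n) (seq b n) (seq c n) x₁ y₁ x₂ y₂ x₃ y₃)
    (combine (x₃ - x₂) (x₁ - x₃) (x₂ - x₁))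
    where
    eq : ∀ a b c x₁ y₁ x₂ y₂ x₃ y₃ →
      (x₃ - x₂) * ((a * x₁ + b * y₁) - c) + ((x₁ - x₃) * ((a * x₂ + b * y₂) - c) + (x₂ - x₁) * ((a * x₃ + b * y₃) - c))
      ≡ ((x₂ - x₁) * (y₃ - y₁) - (y₂ - y₁) * (x₃ - x₁)) * b
    eq = solve-∀ ℚ-ring
  divide : ∀ {z} → Null (λ n → o * z n) → Null z
  divide {z} h = null-cong (λ n → trans (sym (*-assoc (ℚ.1/ o) o (z n))) (trans (cong (_* z n) (*-inverseˡ o)) (*-identityˡ (z n))))
    (null-* (ℚ.1/ o) {λ n → o * z n} h)

module Through (p q : ℚ × ℚ) (x≢ : proj₁ p ≢ proj₁ q) where

  private
    x₁ = proj₁ p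
    y₁ = proj₂ p
    x₂ = proj₁ q
    y₂ = proj₂ q
    A B C : ℚ
    A = - (y₂ - y₁)
    B = x₂ - x₁
    C = A * x₁ + B * y₁

  line : Line
  line = record
    { a = fromℚ A ; b = fromℚ B ; c = fromℚ C
    ; nondegenerate = λ (_ , b≈0) → x≢ (sym (trans (eq x₂ x₁)
        (trans (cong (_+ x₁) (constant-≈⁻¹ {fromℚ B} {0ℝ} (λ _ → refl) (λ _ → refl) b≈0)) (+-identityˡ x₁)))) }
    where
    eq : ∀ x y → x ≡ x - y + y
    eq = solve-∀ ℚ-ring

  value : ℚ × ℚ → ℚ
  value (x , y) = A * x + B * y

  value-C : ∀ r → value r - C ≡ orient p q r
  value-C (x₃ , y₃) = eq x₁ y₁ x₂ y₂ x₃ y₃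
    where
    eq : ∀ x₁ y₁ x₂ y₂ x₃ y₃ →
      ((- (y₂ - y₁)) * x₃ + (x₂ - x₁) * y₃) - ((- (y₂ - y₁)) * x₁ + (x₂ - x₁) * y₁) ≡ (x₂ - x₁) * (y₃ - y₁) - (y₂ - y₁) * (x₃ - x₁)
    eq = solve-∀ ℚ-ring

  private
    value≡ : ∀ r → value r ≡ C + orient p q r
    value≡ r = trans (eq (value r) C) (cong (_+_ C) (value-C r))
      where
      eq : ∀ v c → v ≡ c + (v - c)
      eq = solve-∀ ℚ-ring

  on⁺ : ∀ r → orient p q r ≡ 0ℚ → point r on line
  on⁺ r e = constant-≈ {Line.form line (point r)} {fromℚ C} (λ _ → refl) (λ _ → refl)
    (trans (value≡ r) (trans (cong (_+_ C) e) (+-identityʳ C)))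

  on⁻ : ∀ r → point r on line → orient p q r ≡ 0ℚ
  on⁻ r h = trans (sym (value-C r)) (trans (cong (_- C)
    (constant-≈⁻¹ {Line.form line (point r)} {fromℚ C} {value r} (λ _ → refl) (λ _ → refl) h)) (+-inverseʳ C))

  side⁺ : ∀ r → 0ℚ < orient p q r → Side⁺ line (point r)
  side⁺ r h = constant-< {fromℚ C} {Line.form line (point r)} {C} {value r} (λ _ → refl) (λ _ → refl) (<-by (orient p q r) h (value≡ r))

  side⁺⁻¹ : ∀ r → Side⁺ line (point r) → 0ℚ < orient p q r
  side⁺⁻¹ r h = subst (0ℚ <_) (value-C r)
    (0<- (constant-<⁻¹ {fromℚ C} {Line.form line (point r)} {C} {value r} (λ _ → refl) (λ _ → refl) h))

  side⁻ : ∀ r → orient p q r < 0ℚ → Side⁻ line (point r)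
  side⁻ r h = constant-< {Line.form line (point r)} {fromℚ C} {value r} {C} (λ _ → refl) (λ _ → refl)
    (<-by (- orient p q r) (neg-antimono-< h) (trans (eq C (orient p q r)) (cong (_+ (- orient p q r)) (sym (value≡ r)))))
    where
    eq : ∀ c o → c ≡ (c + o) + (- o)
    eq = solve-∀ ℚ-ring

  side⁻⁻¹ : ∀ r → Side⁻ line (point r) → orient p q r < 0ℚ
  side⁻⁻¹ r h = 0<-⇒<0 (subst (0ℚ <_) (trans (eq (value r) C) (cong -_ (value-C r)))
    (0<- (constant-<⁻¹ {Line.form line (point r)} {fromℚ C} {value r} {C} (λ _ → refl) (λ _ → refl) h)))
    where
    eq : ∀ v c → c - v ≡ - (v - c)
    eq = solve-∀ ℚ-ring

-- Counting by sums

𝟏 : Bool → ℤ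
𝟏 true  = 1ℤ
𝟏 false = 0ℤ

∣tabulate∣ : ∀ {n} {A : Set} (g : A → Bool) (h : Fin n → A) →
             + Subset.∣ Vec.tabulate (g ∘ h) ∣ ≡ ∑ˡ (List.tabulate h) (𝟏 ∘ g)
∣tabulate∣ {zero}  g h = refl
∣tabulate∣ {suc n} g h with g (h Fin.zero)
... | true  = cong (ℤ._+_ 1ℤ) (∣tabulate∣ g (h ∘ Fin.suc))
... | false = trans (∣tabulate∣ g (h ∘ Fin.suc)) (sym (ℤ.+-identityˡ _))

∑-pair : ∀ (F : Finite) {i j} (f : ∥ F ∥ → ℤ) → i ≢ j → (∀ k → k ≢ i → k ≢ j → f k ≡ 0ℤ) → ∑ F f ≡ f i ℤ.+ f j
∑-pair F {i} {j} f i≢j h = trans (sym (ℤ.+-identityʳ (∑ F f)))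
  (trans (cong (ℤ._+_ (∑ F f)) (sym (at-i (i ≟ᶠ i))))
  (trans (∑-change F {i} {f} {g} λ k k≢i → sym (off-i k k≢i (k ≟ᶠ i)))
  (trans (cong (ℤ._+ f i) (trans (∑-single F {j} {g} off-j) (off-i j (λ e → i≢j (sym e)) (j ≟ᶠ i)))) (ℤ.+-comm (f j) (f i)))))
  where
  open Finite F using (_≟ᶠ_)
  pick : ∀ k → Dec (k ≡ i) → ℤ
  pick k (yes _) = 0ℤ
  pick k (no _)  = f k
  g : ∥ F ∥ → ℤ
  g k = pick k (k ≟ᶠ i)
  at-i : ∀ d → pick i d ≡ 0ℤ
  at-i (yes _) = refl
  at-i (no ne) = contradiction refl ne
  off-i : ∀ k → k ≢ i → ∀ d → pick k d ≡ f k
  off-i k ne (yes e) = contradiction e ne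
  off-i k ne (no _)  = refl
  off-j : ∀ k → k ≢ j → g k ≡ 0ℤ
  off-j k k≢j = go (k ≟ᶠ i)
    where
    go : ∀ d → pick k d ≡ 0ℤ
    go (yes _)  = refl
    go (no k≢i) = h k k≢i k≢j

does⇒ : ∀ {A : Set} (d : Dec A) → does d ≡ true → A
does⇒ (yes a) _ = a

⇒does : ∀ {A : Set} (d : Dec A) → A → does d ≡ true
⇒does (yes _) _ = refl
⇒does (no ¬a) a = contradiction a ¬a

𝟏-yes : ∀ {A : Set} (d : Dec A) → A → 𝟏 (does d) ≡ 1ℤ
𝟏-yes d a = cong 𝟏 (⇒does d a)

𝟏-no : ∀ {A : Set} (d : Dec A) → ¬ A → 𝟏 (does d) ≡ 0ℤ
𝟏-no (yes a) ¬a = contradiction a ¬a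
𝟏-no (no _)  _  = refl

zero⊎nonzero : ∀ p → p ≡ 0ℚ ⊎ (0ℚ < p ⊎ p < 0ℚ)
zero⊎nonzero p with p ≟ 0ℚ
... | yes e = inj₁ e
... | no ne = inj₂ (≢0-cases ne)

module Count {n : ℕ} (f : Fin n → ℚ) where

  pos? neg? : Fin n → Bool
  pos? k = does (0ℚ <? f k)
  neg? k = does (f k <? 0ℚ)

  private
    F = finᶠ n

    zero# : Fin n → ℤ
    zero# k = 1ℤ ℤ.- (𝟏 (pos? k) ℤ.+ 𝟏 (neg? k))

    sgn-split : ∀ k → sgn (f k) ≡ 𝟏 (pos? k) ℤ.- 𝟏 (neg? k)
    sgn-split k = go (zero⊎nonzero (f k))
      where
      go : f k ≡ 0ℚ ⊎ (0ℚ < f k ⊎ f k < 0ℚ) → sgn (f k) ≡ 𝟏 (pos? k) ℤ.- 𝟏 (neg? k)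
      go (inj₁ e) = trans (sgn-zero e) (sym (cong₂ ℤ._-_ (𝟏-no (0ℚ <? f k) (<-irrefl (sym e))) (𝟏-no (f k <? 0ℚ) (<-irrefl e))))
      go (inj₂ (inj₁ h)) = trans (sgn-pos h) (sym (cong₂ ℤ._-_ (𝟏-yes (0ℚ <? f k) h) (𝟏-no (f k <? 0ℚ) (<-asym h))))
      go (inj₂ (inj₂ h)) = trans (sgn-neg h) (sym (cong₂ ℤ._-_ (𝟏-no (0ℚ <? f k) (<-asym h)) (𝟏-yes (f k <? 0ℚ) h)))

    zero#-zero : ∀ {k} → f k ≡ 0ℚ → zero# k ≡ 1ℤ
    zero#-zero {k} e = cong (ℤ._-_ 1ℤ) (cong₂ ℤ._+_ (𝟏-no (0ℚ <? f k) (<-irrefl (sym e))) (𝟏-no (f k <? 0ℚ) (<-irrefl e)))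

    zero#-nonzero : ∀ {k} → f k ≢ 0ℚ → zero# k ≡ 0ℤ
    zero#-nonzero {k} ne = go (≢0-cases ne)
      where
      go : 0ℚ < f k ⊎ f k < 0ℚ → zero# k ≡ 0ℤ
      go (inj₁ h) = cong (ℤ._-_ 1ℤ) (cong₂ ℤ._+_ (𝟏-yes (0ℚ <? f k) h) (𝟏-no (f k <? 0ℚ) (<-asym h)))
      go (inj₂ h) = cong (ℤ._-_ 1ℤ) (cong₂ ℤ._+_ (𝟏-no (0ℚ <? f k) (<-asym h)) (𝟏-yes (f k <? 0ℚ) h))

  positives negatives : Subset n
  positives = Vec.tabulate pos?
  negatives = Vec.tabulate neg?

  module _ {i j} (i≢j : i ≢ j) (fi : f i ≡ 0ℚ) (fj : f j ≡ 0ℚ) (off : ∀ k → k ≢ i → k ≢ j → f k ≢ 0ℚ)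
           (balanced : ∑ F (sgn ∘ f) ≡ 0ℤ) where

    private
      p m : ℤ
      p = ∑ F (𝟏 ∘ pos?)
      m = ∑ F (𝟏 ∘ neg?)

      p-m : p ℤ.- m ≡ 0ℤ
      p-m = trans (cong (ℤ._+_ p) (trans (sym (ℤ.-1*i≡-i m)) (sym (∑-* F -1ℤ (𝟏 ∘ neg?)))))
        (trans (sym (∑-+ F (𝟏 ∘ pos?) (λ k → -1ℤ ℤ.* 𝟏 (neg? k))))
          (trans (∑-cong F λ k → trans (cong (ℤ._+_ (𝟏 (pos? k))) (ℤ.-1*i≡-i (𝟏 (neg? k)))) (sym (sgn-split k))) balanced))

      -- Every index counts once as positive, negative or zero, and exactly `i` and `j` count as
      -- zero; this produces the 2 in (n - 2)/2.
      total : + n ≡ p ℤ.+ m ℤ.+ + 2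
      total = begin
        + n                              ≡⟨ ℤ.*-identityʳ (+ n) ⟨
        + n ℤ.* 1ℤ                       ≡⟨ cong (λ n → + n ℤ.* 1ℤ) (size-fin n) ⟨
        + size F ℤ.* 1ℤ                  ≡⟨ ∑-const F 1ℤ ⟨
        ∑ F (λ _ → 1ℤ)                   ≡⟨ ∑-cong F (λ k → eq (𝟏 (pos? k)) (𝟏 (neg? k))) ⟩
        ∑ F (λ k → (𝟏 (pos? k) ℤ.+ 𝟏 (neg? k)) ℤ.+ zero# k) ≡⟨ ∑-+ F (λ k → 𝟏 (pos? k) ℤ.+ 𝟏 (neg? k)) zero# ⟩
        ∑ F (λ k → 𝟏 (pos? k) ℤ.+ 𝟏 (neg? k)) ℤ.+ ∑ F zero# ≡⟨ cong₂ ℤ._+_ (∑-+ F (𝟏 ∘ pos?) (𝟏 ∘ neg?))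
             (trans (∑-pair F zero# i≢j (λ k h₁ h₂ → zero#-nonzero (off k h₁ h₂))) (cong₂ ℤ._+_ (zero#-zero fi) (zero#-zero fj))) ⟩
        p ℤ.+ m ℤ.+ + 2                  ∎
        where
        open ≡-Reasoning
        eq : ∀ a b → 1ℤ ≡ (a ℤ.+ b) ℤ.+ (1ℤ ℤ.- (a ℤ.+ b))
        eq = solve-∀ ℤ-ring

    ∣positives∣≡∣negatives∣ : Subset.∣ positives ∣ ≡ Subset.∣ negatives ∣
    ∣positives∣≡∣negatives∣ = ℤ.+-injective (trans (∣tabulate∣ pos? id) (trans (ℤ.i-j≡0⇒i≡j p m p-m) (sym (∣tabulate∣ neg? id))))

    2∣negatives∣+2≡n : 2 ℕ.* Subset.∣ negatives ∣ ℕ.+ 2 ≡ n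
    2∣negatives∣+2≡n = ℤ.+-injective (sym (trans total (trans
      (cong₂ (λ a b → a ℤ.+ b ℤ.+ + 2) (trans (ℤ.i-j≡0⇒i≡j p m p-m) (sym (∣tabulate∣ neg? id))) (sym (∣tabulate∣ neg? id)))
      (cong (λ z → + (z ℕ.+ 2)) (cong (Subset.∣ negatives ∣ ℕ.+_) (sym (ℕ.+-identityʳ Subset.∣ negatives ∣)))))))

-- Distances and density

sq-cancel : ∀ {p q} → 0ℚ ≤ q → p * p ≤ q * q → p ≤ q
sq-cancel {p} {q} 0≤q h = ≮⇒≥ λ q<p → <-irrefl refl (≤-<-trans h
  (≤-<-trans (*-mono-l 0≤q (<⇒≤ q<p)) (*-monoˡ-<-pos p {{ℚ.positive (≤-<-trans 0≤q q<p)}} q<p)))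

sqrtℚ-≤ : ∀ k {q R} → 0ℚ ≤ R → ∣ q ∣ ≤ R * R → sqrtℚ k q ≤ R
sqrtℚ-≤ k {q} 0≤R h = sq-cancel 0≤R (≤-trans (sqrtℚ-lower k q) h)

sqrtℚ-≥ : ∀ k {q d} → d * d ≤ ∣ q ∣ → d ≤ sqrtℚ k q + inv k
sqrtℚ-≥ k {q} h = sq-cancel (0≤sqrtℚ k q ⊕ 0≤inv k) (≤-trans h (sqrtℚ-upper k q))

∣∣-sq : ∀ p → ∣ p ∣ * ∣ p ∣ ≡ p * p
∣∣-sq p = go (∣p∣≡p∨∣p∣≡-p p)
  where
  eq : ∀ p → (- p) * (- p) ≡ p * p
  eq = solve-∀ ℚ-ring
  go : ∣ p ∣ ≡ p ⊎ ∣ p ∣ ≡ - p → ∣ p ∣ * ∣ p ∣ ≡ p * p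
  go (inj₁ e) = cong (λ z → z * z) e
  go (inj₂ e) = trans (cong (λ z → z * z) e) (eq p)

0≤sq : ∀ p → 0ℚ ≤ p * p
0≤sq p = ≤-trans (0≤∣p∣ p ⊗ 0≤∣p∣ p) (≤-reflexive (∣∣-sq p))

module _ {β dx dy : ℚ} where

  -- A rational substitute for the diagonal of a square of side 17/8: twice 17² is 578, at most 25²
  -- = 625.
  norm-upper : 0ℚ ≤ β → ∣ dx ∣ ≤ ι 17 * inv 7 * β → ∣ dy ∣ ≤ ι 17 * inv 7 * β → ∣ dx * dx + dy * dy ∣ ≤ (ι 25 * inv 7 * β) * (ι 25 * inv 7 * β)
  norm-upper 0≤β hx hy = ≤-trans (≤-reflexive (∣pos∣ (0≤sq dx ⊕ 0≤sq dy)))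
    (≤-trans (+-mono-≤ (sq dx hx) (sq dy hy))
      (≤-by (ι 47 * inv 63 * (β * β)) ((0≤ι 47 ⊗ 0≤inv 63) ⊗ (0≤β ⊗ 0≤β)) (eq β)))
    where
    sq : ∀ d → ∣ d ∣ ≤ ι 17 * inv 7 * β → d * d ≤ (ι 17 * inv 7 * β) * (ι 17 * inv 7 * β)
    sq d h = ≤-trans (≤-reflexive (sym (∣∣-sq d))) (*-mono (0≤∣p∣ d) (≤-trans (0≤∣p∣ d) h) h h)
    eq : ∀ β → (ι 25 * inv 7 * β) * (ι 25 * inv 7 * β) ≡
      ((ι 17 * inv 7 * β) * (ι 17 * inv 7 * β) + (ι 17 * inv 7 * β) * (ι 17 * inv 7 * β)) + ι 47 * inv 63 * (β * β)
    eq = solve-∀ ℚ-ring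

  norm-lower : ∀ {d} → 0ℚ ≤ d → d ≤ ∣ dx ∣ ⊎ d ≤ ∣ dy ∣ → d * d ≤ ∣ dx * dx + dy * dy ∣
  norm-lower {d} 0≤d h = ≤-trans (go h) (≤-reflexive (sym (∣pos∣ (0≤sq dx ⊕ 0≤sq dy))))
    where
    sq : ∀ e → d ≤ ∣ e ∣ → d * d ≤ e * e
    sq e h = ≤-trans (*-mono 0≤d (0≤∣p∣ e) h h) (≤-reflexive (∣∣-sq e))
    go : d ≤ ∣ dx ∣ ⊎ d ≤ ∣ dy ∣ → d * d ≤ dx * dx + dy * dy
    go (inj₁ h) = ≤-trans (sq dx h) (p≤p+q (0≤sq dy))
    go (inj₂ h) = ≤-trans (sq dy h) (p≤q+p (0≤sq dx))

lookup-injective : ∀ {A : Set} {xs : List.List A} → Unique xs → ∀ {i j} → lookup xs i ≡ lookup xs j → i ≡ j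
lookup-injective (_ ∷ _) {Fin.zero}  {Fin.zero}  _ = refl
lookup-injective (x∉ ∷ _) {Fin.zero} {Fin.suc j} e = contradiction e (All.lookup x∉ (∈-lookup j))
lookup-injective (x∉ ∷ _) {Fin.suc i} {Fin.zero} e = contradiction (sym e) (All.lookup x∉ (∈-lookup i))
lookup-injective (_ ∷ u) {Fin.suc i} {Fin.suc j} e = cong Fin.suc (lookup-injective u e)

-- The numerical core of 4-density: a diameter of at most 25/8 b against 4 times (1 - 1/64) b times
-- 55/64, where 55/64 is the least distance 7/8 reduced by the error 1/64 of a truncated root.
25/8≤ : ι 25 * inv 7 ≤ ι 4 * (1ℚ - inv 63) * (ι 55 * inv 63)
25/8≤ = from-yes (ι 25 * inv 7 ≤? ι 4 * (1ℚ - inv 63) * (ι 55 * inv 63))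

dense-bound : ∀ {β s₁ s₂ s₃} → 1ℚ ≤ β → s₃ ≤ ι 25 * inv 7 * β → β ≤ s₁ + inv 63 → 1ℚ - inv 7 ≤ s₂ + inv 63 →
              0ℚ ≤ s₁ → s₃ ≤ ι 4 * s₁ * s₂
dense-bound {β} {s₁} {s₂} {s₃} 1≤β h₃ h₁ h₂ 0≤s₁ = begin
  s₃                                                ≤⟨ h₃ ⟩
  ι 25 * inv 7 * β                                  ≤⟨ *-mono-r 0≤β 25/8≤ ⟩
  ι 4 * (1ℚ - inv 63) * (ι 55 * inv 63) * β         ≡⟨ eq₁ β (inv 63) ⟩
  ι 4 * (β - β * inv 63) * (ι 55 * inv 63)          ≤⟨ *-mono-r (0≤ι 55 ⊗ 0≤inv 63) (*-mono-l (0≤ι 4) s₁≥) ⟩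
  ι 4 * s₁ * (ι 55 * inv 63)                        ≤⟨ *-mono-l (0≤ι 4 ⊗ 0≤s₁) s₂≥ ⟩
  ι 4 * s₁ * s₂                                     ∎
  where
  open ≤-Reasoning
  0≤β : 0ℚ ≤ β
  0≤β = ≤-trans (<⇒≤ 0<1) 1≤β
  eq₁ : ∀ β t → ι 4 * (1ℚ - t) * (ι 55 * t) * β ≡ ι 4 * (β - β * t) * (ι 55 * t)
  eq₁ = solve-∀ ℚ-ring
  s₁≥ : β - β * inv 63 ≤ s₁
  s₁≥ = ≤-by ((s₁ + inv 63 - β) + (β - 1ℚ) * inv 63) (0≤- h₁ ⊕ 0≤- 1≤β ⊗ 0≤inv 63) (eq β s₁ (inv 63))
    where
    eq : ∀ β s t → s ≡ (β - β * t) + ((s + t - β) + (β - 1ℚ) * t)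
    eq = solve-∀ ℚ-ring
  s₂≥ : ι 55 * inv 63 ≤ s₂
  s₂≥ = ≤-trans (from-yes (ι 55 * inv 63 ≤? 1ℚ - inv 7 - inv 63)) (≤-by (s₂ + inv 63 - (1ℚ - inv 7)) (0≤- h₂) (eq s₂ (inv 63) (1ℚ - inv 7)))
    where
    eq : ∀ s t v → s ≡ (v - t) + (s + t - v)
    eq = solve-∀ ℚ-ring

-- From a configuration to a set of points in the plane

module Realize {n b : ℕ} (C : Configuration n b) (δ : ℚ) (0<δ : 0ℚ < δ) (δ≤ : δ ≤ 𝟙/32)
               (st : ∀ i j k → Stable δ (Configuration.pos C i) (Configuration.pos C j) (Configuration.pos C k))
               (good : Generic.Good (finᶠ n) (Configuration.pos C) δ 0<δ (elems (finᶠ n))) where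

  open Configuration C
  open Generic.Good good using (near) renaming (pos to pos′)

  x-distinct : ∀ {i j} → i ≢ j → proj₁ (pos′ i) ≢ proj₁ (pos′ j)
  x-distinct {i} {j} = Generic.Good.x-distinct good (complete (finᶠ n) i) (complete (finᶠ n) j)

  general : ∀ {i j k} → i ≢ j → i ≢ k → j ≢ k → orient (pos′ i) (pos′ j) (pos′ k) ≢ 0ℚ
  general {i} {j} {k} = Generic.Good.general good (complete (finᶠ n) i) (complete (finᶠ n) j) (complete (finᶠ n) k)

  P : PointSet n
  P = record
    { pt = λ i → point (pos′ i)
    ; distinct = λ {i} {j} i≢j (ex , _) → x-distinct i≢j
        (constant-≈⁻¹ {fromℚ (proj₁ (pos′ i))} {fromℚ (proj₁ (pos′ j))} (λ _ → refl) (λ _ → refl) ex)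
    }

  generalPosition : GeneralPosition P
  generalPosition {i} {j} {k} i≢j i≢k j≢k = not-collinear (pos′ i) (pos′ j) (pos′ k) (general i≢j i≢k j≢k)

  private
    β : ℚ
    β = ι b

    1≤β : 1ℚ ≤ β
    1≤β = ι-mono {1} {b} 1≤b

    0≤β : 0ℚ ≤ β
    0≤β = ≤-trans (<⇒≤ 0<1) 1≤β

    bound′ : ∀ {x x′} → ∣ x ∣ ≤ β + 𝟙/32 → ∣ x′ - x ∣ ≤ δ → ∣ x′ ∣ ≤ β + 𝟙/32 + 𝟙/32
    bound′ {x} {x′} h d = ≤-trans (∣∣≤∣∣+∣-∣ x′ x) (+-mono-≤ h (≤-trans d δ≤))

    -- The margins 1/32 of the lift and of the perturbation add up to 1/8 for a difference; this is
    -- absorbed into the coefficient since 1 ≤ `β`.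
    spread : ∀ {x y} → ∣ x ∣ ≤ β + 𝟙/32 + 𝟙/32 → ∣ y ∣ ≤ β + 𝟙/32 + 𝟙/32 → ∣ x - y ∣ ≤ ι 17 * inv 7 * β
    spread {x} {y} hx hy = ≤-trans (∣+∣≤ {x} {(- y)} hx (∣-∣≤ {y} hy))
      (≤-by (inv 7 * (β - 1ℚ)) (0≤inv 7 ⊗ 0≤- 1≤β) (eq β))
      where
      eq : ∀ β → ι 17 * inv 7 * β ≡ (β + 𝟙/32 + 𝟙/32 + (β + 𝟙/32 + 𝟙/32)) + inv 7 * (β - 1ℚ)
      eq = solve-∀ ℚ-ring

    7/8 : ℚ
    7/8 = 1ℚ - inv 7

    gap : ∀ {x y x′ y′} → ∣ x′ - x ∣ ≤ δ → ∣ y′ - y ∣ ≤ δ → 1ℚ - 𝟙/16 ≤ ∣ x - y ∣ → 7/8 ≤ ∣ x′ - y′ ∣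
    gap {x} {y} {x′} {y′} hx hy h = ≤-by ((∣ x′ - y′ ∣ + (𝟙/32 + 𝟙/32)) - (1ℚ - 𝟙/16))
      (0≤- (≤-trans h (≤-trans (∣∣≤∣∣+∣-∣ (x - y) (x′ - y′)) (+-monoʳ-≤ (∣ x′ - y′ ∣)
        (≤-trans (≤-reflexive (∣-∣-sym (x - y) (x′ - y′)))
          (≤-trans (diff-near {y} {x} {y′} {x′} hy hx) (+-mono-≤ δ≤ δ≤)))))))
      (eq (∣ x′ - y′ ∣))
      where
      eq : ∀ d → d ≡ (1ℚ - inv 7) + ((d + (𝟙/32 + 𝟙/32)) - (1ℚ - 𝟙/16))
      eq = solve-∀ ℚ-ring

    0≤7/8 : 0ℚ ≤ 7/8
    0≤7/8 = from-yes (0ℚ ≤? 1ℚ - inv 7)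

    sq-dist : Fin n → Fin n → ℚ
    sq-dist i j = let (x₁ , y₁) = pos′ i ; (x₂ , y₂) = pos′ j in (x₁ - x₂) * (x₁ - x₂) + (y₁ - y₂) * (y₁ - y₂)

    far-dist : ∀ i j → ∣ sq-dist i j ∣ ≤ (ι 25 * inv 7 * β) * (ι 25 * inv 7 * β)
    far-dist i j = norm-upper {β} {proj₁ (pos′ i) - proj₁ (pos′ j)} {proj₂ (pos′ i) - proj₂ (pos′ j)} 0≤β
      (spread {proj₁ (pos′ i)} {proj₁ (pos′ j)} (bound′ {proj₁ (pos i)} (x-bound i) (proj₁ (near i))) (bound′ {proj₁ (pos j)} (x-bound j) (proj₁ (near j))))
      (spread {proj₂ (pos′ i)} {proj₂ (pos′ j)} (bound′ {proj₂ (pos i)} (y-bound i) (proj₂ (near i))) (bound′ {proj₂ (pos j)} (y-bound j) (proj₂ (near j))))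

    near-dist : ∀ {i j} → i ≢ j → 7/8 * 7/8 ≤ ∣ sq-dist i j ∣
    near-dist {i} {j} i≢j = norm-lower {β} {proj₁ (pos′ i) - proj₁ (pos′ j)} {proj₂ (pos′ i) - proj₂ (pos′ j)} 0≤7/8 (go (apart i≢j))
      where
      go : 1ℚ - 𝟙/16 ≤ ∣ proj₁ (pos i) - proj₁ (pos j) ∣ ⊎ 1ℚ - 𝟙/16 ≤ ∣ proj₂ (pos i) - proj₂ (pos j) ∣ →
           7/8 ≤ ∣ proj₁ (pos′ i) - proj₁ (pos′ j) ∣ ⊎ 7/8 ≤ ∣ proj₂ (pos′ i) - proj₂ (pos′ j) ∣
      go (inj₁ h) = inj₁ (gap {proj₁ (pos i)} {proj₁ (pos j)} {proj₁ (pos′ i)} {proj₁ (pos′ j)} (proj₁ (near i)) (proj₁ (near j)) h)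
      go (inj₂ h) = inj₂ (gap {proj₂ (pos i)} {proj₂ (pos j)} {proj₂ (pos′ i)} {proj₂ (pos′ j)} (proj₂ (near i)) (proj₂ (near j)) h)

  dense : Dense (fromℕ 4) P
  -- From index 63 on, `sqrtℚ` falls short of the true root by at most 1/64.
  dense {i} {j} {k} {l} i≢j k≢l ε 0<ε = 63 , λ {m} 63≤m → ≤-trans
    (dense-bound {β} {sqrtℚ m (ι n)} {sqrtℚ m (sq-dist k l)} {sqrtℚ m (sq-dist i j)} 1≤β
      (sqrtℚ-≤ m ((0≤ι 25 ⊗ 0≤inv 7) ⊗ 0≤β) (far-dist i j))
      (≤-trans (sqrtℚ-≥ m (≤-trans β²≤n (≤∣∣ (ι n)))) (+-monoʳ-≤ (sqrtℚ m (ι n)) (inv-anti 63≤m)))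
      (≤-trans (sqrtℚ-≥ m (near-dist k≢l)) (+-monoʳ-≤ (sqrtℚ m (sq-dist k l)) (inv-anti 63≤m)))
      (0≤sqrtℚ m (ι n)))
    (p≤p+q (<⇒≤ 0<ε))
    where
    β²≤n : β * β ≤ ι n
    β²≤n = ≤-trans (≤-reflexive (sym (ι-* b b))) (ι-mono b²≤n)

  module HalvingLines (e : ∥ E ∥) where

    i j : Fin n
    i = end₁ e
    j = end₂ e

    open Through (pos′ i) (pos′ j) (x-distinct (ends-distinct e)) public
    open HalvingPair (halving e) using (off; balanced)

    f : Fin n → ℚ
    f k = orient (pos′ i) (pos′ j) (pos′ k)

    same-sign : ∀ k → sgn (f k) ≡ sgn (orient (pos i) (pos j) (pos k))
    same-sign k = go (k Fin.≟ i) (k Fin.≟ j)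
      where
      go : Dec (k ≡ i) → Dec (k ≡ j) → sgn (f k) ≡ sgn (orient (pos i) (pos j) (pos k))
      go (yes refl) _ = trans (sgn-zero (orient-left (pos′ i) (pos′ j))) (sym (sgn-zero (orient-left (pos i) (pos j))))
      go (no _) (yes refl) = trans (sgn-zero (orient-right (pos′ i) (pos′ j))) (sym (sgn-zero (orient-right (pos i) (pos j))))
      go (no k≢i) (no k≢j) = st i j k (off k k≢i k≢j) (pos′ i) (pos′ j) (pos′ k) (near i) (near j) (near k)

    open Count f

    halvingLine : HalvingLine P line
    halvingLine = (i , j , ends-distinct e , on⁺ (pos′ i) (orient-left (pos′ i) (pos′ j)) , on⁺ (pos′ j) (orient-right (pos′ i) (pos′ j))) ,
      Subset.∣ negatives ∣ , 2∣negatives∣+2≡n ends fi fj general′ bal ,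
      (negatives , (λ k → mk⇔ (λ k∈ → side⁻ (pos′ k) (does⇒ (f k <? 0ℚ) (trans (sym (Vec.lookup∘tabulate neg? k)) (Vec.[]=⇒lookup k∈))))
                              (λ h → Vec.lookup⇒[]= k negatives (trans (Vec.lookup∘tabulate neg? k) (⇒does (f k <? 0ℚ) (side⁻⁻¹ (pos′ k) h))))) , refl) ,
      (positives , (λ k → mk⇔ (λ k∈ → side⁺ (pos′ k) (does⇒ (0ℚ <? f k) (trans (sym (Vec.lookup∘tabulate pos? k)) (Vec.[]=⇒lookup k∈))))
                              (λ h → Vec.lookup⇒[]= k positives (trans (Vec.lookup∘tabulate pos? k) (⇒does (0ℚ <? f k) (side⁺⁻¹ (pos′ k) h))))) ,
        ∣positives∣≡∣negatives∣ ends fi fj general′ bal)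
      where
      ends = ends-distinct e
      fi = orient-left (pos′ i) (pos′ j)
      fj = orient-right (pos′ i) (pos′ j)
      general′ : ∀ k → k ≢ i → k ≢ j → f k ≢ 0ℚ
      general′ k k≢i k≢j = general ends (λ e → k≢i (sym e)) (λ e → k≢j (sym e))
      bal : ∑ (finᶠ n) (sgn ∘ f) ≡ 0ℤ
      bal = trans (∑-cong (finᶠ n) same-sign) balanced

  halvingLines : HalvingLines≥ P (size E)
  halvingLines = (λ k → HalvingLines.line (edge k)) , (λ k → HalvingLines.halvingLine (edge k)) , distinct-lines
    where
    edge : Fin (size E) → ∥ E ∥
    edge = lookup (elems E)
    -- If the lines coincided, an end of one edge that is no end of the other would be a third point
    -- on the line of the other, against general position.
    distinct-lines : ∀ {k l} → k ≢ l → ¬ (HalvingLines.line (edge k) ≈ᴸ HalvingLines.line (edge l))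
    distinct-lines {k} {l} k≢l same =
      let (p , p-end , p≢₁ , p≢₂) = distinct {edge k} {edge l} (λ e → k≢l (lookup-injective (unique E) e))
      in general (ends-distinct (edge k)) (λ e → p≢₁ (sym e)) (λ e → p≢₂ (sym e))
           (HalvingLines.on⁻ (edge k) (pos′ p) (Equivalence.from (same (point (pos′ p))) (end-on p-end)))
      where
      end-on : ∀ {p} → p ≡ end₁ (edge l) ⊎ p ≡ end₂ (edge l) → point (pos′ p) on HalvingLines.line (edge l)
      end-on (inj₁ refl) = HalvingLines.on⁺ (edge l) _ (orient-left (pos′ (end₁ (edge l))) (pos′ (end₂ (edge l))))
      end-on (inj₂ refl) = HalvingLines.on⁺ (edge l) _ (orient-right (pos′ (end₁ (edge l))) (pos′ (end₂ (edge l))))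

  realized : Σ[ P ∈ PointSet n ] GeneralPosition P × Dense (fromℕ 4) P × HalvingLines≥ P (size E)
  realized = P , (λ {i} {j} {k} → generalPosition {i} {j} {k}) , (λ {i} {j} {k} {l} → dense {i} {j} {k} {l}) , halvingLines

realize : ∀ {n b} (C : Configuration n b) → Σ[ P ∈ PointSet n ] GeneralPosition P × Dense (fromℕ 4) P × HalvingLines≥ P (size (Configuration.E C))
realize {n} C =
  let (δ₀ , 0<δ₀ , st) = stable-all (finᶠ n) pos
      (δ , 0<δ , δ≤δ₀ , δ≤𝟙/32) = min-pos 0<δ₀ (inv>0 31)
  in Realize.realized C δ 0<δ δ≤𝟙/32
       (λ i j k o≢0 p q r h₁ h₂ h₃ → st i j k o≢0 p q r
         (near-mono {p = pos i} {p} δ≤δ₀ h₁) (near-mono {p = pos j} {q} δ≤δ₀ h₂) (near-mono {p = pos k} {r} δ≤δ₀ h₃))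
       (Generic.perturbed (finᶠ n) pos δ 0<δ)
  where open Configuration C

-- Layouts over finite index types, and the plain grid

-- The geometric content of a `Configuration`, but over any finite index type, so that constructions
-- may use sums and products of types; enumeration leads back to `Fin n`.
record Layout (b : ℕ) : Set₁ where
  field
    I   : Finite
    pos : ∥ I ∥ → ℚ × ℚ
    x-bound : ∀ i → ∣ proj₁ (pos i) ∣ ≤ ι b + 𝟙/32
    y-bound : ∀ i → ∣ proj₂ (pos i) ∣ ≤ ι b + 𝟙/32
    apart  : ∀ {i j} → i ≢ j → 1ℚ - 𝟙/16 ≤ ∣ proj₁ (pos i) - proj₁ (pos j) ∣ ⊎ 1ℚ - 𝟙/16 ≤ ∣ proj₂ (pos i) - proj₂ (pos j) ∣
    E      : Finite
    end₁ end₂ : ∥ E ∥ → ∥ I ∥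
    ends-distinct : ∀ e → end₁ e ≢ end₂ e
    halving  : ∀ e → HalvingPair I pos (end₁ e) (end₂ e)
    distinct : ∀ {e e′} → e ≢ e′ → Σ[ p ∈ ∥ I ∥ ] ((p ≡ end₁ e′ ⊎ p ≡ end₂ e′) × p ≢ end₁ e × p ≢ end₂ e)

module _ {b : ℕ} (Λ : Layout b) where

  open Layout Λ

  private
    n : ℕ
    n = size I

    at : Fin n → ∥ I ∥
    at = lookup (elems I)

    toFin : ∥ I ∥ → Fin n
    toFin x = Any.index (complete I x)

    at-toFin : ∀ x → at (toFin x) ≡ x
    at-toFin x = sym (Any.lookup-index (complete I x))

    toFin-at : ∀ i → toFin (at i) ≡ i
    toFin-at i = lookup-injective (unique I) (at-toFin (at i))

    toFin-injective : ∀ {x y} → toFin x ≡ toFin y → x ≡ y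
    toFin-injective {x} {y} e = trans (sym (at-toFin x)) (trans (cong at e) (at-toFin y))

    at≢ : ∀ {i x} → i ≢ toFin x → at i ≢ x
    at≢ {i} ne e = ne (trans (sym (toFin-at i)) (cong toFin e))

    ∑-at : ∀ f → ∑ (finᶠ n) (f ∘ at) ≡ ∑ I f
    ∑-at f = trans (sym (∑ˡ-map at (List.allFin n) f))
      (cong (λ xs → ∑ˡ xs f) (trans (List.map-tabulate (λ i → i) at) (List.tabulate-lookup (elems I))))

  configuration : 1 ℕ.≤ b → b ℕ.* b ℕ.≤ size I → Configuration (size I) b
  configuration 1≤b b²≤n = record
    { 1≤b = 1≤b ; b²≤n = b²≤n
    ; pos = pos ∘ at
    ; x-bound = x-bound ∘ at
    ; y-bound = y-bound ∘ at
    ; apart = λ {i} {j} i≢j → apart λ e → i≢j (lookup-injective (unique I) e)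
    ; E = E
    ; end₁ = toFin ∘ end₁
    ; end₂ = toFin ∘ end₂
    ; ends-distinct = λ e h → ends-distinct e (toFin-injective h)
    ; halving = halving′
    ; distinct = λ e≢ → let (p , p-end , p≢₁ , p≢₂) = distinct e≢ in
        toFin p , [ inj₁ ∘ cong toFin , inj₂ ∘ cong toFin ]′ p-end , (λ h → p≢₁ (toFin-injective h)) , (λ h → p≢₂ (toFin-injective h))
    }
    where
    halving′ : ∀ e → HalvingPair (finᶠ n) (pos ∘ at) (toFin (end₁ e)) (toFin (end₂ e))
    halving′ e = record
      { off = λ k h₁ h₂ o → HalvingPair.off (halving e) (at k) (at≢ h₁) (at≢ h₂)
          (trans (cong₂ (λ p q → orient (pos p) (pos q) (pos (at k))) (sym (at-toFin (end₁ e))) (sym (at-toFin (end₂ e)))) o)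
      ; balanced = trans (cong₂ (λ p q → ∑ (finᶠ n) (λ k → sgn (orient (pos p) (pos q) (pos (at k))))) (at-toFin (end₁ e)) (at-toFin (end₂ e)))
          (trans (∑-at (λ k → sgn (orient (pos (end₁ e)) (pos (end₂ e)) (pos k)))) (HalvingPair.balanced (halving e)))
      }

module Grid (b : ℕ) where

  column row : ℕ → ℕ
  column i = i ℕ.% suc b
  row    i = i ℕ./ suc b

  column≤ : ∀ i → column i ℕ.≤ b
  column≤ i = ℕ.s≤s⁻¹ (ℕ.m%n<n i (suc b))

  row≤ : ∀ {i r} → i ℕ.< r ℕ.* suc b ℕ.+ suc b → row i ℕ.≤ r
  row≤ {i} {r} h = ℕ.s≤s⁻¹ (ℕ.m<n*o⇒m/o<n (subst (i ℕ.<_) (ℕ.+-comm (r ℕ.* suc b) (suc b)) h))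

  grid-injective : ∀ {i j} → column i ≡ column j → row i ≡ row j → i ≡ j
  grid-injective {i} {j} e e′ = trans (ℕ.m≡m%n+[m/n]*n i (suc b))
    (trans (cong₂ (λ c r → c ℕ.+ r ℕ.* suc b) e e′) (sym (ℕ.m≡m%n+[m/n]*n j (suc b))))

  grid-apart : ∀ {i j} → i ≢ j → column i ≢ column j ⊎ row i ≢ row j
  grid-apart {i} {j} i≢j = go (column i ℕ.≟ column j)
    where
    go : Dec (column i ≡ column j) → column i ≢ column j ⊎ row i ≢ row j
    go (no ne) = inj₁ ne
    go (yes e) = inj₂ λ e′ → i≢j (grid-injective e e′)

ι-apart : ∀ {m n} → m ≢ n → 1ℚ ≤ ∣ ι m - ι n ∣
ι-apart {m} {n} ne = go (ι-compare m n)
  where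
  go : (m ≡ n) ⊎ (1ℚ ≤ ι m - ι n) ⊎ (1ℚ ≤ ι n - ι m) → 1ℚ ≤ ∣ ι m - ι n ∣
  go (inj₁ e)        = contradiction e ne
  go (inj₂ (inj₁ h)) = ∣∣≥1 h
  go (inj₂ (inj₂ h)) = subst (1ℚ ≤_) (∣-∣-sym (ι n) (ι m)) (∣∣≥1 h)

1-𝟙/16≤1 : 1ℚ - 𝟙/16 ≤ 1ℚ
1-𝟙/16≤1 = ≤-by 𝟙/16 (0≤inv 15) (eq 𝟙/16)
  where
  eq : ∀ t → 1ℚ ≡ 1ℚ - t + t
  eq = solve-∀ ℚ-ring

-- Below the threshold no halving lines are demanded, and part of a square grid suffices.
gridLayout : ∀ n b → n ℕ.< suc b ℕ.* suc b → Layout b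
gridLayout n b n<[1+b]² = record
  { I = finᶠ n
  ; pos = λ i → ι (column (toℕ i)) , ι (row (toℕ i))
  ; x-bound = λ i → ι-bound (column≤ (toℕ i))
  ; y-bound = λ i → ι-bound (row≤ {toℕ i} {b} (ℕ.<-trans (Fin.toℕ<n i) (subst (n ℕ.<_) (ℕ.+-comm (suc b) (b ℕ.* suc b)) n<[1+b]²)))
  ; apart = λ i≢j → [ (λ ne → inj₁ (≤-trans 1-𝟙/16≤1 (ι-apart ne))) , (λ ne → inj₂ (≤-trans 1-𝟙/16≤1 (ι-apart ne))) ]′
      (grid-apart (i≢j ∘ Fin.toℕ-injective))
  ; E = finᶠ 0
  ; end₁ = λ () ; end₂ = λ () ; ends-distinct = λ () ; halving = λ () ; distinct = λ { {()} }
  }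
  where
  open Grid b
  ι-bound : ∀ {k} → k ℕ.≤ b → ∣ ι k ∣ ≤ ι b + 𝟙/32
  ι-bound {k} h = ≤-trans (≤-reflexive (∣pos∣ (0≤ι k))) (≤-trans (ι-mono h) (p≤p+q (0≤inv 31)))

-- Assembly of flattened copies, their counterparts and fillers

*-≢0 : ∀ {p q} → p ≢ 0ℚ → q ≢ 0ℚ → p * q ≢ 0ℚ
*-≢0 {p} {q} p≢0 q≢0 = ∣∣>0⇒≢0 (subst (0ℚ <_) (sym (∣p*q∣≡∣p∣*∣q∣ p q)) (0<* (∣∣-≢0 p≢0) (∣∣-≢0 q≢0)))

1≤∣∣⇒≢0 : ∀ {p} → 1ℚ ≤ ∣ p ∣ → p ≢ 0ℚ
1≤∣∣⇒≢0 h = ∣∣>0⇒≢0 (<-≤-trans 0<1 h)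

digits-injective : ∀ {N a a′ i i′} → i ℕ.< N → i′ ℕ.< N → N ℕ.* a ℕ.+ i ≡ N ℕ.* a′ ℕ.+ i′ → i ≡ i′ × a ≡ a′
digits-injective {N} {a} {a′} {i} {i′} i<N i′<N e = i≡i′ ,
  ℕ.*-cancelˡ-≡ a a′ N (ℕ.+-cancelʳ-≡ i′ (N ℕ.* a) (N ℕ.* a′) (trans (cong (N ℕ.* a ℕ.+_) (sym i≡i′)) e))
  where
  instance
    N≢0 : NonZero N
    N≢0 = ℕ.>-nonZero (ℕ.≤-<-trans ℕ.z≤n i<N)
  rem : ∀ a {i} → i ℕ.< N → (N ℕ.* a ℕ.+ i) ℕ.% N ≡ i
  rem a {i} i<N = trans (cong (ℕ._% N) (trans (ℕ.+-comm (N ℕ.* a) i) (cong (i ℕ.+_) (ℕ.*-comm N a))))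
    (trans (ℕ.[m+kn]%n≡m%n i a N) (ℕ.m<n⇒m%n≡m i<N))
  i≡i′ : i ≡ i′
  i≡i′ = trans (sym (rem a i<N)) (trans (cong (ℕ._% N) e) (rem a′ i′<N))

-- There are `G * J` copies, in `J` different translates, with abscissae between `L` and 2`L` by
-- `fit`. The condition on 16`G` keeps all slopes below 1/8, `b` < 8`L` keeps the lines below the
-- upper fillers, 2`L` ≤ `b` keeps the copies in the square, and `rows` provides room for the
-- fillers.
module Assembly (T : Pattern) (G J L b u d : ℕ) {{_ : NonZero J}} (2≤L : 2 ℕ.≤ L)
                (fit : size (Pattern.P T) ℕ.* J ℕ.+ size (Pattern.P T) ℕ.* Pattern.W T ℕ.≤ L) (16G≤L : G ℕ.* 16 ℕ.≤ L) (b<8L : b ℕ.< L ℕ.* 8) (2L≤b : L ℕ.+ L ℕ.≤ b)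
                (u≡d+N : u ≡ d ℕ.+ size (Pattern.P T)) (rows : u ℕ.≤ (b ℕ.∸ L) ℕ.* suc b ℕ.+ suc b) where

  open Pattern T hiding (pos; halving; distinct)
  open Grid b

  N : ℕ
  N = size P

  C I : Finite
  C = finᶠ (G ℕ.* J)
  I = ((C ×ᶠ P) ⊎ᶠ (C ×ᶠ P)) ⊎ᶠ (finᶠ u ⊎ᶠ finᶠ d)

  pattern right κ p = inj₁ (inj₁ (κ , p))
  pattern left κ p  = inj₁ (inj₂ (κ , p))
  pattern up i      = inj₂ (inj₁ i)
  pattern down i    = inj₂ (inj₂ i)

  shift ξ : ∥ C ∥ → ∥ P ∥ → ℕ
  shift κ p = N ℕ.* (toℕ κ ℕ.% J) ℕ.+ X p
  ξ κ p = L ℕ.+ shift κ p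

  shift≤L : ∀ κ p → shift κ p ℕ.≤ L
  shift≤L κ p = ℕ.≤-trans (ℕ.+-mono-≤ (ℕ.*-monoʳ-≤ N (ℕ.<⇒≤ (ℕ.m%n<n (toℕ κ) J))) (ℕ.<⇒≤ X<NW)) fit
    where
    X<NW : X p ℕ.< N ℕ.* W
    X<NW = ℕ.<-≤-trans (ℕ.+-monoʳ-< (N ℕ.* quot p) (idx<N p))
      (ℕ.≤-trans (ℕ.≤-reflexive (trans (ℕ.+-comm (N ℕ.* quot p) N) (sym (ℕ.*-suc N (quot p))))) (ℕ.*-monoʳ-≤ N (quot<W p)))

  -- The last digit in base `N` is `idx p`, which identifies `p`. Once `p` is known, so is `quot p`,
  -- and what remains of the leading part is the translate.
  ξ-injective : ∀ {κ κ′ p p′} → ξ κ p ≡ ξ κ′ p′ → p ≡ p′ × toℕ κ ℕ.% J ≡ toℕ κ′ ℕ.% J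
  ξ-injective {κ} {κ′} {p} {p′} e = p≡p′ , ℕ.+-cancelʳ-≡ (quot p′) _ _ (trans (cong (λ q → toℕ κ ℕ.% J ℕ.+ quot q) (sym p≡p′)) (proj₂ dd))
    where
    regroup : ∀ κ p → shift κ p ≡ N ℕ.* (toℕ κ ℕ.% J ℕ.+ quot p) ℕ.+ idx p
    regroup κ p = trans (sym (ℕ.+-assoc (N ℕ.* (toℕ κ ℕ.% J)) (N ℕ.* quot p) (idx p)))
      (cong (ℕ._+ idx p) (sym (ℕ.*-distribˡ-+ N (toℕ κ ℕ.% J) (quot p))))
    dd = digits-injective {N} {toℕ κ ℕ.% J ℕ.+ quot p} {toℕ κ′ ℕ.% J ℕ.+ quot p′} (idx<N p) (idx<N p′)
      (trans (sym (regroup κ p)) (trans (ℕ.+-cancelˡ-≡ L (shift κ p) (shift κ′ p′) e) (regroup κ′ p′)))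
    p≡p′ : p ≡ p′
    p≡p′ = idx-injective (proj₁ dd)

  -- The copy κ lies along the line of slope 2κ/(JL) through the origin, on its right half, and is balanced
  -- by N points on the left half of the line of slope (2κ + 1)/(JL).
  η : ℚ
  η = recip {ι (J ℕ.* L)} 0<JL
    where
    0<JL : 0ℚ < ι (J ℕ.* L)
    0<JL = ι-mono-< {0} (ℕ.*-mono-< {0} {J} {0} {L} (ℕ.>-nonZero⁻¹ J) (ℕ.<-≤-trans (ℕ.s≤s ℕ.z≤n) 2≤L))

  0<η : 0ℚ < η
  0<η = 0<recip (ι-mono-< {0} (ℕ.*-mono-< {0} {J} {0} {L} (ℕ.>-nonZero⁻¹ J) (ℕ.<-≤-trans (ℕ.s≤s ℕ.z≤n) 2≤L)))

  0≤η : 0ℚ ≤ η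
  0≤η = <⇒≤ 0<η

  JLη : ι J * ι L * η ≡ 1ℚ
  JLη = trans (cong (_* η) (sym (ι-* J L))) (*-recip (ι-mono-< {0} (ℕ.*-mono-< {0} {J} {0} {L} (ℕ.>-nonZero⁻¹ J) (ℕ.<-≤-trans (ℕ.s≤s ℕ.z≤n) 2≤L))))

  sR sL : ∥ C ∥ → ℚ
  sR κ = η * (ι 2 * ι (toℕ κ))
  sL κ = η * (ι 2 * ι (toℕ κ) + 1ℚ)

  0≤sR : ∀ κ → 0ℚ ≤ sR κ
  0≤sR κ = 0≤η ⊗ (0≤ι 2 ⊗ 0≤ι (toℕ κ))

  sR≤sL : ∀ κ → sR κ ≤ sL κ
  sR≤sL κ = *-mono-l 0≤η (p≤p+q (<⇒≤ 0<1))

  0≤sL : ∀ κ → 0ℚ ≤ sL κ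
  0≤sL κ = ≤-trans (0≤sR κ) (sR≤sL κ)

  8sL≤1 : ∀ κ → ι 8 * sL κ ≤ 1ℚ
  8sL≤1 κ = begin
    ι 8 * (η * (ι 2 * ι k + 1ℚ))          ≡⟨ eq η (ι k) ⟩
    η * (ι 16 * ι k + ι 8)                ≤⟨ *-mono-l 0≤η (+-monoʳ-≤ (ι 16 * ι k) (ι-mono {8} {16} (ℕ.m≤m+n 8 8))) ⟩
    η * (ι 16 * ι k + ι 16)               ≡⟨ cong (η *_) (eq′ (ι k)) ⟩
    η * ((1ℚ + ι k) * ι 16)               ≡⟨ cong (λ z → η * (z * ι 16)) (ι-suc k) ⟨
    η * (ι (suc k) * ι 16)                ≡⟨ cong (η *_) (ι-* (suc k) 16) ⟨
    η * ι (suc k ℕ.* 16)                  ≤⟨ *-mono-l 0≤η (ι-mono bound) ⟩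
    η * ι (J ℕ.* L)                       ≡⟨ trans (*-comm η (ι (J ℕ.* L))) (trans (cong (_* η) (ι-* J L)) JLη) ⟩
    1ℚ                                    ∎
    where
    open ≤-Reasoning
    k = toℕ κ
    eq : ∀ η k → ι 8 * (η * (ι 2 * k + 1ℚ)) ≡ η * (ι 16 * k + ι 8)
    eq = solve-∀ ℚ-ring
    eq′ : ∀ k → ι 16 * k + ι 16 ≡ (1ℚ + k) * ι 16
    eq′ = solve-∀ ℚ-ring
    bound : suc k ℕ.* 16 ℕ.≤ J ℕ.* L
    bound = ℕ.≤-trans (ℕ.*-monoˡ-≤ 16 (Fin.toℕ<n κ)) (ℕ.≤-trans (ℕ.≤-reflexive (trans (cong (ℕ._* 16) (ℕ.*-comm G J)) (ℕ.*-assoc J G 16))) (ℕ.*-monoʳ-≤ J 16G≤L))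

  px py : ∥ I ∥ → ℚ
  px (right κ p) = ι (ξ κ p)
  px (left κ p)  = - ι (ξ κ p)
  px (up i)      = ι (column (toℕ i))
  px (down i)    = ι (column (toℕ i))
  py (right κ p) = sR κ * ι (ξ κ p)
  py (left κ p)  = sL κ * (- ι (ξ κ p))
  py (up i)      = ι (L ℕ.+ row (toℕ i))
  py (down i)    = - ι (L ℕ.+ row (toℕ i))

  L≤ξ : ∀ κ p → ι L ≤ ι (ξ κ p)
  L≤ξ κ p = ι-mono (ℕ.m≤m+n L (shift κ p))

  2≤ιL : ι 2 ≤ ι L
  2≤ιL = ι-mono 2≤L

  0<ξ : ∀ κ p → 0ℚ < ι (ξ κ p)
  0<ξ κ p = <-≤-trans (0<ι-suc 1) (≤-trans 2≤ιL (L≤ξ κ p))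

  ξ≤2L : ∀ κ p → ι (ξ κ p) ≤ ι L + ι L
  ξ≤2L κ p = ≤-trans (ι-mono (ℕ.+-monoʳ-≤ L (shift≤L κ p))) (≤-reflexive (ι-+ L L))

  2L≤ιb : ι L + ι L ≤ ι b
  2L≤ιb = ≤-trans (≤-reflexive (sym (ι-+ L L))) (ι-mono 2L≤b)

  L≤b : L ℕ.≤ b
  L≤b = ℕ.≤-trans (ℕ.m≤m+n L L) 2L≤b

  -- Slopes up to 1/8 and abscissae up to 2`L` confine the copies to a strip of half-width `L`/4,
  -- clear of the fillers, which start at height `L`.
  4∣y∣≤L : ∀ κ p {s} → 0ℚ ≤ s → s ≤ sL κ → ι 4 * (s * ι (ξ κ p)) ≤ ι L
  4∣y∣≤L κ p {s} 0≤s s≤ = ≤-by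
    (½ * ((1ℚ - ι 8 * sL κ) * ξ′ + ι 8 * (sL κ - s) * ξ′ + (ι L + ι L - ξ′)))
    (0≤½ ⊗ (0≤- (8sL≤1 κ) ⊗ 0≤ι (ξ κ p) ⊕ 0≤ι 8 ⊗ 0≤- s≤ ⊗ 0≤ι (ξ κ p) ⊕ 0≤- (ξ≤2L κ p)))
    (eq (sL κ) s ξ′ (ι L))
    where
    ξ′ = ι (ξ κ p)
    eq : ∀ t s ξ L → L ≡ ι 4 * (s * ξ) + ½ * ((1ℚ - ι 8 * t) * ξ + ι 8 * (t - s) * ξ + (L + L - ξ))
    eq = solve-∀ ℚ-ring

  4∣y∣-right : ∀ κ p → ι 4 * ∣ py (right κ p) ∣ ≤ ι L
  4∣y∣-right κ p = ≤-trans (≤-reflexive (cong (ι 4 *_) (∣pos∣ (0≤sR κ ⊗ 0≤ι (ξ κ p))))) (4∣y∣≤L κ p (0≤sR κ) (sR≤sL κ))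

  4∣y∣-left : ∀ κ p → ι 4 * ∣ py (left κ p) ∣ ≤ ι L
  4∣y∣-left κ p = ≤-trans (≤-reflexive (cong (ι 4 *_) (trans (cong ∣_∣ (eq (sL κ) (ι (ξ κ p))))
      (trans (∣-p∣≡∣p∣ (sL κ * ι (ξ κ p))) (∣pos∣ (0≤sL κ ⊗ 0≤ι (ξ κ p))))))) (4∣y∣≤L κ p (0≤sL κ) ≤-refl)
    where
    eq : ∀ s ξ → s * (- ξ) ≡ - (s * ξ)
    eq = solve-∀ ℚ-ring

  row-bound : ∀ {i} → i ℕ.< u → L ℕ.+ row i ℕ.≤ b
  row-bound {i} i<u = ℕ.≤-trans (ℕ.+-monoʳ-≤ L (row≤ {i} {b ℕ.∸ L} (ℕ.<-≤-trans i<u rows))) (ℕ.≤-reflexive (ℕ.m+[n∸m]≡n L≤b))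

  d≤u : d ℕ.≤ u
  d≤u = ℕ.≤-trans (ℕ.m≤m+n d N) (ℕ.≤-reflexive (sym u≡d+N))

  private
    quarter : ∀ {p q} → 0ℚ ≤ p → ι 4 * p ≤ q → p ≤ q
    quarter {p} {q} 0≤p h = ≤-by (ι 3 * p + (q - ι 4 * p)) (0≤ι 3 ⊗ 0≤p ⊕ 0≤- h) (eq p q)
      where
      eq : ∀ p q → q ≡ p + (ι 3 * p + (q - ι 4 * p))
      eq = solve-∀ ℚ-ring

    ∣ι∣ : ∀ k → ∣ ι k ∣ ≡ ι k
    ∣ι∣ k = ∣pos∣ (0≤ι k)

    ∣-ι∣ : ∀ k → ∣ - ι k ∣ ≡ ι k
    ∣-ι∣ k = trans (∣-p∣≡∣p∣ (ι k)) (∣ι∣ k)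

  ∣x∣≤b : ∀ i → ∣ px i ∣ ≤ ι b
  ∣x∣≤b (right κ p) = ≤-trans (≤-reflexive (∣ι∣ (ξ κ p))) (≤-trans (ξ≤2L κ p) 2L≤ιb)
  ∣x∣≤b (left κ p)  = ≤-trans (≤-reflexive (∣-ι∣ (ξ κ p))) (≤-trans (ξ≤2L κ p) 2L≤ιb)
  ∣x∣≤b (up i)      = ≤-trans (≤-reflexive (∣ι∣ (column (toℕ i)))) (ι-mono (column≤ (toℕ i)))
  ∣x∣≤b (down i)    = ≤-trans (≤-reflexive (∣ι∣ (column (toℕ i)))) (ι-mono (column≤ (toℕ i)))

  ∣y∣≤b : ∀ i → ∣ py i ∣ ≤ ι b
  ∣y∣≤b (right κ p) = ≤-trans (quarter (0≤∣p∣ (py (right κ p))) (4∣y∣-right κ p)) (ι-mono L≤b)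
  ∣y∣≤b (left κ p)  = ≤-trans (quarter (0≤∣p∣ (py (left κ p))) (4∣y∣-left κ p)) (ι-mono L≤b)
  ∣y∣≤b (up i)      = ≤-trans (≤-reflexive (∣ι∣ (L ℕ.+ row (toℕ i)))) (ι-mono (row-bound (Fin.toℕ<n i)))
  ∣y∣≤b (down i)    = ≤-trans (≤-reflexive (∣-ι∣ (L ℕ.+ row (toℕ i)))) (ι-mono (row-bound (ℕ.<-≤-trans (Fin.toℕ<n i) d≤u)))

  Apart : ∥ I ∥ → ∥ I ∥ → Set
  Apart i j = 1ℚ ≤ ∣ px i - px j ∣ ⊎ 1ℚ ≤ ∣ py i - py j ∣

  apart-sym : ∀ {i j} → Apart i j → Apart j i
  apart-sym {i} {j} (inj₁ h) = inj₁ (subst (1ℚ ≤_) (∣-∣-sym (px i) (px j)) h)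
  apart-sym {i} {j} (inj₂ h) = inj₂ (subst (1ℚ ≤_) (∣-∣-sym (py i) (py j)) h)

  -- Points of two copies with equal abscissae belong to copies whose indices differ by a multiple of J.
  index-gap : ∀ {κ κ′ : ∥ C ∥} → κ ≢ κ′ → toℕ κ ℕ.% J ≡ toℕ κ′ ℕ.% J → ι J ≤ ∣ ι (toℕ κ) - ι (toℕ κ′) ∣
  index-gap {κ} {κ′} ne e = ≤-trans (≤-reflexive (sym (*-identityʳ (ι J))))
    (≤-trans (*-mono-l (0≤ι J) (ι-apart quot≢))
    (≤-reflexive (trans (cong (_* ∣ ι g - ι g′ ∣) (sym (∣ι∣ J))) (trans (sym (∣p*q∣≡∣p∣*∣q∣ (ι J) (ι g - ι g′)))
      (cong ∣_∣ (trans (eq (ι J) (ι g) (ι g′) (ι (toℕ κ ℕ.% J))) (cong₂ _-_ (expand κ) (trans (cong (λ r → ι r + ι g′ * ι J) e) (expand κ′)))))))))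
    where
    g = toℕ κ ℕ./ J
    g′ = toℕ κ′ ℕ./ J
    quot≢ : g ≢ g′
    quot≢ e′ = ne (Fin.toℕ-injective (trans (ℕ.m≡m%n+[m/n]*n (toℕ κ) J)
      (trans (cong₂ (λ r g → r ℕ.+ g ℕ.* J) e e′) (sym (ℕ.m≡m%n+[m/n]*n (toℕ κ′) J)))))
    expand : ∀ (κ : ∥ C ∥) → ι (toℕ κ ℕ.% J) + ι (toℕ κ ℕ./ J) * ι J ≡ ι (toℕ κ)
    expand κ = trans (cong (_+_ (ι (toℕ κ ℕ.% J))) (sym (ι-* (toℕ κ ℕ./ J) J)))
      (trans (sym (ι-+ (toℕ κ ℕ.% J) (toℕ κ ℕ./ J ℕ.* J))) (cong ι (sym (ℕ.m≡m%n+[m/n]*n (toℕ κ) J))))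
    eq : ∀ J g g′ r → J * (g - g′) ≡ (r + g * J) - (r + g′ * J)
    eq = solve-∀ ℚ-ring

  -- Indices at least `J` apart give slopes at least 2/`L` apart, and the abscissae are at least
  -- `L`. This is the reason for the denominator `J * L` of the slopes: copies over the same
  -- abscissa keep their distance.
  slope-gap : ∀ {κ κ′ : ∥ C ∥} {ξ} → ι J ≤ ∣ ι (toℕ κ) - ι (toℕ κ′) ∣ → ι L ≤ ξ → 1ℚ ≤ ∣ (η * (ι 2 * (ι (toℕ κ) - ι (toℕ κ′)))) * ξ ∣
  slope-gap {κ} {κ′} {ξ} hJ hL = ≤-trans (≤-trans (≤-reflexive (trans (sym JLη) (eq (ι J) (ι L) η)))
      (≤-trans (*-mono (0≤η ⊗ 0≤ι J) (≤-trans (0≤ι L) hL) (*-mono-l 0≤η hJ) hL)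
        (p≤p+q (0≤η ⊗ 0≤∣p∣ z ⊗ ≤-trans (0≤ι L) hL))))
    (≤-reflexive (trans (eq′ η (∣ z ∣) ξ) (sym (trans (∣p*q∣≡∣p∣*∣q∣ (η * (ι 2 * z)) ξ)
      (cong₂ _*_ (trans (∣p*q∣≡∣p∣*∣q∣ η (ι 2 * z)) (cong₂ _*_ (∣pos∣ 0≤η) (∣p*q∣≡∣p∣*∣q∣ (ι 2) z))) (∣pos∣ (≤-trans (0≤ι L) hL)))))))
    where
    z = ι (toℕ κ) - ι (toℕ κ′)
    eq : ∀ J L η → J * L * η ≡ η * J * L
    eq = solve-∀ ℚ-ring
    eq′ : ∀ η z ξ → η * z * ξ + η * z * ξ ≡ η * (ι 2 * z) * ξ
    eq′ = solve-∀ ℚ-ring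

  private
    filler-gap : ∀ {c f} → ι 4 * ∣ c ∣ ≤ ι L → ι L ≤ ∣ f ∣ → 1ℚ ≤ ∣ c - f ∣
    filler-gap {c} {f} hc hf = ≤-by (½ * ½ * (ι L - ι 4 * ∣ c ∣) + (∣ f ∣ - ι L) + (∣ c ∣ + ∣ c - f ∣ - ∣ f ∣) + ¼ * ι 3 * (ι L - ι 2) + ½)
      ((0≤½ ⊗ 0≤½) ⊗ 0≤- hc ⊕ 0≤- hf ⊕ 0≤- (≤-trans (∣∣≤∣∣+∣-∣ f c) (≤-reflexive (cong (_+_ (∣ c ∣)) (∣-∣-sym f c))))
        ⊕ (<⇒≤ 0<¼ ⊗ 0≤ι 3) ⊗ 0≤- 2≤ιL ⊕ 0≤½)
      (eq (∣ c ∣) (∣ f ∣) (∣ c - f ∣) (ι L))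
      where
      eq : ∀ c f d L → d ≡ 1ℚ + (½ * ½ * (L - ι 4 * c) + (f - L) + (c + d - f) + ¼ * ι 3 * (L - ι 2) + ½)
      eq = solve-∀ ℚ-ring

    L≤up : ∀ i → ι L ≤ ∣ py (up i) ∣
    L≤up i = ≤-trans (ι-mono (ℕ.m≤m+n L (row (toℕ i)))) (≤-reflexive (sym (∣ι∣ (L ℕ.+ row (toℕ i)))))

    L≤down : ∀ i → ι L ≤ ∣ py (down i) ∣
    L≤down i = ≤-trans (ι-mono (ℕ.m≤m+n L (row (toℕ i)))) (≤-reflexive (sym (∣-ι∣ (L ℕ.+ row (toℕ i)))))

  right-right : ∀ κ p κ′ p′ → (κ , p) ≢ (κ′ , p′) → Apart (right κ p) (right κ′ p′)
  right-right κ p κ′ p′ ne = go (ξ κ p ℕ.≟ ξ κ′ p′)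
    where
    go : Dec (ξ κ p ≡ ξ κ′ p′) → Apart (right κ p) (right κ′ p′)
    go (no ξ≢) = inj₁ (ι-apart ξ≢)
    go (yes e) = let (p≡ , j≡) = ξ-injective {κ} {κ′} {p} {p′} e in
      inj₂ (subst (λ z → 1ℚ ≤ ∣ z ∣) (trans (eq η (ι (toℕ κ)) (ι (toℕ κ′)) (ι (ξ κ p))) (cong (λ z → sR κ * ι (ξ κ p) - sR κ′ * ι z) e))
        (slope-gap {κ} {κ′} {ι (ξ κ p)} (index-gap {κ} {κ′} (λ { refl → ne (cong (κ ,_) p≡) }) j≡) (L≤ξ κ p)))
      where
      eq : ∀ η k k′ ξ → (η * (ι 2 * (k - k′))) * ξ ≡ η * (ι 2 * k) * ξ - η * (ι 2 * k′) * ξ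
      eq = solve-∀ ℚ-ring

  left-left : ∀ κ p κ′ p′ → (κ , p) ≢ (κ′ , p′) → Apart (left κ p) (left κ′ p′)
  left-left κ p κ′ p′ ne = go (ξ κ p ℕ.≟ ξ κ′ p′)
    where
    go : Dec (ξ κ p ≡ ξ κ′ p′) → Apart (left κ p) (left κ′ p′)
    go (no ξ≢) = inj₁ (subst (1ℚ ≤_) (trans (sym (∣-p∣≡∣p∣ (ι (ξ κ p) - ι (ξ κ′ p′)))) (cong ∣_∣ (eq (ι (ξ κ p)) (ι (ξ κ′ p′))))) (ι-apart ξ≢))
      where
      eq : ∀ a b → - (a - b) ≡ (- a) - (- b)
      eq = solve-∀ ℚ-ring
    go (yes e) = let (p≡ , j≡) = ξ-injective {κ} {κ′} {p} {p′} e in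
      inj₂ (subst (1ℚ ≤_) (trans (sym (∣-p∣≡∣p∣ (η * (ι 2 * (ι (toℕ κ) - ι (toℕ κ′))) * ι (ξ κ p))))
          (cong ∣_∣ (trans (eq η (ι (toℕ κ)) (ι (toℕ κ′)) (ι (ξ κ p))) (cong (λ z → sL κ * (- ι (ξ κ p)) - sL κ′ * (- ι z)) e))))
        (slope-gap {κ} {κ′} {ι (ξ κ p)} (index-gap {κ} {κ′} (λ { refl → ne (cong (κ ,_) p≡) }) j≡) (L≤ξ κ p)))
      where
      eq : ∀ η k k′ ξ → - ((η * (ι 2 * (k - k′))) * ξ) ≡ η * (ι 2 * k + 1ℚ) * (- ξ) - η * (ι 2 * k′ + 1ℚ) * (- ξ)
      eq = solve-∀ ℚ-ring

  right-left : ∀ κ p κ′ p′ → Apart (right κ p) (left κ′ p′)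
  right-left κ p κ′ p′ = inj₁ (≤-trans (≤-by ((ι (ξ κ p) - ι 2) + 1ℚ + ι (ξ κ′ p′)) (0≤- (≤-trans 2≤ιL (L≤ξ κ p)) ⊕ <⇒≤ 0<1 ⊕ 0≤ι (ξ κ′ p′))
      (eq (ι (ξ κ p)) (ι (ξ κ′ p′)))) (≤∣∣ (ι (ξ κ p) - (- ι (ξ κ′ p′)))))
    where
    eq : ∀ a b → a - (- b) ≡ 1ℚ + ((a - ι 2) + 1ℚ + b)
    eq = solve-∀ ℚ-ring

  up-up : ∀ i j → i ≢ j → Apart (up i) (up j)
  up-up i j ne = [ (λ h → inj₁ (ι-apart h)) , (λ h → inj₂ (ι-apart (h ∘ ℕ.+-cancelˡ-≡ L (row (toℕ i)) (row (toℕ j))))) ]′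
    (grid-apart (ne ∘ Fin.toℕ-injective))

  down-down : ∀ i j → i ≢ j → Apart (down i) (down j)
  down-down i j ne = [ (λ h → inj₁ (ι-apart h)) , (λ h → inj₂ (subst (1ℚ ≤_)
      (trans (sym (∣-p∣≡∣p∣ (ι (L ℕ.+ row (toℕ i)) - ι (L ℕ.+ row (toℕ j))))) (cong ∣_∣ (eq (ι (L ℕ.+ row (toℕ i))) (ι (L ℕ.+ row (toℕ j))))))
      (ι-apart (h ∘ ℕ.+-cancelˡ-≡ L (row (toℕ i)) (row (toℕ j)))))) ]′
    (grid-apart (ne ∘ Fin.toℕ-injective))
    where
    eq : ∀ a b → - (a - b) ≡ (- a) - (- b)
    eq = solve-∀ ℚ-ring

  up-down : ∀ i j → Apart (up i) (down j)
  up-down i j = inj₂ (≤-trans (≤-by ((f - ι 2) + 1ℚ + g) (0≤- (≤-trans 2≤ιL (ι-mono (ℕ.m≤m+n L (row (toℕ i))))) ⊕ <⇒≤ 0<1 ⊕ 0≤ι (L ℕ.+ row (toℕ j)))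
      (eq f g)) (≤∣∣ (f - (- g))))
    where
    f = ι (L ℕ.+ row (toℕ i))
    g = ι (L ℕ.+ row (toℕ j))
    eq : ∀ a b → a - (- b) ≡ 1ℚ + ((a - ι 2) + 1ℚ + b)
    eq = solve-∀ ℚ-ring

  apart₀ : ∀ i j → i ≢ j → Apart i j
  apart₀ (right κ p) (right κ′ p′) ne = right-right κ p κ′ p′ λ e → ne (cong (inj₁ ∘ inj₁) e)
  apart₀ (right κ p) (left κ′ p′)  _  = right-left κ p κ′ p′
  apart₀ (right κ p) (up i)        _  = inj₂ (filler-gap {py (right κ p)} {py (up i)} (4∣y∣-right κ p) (L≤up i))
  apart₀ (right κ p) (down i)      _  = inj₂ (filler-gap {py (right κ p)} {py (down i)} (4∣y∣-right κ p) (L≤down i))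
  apart₀ (left κ p)  (right κ′ p′) _  = apart-sym {right κ′ p′} {left κ p} (right-left κ′ p′ κ p)
  apart₀ (left κ p)  (left κ′ p′)  ne = left-left κ p κ′ p′ λ e → ne (cong (inj₁ ∘ inj₂) e)
  apart₀ (left κ p)  (up i)        _  = inj₂ (filler-gap {py (left κ p)} {py (up i)} (4∣y∣-left κ p) (L≤up i))
  apart₀ (left κ p)  (down i)      _  = inj₂ (filler-gap {py (left κ p)} {py (down i)} (4∣y∣-left κ p) (L≤down i))
  apart₀ (up i)   (right κ p) _  = apart-sym {right κ p} {up i} (inj₂ (filler-gap {py (right κ p)} {py (up i)} (4∣y∣-right κ p) (L≤up i)))
  apart₀ (up i)   (left κ p)  _  = apart-sym {left κ p} {up i} (inj₂ (filler-gap {py (left κ p)} {py (up i)} (4∣y∣-left κ p) (L≤up i)))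
  apart₀ (up i)   (up j)      ne = up-up i j λ { refl → ne refl }
  apart₀ (up i)   (down j)    _  = up-down i j
  apart₀ (down i) (right κ p) _  = apart-sym {right κ p} {down i} (inj₂ (filler-gap {py (right κ p)} {py (down i)} (4∣y∣-right κ p) (L≤down i)))
  apart₀ (down i) (left κ p)  _  = apart-sym {left κ p} {down i} (inj₂ (filler-gap {py (left κ p)} {py (down i)} (4∣y∣-left κ p) (L≤down i)))
  apart₀ (down i) (up j)      _  = apart-sym {up j} {down i} (up-down j i)
  apart₀ (down i) (down j)    ne = down-down i j λ { refl → ne refl }

  flat : ∥ I ∥ → ℚ × ℚ
  flat i = px i , py i

  module _ (κ : ∥ C ∥) where

    -- The height above the line that carries the copy `κ` before it is lifted.
    level : ∥ I ∥ → ℚ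
    level i = py i - sR κ * px i

    level-right : ∀ κ′ p → level (right κ′ p) ≡ (η * ι (ξ κ′ p)) * (- (ι 2 * (ι (toℕ κ) - ι (toℕ κ′))))
    level-right κ′ p = eq η (ι (toℕ κ)) (ι (toℕ κ′)) (ι (ξ κ′ p))
      where
      eq : ∀ η k k′ ξ → η * (ι 2 * k′) * ξ - η * (ι 2 * k) * ξ ≡ (η * ξ) * (- (ι 2 * (k - k′)))
      eq = solve-∀ ℚ-ring

    level-left : ∀ κ′ p → level (left κ′ p) ≡ (η * ι (ξ κ′ p)) * (- (1ℚ - ι 2 * (ι (toℕ κ) - ι (toℕ κ′))))
    level-left κ′ p = eq η (ι (toℕ κ)) (ι (toℕ κ′)) (ι (ξ κ′ p))
      where
      eq : ∀ η k k′ ξ → η * (ι 2 * k′ + 1ℚ) * (- ξ) - η * (ι 2 * k) * (- ξ) ≡ (η * ξ) * (- (1ℚ - ι 2 * (k - k′)))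
      eq = solve-∀ ℚ-ring

    0<ηξ : ∀ κ′ p → 0ℚ < η * ι (ξ κ′ p)
    0<ηξ κ′ p = 0<* 0<η (0<ξ κ′ p)

    8sx≤b : ∀ i → ι 8 * (sR κ * ι (column i)) ≤ ι b
    8sx≤b i = ≤-by ((1ℚ - ι 8 * sL κ) * ι b + ι 8 * (sL κ - sR κ) * ι b + ι 8 * sR κ * (ι b - ι (column i)))
      (0≤- (8sL≤1 κ) ⊗ 0≤ι b ⊕ 0≤ι 8 ⊗ 0≤- (sR≤sL κ) ⊗ 0≤ι b ⊕ 0≤ι 8 ⊗ 0≤sR κ ⊗ 0≤- (ι-mono (column≤ i)))
      (eq (sL κ) (sR κ) (ι b) (ι (column i)))
      where
      eq : ∀ t s b x → b ≡ ι 8 * (s * x) + ((1ℚ - ι 8 * t) * b + ι 8 * (t - s) * b + ι 8 * s * (b - x))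
      eq = solve-∀ ℚ-ring

    -- A line of slope at most 1/8 stays below height `L` up to the abscissa `b`, because `b` <
    -- 8`L`.
    0<level-up : ∀ i → 0ℚ < level (up i)
    0<level-up i = cancel-< {ι 8} (0<ι-suc 7) (<-by (ι 8 * level (up i))
        (<-≤-trans (0<- b<L8) (≤-by (ι 8 * (ι (L ℕ.+ row (toℕ i)) - ι L) + (ι b - ι 8 * (sR κ * ι (column (toℕ i)))))
          (0≤ι 8 ⊗ 0≤- (ι-mono (ℕ.m≤m+n L (row (toℕ i)))) ⊕ 0≤- (8sx≤b (toℕ i)))
          (eq (ι (L ℕ.+ row (toℕ i))) (ι L) (ι b) (sR κ * ι (column (toℕ i))))))
      (eq′ (level (up i))))
      where
      b<L8 : ι b < ι L * ι 8
      b<L8 = subst (ι b <_) (ι-* L 8) (ι-mono-< b<8L)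
      eq : ∀ f L b z → ι 8 * (f - z) ≡ (L * ι 8 - b) + (ι 8 * (f - L) + (b - ι 8 * z))
      eq = solve-∀ ℚ-ring
      eq′ : ∀ l → ι 8 * l ≡ ι 8 * 0ℚ + ι 8 * l
      eq′ = solve-∀ ℚ-ring

    level-down<0 : ∀ i → level (down i) < 0ℚ
    level-down<0 i = 0<-⇒<0 (<-≤-trans (<-≤-trans (0<ι-suc 1) 2≤ιL)
      (≤-by ((f - ι L) + sR κ * ι (column (toℕ i))) (0≤- (ι-mono (ℕ.m≤m+n L (row (toℕ i)))) ⊕ 0≤sR κ ⊗ 0≤ι (column (toℕ i)))
        (eq f (ι L) (sR κ * ι (column (toℕ i))))))
      where
      f = ι (L ℕ.+ row (toℕ i))
      eq : ∀ f L z → - ((- f) - z) ≡ L + ((f - L) + z)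
      eq = solve-∀ ℚ-ring

    orient-flat : ∀ p q i → orient (flat (right κ p)) (flat (right κ q)) (flat i) ≡ (ι (ξ κ q) - ι (ξ κ p)) * level i
    orient-flat p q i = eq (ι (ξ κ p)) (ι (ξ κ q)) (sR κ) (px i) (py i)
      where
      eq : ∀ x₁ x₂ s x₃ y₃ → (x₂ - x₁) * (y₃ - s * x₁) - (s * x₂ - s * x₁) * (x₃ - x₁) ≡ (x₂ - x₁) * (y₃ - s * x₃)
      eq = solve-∀ ℚ-ring

  module Lifted (ε δ : ℚ) (0<ε : 0ℚ < ε) (0≤δ : 0ℚ ≤ δ) (st : ∀ i j k → Stable δ (flat i) (flat j) (flat k))
                (small : ∀ p → ∣ ε * height p ∣ ≤ δ) (δ≤𝟙/32 : δ ≤ 𝟙/32) where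

    lift : ∥ I ∥ → ℚ
    lift (right κ p) = ε * height p
    lift (left κ p)  = 0ℚ
    lift (up i)      = 0ℚ
    lift (down i)    = 0ℚ

    ∣lift∣≤δ : ∀ i → ∣ lift i ∣ ≤ δ
    ∣lift∣≤δ (right κ p) = small p
    ∣lift∣≤δ (left κ p)  = 0≤δ
    ∣lift∣≤δ (up i)      = 0≤δ
    ∣lift∣≤δ (down i)    = 0≤δ

    place : ∥ I ∥ → ℚ × ℚ
    place i = px i , py i + lift i

    near : ∀ i → Near δ (flat i) (place i)
    near i = subst (λ z → ∣ z ∣ ≤ δ) (sym (+-inverseʳ (px i))) 0≤δ , subst (λ z → ∣ z ∣ ≤ δ) (eq (py i) (lift i)) (∣lift∣≤δ i)
      where
      eq : ∀ y l → l ≡ y + l - y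
      eq = solve-∀ ℚ-ring

    -- A copy is the image of the pattern under an affine map of determinant `ε`. Stability is
    -- silent here, since the flat copy is collinear; it takes care of all points outside the copy.
    orient-own : ∀ κ p q r → orient (place (right κ p)) (place (right κ q)) (place (right κ r)) ≡
                 ε * orient (Pattern.pos T p) (Pattern.pos T q) (Pattern.pos T r)
    orient-own κ p q r = trans (cong₂ (λ x₁ x₂ → orient (pt x₁ p) (pt x₂ q) (pt (ι (ξ κ r)) r)) (expand p) (expand q))
      (trans (cong (λ x₃ → orient (pt (c₀ + ι (X p)) p) (pt (c₀ + ι (X q)) q) (pt x₃ r)) (expand r))
        (eq c₀ (sR κ) ε (ι (X p)) (height p) (ι (X q)) (height q) (ι (X r)) (height r)))
      where
      c₀ : ℚ
      c₀ = ι L + ι (N ℕ.* (toℕ κ ℕ.% J))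
      pt : ℚ → ∥ P ∥ → ℚ × ℚ
      pt x p = x , sR κ * x + ε * height p
      expand : ∀ p → ι (ξ κ p) ≡ c₀ + ι (X p)
      expand p = trans (ι-+ L (shift κ p)) (trans (cong (_+_ (ι L)) (ι-+ (N ℕ.* (toℕ κ ℕ.% J)) (X p)))
        (sym (+-assoc (ι L) (ι (N ℕ.* (toℕ κ ℕ.% J))) (ι (X p)))))
      eq : ∀ c s ε x₁ y₁ x₂ y₂ x₃ y₃ →
        ((c + x₂) - (c + x₁)) * ((s * (c + x₃) + ε * y₃) - (s * (c + x₁) + ε * y₁))
          - ((s * (c + x₂) + ε * y₂) - (s * (c + x₁) + ε * y₁)) * ((c + x₃) - (c + x₁))
        ≡ ε * ((x₂ - x₁) * (y₃ - y₁) - (y₂ - y₁) * (x₃ - x₁))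
      eq = solve-∀ ℚ-ring

    module OneLine (κ : ∥ C ∥) (p q : ∥ P ∥) (p≢q : p ≢ q)
                   (hp : HalvingPair P (Pattern.pos T) p q) where

      o : ∥ I ∥ → ℚ
      o i = orient (place (right κ p)) (place (right κ q)) (place i)

      Δ : ℚ
      Δ = ι (ξ κ q) - ι (ξ κ p)

      Δ≢0 : Δ ≢ 0ℚ
      Δ≢0 = 1≤∣∣⇒≢0 (ι-apart λ e → p≢q (sym (proj₁ (ξ-injective {κ} {κ} {q} {p} e))))

      flat≢0 : ∀ i → level κ i ≢ 0ℚ → orient (flat (right κ p)) (flat (right κ q)) (flat i) ≢ 0ℚ
      flat≢0 i h e = *-≢0 Δ≢0 h (trans (sym (orient-flat κ p q i)) e)

      o-sign : ∀ i → level κ i ≢ 0ℚ → sgn (o i) ≡ sgn Δ ℤ.* sgn (level κ i)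
      o-sign i h = trans (st (right κ p) (right κ q) i (flat≢0 i h) (place (right κ p)) (place (right κ q)) (place i)
          (near (right κ p)) (near (right κ q)) (near i))
        (trans (cong sgn (orient-flat κ p q i)) (sgn-* Δ (level κ i)))

      o-off : ∀ i → level κ i ≢ 0ℚ → o i ≢ 0ℚ
      o-off i h e = *-≢0 Δ≢0 h (sgn≡0⇒≡0 (Δ * level κ i) (trans (sgn-* Δ (level κ i)) (trans (sym (o-sign i h)) (sgn-zero e))))

      gap : ∥ C ∥ → ℚ
      gap κ′ = ι (toℕ κ) - ι (toℕ κ′)

      level-right≢0 : ∀ {κ′} r → κ′ ≢ κ → level κ (right κ′ r) ≢ 0ℚ
      level-right≢0 {κ′} r ne e = *-≢0 (>0⇒≢0 (0<ηξ κ κ′ r)) (1≤∣∣⇒≢0 {(- (ι 2 * gap κ′))}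
        (≤-trans (even-gap {toℕ κ} {toℕ κ′} (λ e → ne (sym (Fin.toℕ-injective e)))) (≤-reflexive (sym (∣-p∣≡∣p∣ (ι 2 * gap κ′))))))
        (trans (sym (level-right κ κ′ r)) e)

      level-left≢0 : ∀ κ′ r → level κ (left κ′ r) ≢ 0ℚ
      level-left≢0 κ′ r e = *-≢0 (>0⇒≢0 (0<ηξ κ κ′ r)) (1≤∣∣⇒≢0 {(- (1ℚ - ι 2 * gap κ′))}
        (≤-trans (odd-gap (toℕ κ) (toℕ κ′)) (≤-reflexive (sym (∣-p∣≡∣p∣ (1ℚ - ι 2 * gap κ′))))))
        (trans (sym (level-left κ κ′ r)) e)

      off : ∀ i → i ≢ right κ p → i ≢ right κ q → o i ≢ 0ℚ
      off (right κ′ r) ≢p ≢q = go (κ′ Fin.≟ κ)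
        where
        go : Dec (κ′ ≡ κ) → o (right κ′ r) ≢ 0ℚ
        go (no ne) = o-off (right κ′ r) (level-right≢0 r ne)
        go (yes refl) e = *-≢0 (>0⇒≢0 0<ε) (HalvingPair.off hp r (λ e → ≢p (cong (right κ) e)) (λ e → ≢q (cong (right κ) e)))
          (trans (sym (orient-own κ p q r)) e)
      off (left κ′ r) _ _ = o-off (left κ′ r) (level-left≢0 κ′ r)
      off (up i) _ _      = o-off (up i) (>0⇒≢0 (0<level-up κ i))
      off (down i) _ _    = o-off (down i) (<0⇒≢0 (level-down<0 κ i))

      σ : ℤ
      σ = sgn Δ

      sum-right : ∀ κ′ → ∑ P (λ r → sgn (o (right κ′ r))) ≡ + N ℤ.* (σ ℤ.* ℤ.- sgn (ι 2 * gap κ′))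
      sum-right κ′ = go (κ′ Fin.≟ κ)
        where
        go : Dec (κ′ ≡ κ) → ∑ P (λ r → sgn (o (right κ′ r))) ≡ + N ℤ.* (σ ℤ.* ℤ.- sgn (ι 2 * gap κ′))
        go (no ne) = trans (∑-cong P λ r → trans (o-sign (right κ′ r) (level-right≢0 r ne))
            (cong (ℤ._*_ σ) (trans (cong sgn (level-right κ κ′ r)) (trans (sgn-pos-* (- (ι 2 * gap κ′)) (0<ηξ κ κ′ r)) (sgn-negate (ι 2 * gap κ′))))))
          (∑-const P (σ ℤ.* ℤ.- sgn (ι 2 * gap κ′)))
        go (yes refl) = trans (trans (∑-cong P λ r → trans (cong sgn (orient-own κ p q r)) (sgn-pos-* (orient (Pattern.pos T p) (Pattern.pos T q) (Pattern.pos T r)) 0<ε)) (HalvingPair.balanced hp))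
          (sym (trans (cong (λ z → + N ℤ.* (σ ℤ.* ℤ.- z)) (sgn-zero (eq (ι (toℕ κ))))) (eq′ (+ N) σ)))
          where
          eq : ∀ k → ι 2 * (k - k) ≡ 0ℚ
          eq = solve-∀ ℚ-ring
          eq′ : ∀ n s → n ℤ.* (s ℤ.* 0ℤ) ≡ 0ℤ
          eq′ = solve-∀ ℤ-ring

      sum-left : ∀ κ′ → ∑ P (λ r → sgn (o (left κ′ r))) ≡ + N ℤ.* (σ ℤ.* ℤ.- sgn (1ℚ - ι 2 * gap κ′))
      sum-left κ′ = trans (∑-cong P λ r → trans (o-sign (left κ′ r) (level-left≢0 κ′ r))
          (cong (ℤ._*_ σ) (trans (cong sgn (level-left κ κ′ r)) (trans (sgn-pos-* (- (1ℚ - ι 2 * gap κ′)) (0<ηξ κ κ′ r)) (sgn-negate (1ℚ - ι 2 * gap κ′))))))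
        (∑-const P (σ ℤ.* ℤ.- sgn (1ℚ - ι 2 * gap κ′)))

      -- For another index the copies on the right and on the left cancel by `sgn-even+odd`. For `κ`
      -- itself the right copy is balanced on its own, and the left one leaves `N` points on one
      -- side.
      sum-copies : ∑ (C ×ᶠ P) (λ (κ′ , r) → sgn (o (right κ′ r))) ℤ.+ ∑ (C ×ᶠ P) (λ (κ′ , r) → sgn (o (left κ′ r))) ≡ + N ℤ.* (σ ℤ.* -1ℤ)
      sum-copies = begin
        ∑ (C ×ᶠ P) (λ (κ′ , r) → sgn (o (right κ′ r))) ℤ.+ ∑ (C ×ᶠ P) (λ (κ′ , r) → sgn (o (left κ′ r)))
          ≡⟨ cong₂ ℤ._+_ (trans (∑-× C P (λ (κ′ , r) → sgn (o (right κ′ r)))) (∑-cong C sum-right))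
               (trans (∑-× C P (λ (κ′ , r) → sgn (o (left κ′ r)))) (∑-cong C sum-left)) ⟩
        ∑ C (λ κ′ → + N ℤ.* (σ ℤ.* ℤ.- e κ′)) ℤ.+ ∑ C (λ κ′ → + N ℤ.* (σ ℤ.* ℤ.- o′ κ′))
          ≡⟨ ∑-+ C (λ κ′ → + N ℤ.* (σ ℤ.* ℤ.- e κ′)) (λ κ′ → + N ℤ.* (σ ℤ.* ℤ.- o′ κ′)) ⟨
        ∑ C (λ κ′ → + N ℤ.* (σ ℤ.* ℤ.- e κ′) ℤ.+ + N ℤ.* (σ ℤ.* ℤ.- o′ κ′))
          ≡⟨ ∑-cong C (λ κ′ → eq (+ N) σ (e κ′) (o′ κ′)) ⟩
        ∑ C (λ κ′ → + N ℤ.* (σ ℤ.* -1ℤ) ℤ.* (e κ′ ℤ.+ o′ κ′))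
          ≡⟨ ∑-* C (+ N ℤ.* (σ ℤ.* -1ℤ)) (λ κ′ → e κ′ ℤ.+ o′ κ′) ⟩
        + N ℤ.* (σ ℤ.* -1ℤ) ℤ.* ∑ C (λ κ′ → e κ′ ℤ.+ o′ κ′)
          ≡⟨ cong (ℤ._*_ (+ N ℤ.* (σ ℤ.* -1ℤ))) (trans (∑-single C {κ} {λ κ′ → e κ′ ℤ.+ o′ κ′}
               (λ κ′ ne → sgn-even+odd {toℕ κ} {toℕ κ′} (λ e → ne (sym (Fin.toℕ-injective e))))) (sgn-even+odd-self (toℕ κ))) ⟩
        + N ℤ.* (σ ℤ.* -1ℤ) ℤ.* 1ℤ
          ≡⟨ ℤ.*-identityʳ (+ N ℤ.* (σ ℤ.* -1ℤ)) ⟩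
        + N ℤ.* (σ ℤ.* -1ℤ) ∎
        where
        open ≡-Reasoning
        e o′ : ∥ C ∥ → ℤ
        e κ′  = sgn (ι 2 * gap κ′)
        o′ κ′ = sgn (1ℚ - ι 2 * gap κ′)
        eq : ∀ n s e o → n ℤ.* (s ℤ.* ℤ.- e) ℤ.+ n ℤ.* (s ℤ.* ℤ.- o) ≡ n ℤ.* (s ℤ.* -1ℤ) ℤ.* (e ℤ.+ o)
        eq = solve-∀ ℤ-ring

      -- All upper fillers are on one side and all lower ones on the other; the `N` additional upper
      -- ones offset the unpaired left copy.
      sum-fillers : ∑ (finᶠ u) (λ i → sgn (o (up i))) ℤ.+ ∑ (finᶠ d) (λ i → sgn (o (down i))) ≡ + N ℤ.* σ
      sum-fillers = begin
        ∑ (finᶠ u) (λ i → sgn (o (up i))) ℤ.+ ∑ (finᶠ d) (λ i → sgn (o (down i)))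
          ≡⟨ cong₂ ℤ._+_
               (trans (∑-cong (finᶠ u) λ i → trans (o-sign (up i) (>0⇒≢0 (0<level-up κ i))) (cong (ℤ._*_ σ) (sgn-pos (0<level-up κ i)))) (∑-const (finᶠ u) (σ ℤ.* 1ℤ)))
               (trans (∑-cong (finᶠ d) λ i → trans (o-sign (down i) (<0⇒≢0 (level-down<0 κ i))) (cong (ℤ._*_ σ) (sgn-neg (level-down<0 κ i)))) (∑-const (finᶠ d) (σ ℤ.* -1ℤ))) ⟩
        + size (finᶠ u) ℤ.* (σ ℤ.* 1ℤ) ℤ.+ + size (finᶠ d) ℤ.* (σ ℤ.* -1ℤ)
          ≡⟨ cong₂ (λ u d → + u ℤ.* (σ ℤ.* 1ℤ) ℤ.+ + d ℤ.* (σ ℤ.* -1ℤ)) (trans (size-fin u) u≡d+N) (size-fin d) ⟩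
        (+ d ℤ.+ + N) ℤ.* (σ ℤ.* 1ℤ) ℤ.+ + d ℤ.* (σ ℤ.* -1ℤ)
          ≡⟨ eq (+ d) (+ N) σ ⟩
        + N ℤ.* σ ∎
        where
        open ≡-Reasoning
        eq : ∀ d n s → (d ℤ.+ n) ℤ.* (s ℤ.* 1ℤ) ℤ.+ d ℤ.* (s ℤ.* -1ℤ) ≡ n ℤ.* s
        eq = solve-∀ ℤ-ring

      halvingPair : HalvingPair I place (right κ p) (right κ q)
      halvingPair = record
        { off = off
        ; balanced = begin
            ∑ I (sgn ∘ o)
              ≡⟨ trans (∑-⊎ ((C ×ᶠ P) ⊎ᶠ (C ×ᶠ P)) (finᶠ u ⊎ᶠ finᶠ d) (sgn ∘ o))
                   (cong₂ ℤ._+_ (∑-⊎ (C ×ᶠ P) (C ×ᶠ P) (sgn ∘ o ∘ inj₁)) (∑-⊎ (finᶠ u) (finᶠ d) (sgn ∘ o ∘ inj₂))) ⟩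
            (∑ (C ×ᶠ P) (sgn ∘ o ∘ inj₁ ∘ inj₁) ℤ.+ ∑ (C ×ᶠ P) (sgn ∘ o ∘ inj₁ ∘ inj₂)) ℤ.+
              (∑ (finᶠ u) (sgn ∘ o ∘ up) ℤ.+ ∑ (finᶠ d) (sgn ∘ o ∘ down))
              ≡⟨ cong₂ ℤ._+_ sum-copies sum-fillers ⟩
            + N ℤ.* (σ ℤ.* -1ℤ) ℤ.+ + N ℤ.* σ
              ≡⟨ eq (+ N) σ ⟩
            0ℤ ∎
        }
        where
        open ≡-Reasoning
        eq : ∀ n s → n ℤ.* (s ℤ.* -1ℤ) ℤ.+ n ℤ.* s ≡ 0ℤ
        eq = solve-∀ ℤ-ring

    layout : Layout b
    layout = record
      { I = I ; pos = place
      ; x-bound = λ i → ≤-trans (∣x∣≤b i) (p≤p+q (0≤inv 31))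
      ; y-bound = λ i → ∣+∣≤ {py i} (∣y∣≤b i) (≤-trans (∣lift∣≤δ i) δ≤𝟙/32)
      ; apart = λ {i} {j} ne → lift-apart i j (apart₀ i j ne)
      ; E = C ×ᶠ E
      ; end₁ = λ (κ , e) → right κ (end₁ e)
      ; end₂ = λ (κ , e) → right κ (end₂ e)
      ; ends-distinct = λ (κ , e) h → end₁≢end₂ e (right-injective₂ h)
      ; halving = λ (κ , e) → OneLine.halvingPair κ (end₁ e) (end₂ e) (end₁≢end₂ e) (Pattern.halving T e)
      ; distinct = λ {e} {e′} → distinct′ e e′
      }
      where
      right-injective₁ : ∀ {κ κ′ p p′} → _≡_ {A = ∥ I ∥} (right κ p) (right κ′ p′) → κ ≡ κ′
      right-injective₁ refl = refl
      right-injective₂ : ∀ {κ κ′ p p′} → _≡_ {A = ∥ I ∥} (right κ p) (right κ′ p′) → p ≡ p′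
      right-injective₂ refl = refl
      lift-apart : ∀ i j → Apart i j → 1ℚ - 𝟙/16 ≤ ∣ px i - px j ∣ ⊎ 1ℚ - 𝟙/16 ≤ ∣ (py i + lift i) - (py j + lift j) ∣
      lift-apart i j (inj₁ h) = inj₁ (≤-trans 1-𝟙/16≤1 h)
      lift-apart i j (inj₂ h) = inj₂ (≤-by ((D + (𝟙/32 + 𝟙/32)) - 1ℚ) (0≤- (≤-trans h (≤-trans (∣∣≤∣∣+∣-∣ (py i - py j) ((py i + lift i) - (py j + lift j)))
          (+-monoʳ-≤ D (subst (λ z → ∣ z ∣ ≤ 𝟙/32 + 𝟙/32) (eq (py i) (py j) (lift i) (lift j))
            (∣+∣≤ {(- lift i)} (∣-∣≤ {lift i} (≤-trans (∣lift∣≤δ i) δ≤𝟙/32)) (≤-trans (∣lift∣≤δ j) δ≤𝟙/32)))))))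
        (eq′ D))
        where
        D = ∣ (py i + lift i) - (py j + lift j) ∣
        eq : ∀ y z l m → (- l) + m ≡ (y - z) - ((y + l) - (z + m))
        eq = solve-∀ ℚ-ring
        eq′ : ∀ D → D ≡ (1ℚ - 𝟙/16) + ((D + (𝟙/32 + 𝟙/32)) - 1ℚ)
        eq′ = solve-∀ ℚ-ring
      distinct′ : ∀ (e e′ : ∥ C ×ᶠ E ∥) → e ≢ e′ → Σ[ i ∈ ∥ I ∥ ] ((i ≡ right (proj₁ e′) (end₁ (proj₂ e′)) ⊎ i ≡ right (proj₁ e′) (end₂ (proj₂ e′))) ×
                  i ≢ right (proj₁ e) (end₁ (proj₂ e)) × i ≢ right (proj₁ e) (end₂ (proj₂ e)))
      distinct′ (κ , e) (κ′ , e′) ne = go (κ Fin.≟ κ′)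
        where
        go : Dec (κ ≡ κ′) → Σ[ i ∈ ∥ I ∥ ] ((i ≡ right κ′ (end₁ e′) ⊎ i ≡ right κ′ (end₂ e′)) × i ≢ right κ (end₁ e) × i ≢ right κ (end₂ e))
        go (no κ≢) = right κ′ (end₁ e′) , inj₁ refl , (λ h → κ≢ (sym (right-injective₁ h))) , (λ h → κ≢ (sym (right-injective₁ h)))
        go (yes refl) = let (p , p-end , p≢₁ , p≢₂) = Pattern.distinct T {e} {e′} (λ h → ne (cong (κ ,_) h)) in
          right κ p , [ inj₁ ∘ cong (right κ) , inj₂ ∘ cong (right κ) ]′ p-end ,
          (λ h → p≢₁ (right-injective₂ h)) , (λ h → p≢₂ (right-injective₂ h))

  assembled : Σ[ Λ ∈ Layout b ] size (Layout.I Λ) ≡ 2 ℕ.* (G ℕ.* J ℕ.* N) ℕ.+ (u ℕ.+ d) × size (Layout.E Λ) ≡ G ℕ.* J ℕ.* size E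
  assembled =
    let (δ₀ , 0<δ₀ , st) = stable-all I flat
        (δ , 0<δ , δ≤δ₀ , δ≤𝟙/32) = min-pos 0<δ₀ (inv>0 31)
        (ε , 0<ε , εh) = uniform P {λ p ε → ε * ∣ height p ∣ ≤ δ} (λ p le h → ≤-trans (*-mono-r (0≤∣p∣ (height p)) le) h) (λ p → tilt 0<δ (height p))
    in Lifted.layout ε δ 0<ε (<⇒≤ 0<δ)
         (λ i j k o≢0 p q r h₁ h₂ h₃ → st i j k o≢0 p q r (near-mono {p = flat i} {p} δ≤δ₀ h₁) (near-mono {p = flat j} {q} δ≤δ₀ h₂) (near-mono {p = flat k} {r} δ≤δ₀ h₃))
         (λ p → ≤-trans (≤-reflexive (trans (∣p*q∣≡∣p∣*∣q∣ ε (height p)) (cong (_* ∣ height p ∣) (∣pos∣ (<⇒≤ 0<ε))))) (εh p)) δ≤𝟙/32 ,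
       size-I ,
       trans (size-× C E) (cong (ℕ._* size E) (size-fin (G ℕ.* J)))
    where
    tilt : ∀ {δ} → 0ℚ < δ → ∀ h → ∃[ ε ] 0ℚ < ε × ε * ∣ h ∣ ≤ δ
    tilt {δ} 0<δ h = let (ε , 0<ε , eq) = scale (1ℚ + ∣ h ∣) δ (0<+ 0<1 (0≤∣p∣ h)) 0<δ in
      ε , 0<ε , ≤-trans (*-mono-l (<⇒≤ 0<ε) (p≤q+p (<⇒≤ 0<1))) (≤-reflexive (trans (*-comm ε (1ℚ + ∣ h ∣)) eq))
    size-I : size I ≡ 2 ℕ.* (G ℕ.* J ℕ.* N) ℕ.+ (u ℕ.+ d)
    size-I = trans (size-⊎ ((C ×ᶠ P) ⊎ᶠ (C ×ᶠ P)) (finᶠ u ⊎ᶠ finᶠ d)) (cong₂ ℕ._+_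
      (trans (size-⊎ (C ×ᶠ P) (C ×ᶠ P)) (trans (cong (λ c → c ℕ.+ c) (trans (size-× C P) (cong (ℕ._* N) (size-fin (G ℕ.* J)))))
        (cong (G ℕ.* J ℕ.* N ℕ.+_) (sym (ℕ.+-identityʳ (G ℕ.* J ℕ.* N))))))
      (trans (size-⊎ (finᶠ u) (finᶠ d)) (cong₂ ℕ._+_ (size-fin u) (size-fin d))))

-- The exponential and the logarithm

expTerm-mono : ∀ k {x y} → 0ℚ ≤ x → x ≤ y → 0ℚ ≤ expTerm k x × expTerm k x ≤ expTerm k y
expTerm-mono zero    _ _ = <⇒≤ 0<1 , ≤-refl
expTerm-mono (suc k) {x} {y} 0≤x x≤y = let (0≤t , t≤) = expTerm-mono k 0≤x x≤y in
  0≤t ⊗ 0≤x ⊗ 0≤inv k , *-mono-r (0≤inv k) (*-mono 0≤t (≤-trans 0≤x x≤y) t≤ x≤y)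

expSum-mono : ∀ k {x y} → 0ℚ ≤ x → x ≤ y → expSum k x ≤ expSum k y
expSum-mono zero    _ _ = ≤-refl
expSum-mono (suc k) 0≤x x≤y = +-mono-≤ (expSum-mono k 0≤x x≤y) (proj₂ (expTerm-mono k 0≤x x≤y))

expSum-zero : ∀ k → expSum k 0ℚ ≤ 1ℚ
expSum-zero zero    = <⇒≤ 0<1
expSum-zero (suc k) = ≤-reflexive (go k)
  where
  term : ∀ k → expTerm (suc k) 0ℚ ≡ 0ℚ
  term k = trans (cong (_* inv k) (*-zeroʳ (expTerm k 0ℚ))) (*-zeroˡ (inv k))
  go : ∀ k → expSum (suc k) 0ℚ ≡ 1ℚ
  go zero    = refl
  go (suc k) = cong₂ _+_ (go k) (term k)

-- The truncated form of (1 - z) exp(y + z) ≤ exp(y). The Lipschitz constant of a partial sum is the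
-- preceding partial sum at the larger argument, which gives the bound without a limit.
expSum-shift : ∀ k {y z} → 0ℚ ≤ y → 0ℚ < z → (1ℚ - z) * expSum k (y + z) ≤ expSum k y
expSum-shift zero {y} {z} _ _ = ≤-reflexive (*-zeroʳ (1ℚ - z))
expSum-shift (suc k) {y} {z} 0≤y 0<z = ≤-by
  ((z * expSum k B - (expSum (suc k) B - expSum (suc k) y)) + z * expTerm k B)
  (0≤- (≤-trans (∣∣≤⇒≤ {expSum (suc k) B - expSum (suc k) y} (sum-lipschitz-suc 0<B (≤-reflexive ∣B∣) ∣y∣≤B k))
      (≤-reflexive (trans (cong (λ d → expSum k B * d) (trans (cong ∣_∣ (eq y z)) (∣pos∣ (<⇒≤ 0<z)))) (*-comm (expSum k B) z))))
    ⊕ <⇒≤ 0<z ⊗ 0≤term 0<B k)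
  (eq′ (expSum k B) (expTerm k B) (expSum (suc k) y) z)
  where
  B : ℚ
  B = y + z
  0<B : 0ℚ < B
  0<B = <-≤-trans 0<z (p≤q+p 0≤y)
  ∣B∣ : ∣ B ∣ ≡ B
  ∣B∣ = ∣pos∣ (<⇒≤ 0<B)
  ∣y∣≤B : ∣ y ∣ ≤ B
  ∣y∣≤B = ≤-trans (≤-reflexive (∣pos∣ 0≤y)) (p≤p+q (<⇒≤ 0<z))
  eq : ∀ y z → y + z - y ≡ z
  eq = solve-∀ ℚ-ring
  eq′ : ∀ S T s z → s ≡ (1ℚ - z) * (S + T) + ((z * S - ((S + T) - s)) + z * T)
  eq′ = solve-∀ ℚ-ring

-- As 1 - 3/8 is 5/8, the shift inequality yields exp(3/8) ≤ 8/5, the gain of one stage.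
3/8 : ℚ
3/8 = ι 3 * inv 7

0<3/8 : 0ℚ < 3/8
0<3/8 = 0<* (0<ι-suc 2) (inv>0 7)

expSum-3/8 : ∀ k t → ι (5 ℕ.^ t) * expSum k (ι t * 3/8) ≤ ι (8 ℕ.^ t)
expSum-3/8 k zero    = ≤-trans (≤-reflexive (*-identityˡ (expSum k (ι 0 * 3/8)))) (expSum-zero k)
expSum-3/8 k (suc t) = begin
  ι (5 ℕ.^ suc t) * expSum k (ι (suc t) * 3/8)
    ≡⟨ cong₂ _*_ (ι-* 5 (5 ℕ.^ t)) (cong (expSum k) (trans (cong (_* 3/8) (ι-suc t)) (eq₁ (ι t) 3/8))) ⟩
  ι 5 * ι (5 ℕ.^ t) * expSum k (ι t * 3/8 + 3/8)
    ≡⟨ eq₂ (ι (5 ℕ.^ t)) (expSum k (ι t * 3/8 + 3/8)) ⟩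
  ι 8 * ι (5 ℕ.^ t) * ((1ℚ - 3/8) * expSum k (ι t * 3/8 + 3/8))
    ≤⟨ *-mono-l (0≤ι 8 ⊗ 0≤ι (5 ℕ.^ t)) (expSum-shift k (0≤ι t ⊗ <⇒≤ 0<3/8) 0<3/8) ⟩
  ι 8 * ι (5 ℕ.^ t) * expSum k (ι t * 3/8)
    ≡⟨ *-assoc (ι 8) (ι (5 ℕ.^ t)) (expSum k (ι t * 3/8)) ⟩
  ι 8 * (ι (5 ℕ.^ t) * expSum k (ι t * 3/8))
    ≤⟨ *-mono-l (0≤ι 8) (expSum-3/8 k t) ⟩
  ι 8 * ι (8 ℕ.^ t)
    ≡⟨ ι-* 8 (8 ℕ.^ t) ⟨
  ι (8 ℕ.^ suc t) ∎
  where
  open ≤-Reasoning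
  eq₁ : ∀ t z → (1ℚ + t) * z ≡ t * z + z
  eq₁ = solve-∀ ℚ-ring
  eq₂ : ∀ f e → ι 5 * f * e ≡ ι 8 * f * ((1ℚ - 3/8) * e)
  eq₂ = solve-∀ ℚ-ring

harmonic-mono : ∀ {m n} → m ℕ.≤′ n → harmonic m ≤ harmonic n
harmonic-mono ℕ.≤′-refl           = ≤-refl
harmonic-mono (ℕ.≤′-step {n} m≤n) = ≤-trans (harmonic-mono m≤n) (p≤p+q (0≤inv n))

-- Doubling adds `a` terms, none above 1/`a`. This amounts to log 2 ≤ 1, so that binary exponents
-- bound natural logarithms.
harmonic-double : ∀ a → harmonic (a ℕ.+ a) ≤ 1ℚ + harmonic a
harmonic-double zero    = <⇒≤ 0<1
harmonic-double (suc a) = ≤-trans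
  (block-upper 0 {inv a} (suc a) (suc a) (λ i _ → inv-anti (ℕ.≤-trans (ℕ.n≤1+n a) (ℕ.m≤n+m (suc a) i))))
  (≤-reflexive (cong (_+ harmonic (suc a)) (ι*inv a)))

harmonic-2^ : ∀ a s → harmonic (a ℕ.* 2 ℕ.^ s) ≤ ι s + harmonic a
harmonic-2^ a zero    = ≤-reflexive (trans (cong harmonic (ℕ.*-identityʳ a)) (sym (+-identityˡ (harmonic a))))
harmonic-2^ a (suc s) = begin
  harmonic (a ℕ.* (2 ℕ.* 2 ℕ.^ s))               ≡⟨ cong harmonic (eq a (2 ℕ.^ s)) ⟩
  harmonic (a ℕ.* 2 ℕ.^ s ℕ.+ a ℕ.* 2 ℕ.^ s)     ≤⟨ harmonic-double (a ℕ.* 2 ℕ.^ s) ⟩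
  1ℚ + harmonic (a ℕ.* 2 ℕ.^ s)                  ≤⟨ +-monoʳ-≤ 1ℚ (harmonic-2^ a s) ⟩
  1ℚ + (ι s + harmonic a)                        ≡⟨ +-assoc 1ℚ (ι s) (harmonic a) ⟨
  1ℚ + ι s + harmonic a                          ≡⟨ cong (_+ harmonic a) (ι-suc s) ⟨
  ι (suc s) + harmonic a                         ∎
  where
  open ≤-Reasoning
  eq : ∀ a p → a ℕ.* (2 ℕ.* p) ≡ a ℕ.* p ℕ.+ a ℕ.* p
  eq = ℕ-solve

logSeq-bounds : ∀ {n s} → 1 ℕ.≤ n → n ℕ.≤ 2 ℕ.^ s → ∀ k → 0ℚ ≤ logSeq n k × logSeq n k ≤ ι s
logSeq-bounds {n} {s} 1≤n n≤2^s k =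
  0≤- (harmonic-mono (ℕ.≤⇒≤′ (ℕ.≤-trans (ℕ.≤-reflexive (sym (ℕ.*-identityʳ (suc k)))) (ℕ.*-monoʳ-≤ (suc k) 1≤n)))) ,
  ≤+⇒-≤ {harmonic (suc k ℕ.* n)} {harmonic (suc k)}
    (≤-trans (harmonic-mono (ℕ.≤⇒≤′ (ℕ.*-monoʳ-≤ (suc k) n≤2^s)))
      (≤-trans (harmonic-2^ (suc k) s) (≤-reflexive (+-comm (ι s) (harmonic (suc k))))))

-- The root of the logarithm is at most 136`t`, and 136/512 ≤ 3/8; hence the constant 1/512. The
-- bound holds for each approximant `k`, so no limit has to be taken.
exp-sqrt-log : ∀ {n s t} → 1 ℕ.≤ n → n ℕ.≤ 2 ℕ.^ s → s ℕ.≤ (t ℕ.* 136) ℕ.* (t ℕ.* 136) → ∀ k →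
               ι (5 ℕ.^ t) * expSum k (inv 511 * sqrtℚ k (logSeq n k)) ≤ ι (8 ℕ.^ t)
exp-sqrt-log {n} {s} {t} 1≤n n≤2^s s≤ k = ≤-trans
  (*-mono-l (0≤ι (5 ℕ.^ t)) (expSum-mono k (0≤inv 511 ⊗ 0≤sqrtℚ k (logSeq n k)) arg≤)) (expSum-3/8 k t)
  where
  R : ℚ
  R = ι (t ℕ.* 136)
  0≤log×log≤ = logSeq-bounds {n} {s} 1≤n n≤2^s k
  sqrt≤R : sqrtℚ k (logSeq n k) ≤ R
  sqrt≤R = sqrtℚ-≤ k (0≤ι (t ℕ.* 136)) (≤-trans (≤-reflexive (∣pos∣ (proj₁ 0≤log×log≤)))
    (≤-trans (proj₂ 0≤log×log≤) (≤-trans (ι-mono s≤) (≤-reflexive (ι-* (t ℕ.* 136) (t ℕ.* 136))))))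
  arg≤ : inv 511 * sqrtℚ k (logSeq n k) ≤ ι t * 3/8
  arg≤ = begin
    inv 511 * sqrtℚ k (logSeq n k)     ≤⟨ *-mono-l (0≤inv 511) sqrt≤R ⟩
    inv 511 * ι (t ℕ.* 136)            ≡⟨ trans (cong (inv 511 *_) (ι-* t 136)) (eq (inv 511) (ι t) (ι 136)) ⟩
    ι t * (inv 511 * ι 136)            ≤⟨ *-mono-l (0≤ι t) (from-yes (inv 511 * ι 136 ≤? 3/8)) ⟩
    ι t * 3/8                          ∎
    where
    open ≤-Reasoning
    eq : ∀ i t c → i * (t * c) ≡ t * (i * c)
    eq = solve-∀ ℚ-ring

-- The choice of parameters

-- The length of the interval of abscissae that a rounded pattern needs: its number of points times
-- the range of its quotients.
width : ℕ → ℕ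
width m = ∣P∣ m ℕ.* (resolution m ℕ.* 8)

fromLayout : ∀ {n b} (Λ : Layout b) → size (Layout.I Λ) ≡ n → 1 ℕ.≤ b → b ℕ.* b ℕ.≤ n →
             Σ[ P ∈ PointSet n ] GeneralPosition P × Dense (fromℕ 4) P × HalvingLines≥ P (size (Layout.E Λ))
fromLayout Λ refl 1≤b b²≤n = realize (configuration Λ 1≤b b²≤n)

divide : ∀ b D → 0 ℕ.< D → D ℕ.≤ b → ∃[ h ] 1 ℕ.≤ h × h ℕ.* D ℕ.≤ b × b ℕ.< suc h ℕ.* D
divide b D 0<D D≤b = b ℕ./ D , ℕ.m≥n⇒m/n>0 D≤b , ℕ.m/n*n≤m b D ,
  ℕ.≤-<-trans (ℕ.≤-reflexive (ℕ.m≡m%n+[m/n]*n b D)) (ℕ.+-monoˡ-< (b ℕ./ D ℕ.* D) (ℕ.m%n<n b D))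
  where
  instance
    D≢0 : NonZero D
    D≢0 = ℕ.>-nonZero 0<D

assemble : ∀ m n b → 2 ℕ.∣ n → b ℕ.* b ℕ.≤ n → n ℕ.< suc b ℕ.* suc b → width m ℕ.* 32 ℕ.≤ b →
           Σ[ Λ ∈ Layout b ] size (Layout.I Λ) ≡ n × n ℕ.* 8 ℕ.^ m ℕ.≤ size (Layout.E Λ) ℕ.* 5 ℕ.^ m ℕ.* 4096
assemble m n b (ℕ.divides n′ n≡) b²≤n n< W≤b = build (∣P∣-even m) (divide b (width m ℕ.* 32) (ℕ.*-mono-< {0} {width m} {0} {32} 0<width (ℕ.s≤s ℕ.z≤n)) W≤b)
  where
  T = patternAt m
  N W : ℕ
  N = ∣P∣ m
  W = resolution m ℕ.* 8
  0<N : 0 ℕ.< N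
  0<N = go m
    where
    go : ∀ m → 0 ℕ.< ∣P∣ m
    go zero    = ℕ.s≤s ℕ.z≤n
    go (suc m) = subst (0 ℕ.<_) (sym (∣P∣-suc m)) (ℕ.*-mono-< {0} {∣P∣ m} {0} (go m) (ℕ.*-mono-< {0} {10} {0} (ℕ.s≤s ℕ.z≤n) (ℕ.m^n>0 16 m)))
  0<W : 0 ℕ.< W
  0<W = ℕ.*-mono-< {0} {resolution m} {0} (resolution>0 m) (ℕ.s≤s ℕ.z≤n)
  0<width : 0 ℕ.< width m
  0<width = ℕ.*-mono-< {0} {N} {0} 0<N 0<W
  Result : Set₁
  Result = Σ[ Λ ∈ Layout b ] size (Layout.I Λ) ≡ n × n ℕ.* 8 ℕ.^ m ℕ.≤ size (Layout.E Λ) ℕ.* 5 ℕ.^ m ℕ.* 4096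
  build : ∃[ N′ ] N ≡ 2 ℕ.* N′ → ∃[ h ] 1 ℕ.≤ h × h ℕ.* (width m ℕ.* 32) ℕ.≤ b × b ℕ.< suc h ℕ.* (width m ℕ.* 32) → Result
  build (N′ , N≡) (h , 1≤h , lower , upper) =
    let (Λ , sizeI , sizeE) = Assembly.assembled T G J L b u d 2≤L fit (ℕ.≤-reflexive 16G≡L) b<8L 2L≤b refl rows
    in Λ , trans sizeI total , ℕ.≤-trans count (ℕ.≤-reflexive (cong (λ e → e ℕ.* 5 ℕ.^ m ℕ.* 4096) (sym sizeE)))
    where
    open ℕ.≤-Reasoning
    -- `z` is the multiple of `N * W` with 32`z` ≤ `b` < 64`z`. Then 16`G` = `L`, `N * J` + `N * W`
    -- ≤ 5`z` ≤ `L`, and `G * J * N` = 2`z`²: the copies on both sides have 4`z`² points, a fixed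
    -- fraction of n. The fillers are the rest, split so that the upper ones exceed the lower ones
    -- by `N`.
    z G J L d u : ℕ
    z = N ℕ.* W ℕ.* h
    G = N′ ℕ.* W ℕ.* h
    J = W ℕ.* h ℕ.* 4
    L = z ℕ.* 8
    d = n′ ℕ.∸ (2 ℕ.* (z ℕ.* z) ℕ.+ N′)
    u = d ℕ.+ N
    instance
      J≢0 : NonZero J
      J≢0 = ℕ.>-nonZero (ℕ.*-mono-< {0} {W ℕ.* h} {0} (ℕ.*-mono-< {0} {W} {0} 0<W 1≤h) (ℕ.s≤s ℕ.z≤n))
    0<z : 1 ℕ.≤ z
    0<z = ℕ.*-mono-< {0} {N ℕ.* W} {0} 0<width 1≤h
    NW≤z : N ℕ.* W ℕ.≤ z
    NW≤z = ℕ.≤-trans (ℕ.≤-reflexive (sym (ℕ.*-identityʳ (N ℕ.* W)))) (ℕ.*-monoʳ-≤ (N ℕ.* W) 1≤h)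
    N≤z : N ℕ.≤ z
    N≤z = ℕ.≤-trans (ℕ.≤-trans (ℕ.≤-reflexive (sym (ℕ.*-identityʳ N))) (ℕ.*-monoʳ-≤ N 0<W)) NW≤z
    2≤L : 2 ℕ.≤ L
    2≤L = ℕ.≤-trans (ℕ.m≤m+n 2 6) (ℕ.*-monoˡ-≤ 8 0<z)
    fit : N ℕ.* J ℕ.+ N ℕ.* W ℕ.≤ L
    fit = begin
      N ℕ.* (W ℕ.* h ℕ.* 4) ℕ.+ N ℕ.* W   ≤⟨ ℕ.+-monoʳ-≤ (N ℕ.* J) NW≤z ⟩
      N ℕ.* (W ℕ.* h ℕ.* 4) ℕ.+ z         ≡⟨ eq N W h ⟩
      z ℕ.* 5                             ≤⟨ ℕ.*-monoʳ-≤ z (ℕ.m≤m+n 5 3) ⟩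
      z ℕ.* 8                             ∎
      where
      eq : ∀ N W h → N ℕ.* (W ℕ.* h ℕ.* 4) ℕ.+ N ℕ.* W ℕ.* h ≡ N ℕ.* W ℕ.* h ℕ.* 5
      eq = ℕ-solve
    16G≡L : G ℕ.* 16 ≡ L
    16G≡L = trans (eq N′ W h) (cong (λ N → N ℕ.* W ℕ.* h ℕ.* 8) (sym N≡))
      where
      eq : ∀ N′ W h → N′ ℕ.* W ℕ.* h ℕ.* 16 ≡ 2 ℕ.* N′ ℕ.* W ℕ.* h ℕ.* 8
      eq = ℕ-solve
    32z≤b : z ℕ.* 32 ℕ.≤ b
    32z≤b = ℕ.≤-trans (ℕ.≤-reflexive (eq (N ℕ.* W) h 32)) lower
      where
      eq : ∀ w h c → w ℕ.* h ℕ.* c ≡ h ℕ.* (w ℕ.* c)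
      eq = ℕ-solve
    b<64z : b ℕ.< z ℕ.* 64
    b<64z = ℕ.<-≤-trans upper (ℕ.≤-trans (ℕ.*-monoˡ-≤ (width m ℕ.* 32) (ℕ.+-monoˡ-≤ h 1≤h)) (ℕ.≤-reflexive (eq (N ℕ.* W) h 32)))
      where
      eq : ∀ w h c → (h ℕ.+ h) ℕ.* (w ℕ.* c) ≡ w ℕ.* h ℕ.* (c ℕ.+ c)
      eq = ℕ-solve
    b<8L : b ℕ.< L ℕ.* 8
    b<8L = ℕ.<-≤-trans b<64z (ℕ.≤-reflexive (sym (ℕ.*-assoc z 8 8)))
    2L≤b : L ℕ.+ L ℕ.≤ b
    2L≤b = ℕ.≤-trans (ℕ.≤-trans (ℕ.≤-reflexive (sym (ℕ.*-distribˡ-+ z 8 8))) (ℕ.*-monoʳ-≤ z (ℕ.m≤m+n 16 16))) 32z≤b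
    n≡2n′ : n ≡ 2 ℕ.* n′
    n≡2n′ = trans n≡ (ℕ.*-comm n′ 2)
    room : 2 ℕ.* (z ℕ.* z) ℕ.+ N′ ℕ.≤ n′
    room = ℕ.*-cancelˡ-≤ 2 (begin
      2 ℕ.* (2 ℕ.* (z ℕ.* z) ℕ.+ N′)        ≡⟨ eq z N′ ⟩
      4 ℕ.* (z ℕ.* z) ℕ.+ 2 ℕ.* N′          ≡⟨ cong (4 ℕ.* (z ℕ.* z) ℕ.+_) N≡ ⟨
      4 ℕ.* (z ℕ.* z) ℕ.+ N                 ≤⟨ ℕ.+-monoʳ-≤ (4 ℕ.* (z ℕ.* z)) (ℕ.≤-trans N≤z (ℕ.≤-trans (ℕ.≤-reflexive (sym (ℕ.*-identityʳ z))) (ℕ.*-monoʳ-≤ z 0<z))) ⟩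
      4 ℕ.* (z ℕ.* z) ℕ.+ z ℕ.* z           ≡⟨ eq₅ z ⟩
      z ℕ.* z ℕ.* 5                         ≤⟨ ℕ.*-monoʳ-≤ (z ℕ.* z) (ℕ.m≤m+n 5 11) ⟩
      z ℕ.* z ℕ.* 16                        ≡⟨ eq₁₆ z ⟩
      (z ℕ.* 4) ℕ.* (z ℕ.* 4)               ≤⟨ ℕ.*-mono-≤ 4z≤b 4z≤b ⟩
      b ℕ.* b                               ≤⟨ b²≤n ⟩
      n                                     ≡⟨ n≡2n′ ⟩
      2 ℕ.* n′                              ∎)
      where
      4z≤b : z ℕ.* 4 ℕ.≤ b
      4z≤b = ℕ.≤-trans (ℕ.*-monoʳ-≤ z (ℕ.m≤m+n 4 28)) 32z≤b
      eq : ∀ z N → 2 ℕ.* (2 ℕ.* (z ℕ.* z) ℕ.+ N) ≡ 4 ℕ.* (z ℕ.* z) ℕ.+ 2 ℕ.* N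
      eq = ℕ-solve
      eq₅ : ∀ z → 4 ℕ.* (z ℕ.* z) ℕ.+ z ℕ.* z ≡ z ℕ.* z ℕ.* 5
      eq₅ = ℕ-solve
      eq₁₆ : ∀ z → z ℕ.* z ℕ.* 16 ≡ (z ℕ.* 4) ℕ.* (z ℕ.* 4)
      eq₁₆ = ℕ-solve
    GJN : G ℕ.* J ℕ.* N ≡ 2 ℕ.* (z ℕ.* z)
    GJN = trans (cong (G ℕ.* J ℕ.*_) N≡) (trans (eq N′ W h) (cong (λ N → 2 ℕ.* (N ℕ.* W ℕ.* h ℕ.* (N ℕ.* W ℕ.* h))) (sym N≡)))
      where
      eq : ∀ N W h → N ℕ.* W ℕ.* h ℕ.* (W ℕ.* h ℕ.* 4) ℕ.* (2 ℕ.* N) ≡ 2 ℕ.* (2 ℕ.* N ℕ.* W ℕ.* h ℕ.* (2 ℕ.* N ℕ.* W ℕ.* h))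
      eq = ℕ-solve
    total : 2 ℕ.* (G ℕ.* J ℕ.* N) ℕ.+ (u ℕ.+ d) ≡ n
    total = trans (cong₂ (λ g N → 2 ℕ.* g ℕ.+ (d ℕ.+ N ℕ.+ d)) GJN N≡) (trans (eq (z ℕ.* z) N′ d)
      (trans (cong (2 ℕ.*_) (ℕ.m+[n∸m]≡n room)) (sym n≡2n′)))
      where
      eq : ∀ q N d → 2 ℕ.* (2 ℕ.* q) ℕ.+ (d ℕ.+ 2 ℕ.* N ℕ.+ d) ≡ 2 ℕ.* (2 ℕ.* q ℕ.+ N ℕ.+ d)
      eq = ℕ-solve
    -- Writing `b` as 32`z` + `w` removes the truncated subtraction, and what is left is a
    -- polynomial inequality with nonnegative coefficients.
    rows : u ℕ.≤ (b ℕ.∸ L) ℕ.* suc b ℕ.+ suc b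
    rows = ℕ.*-cancelˡ-≤ 2 (begin
      2 ℕ.* (d ℕ.+ N)                                  ≤⟨ ℕ.*-monoʳ-≤ 2 (ℕ.+-mono-≤ (ℕ.m∸n≤m n′ (2 ℕ.* (z ℕ.* z) ℕ.+ N′)) N≤z) ⟩
      2 ℕ.* (n′ ℕ.+ z)                                 ≡⟨ trans (ℕ.*-distribˡ-+ 2 n′ z) (cong (ℕ._+ 2 ℕ.* z) (sym n≡2n′)) ⟩
      n ℕ.+ 2 ℕ.* z                                    ≤⟨ ℕ.+-monoˡ-≤ (2 ℕ.* z) (ℕ.<⇒≤ n<) ⟩
      suc b ℕ.* suc b ℕ.+ 2 ℕ.* z                      ≡⟨ cong (λ b → suc b ℕ.* suc b ℕ.+ 2 ℕ.* z) b≡ ⟩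
      suc b′ ℕ.* suc b′ ℕ.+ 2 ℕ.* z                    ≤⟨ ℕ.m≤m+n _ (b′ ℕ.* (z ℕ.* 16 ℕ.+ w ℕ.+ 1) ℕ.+ (z ℕ.* 14 ℕ.+ w ℕ.+ 1)) ⟩
      suc b′ ℕ.* suc b′ ℕ.+ 2 ℕ.* z ℕ.+ (b′ ℕ.* (z ℕ.* 16 ℕ.+ w ℕ.+ 1) ℕ.+ (z ℕ.* 14 ℕ.+ w ℕ.+ 1))
                                                       ≡⟨ eq z w ⟨
      2 ℕ.* ((z ℕ.* 24 ℕ.+ w) ℕ.* suc b′ ℕ.+ suc b′)   ≡⟨ cong₂ (λ r b → 2 ℕ.* (r ℕ.* suc b ℕ.+ suc b)) (sym r≡) (sym b≡) ⟩
      2 ℕ.* ((b ℕ.∸ L) ℕ.* suc b ℕ.+ suc b)            ∎)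
      where
      w b′ : ℕ
      w = b ℕ.∸ z ℕ.* 32
      b′ = z ℕ.* 32 ℕ.+ w
      b≡ : b ≡ b′
      b≡ = sym (ℕ.m+[n∸m]≡n 32z≤b)
      r≡ : b ℕ.∸ L ≡ z ℕ.* 24 ℕ.+ w
      r≡ = trans (cong (ℕ._∸ L) (trans b≡ (eq′ z w))) (ℕ.m+n∸m≡n (z ℕ.* 8) (z ℕ.* 24 ℕ.+ w))
        where
        eq′ : ∀ z w → z ℕ.* 32 ℕ.+ w ≡ z ℕ.* 8 ℕ.+ (z ℕ.* 24 ℕ.+ w)
        eq′ = ℕ-solve
      eq : ∀ z w → 2 ℕ.* ((z ℕ.* 24 ℕ.+ w) ℕ.* suc (z ℕ.* 32 ℕ.+ w) ℕ.+ suc (z ℕ.* 32 ℕ.+ w)) ≡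
        suc (z ℕ.* 32 ℕ.+ w) ℕ.* suc (z ℕ.* 32 ℕ.+ w) ℕ.+ 2 ℕ.* z ℕ.+ ((z ℕ.* 32 ℕ.+ w) ℕ.* (z ℕ.* 16 ℕ.+ w ℕ.+ 1) ℕ.+ (z ℕ.* 14 ℕ.+ w ℕ.+ 1))
      eq = ℕ-solve
    edges : z ℕ.* z ℕ.* 8 ℕ.^ m ≡ G ℕ.* J ℕ.* ∣E∣ m ℕ.* 5 ℕ.^ m
    edges = ℕ.*-cancelˡ-≡ _ _ 2 (trans (eq₁ (z ℕ.* z) (8 ℕ.^ m)) (trans (cong (ℕ._* 8 ℕ.^ m) (sym GJN))
      (trans (ℕ.*-assoc (G ℕ.* J) N (8 ℕ.^ m)) (trans (cong (G ℕ.* J ℕ.*_) (sym (∣E∣∣P∣ m))) (eq₂ (G ℕ.* J) (∣E∣ m) (5 ℕ.^ m))))))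
      where
      eq₁ : ∀ q e → 2 ℕ.* (q ℕ.* e) ≡ 2 ℕ.* q ℕ.* e
      eq₁ = ℕ-solve
      eq₂ : ∀ g e f → g ℕ.* (e ℕ.* 2 ℕ.* f) ≡ 2 ℕ.* (g ℕ.* e ℕ.* f)
      eq₂ = ℕ-solve
    -- The copies use only a fixed fraction of the points; as n is at most (64`z`)², the loss is the
    -- factor 4096.
    count : n ℕ.* 8 ℕ.^ m ℕ.≤ G ℕ.* J ℕ.* ∣E∣ m ℕ.* 5 ℕ.^ m ℕ.* 4096
    count = begin
      n ℕ.* 8 ℕ.^ m                                ≤⟨ ℕ.*-monoˡ-≤ (8 ℕ.^ m) (ℕ.≤-trans (ℕ.<⇒≤ n<) (ℕ.*-mono-≤ b<64z b<64z)) ⟩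
      (z ℕ.* 64) ℕ.* (z ℕ.* 64) ℕ.* 8 ℕ.^ m        ≡⟨ eq z 64 (8 ℕ.^ m) ⟩
      z ℕ.* z ℕ.* 8 ℕ.^ m ℕ.* (64 ℕ.* 64)          ≡⟨ cong (ℕ._* 4096) edges ⟩
      G ℕ.* J ℕ.* ∣E∣ m ℕ.* 5 ℕ.^ m ℕ.* 4096       ∎
      where
      eq : ∀ z c e → (z ℕ.* c) ℕ.* (z ℕ.* c) ℕ.* e ≡ z ℕ.* z ℕ.* e ℕ.* (c ℕ.* c)
      eq = ℕ-solve

-- A record, so that powers of two are never unfolded.
infix 4 _≤2^_
record _≤2^_ (x e : ℕ) : Set where
  constructor below
  field
    ≤2^⁻¹ : x ℕ.≤ 2 ℕ.^ e

open _≤2^_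

2^-* : ∀ {x y e f} → x ≤2^ e → y ≤2^ f → x ℕ.* y ≤2^ e ℕ.+ f
2^-* {x} {y} {e} {f} (below hx) (below hy) = below (ℕ.≤-trans (ℕ.*-mono-≤ hx hy) (ℕ.≤-reflexive (sym (ℕ.^-distribˡ-+-* 2 e f))))

2^-mono : ∀ {x e f} → e ℕ.≤ f → x ≤2^ e → x ≤2^ f
2^-mono h (below hx) = below (ℕ.≤-trans hx (ℕ.^-monoʳ-≤ 2 h))

-- Growth of the width, thresholds and the final bound

width-suc : ∀ m → let t = 2 ℕ.^ m in
            width (suc m) ≡ width m ℕ.* (10 ℕ.* 16 ℕ.^ m ℕ.* (t ℕ.* t ℕ.* (t ℕ.* t) ℕ.* multiplicity m ℕ.* 2 ℕ.^ 16))
width-suc m = trans (cong (ℕ._* (resolution m ℕ.* f ℕ.* 8)) (∣P∣-suc m)) (eq (∣P∣ m) (10 ℕ.* 16 ℕ.^ m) (resolution m) f 8)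
  where
  f = 2 ℕ.^ m ℕ.* 2 ℕ.^ m ℕ.* (2 ℕ.^ m ℕ.* 2 ℕ.^ m) ℕ.* multiplicity m ℕ.* 2 ℕ.^ 16
  eq : ∀ p t r k c → p ℕ.* t ℕ.* (r ℕ.* k ℕ.* c) ≡ p ℕ.* (r ℕ.* c) ℕ.* (t ℕ.* k)
  eq = ℕ-solve

-- The stage after m adds at most 12m + 23 to the exponent, while 23m² grows by 46m + 23; the
-- difference 34m is the slack supplied in the proof.
width≤ : ∀ m → width m ≤2^ m ℕ.* m ℕ.* 23 ℕ.+ 10
width≤ zero    = below (ℕ.≤ᵇ⇒≤ (width 0) (2 ℕ.^ 10) tt)
width≤ (suc m) = subst (_≤2^ suc m ℕ.* suc m ℕ.* 23 ℕ.+ 10) (sym (width-suc m))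
  (2^-mono (ℕ.≤-trans (ℕ.m≤m+n (m ℕ.* m ℕ.* 23 ℕ.+ 10 ℕ.+ (e₁ ℕ.+ (e₂ ℕ.+ e₃ ℕ.+ 16))) (m ℕ.* 34)) (ℕ.≤-reflexive (eq m)))
    (2^-* (width≤ m) (2^-* (2^-* (below {10} {4} (ℕ.≤ᵇ⇒≤ 10 16 tt)) 16^m≤)
      (2^-* (2^-* (2^-* (2^-* 2^m≤ 2^m≤) (2^-* 2^m≤ 2^m≤)) (2^-* (below {8} {3} (ℕ.≤ᵇ⇒≤ 8 8 tt)) 16^m≤)) (below {2 ℕ.^ 16} {16} (ℕ.≤ᵇ⇒≤ (2 ℕ.^ 16) (2 ℕ.^ 16) tt))))))
  where
  e₁ e₂ e₃ : ℕ
  e₁ = 4 ℕ.+ 4 ℕ.* m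
  e₂ = m ℕ.+ m ℕ.+ (m ℕ.+ m)
  e₃ = 3 ℕ.+ 4 ℕ.* m
  16^m≤ : 16 ℕ.^ m ≤2^ 4 ℕ.* m
  16^m≤ = below (ℕ.≤-reflexive (ℕ.^-*-assoc 2 4 m))
  2^m≤ : 2 ℕ.^ m ≤2^ m
  2^m≤ = below ℕ.≤-refl
  eq : ∀ m → m ℕ.* m ℕ.* 23 ℕ.+ 10 ℕ.+ (4 ℕ.+ 4 ℕ.* m ℕ.+ (m ℕ.+ m ℕ.+ (m ℕ.+ m) ℕ.+ (3 ℕ.+ 4 ℕ.* m) ℕ.+ 16)) ℕ.+ m ℕ.* 34 ≡
       suc m ℕ.* suc m ℕ.* 23 ℕ.+ 10
  eq = ℕ-solve

abstract
  -- log₂ of the side length from which the stage t + 18 is available.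
  exponent : ℕ → ℕ
  exponent t = (t ℕ.+ 18) ℕ.* (t ℕ.+ 18) ℕ.* 23 ℕ.+ 15

  exponent≡ : ∀ t → exponent t ≡ (t ℕ.+ 18) ℕ.* (t ℕ.+ 18) ℕ.* 23 ℕ.+ 15
  exponent≡ t = refl

-- The exponent is doubled because n is about the square of the side length.
threshold : ℕ → ℕ
threshold t = 2 ℕ.^ (exponent t ℕ.+ exponent t)

private
  -- The origin of 136: with x ≤ 20`T` the left side is at most (46 · 400 + 30)`T`² = 18430`T`², and
  -- 136² is 18496.
  quadratic-bound : ∀ {T x} → 1 ℕ.≤ T → x ℕ.≤ T ℕ.* 20 → (x ℕ.* x ℕ.* 23 ℕ.+ 15) ℕ.+ (x ℕ.* x ℕ.* 23 ℕ.+ 15) ℕ.≤ (T ℕ.* 136) ℕ.* (T ℕ.* 136)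
  quadratic-bound {T} {x} 1≤T bound = begin
    (x ℕ.* x ℕ.* 23 ℕ.+ 15) ℕ.+ (x ℕ.* x ℕ.* 23 ℕ.+ 15)
      ≡⟨ double (x ℕ.* x) 23 15 ⟩
    x ℕ.* x ℕ.* 46 ℕ.+ 1 ℕ.* 30
      ≤⟨ ℕ.+-mono-≤ (ℕ.*-monoˡ-≤ 46 (ℕ.*-mono-≤ bound bound)) (ℕ.*-monoˡ-≤ 30 {1} {T ℕ.* T} (ℕ.*-mono-≤ 1≤T 1≤T)) ⟩
    (T ℕ.* 20) ℕ.* (T ℕ.* 20) ℕ.* 46 ℕ.+ T ℕ.* T ℕ.* 30
      ≡⟨ collect T 20 46 30 ⟩
    T ℕ.* T ℕ.* (20 ℕ.* 20 ℕ.* 46 ℕ.+ 30)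
      ≤⟨ ℕ.*-monoʳ-≤ (T ℕ.* T) (ℕ.≤ᵇ⇒≤ (20 ℕ.* 20 ℕ.* 46 ℕ.+ 30) (136 ℕ.* 136) tt) ⟩
    T ℕ.* T ℕ.* (136 ℕ.* 136)
      ≡⟨ square T 136 ⟩
    (T ℕ.* 136) ℕ.* (T ℕ.* 136) ∎
    where
    open ℕ.≤-Reasoning
    double : ∀ x c d → x ℕ.* c ℕ.+ d ℕ.+ (x ℕ.* c ℕ.+ d) ≡ x ℕ.* (c ℕ.+ c) ℕ.+ 1 ℕ.* (d ℕ.+ d)
    double = ℕ-solve
    collect : ∀ T a b c → (T ℕ.* a) ℕ.* (T ℕ.* a) ℕ.* b ℕ.+ T ℕ.* T ℕ.* c ≡ T ℕ.* T ℕ.* (a ℕ.* a ℕ.* b ℕ.+ c)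
    collect = ℕ-solve
    square : ∀ T a → T ℕ.* T ℕ.* (a ℕ.* a) ≡ (T ℕ.* a) ℕ.* (T ℕ.* a)
    square = ℕ-solve

exponent≤ : ∀ t → exponent (suc (suc t)) ℕ.+ exponent (suc (suc t)) ℕ.≤ (suc t ℕ.* 136) ℕ.* (suc t ℕ.* 136)
exponent≤ t = subst (λ e → e ℕ.+ e ℕ.≤ (suc t ℕ.* 136) ℕ.* (suc t ℕ.* 136)) (sym (exponent≡ (suc (suc t))))
  (quadratic-bound {suc t} {suc (suc t) ℕ.+ 18} (ℕ.s≤s ℕ.z≤n) (ℕ.≤-trans (ℕ.m≤m+n (suc (suc t) ℕ.+ 18) (t ℕ.* 19)) (ℕ.≤-reflexive (eq t))))
  where
  eq : ∀ t → suc (suc t) ℕ.+ 18 ℕ.+ t ℕ.* 19 ≡ suc t ℕ.* 20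
  eq = ℕ-solve

n<2^n : ∀ n → n ℕ.< 2 ℕ.^ n
n<2^n zero    = ℕ.s≤s ℕ.z≤n
n<2^n (suc n) = ℕ.≤-trans (ℕ.+-mono-≤ (ℕ.m^n>0 2 n) (n<2^n n)) (ℕ.≤-reflexive (cong (2 ℕ.^ n ℕ.+_) (sym (ℕ.+-identityʳ (2 ℕ.^ n)))))

n<threshold : ∀ n → n ℕ.< threshold (suc n)
n<threshold n = ℕ.<-≤-trans (n<2^n n) (ℕ.^-monoʳ-≤ 2 n≤)
  where
  n≤ : n ℕ.≤ exponent (suc n) ℕ.+ exponent (suc n)
  n≤ = begin
    n                                     ≤⟨ ℕ.≤-trans (ℕ.n≤1+n n) (ℕ.m≤m+n (suc n) 18) ⟩
    k                                     ≤⟨ ℕ.m≤m*n k k ⟩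
    k ℕ.* k                               ≤⟨ ℕ.m≤m*n (k ℕ.* k) 23 ⟩
    k ℕ.* k ℕ.* 23                        ≤⟨ ℕ.m≤m+n (k ℕ.* k ℕ.* 23) 15 ⟩
    k ℕ.* k ℕ.* 23 ℕ.+ 15                 ≡⟨ exponent≡ (suc n) ⟨
    exponent (suc n)                      ≤⟨ ℕ.m≤m+n (exponent (suc n)) (exponent (suc n)) ⟩
    exponent (suc n) ℕ.+ exponent (suc n) ∎
    where
    open ℕ.≤-Reasoning
    k = suc n ℕ.+ 18

last-threshold : ∀ {n} → threshold 1 ℕ.≤ n → ∃[ t ] threshold (suc t) ℕ.≤ n × n ℕ.< threshold (suc (suc t))
last-threshold {n} h = go n (n<threshold n)
  where
  go : ∀ k → n ℕ.< threshold (suc k) → ∃[ t ] threshold (suc t) ℕ.≤ n × n ℕ.< threshold (suc (suc t))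
  go zero    n< = contradiction (ℕ.<-≤-trans n< h) (ℕ.<-irrefl refl)
  go (suc k) n< = step (ℕ.≤-<-connex (threshold (suc k)) n)
    where
    step : threshold (suc k) ℕ.≤ n ⊎ n ℕ.< threshold (suc k) → ∃[ t ] threshold (suc t) ℕ.≤ n × n ℕ.< threshold (suc (suc t))
    step (inj₁ k≤n) = k , k≤n , n<
    step (inj₂ n<k) = go k n<k

isqrt>0 : ∀ {n} → 0 ℕ.< n → 1 ℕ.≤ isqrt n
isqrt>0 {n} 0<n = ℕ.≰⇒> λ b≤0 → ℕ.<-irrefl refl (ℕ.<-≤-trans (isqrt-upper n)
  (ℕ.≤-trans (ℕ.*-mono-≤ (ℕ.s≤s b≤0) (ℕ.s≤s b≤0)) 0<n))

wide : ∀ {n} t → threshold t ℕ.≤ n → width (t ℕ.+ 18) ℕ.* 32 ℕ.≤ isqrt n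
wide {n} t h = ℕ.≤-trans (≤2^⁻¹ (subst (width (t ℕ.+ 18) ℕ.* 32 ≤2^_) (trans (ℕ.+-assoc ((t ℕ.+ 18) ℕ.* (t ℕ.+ 18) ℕ.* 23) 10 5) (sym (exponent≡ t)))
    (2^-* (width≤ (t ℕ.+ 18)) (below {32} {5} (ℕ.≤ᵇ⇒≤ 32 32 tt)))))
  (ℕ.≮⇒≥ λ b< → ℕ.<-irrefl refl (ℕ.<-≤-trans (isqrt-upper n)
    (ℕ.≤-trans (ℕ.*-mono-≤ b< b<) (ℕ.≤-trans (ℕ.≤-reflexive (sym (ℕ.^-distribˡ-+-* 2 (exponent t) (exponent t)))) h))))

-- Eighteen additional stages gain more than the lost factor 4096, since 4096 times the 18th power
-- of 5 is at most that of 8.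
drop-18 : ∀ n M t → n ℕ.* 8 ℕ.^ (t ℕ.+ 18) ℕ.≤ M ℕ.* 5 ℕ.^ (t ℕ.+ 18) ℕ.* 4096 → n ℕ.* 8 ℕ.^ t ℕ.≤ M ℕ.* 5 ℕ.^ t
drop-18 n M t h = ℕ.*-cancelʳ-≤ (n ℕ.* 8 ℕ.^ t) (M ℕ.* 5 ℕ.^ t) (8 ℕ.^ 18) (begin
  n ℕ.* 8 ℕ.^ t ℕ.* 8 ℕ.^ 18                  ≡⟨ trans (ℕ.*-assoc n (8 ℕ.^ t) (8 ℕ.^ 18)) (cong (n ℕ.*_) (sym (ℕ.^-distribˡ-+-* 8 t 18))) ⟩
  n ℕ.* 8 ℕ.^ (t ℕ.+ 18)                      ≤⟨ h ⟩
  M ℕ.* 5 ℕ.^ (t ℕ.+ 18) ℕ.* 4096             ≡⟨ cong (λ f → M ℕ.* f ℕ.* 4096) (ℕ.^-distribˡ-+-* 5 t 18) ⟩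
  M ℕ.* (5 ℕ.^ t ℕ.* 5 ℕ.^ 18) ℕ.* 4096       ≡⟨ eq M (5 ℕ.^ t) (5 ℕ.^ 18) 4096 ⟩
  M ℕ.* 5 ℕ.^ t ℕ.* (5 ℕ.^ 18 ℕ.* 4096)       ≤⟨ ℕ.*-monoʳ-≤ (M ℕ.* 5 ℕ.^ t) (ℕ.≤ᵇ⇒≤ (5 ℕ.^ 18 ℕ.* 4096) (8 ℕ.^ 18) tt) ⟩
  M ℕ.* 5 ℕ.^ t ℕ.* 8 ℕ.^ 18                  ∎)
  where
  open ℕ.≤-Reasoning
  eq : ∀ M f a b → M ℕ.* (f ℕ.* a) ℕ.* b ≡ M ℕ.* f ℕ.* (a ℕ.* b)
  eq = ℕ-solve

growth : ∀ n-1 M t → suc n-1 ℕ.* 8 ℕ.^ suc t ℕ.≤ M ℕ.* 5 ℕ.^ suc t → suc n-1 ℕ.< threshold (suc (suc t)) →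
         fromℕ (suc n-1) *ℝ exp (fromℚ (inv 511) *ℝ sqrt (log (suc n-1))) ≤ℝ fromℕ M
growth n-1 M t h n< ε 0<ε = 0 , λ {k} _ → ≤-trans (bound k) (p≤p+q (<⇒≤ 0<ε))
  where
  n = suc n-1
  s = exponent (suc (suc t)) ℕ.+ exponent (suc (suc t))
  bound : ∀ k → ι n * expSum k (inv 511 * sqrtℚ k (logSeq n k)) ≤ ι M
  bound k = cancel-≤ (ι-mono-< {0} (ℕ.m^n>0 5 (suc t))) (begin
    ι (5 ℕ.^ suc t) * (ι n * S)      ≡⟨ eq (ι (5 ℕ.^ suc t)) (ι n) S ⟩
    ι n * (ι (5 ℕ.^ suc t) * S)      ≤⟨ *-mono-l (0≤ι n) (exp-sqrt-log {n} {s} {suc t} (ℕ.s≤s ℕ.z≤n)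
                                          (ℕ.<⇒≤ n<) (exponent≤ t) k) ⟩
    ι n * ι (8 ℕ.^ suc t)            ≡⟨ ι-* n (8 ℕ.^ suc t) ⟨
    ι (n ℕ.* 8 ℕ.^ suc t)            ≤⟨ ι-mono h ⟩
    ι (M ℕ.* 5 ℕ.^ suc t)            ≡⟨ trans (ι-* M (5 ℕ.^ suc t)) (*-comm (ι M) (ι (5 ℕ.^ suc t))) ⟩
    ι (5 ℕ.^ suc t) * ι M            ∎)
    where
    open ≤-Reasoning
    S = expSum k (inv 511 * sqrtℚ k (logSeq n k))
    eq : ∀ a b c → a * (b * c) ≡ b * (a * c)
    eq = solve-∀ ℚ-ring

theorem1 : ∃[ c ] ∃[ n₀ ] 0ℝ <ℝ c ×
    (∀ (n : ℕ) .{{_ : NonZero n}} → 2 ℕ.∣ n →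
    Σ[ P ∈ PointSet n ]
    GeneralPosition P ×
    Dense (fromℕ 4) P ×
    (n₀ ℕ.≤ n →
    ∃[ m ] HalvingLines≥ P m ×
    fromℕ n *ℝ exp (c *ℝ sqrt (log n)) ≤ℝ fromℕ m))
theorem1 = fromℚ (inv 511) , threshold 1 , constant-< {0ℝ} {fromℚ (inv 511)} (λ _ → refl) (λ _ → refl) (inv>0 511) , point-set
  where
  point-set : ∀ (n : ℕ) .{{_ : NonZero n}} → 2 ℕ.∣ n → Σ[ P ∈ PointSet n ] GeneralPosition P × Dense (fromℕ 4) P ×
              (threshold 1 ℕ.≤ n → ∃[ m ] HalvingLines≥ P m × fromℕ n *ℝ exp (fromℚ (inv 511) *ℝ sqrt (log n)) ≤ℝ fromℕ m)
  point-set (suc n-1) 2∣n = go (ℕ.≤-<-connex (threshold 1) (suc n-1))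
    where
    n = suc n-1
    b = isqrt n
    1≤b : 1 ℕ.≤ b
    1≤b = isqrt>0 {n} (ℕ.s≤s ℕ.z≤n)
    go : threshold 1 ℕ.≤ n ⊎ n ℕ.< threshold 1 → Σ[ P ∈ PointSet n ] GeneralPosition P × Dense (fromℕ 4) P ×
         (threshold 1 ℕ.≤ n → ∃[ m ] HalvingLines≥ P m × fromℕ n *ℝ exp (fromℚ (inv 511) *ℝ sqrt (log n)) ≤ℝ fromℕ m)
    go (inj₂ small) =
      let (P , general , dense , _) = fromLayout (gridLayout n b (isqrt-upper n)) (size-fin n) 1≤b (isqrt-lower n)
      in P , (λ {i} {j} {k} → general {i} {j} {k}) , (λ {i} {j} {k} {l} → dense {i} {j} {k} {l}) ,
         λ large → contradiction (ℕ.<-≤-trans small large) (ℕ.<-irrefl refl)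
    go (inj₁ large) =
      let (t , t≤ , <t) = last-threshold large
          (Λ , sizeI , count) = assemble (suc t ℕ.+ 18) n b 2∣n (isqrt-lower n) (isqrt-upper n) (wide {n} (suc t) t≤)
          (P , general , dense , lines) = fromLayout Λ sizeI 1≤b (isqrt-lower n)
          M = size (Layout.E Λ)
      in P , (λ {i} {j} {k} → general {i} {j} {k}) , (λ {i} {j} {k} {l} → dense {i} {j} {k} {l}) ,
         λ _ → M , lines , growth n-1 M t (drop-18 n M (suc t) count) <t
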